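{- Given $0<\theta\le1$ and $\gamma>0$, there exists $\nu=\nu(\theta,\gamma)\in(0,1)$ such that the following holds for all sufficiently large $x$: if $A,B\subseteq\{1,2,\dots,x\}$ satisfy $|A|,|B|>x^\nu$, then $$\Bigl|\,\#\{(a,b):\ a\in A,\ b\in B,\ a+b\text{ is }x^\theta\text{ -smooth}\}-\rho(1/\theta)\,|A|\cdot|B|\,\Bigr|<\gamma\,|A|\cdot|B|.$$ The same result holds for differences $a-b$ in place of sums $a+b$ (with possibly a different value of $\nu$).
   Context: An integer is $y$-smooth if it has no prime divisor greater than $y$ (in particular $0$, which is divisible by every prime, is not $y$-smooth, and a negative integer $n$ is $y$-smooth iff $|n|$ is). $\Psi(x,y)$ denotes the number of $y$-smooth positive integers $\le x$, and Dickman's function is $\rho(u)=\lim_{x\to\infty}\Psi(x,x^{1/u})/x$ (the limit is known to exist). "Sufficiently large" means larger than a bound depending only on $\theta$ and $\gamma$ (and $\nu$), not on $A$ and $B$. -}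

module Defs where

open import Data.Nat as ℕ using (ℕ; suc; NonZero)
import Data.Nat.Properties as ℕP
open import Data.Nat.Primality using (Prime)
open import Data.Integer as ℤ using (ℤ; +_)
open import Data.Integer.Divisibility using (_∣_)
open import Data.Rational as ℚ using (ℚ; 0ℚ; 1ℚ; ½)
open import Data.Rational.Properties as ℚP using (module ≤-Reasoning)
open import Data.Rational.Solver using (module +-*-Solver)
open import Algebra.Definitions.RawSemiring (ℚ.+-*-rawSemiring)
  using () renaming (_^_ to _^ℚ_)
open import Data.Fin using (Fin; toℕ)
open import Data.Fin.Subset as Subset using (Subset)
open import Data.List using (length)
open import Data.List.Membership.Propositional using () renaming (_∈_ to _∈ˡ_)
open import Data.List.Relation.Unary.Unique.Propositional using (Unique)
open import Data.Product using (_×_; _,_; ∃; ∃₂; proj₁; proj₂)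
open import Data.Sum using (inj₁; inj₂)
open import Function.Bundles using (_⇔_)
open import Relation.Nullary using (¬_)
open import Relation.Binary.PropositionalEquality
  using (_≡_; refl; sym; trans; cong; cong₂; subst)

IsCauchy : (ℕ → ℚ) → Set
IsCauchy s = ∀ ε → 0ℚ ℚ.< ε →
  ∃ λ N → ∀ m n → N ℕ.≤ m → N ℕ.≤ n → ℚ.∣ s m ℚ.- s n ∣ ℚ.< ε

record ℝ : Set where
  field
    seq    : ℕ → ℚ
    cauchy : IsCauchy seq

open ℝ

infix 4 _<_ _≤_

_<_ : ℝ → ℝ → Set
x < y = ∃ λ c → 0ℚ ℚ.< c ×
  ∃ λ N → ∀ n → N ℕ.≤ n → seq x n ℚ.+ c ℚ.≤ seq y n

_≤_ : ℝ → ℝ → Set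
x ≤ y = ¬ (y < x)

private
  module Identities where
    open +-*-Solver

    halves : ∀ c e i h → c ℚ.* (h ℚ.* (e ℚ.* i) ℚ.+ h ℚ.* (e ℚ.* i)) ≡
                         (c ℚ.* i) ℚ.* ((h ℚ.+ h) ℚ.* e)
    halves = solve 4 (λ c e i h → c :* (h :* (e :* i) :+ h :* (e :* i)) :=
                                  (c :* i) :* ((h :+ h) :* e)) refl

    insert : ∀ u v → u ≡ (u ℚ.- v) ℚ.+ v
    insert = solve 2 (λ u v → u := (u :- v) :+ v) refl

    cancel : ∀ u v → (u ℚ.+ v) ℚ.- v ≡ u
    cancel = solve 2 (λ u v → (u :+ v) :- v := u) refl

    swap : ∀ u v → ℚ.- (v ℚ.- u) ≡ u ℚ.- v
    swap = solve 2 (λ u v → :- (v :- u) := u :- v) refl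

    regroup : ∀ a b c d → (a ℚ.- b) ℚ.- (c ℚ.- d) ≡ (a ℚ.- c) ℚ.- (b ℚ.- d)
    regroup = solve 4 (λ a b c d →
      (a :- b) :- (c :- d) := (a :- c) :- (b :- d)) refl

    product : ∀ a b c d → a ℚ.* b ℚ.- c ℚ.* d ≡
                          a ℚ.* (b ℚ.- d) ℚ.+ (a ℚ.- c) ℚ.* d
    product = solve 4 (λ a b c d →
      a :* b :- c :* d := a :* (b :- d) :+ (a :- c) :* d) refl

    factor : ∀ c u v → c ℚ.* v ℚ.+ u ℚ.* c ≡ c ℚ.* (u ℚ.+ v)
    factor = solve 3 (λ c u v → c :* v :+ u :* c := c :* (u :+ v)) refl

    rotate : ∀ i k d → i ℚ.* (k ℚ.* d) ≡ (k ℚ.* i) ℚ.* d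
    rotate = solve 3 (λ i k d → i :* (k :* d) := (k :* i) :* d) refl

    reciprocals : ∀ i j k l → i ℚ.* (l ℚ.* j) ℚ.- j ℚ.* (k ℚ.* i) ≡
                              (i ℚ.* j) ℚ.* (l ℚ.- k)
    reciprocals = solve 4 (λ i j k l →
      i :* (l :* j) :- j :* (k :* i) := (i :* j) :* (l :- k)) refl

  open Identities

  dist : (ℕ → ℚ) → ℕ → ℕ → ℚ
  dist s m n = ℚ.∣ s m ℚ.- s n ∣

  0<1/ : ∀ q (0<q : 0ℚ ℚ.< q) →
         0ℚ ℚ.< ℚ.1/_ q {{ℚP.pos⇒nonZero q {{ℚ.positive 0<q}}}}
  0<1/ q 0<q =
    ℚP.positive⁻¹ _ {{ℚP.1/pos⇒pos q {{ℚ.positive 0<q}}}}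

  0<* : ∀ {p q} → 0ℚ ℚ.< p → 0ℚ ℚ.< q → 0ℚ ℚ.< p ℚ.* q
  0<* {p} {q} 0<p 0<q = ℚP.positive⁻¹ _
    {{ℚP.pos*pos⇒pos p {{ℚ.positive 0<p}} q {{ℚ.positive 0<q}}}}

  *-mono-≤ : ∀ p q r s → 0ℚ ℚ.≤ r → 0ℚ ℚ.≤ q →
             p ℚ.≤ q → r ℚ.≤ s → p ℚ.* r ℚ.≤ q ℚ.* s
  *-mono-≤ p q r s 0≤r 0≤q p≤q r≤s = ℚP.≤-trans
    (ℚP.*-monoʳ-≤-nonNeg r {{ℚ.nonNegative 0≤r}} p≤q)
    (ℚP.*-monoˡ-≤-nonNeg q {{ℚ.nonNegative 0≤q}} r≤s)

  lipschitz : (x y : ℝ) (f : ℕ → ℚ) (C : ℚ) → 0ℚ ℚ.< C →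
    (∃ λ K → ∀ m n → K ℕ.≤ m → K ℕ.≤ n →
      dist f m n ℚ.≤ C ℚ.* (dist (seq x) m n ℚ.+ dist (seq y) m n)) →
    IsCauchy f
  lipschitz x y f C 0<C (K , bound) ε 0<ε =
    K ℕ.⊔ (Nx ℕ.⊔ Ny) , λ m n le₁ le₂ →
      let
        k≤ : ∀ {i} → K ℕ.⊔ (Nx ℕ.⊔ Ny) ℕ.≤ i → K ℕ.≤ i
        k≤ = ℕP.m⊔n≤o⇒m≤o K (Nx ℕ.⊔ Ny)
        x≤ : ∀ {i} → K ℕ.⊔ (Nx ℕ.⊔ Ny) ℕ.≤ i → Nx ℕ.≤ i
        x≤ le = ℕP.m⊔n≤o⇒m≤o Nx Ny (ℕP.m⊔n≤o⇒n≤o K (Nx ℕ.⊔ Ny) le)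
        y≤ : ∀ {i} → K ℕ.⊔ (Nx ℕ.⊔ Ny) ℕ.≤ i → Ny ℕ.≤ i
        y≤ le = ℕP.m⊔n≤o⇒n≤o Nx Ny (ℕP.m⊔n≤o⇒n≤o K (Nx ℕ.⊔ Ny) le)
      in begin-strict
        dist f m n
          ≤⟨ bound m n (k≤ le₁) (k≤ le₂) ⟩
        C ℚ.* (dist (seq x) m n ℚ.+ dist (seq y) m n)
          <⟨ ℚP.*-monoʳ-<-pos C {{C⁺}} (ℚP.+-mono-<
               (proj₂ xN m n (x≤ le₁) (x≤ le₂))
               (proj₂ yN m n (y≤ le₁) (y≤ le₂))) ⟩
        C ℚ.* (δ ℚ.+ δ)
          ≡⟨ halves C ε C⁻¹ ½ ⟩
        (C ℚ.* C⁻¹) ℚ.* (1ℚ ℚ.* ε)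
          ≡⟨ cong₂ ℚ._*_ (ℚP.*-inverseʳ C {{C≢0}}) (ℚP.*-identityˡ ε) ⟩
        1ℚ ℚ.* ε
          ≡⟨ ℚP.*-identityˡ ε ⟩
        ε ∎
    where
    open ≤-Reasoning
    C⁺ = ℚ.positive 0<C
    C≢0 = ℚP.pos⇒nonZero C {{C⁺}}
    C⁻¹ = ℚ.1/_ C {{C≢0}}
    δ = ½ ℚ.* (ε ℚ.* C⁻¹)
    0<δ : 0ℚ ℚ.< δ
    0<δ = 0<* (ℚP.positive⁻¹ ½) (0<* 0<ε (0<1/ C 0<C))
    xN = cauchy x δ 0<δ
    yN = cauchy y δ 0<δ
    Nx = proj₁ xN
    Ny = proj₁ yN

  0<1 : 0ℚ ℚ.< 1ℚ
  0<1 = ℚP.positive⁻¹ 1ℚ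

  a≤a+b : ∀ a b → 0ℚ ℚ.≤ b → a ℚ.≤ a ℚ.+ b
  a≤a+b a b 0≤b =
    subst (ℚ._≤ a ℚ.+ b) (ℚP.+-identityʳ a) (ℚP.+-monoʳ-≤ a 0≤b)

  bounded : (x : ℝ) →
    ∃₂ λ B N → 0ℚ ℚ.< B × (∀ n → N ℕ.≤ n → ℚ.∣ seq x n ∣ ℚ.≤ B)
  bounded x =
    1ℚ ℚ.+ ℚ.∣ seq x N ∣ , N ,
    ℚP.<-≤-trans 0<1 (a≤a+b 1ℚ ℚ.∣ seq x N ∣ (ℚP.0≤∣p∣ (seq x N))) ,
    λ n N≤n → begin
      ℚ.∣ seq x n ∣
        ≡⟨ cong ℚ.∣_∣ (insert (seq x n) (seq x N)) ⟩
      ℚ.∣ (seq x n ℚ.- seq x N) ℚ.+ seq x N ∣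
        ≤⟨ ℚP.∣p+q∣≤∣p∣+∣q∣ (seq x n ℚ.- seq x N) (seq x N) ⟩
      dist (seq x) n N ℚ.+ ℚ.∣ seq x N ∣
        ≤⟨ ℚP.+-monoˡ-≤ ℚ.∣ seq x N ∣
             (ℚP.<⇒≤ (proj₂ xN n N N≤n ℕP.≤-refl)) ⟩
      1ℚ ℚ.+ ℚ.∣ seq x N ∣ ∎
    where
    open ≤-Reasoning
    xN = cauchy x 1ℚ 0<1
    N = proj₁ xN

fromℚ : ℚ → ℝ
fromℚ q .seq _ = q
fromℚ q .cauchy ε 0<ε = 0 , λ _ _ _ _ →
  subst (ℚ._< ε) (sym (cong ℚ.∣_∣ (ℚP.+-inverseʳ q))) 0<ε

fromℕ : ℕ → ℝ
fromℕ n = fromℚ (+ n ℚ./ 1)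

infixl 7 _*_
infixl 6 _-_

_-_ : ℝ → ℝ → ℝ
(x - y) .seq n = seq x n ℚ.- seq y n
(x - y) .cauchy = lipschitz x y (λ n → seq x n ℚ.- seq y n) 1ℚ 0<1
  (0 , λ m n _ _ → begin
    ℚ.∣ (seq x m ℚ.- seq y m) ℚ.- (seq x n ℚ.- seq y n) ∣
      ≡⟨ cong ℚ.∣_∣ (regroup (seq x m) (seq y m) (seq x n) (seq y n)) ⟩
    ℚ.∣ (seq x m ℚ.- seq x n) ℚ.- (seq y m ℚ.- seq y n) ∣
      ≤⟨ ℚP.∣p-q∣≤∣p∣+∣q∣ (seq x m ℚ.- seq x n) (seq y m ℚ.- seq y n) ⟩
    dist (seq x) m n ℚ.+ dist (seq y) m n
      ≡⟨ ℚP.*-identityˡ (dist (seq x) m n ℚ.+ dist (seq y) m n) ⟨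
    1ℚ ℚ.* (dist (seq x) m n ℚ.+ dist (seq y) m n) ∎)
  where
  open ≤-Reasoning

_*_ : ℝ → ℝ → ℝ
(x * y) .seq n = seq x n ℚ.* seq y n
(x * y) .cauchy =
  lipschitz x y (λ n → seq x n ℚ.* seq y n) C 0<C (Nx ℕ.⊔ Ny , bound)
  where
  open ≤-Reasoning
  Bx = proj₁ (bounded x)
  By = proj₁ (bounded y)
  Nx = proj₁ (proj₂ (bounded x))
  Ny = proj₁ (proj₂ (bounded y))
  0<Bx = proj₁ (proj₂ (proj₂ (bounded x)))
  0<By = proj₁ (proj₂ (proj₂ (bounded y)))

  C : ℚ
  C = Bx ℚ.+ By
  0<C : 0ℚ ℚ.< C
  0<C = ℚP.<-≤-trans 0<Bx (a≤a+b Bx By (ℚP.<⇒≤ 0<By))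
  ∣x∣≤C : ∀ n → Nx ℕ.≤ n → ℚ.∣ seq x n ∣ ℚ.≤ C
  ∣x∣≤C n le = ℚP.≤-trans (proj₂ (proj₂ (proj₂ (bounded x))) n le)
    (a≤a+b Bx By (ℚP.<⇒≤ 0<By))
  ∣y∣≤C : ∀ n → Ny ℕ.≤ n → ℚ.∣ seq y n ∣ ℚ.≤ C
  ∣y∣≤C n le = ℚP.≤-trans (proj₂ (proj₂ (proj₂ (bounded y))) n le)
    (subst (By ℚ.≤_) (ℚP.+-comm By Bx) (a≤a+b By Bx (ℚP.<⇒≤ 0<Bx)))

  bound : ∀ m n → Nx ℕ.⊔ Ny ℕ.≤ m → Nx ℕ.⊔ Ny ℕ.≤ n →
    ℚ.∣ seq x m ℚ.* seq y m ℚ.- seq x n ℚ.* seq y n ∣ ℚ.≤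
    C ℚ.* (dist (seq x) m n ℚ.+ dist (seq y) m n)
  bound m n le₁ le₂ = begin
    ℚ.∣ a ℚ.* b ℚ.- c ℚ.* d ∣
      ≡⟨ cong ℚ.∣_∣ (product a b c d) ⟩
    ℚ.∣ a ℚ.* (b ℚ.- d) ℚ.+ (a ℚ.- c) ℚ.* d ∣
      ≤⟨ ℚP.∣p+q∣≤∣p∣+∣q∣ (a ℚ.* (b ℚ.- d)) ((a ℚ.- c) ℚ.* d) ⟩
    ℚ.∣ a ℚ.* (b ℚ.- d) ∣ ℚ.+ ℚ.∣ (a ℚ.- c) ℚ.* d ∣
      ≡⟨ cong₂ ℚ._+_ (ℚP.∣p*q∣≡∣p∣*∣q∣ a (b ℚ.- d))
                     (ℚP.∣p*q∣≡∣p∣*∣q∣ (a ℚ.- c) d) ⟩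
    ℚ.∣ a ∣ ℚ.* v ℚ.+ u ℚ.* ℚ.∣ d ∣
      ≤⟨ ℚP.+-mono-≤
           (*-mono-≤ ℚ.∣ a ∣ C v v (ℚP.0≤∣p∣ (b ℚ.- d)) (ℚP.<⇒≤ 0<C)
             (∣x∣≤C m (ℕP.m⊔n≤o⇒m≤o Nx Ny le₁)) ℚP.≤-refl)
           (*-mono-≤ u u ℚ.∣ d ∣ C (ℚP.0≤∣p∣ d) (ℚP.0≤∣p∣ (a ℚ.- c))
             ℚP.≤-refl (∣y∣≤C n (ℕP.m⊔n≤o⇒n≤o Nx Ny le₂))) ⟩
    C ℚ.* v ℚ.+ u ℚ.* C
      ≡⟨ factor C u v ⟩
    C ℚ.* (u ℚ.+ v) ∎
    where
    a = seq x m
    b = seq y m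
    c = seq x n
    d = seq y n
    u = dist (seq x) m n
    v = dist (seq y) m n

private
  ∣p∣-∣q∣≤∣p-q∣ : ∀ p q → ℚ.∣ p ∣ ℚ.- ℚ.∣ q ∣ ℚ.≤ ℚ.∣ p ℚ.- q ∣
  ∣p∣-∣q∣≤∣p-q∣ p q = begin
    ℚ.∣ p ∣ ℚ.- ℚ.∣ q ∣
      ≡⟨ cong (λ t → ℚ.∣ t ∣ ℚ.- ℚ.∣ q ∣) (insert p q) ⟩
    ℚ.∣ (p ℚ.- q) ℚ.+ q ∣ ℚ.- ℚ.∣ q ∣
      ≤⟨ ℚP.+-monoˡ-≤ (ℚ.- ℚ.∣ q ∣) (ℚP.∣p+q∣≤∣p∣+∣q∣ (p ℚ.- q) q) ⟩
    (ℚ.∣ p ℚ.- q ∣ ℚ.+ ℚ.∣ q ∣) ℚ.- ℚ.∣ q ∣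
      ≡⟨ cancel ℚ.∣ p ℚ.- q ∣ ℚ.∣ q ∣ ⟩
    ℚ.∣ p ℚ.- q ∣ ∎
    where open ≤-Reasoning

  ∣p-q∣-sym : ∀ p q → ℚ.∣ p ℚ.- q ∣ ≡ ℚ.∣ q ℚ.- p ∣
  ∣p-q∣-sym p q =
    trans (sym (ℚP.∣-p∣≡∣p∣ (p ℚ.- q))) (cong ℚ.∣_∣ (swap q p))

  ∣∣p∣-∣q∣∣≤∣p-q∣ : ∀ p q → ℚ.∣ ℚ.∣ p ∣ ℚ.- ℚ.∣ q ∣ ∣ ℚ.≤ ℚ.∣ p ℚ.- q ∣
  ∣∣p∣-∣q∣∣≤∣p-q∣ p q with ℚP.∣p∣≡p∨∣p∣≡-p (ℚ.∣ p ∣ ℚ.- ℚ.∣ q ∣)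
  ... | inj₁ e = subst (ℚ._≤ ℚ.∣ p ℚ.- q ∣) (sym e) (∣p∣-∣q∣≤∣p-q∣ p q)
  ... | inj₂ e = subst (ℚ._≤ ℚ.∣ p ℚ.- q ∣)
    (sym (trans e (swap ℚ.∣ q ∣ ℚ.∣ p ∣)))
    (subst (ℚ.∣ q ∣ ℚ.- ℚ.∣ p ∣ ℚ.≤_) (∣p-q∣-sym q p) (∣p∣-∣q∣≤∣p-q∣ q p))

∣_∣ : ℝ → ℝ
∣ x ∣ .seq n = ℚ.∣ seq x n ∣
∣ x ∣ .cauchy ε 0<ε with cauchy x ε 0<ε
... | N , close = N , λ m n N≤m N≤n →
  ℚP.≤-<-trans (∣∣p∣-∣q∣∣≤∣p-q∣ (seq x m) (seq x n)) (close m n N≤m N≤n)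

private
  1/-antitone : ∀ p q (0<p : 0ℚ ℚ.< p) (0<q : 0ℚ ℚ.< q) → p ℚ.≤ q →
    ℚ.1/_ q {{ℚP.pos⇒nonZero q {{ℚ.positive 0<q}}}} ℚ.≤
    ℚ.1/_ p {{ℚP.pos⇒nonZero p {{ℚ.positive 0<p}}}}
  1/-antitone p q 0<p 0<q p≤q = begin
    q⁻¹                    ≡⟨ ℚP.*-identityʳ q⁻¹ ⟨
    q⁻¹ ℚ.* 1ℚ             ≡⟨ cong (q⁻¹ ℚ.*_) (ℚP.*-inverseʳ p {{p≢0}}) ⟨
    q⁻¹ ℚ.* (p ℚ.* p⁻¹)
      ≤⟨ ℚP.*-monoˡ-≤-nonNeg q⁻¹ {{ℚ.nonNegative (ℚP.<⇒≤ (0<1/ q 0<q))}}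
           (ℚP.*-monoʳ-≤-nonNeg p⁻¹
             {{ℚ.nonNegative (ℚP.<⇒≤ (0<1/ p 0<p))}} p≤q) ⟩
    q⁻¹ ℚ.* (q ℚ.* p⁻¹)    ≡⟨ rotate q⁻¹ q p⁻¹ ⟩
    (q ℚ.* q⁻¹) ℚ.* p⁻¹    ≡⟨ cong (ℚ._* p⁻¹) (ℚP.*-inverseʳ q {{q≢0}}) ⟩
    1ℚ ℚ.* p⁻¹             ≡⟨ ℚP.*-identityˡ p⁻¹ ⟩
    p⁻¹                    ∎
    where
    open ≤-Reasoning
    p≢0 = ℚP.pos⇒nonZero p {{ℚ.positive 0<p}}
    q≢0 = ℚP.pos⇒nonZero q {{ℚ.positive 0<q}}
    p⁻¹ = ℚ.1/_ p {{p≢0}}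
    q⁻¹ = ℚ.1/_ q {{q≢0}}

  p≤∣p∣ : ∀ p → p ℚ.≤ ℚ.∣ p ∣
  p≤∣p∣ p with ℚP.≤-total 0ℚ p
  ... | inj₁ 0≤p = ℚP.≤-reflexive (sym (ℚP.0≤p⇒∣p∣≡p 0≤p))
  ... | inj₂ p≤0 = ℚP.≤-trans p≤0 (ℚP.0≤∣p∣ p)

-- The inverse of a positive real.  The sequence is first cut off below at the
-- lower bound c contained in the positivity proof, which changes only finitely
-- many of its terms.
1/ : (x : ℝ) → fromℕ 0 < x → ℝ
1/ x (c , 0<c , N , c≤x) = record { seq = inv ; cauchy = inv-cauchy }
  where
  open ≤-Reasoning
  cut : ℕ → ℚ
  cut n = c ℚ.⊔ seq x n
  0<cut : ∀ n → 0ℚ ℚ.< cut n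
  0<cut n = ℚP.<-≤-trans 0<c (ℚP.p≤p⊔q c (seq x n))
  cut≢0 : ∀ n → ℚ.NonZero (cut n)
  cut≢0 n = ℚP.pos⇒nonZero (cut n) {{ℚ.positive (0<cut n)}}
  inv : ℕ → ℚ
  inv n = ℚ.1/_ (cut n) {{cut≢0 n}}

  c⁻¹ : ℚ
  c⁻¹ = ℚ.1/_ c {{ℚP.pos⇒nonZero c {{ℚ.positive 0<c}}}}
  0<c⁻¹ = 0<1/ c 0<c
  0<inv : ∀ n → 0ℚ ℚ.< inv n
  0<inv n = 0<1/ (cut n) (0<cut n)
  cut*inv : ∀ n → cut n ℚ.* inv n ≡ 1ℚ
  cut*inv n = ℚP.*-inverseʳ (cut n) {{cut≢0 n}}

  inv≤c⁻¹ : ∀ n → inv n ℚ.≤ c⁻¹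
  inv≤c⁻¹ n = 1/-antitone c (cut n) 0<c (0<cut n) (ℚP.p≤p⊔q c (seq x n))

  cut≡x : ∀ n → N ℕ.≤ n → cut n ≡ seq x n
  cut≡x n N≤n = ℚP.p≤q⇒p⊔q≡q
    (subst (ℚ._≤ seq x n) (ℚP.+-identityˡ c) (c≤x n N≤n))

  inv-diff : ∀ m n → inv m ℚ.- inv n ≡ (inv m ℚ.* inv n) ℚ.* (cut n ℚ.- cut m)
  inv-diff m n = trans
    (trans (cong₂ ℚ._-_ (sym (ℚP.*-identityʳ (inv m)))
                        (sym (ℚP.*-identityʳ (inv n))))
      (cong₂ (λ s t → inv m ℚ.* s ℚ.- inv n ℚ.* t)
        (sym (cut*inv n)) (sym (cut*inv m))))
    (reciprocals (inv m) (inv n) (cut m) (cut n))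

  ∣inv∣ : ∀ n → ℚ.∣ inv n ∣ ≡ inv n
  ∣inv∣ n = ℚP.0≤p⇒∣p∣≡p (ℚP.<⇒≤ (0<inv n))

  inv-cauchy : IsCauchy inv
  inv-cauchy = lipschitz x x inv (c⁻¹ ℚ.* c⁻¹) 0<c⁻² (N , bound)
    where
    0<c⁻² : 0ℚ ℚ.< c⁻¹ ℚ.* c⁻¹
    0<c⁻² = 0<* 0<c⁻¹ 0<c⁻¹
    bound : ∀ m n → N ℕ.≤ m → N ℕ.≤ n → dist inv m n ℚ.≤
      (c⁻¹ ℚ.* c⁻¹) ℚ.* (dist (seq x) m n ℚ.+ dist (seq x) m n)
    bound m n N≤m N≤n = begin
      ℚ.∣ inv m ℚ.- inv n ∣
        ≡⟨ cong ℚ.∣_∣ (inv-diff m n) ⟩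
      ℚ.∣ (inv m ℚ.* inv n) ℚ.* (cut n ℚ.- cut m) ∣
        ≡⟨ ℚP.∣p*q∣≡∣p∣*∣q∣ (inv m ℚ.* inv n) (cut n ℚ.- cut m) ⟩
      ℚ.∣ inv m ℚ.* inv n ∣ ℚ.* dist cut n m
        ≡⟨ cong₂ ℚ._*_
             (trans (ℚP.∣p*q∣≡∣p∣*∣q∣ (inv m) (inv n))
               (cong₂ ℚ._*_ (∣inv∣ m) (∣inv∣ n)))
             (trans (cong₂ (λ s t → ℚ.∣ s ℚ.- t ∣) (cut≡x n N≤n) (cut≡x m N≤m))
               (∣p-q∣-sym (seq x n) (seq x m))) ⟩
      (inv m ℚ.* inv n) ℚ.* d
        ≤⟨ *-mono-≤ (inv m ℚ.* inv n) (c⁻¹ ℚ.* c⁻¹) d (d ℚ.+ d)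
             0≤d (ℚP.<⇒≤ 0<c⁻²)
             (*-mono-≤ (inv m) c⁻¹ (inv n) c⁻¹
               (ℚP.<⇒≤ (0<inv n)) (ℚP.<⇒≤ 0<c⁻¹) (inv≤c⁻¹ m) (inv≤c⁻¹ n))
             (a≤a+b d d 0≤d) ⟩
      (c⁻¹ ℚ.* c⁻¹) ℚ.* (d ℚ.+ d) ∎
      where
      d = dist (seq x) m n
      0≤d : 0ℚ ℚ.≤ d
      0≤d = ℚP.0≤∣p∣ (seq x m ℚ.- seq x n)

1/-positive : ∀ x (0<x : fromℕ 0 < x) → fromℕ 0 < 1/ x 0<x
1/-positive x 0<x@(c , 0<c , _ , _) = D⁻¹ , 0<1/ D 0<D , M , λ n M≤n →
  subst (ℚ._≤ seq (1/ x 0<x) n) (sym (ℚP.+-identityˡ D⁻¹)) (D⁻¹≤ n M≤n)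
  where
  B = proj₁ (bounded x)
  M = proj₁ (proj₂ (bounded x))
  D = c ℚ.⊔ B
  0<D : 0ℚ ℚ.< D
  0<D = ℚP.<-≤-trans 0<c (ℚP.p≤p⊔q c B)
  D⁻¹ = ℚ.1/_ D {{ℚP.pos⇒nonZero D {{ℚ.positive 0<D}}}}
  D⁻¹≤ : ∀ n → M ℕ.≤ n → D⁻¹ ℚ.≤ seq (1/ x 0<x) n
  D⁻¹≤ n M≤n = 1/-antitone (c ℚ.⊔ seq x n) D
    (ℚP.<-≤-trans 0<c (ℚP.p≤p⊔q c (seq x n))) 0<D
    (ℚP.⊔-monoʳ-≤ c (ℚP.≤-trans (p≤∣p∣ (seq x n))
      (proj₂ (proj₂ (proj₂ (bounded x))) n M≤n)))

-- A real y given by its upper cut { q ∈ ℚ ∣ y < q }.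
UpperCut : Set₁
UpperCut = ℚ → Set

-- x ^ θ = inf { x ^ (m / n) ∣ θ < m / n }, where x ^ (m / n) < q means
-- x ^ m < q ^ n.  This is meant for x ≥ 1 and θ ≥ 0 only: exponents m / n < 0
-- are left out.
infixr 8 _^_

_^_ : ℕ → ℝ → UpperCut
(x ^ θ) q = 0ℚ ℚ.< q × ∃₂ λ m n → θ < fromℚ (+ m ℚ./ suc n) ×
  (+ x ℚ./ 1) ^ℚ m ℚ.< q ^ℚ suc n

infix 4 _≺_

_≺_ : UpperCut → ℕ → Set
y ≺ n = y (+ n ℚ./ 1)

Smooth : UpperCut → ℤ → Set
Smooth y n = ∀ p → Prime p → + p ∣ n → ¬ (y ≺ p)

-- A relation rather than a count by decision, because smoothness with respect to
-- a real bound is not constructively decidable.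
HasCardinality : {A : Set} → (A → Set) → ℕ → Set
HasCardinality P n = ∃ λ xs →
  Unique xs × (∀ a → (a ∈ˡ xs) ⇔ P a) × length xs ≡ n

Ψ[_,_]≡_ : ℕ → UpperCut → ℕ → Set
Ψ[ x , y ]≡ k =
  HasCardinality (λ n → 1 ℕ.≤ n × n ℕ.≤ x × Smooth y (+ n)) k

-- ρ(u) = r, as the relation "Ψ(x, x ^ (1 / u)) / x tends to r as x → ∞": that the
-- limit exists is a theorem, so ρ is not available as a function.
ρ[_,_]≡_ : (u : ℝ) → fromℕ 0 < u → ℝ → Set
ρ[ u , 0<u ]≡ r = ∀ ε → fromℕ 0 < ε → ∃ λ x₀ →
  ∀ x .{{_ : NonZero x}} → x₀ ℕ.≤ x →
  ∀ k → Ψ[ x , x ^ 1/ u 0<u ]≡ k →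
  ∣ fromℚ (+ k ℚ./ x) - r ∣ < ε

-- Subset x is read as the subsets of {1, …, x}, with i : Fin x standing for i + 1.
element : ∀ {x} → Fin x → ℤ
element i = + suc (toℕ i)

SmoothPair : (ℤ → ℤ → ℤ) → UpperCut → ∀ {x} → Subset x → Subset x →
             Fin x × Fin x → Set
SmoothPair _∙_ y A B (a , b) =
  a Subset.∈ A × b Subset.∈ B × Smooth y (element a ∙ element b)

{-# OPTIONS --safe #-}

-- Write y = x ^ θ.  A nonzero n is y-smooth iff Σ μ(d), over the divisors d of n composed
-- of primes > y, is nonzero.  Truncating this sum at D = x ^ (1 - ε) only matters if
-- some such d > D divides n; then no prime in (x ^ ε, y] divides n, up to constants.
-- Since Σ 1 / p over these primes is large for small ε, Turán's inequality shows that
-- such n are rare, both among the sums a + b and in {1, …, x}, and on either side the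
-- truncated sum has the mean Σ μ(d) / d over d ≤ D, up to a small error.
--
-- For the sums a + b this is a large sieve: 1[d ∣ n] is 1 / d times the sum of the
-- Ramanujan sums c_e(n) over e ∣ d, and Σ c_e(a + b) is controlled, through
-- Cauchy-Schwarz, by the mean square over n of Σ_e Σ_b c_e(n + b).  The products
-- c_e(n + b) c_e′(n + b′) have mean 0 for e ≠ e′ and c_e(b - b′) for e = e′, and repeated
-- averaging makes the contribution of incomplete periods negligible.  This saves a
-- power of x, which absorbs the factor lost because |A|, |B| are only > x ^ ν.
--
-- Constructively, only ν and x₀ are needed explicitly.  The final inequality follows
-- from a decidable one between rationals, which may be proved under double negation,
-- that is, with the finitely many conditions x ^ θ < p for p ≤ 2x taken as decidable.
module Submission where

open import Data.Bool using (true; false; if_then_else_)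
open import Data.Empty using (⊥; ⊥-elim)
open import Data.Fin as Fin using (Fin; toℕ)
import Data.Fin.Properties as FinP
open import Data.Fin.Subset as Subset using (Subset)
open import Data.Integer as ℤ using (ℤ) renaming (+_ to pos)
open import Data.Integer.Divisibility.Signed as ℤD using (∣ᵤ⇒∣; ∣⇒∣ᵤ)
import Data.Integer.DivMod as ℤDM
import Data.Integer.Properties as ℤP
open import Data.Integer.Tactic.RingSolver using (solve-∀)
open import Data.List
  using (List; []; _∷_; _++_; map; length; filter; downFrom; cartesianProduct; allFin)
open import Data.List.Membership.Propositional using (_∈_)
open import Data.List.Membership.Propositional.Properties using
  ( ∈-filter⁺; ∈-filter⁻; ∈-downFrom⁺; ∈-downFrom⁻; ∈-∃++; ∈-++⁺ˡ; ∈-++⁺ʳ; ∈-++⁻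
  ; ∈-cartesianProduct⁺; ∈-allFin)
import Data.List.Properties as ListP
open import Data.List.Relation.Unary.All as All using (All; []; _∷_)
import Data.List.Relation.Unary.All.Properties as AllP
open import Data.List.Relation.Unary.AllPairs using ([]; _∷_)
open import Data.List.Relation.Unary.Any using (here; there)
open import Data.List.Relation.Unary.Unique.Propositional using (Unique)
import Data.List.Relation.Unary.Unique.Propositional.Properties as UniqueP
open import Data.Nat as ℕ using (ℕ; zero; suc)
open import Data.Nat.Coprimality as Coprimality using (Coprime)
open import Data.Nat.Divisibility as ℕD using (_∣_; _∣?_)
import Data.Nat.GCD as GCD
open import Data.Nat.Induction using (<-rec)
open import Data.Nat.ListAction using (product)
open import Data.Nat.ListAction.Properties using (∈⇒∣product)
open import Data.Nat.Primality
  using (Prime; prime?; euclidsLemma; prime⇒irreducible; prime⇒nonZero; prime⇒nonTrivial)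
open import Data.Nat.Primality.Factorisation as Factorisation
  using (factorise; factorisationHasAllPrimeFactors)
import Data.Nat.Properties as ℕP
open import Data.Nat.Tactic.RingSolver using () renaming (solve-∀ to solve-ℕ)
open import Data.Product using (_×_; _,_; proj₁; proj₂; ∃; ∃₂)
import Data.Rational as ℚ
import Data.Rational.Properties as ℚP
open import Data.Sum using (_⊎_; inj₁; inj₂)
open import Data.Unit using (⊤; tt)
open import Data.Vec as Vec using ([]; _∷_)
open import Function.Bundles using (_⇔_; mk⇔; Equivalence)
open import Relation.Binary.PropositionalEquality
  using (_≡_; _≢_; refl; sym; trans; cong; cong₂; subst; subst₂; ≢-sym; module ≡-Reasoning)
open import Relation.Nullary using (¬_; Dec; yes; no; does)
open import Relation.Nullary.Decidable using (dec-true; dec-false; decidable-stable; dec⇒maybe;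
  ¬¬-excluded-middle; _×-dec_)
open import Relation.Unary using (Decidable)

-- Everything is measured in powers of `t`, the integer part of x ^ (1 / `K`), where `K = i + h`. On
-- moduli between t ^ l and t ^ (l + 1) the coefficients are about t ^ -l, while averaging away
-- incomplete periods costs an interval of length `N`, about x + t ^ (2l + 3): slightly more than
-- the square of the moduli. Such a level contributes about √(|A| |B|) N / t ^ l, which for i ≤ l ≤
-- h + 2 is at most √(|A| |B|) t ^ (h + 5), up to constants. With t ^ (h + 7) elements in each set
-- this is below |A| |B| / t, and i = 8 turns the requirement into ν = (K - 1) / K. The cut-off is
-- therefore D = t ^ (h + 2). As 2x < t ^ i D, a divisor d > D leaves a cofactor below t ^ i, which
-- excludes every prime of [t ^ i, t ^ J]. Here i is fixed while J = K / v can be taken as large as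
-- needed, so the reciprocal sum of these test primes exceeds any bound. The mean Σ μ(d) / d is
-- never evaluated: it is common to the sums and to the integers up to x and is eliminated between
-- them, the count of smooth integers taking its place.

-- Rational arithmetic, with a ring solver for opaque operations

module Rat where

  open import Level using (0ℓ)
  import Algebra.Solver.Ring as Solver
  open import Algebra.Solver.Ring.AlmostCommutativeRing
    using (AlmostCommutativeRing; fromCommutativeRing; IsAlmostCommutativeRing;
      _-Raw-AlmostCommutative⟶_)
  open import Data.Rational public using (ℚ; 0ℚ; 1ℚ; ½; _≤_; _<_)
  open import Data.Rational.Properties public using
    ( ≤-refl; ≤-reflexive; ≤-trans; ≤-antisym; ≤-total; <⇒≤; <-≤-trans; ≤-<-trans
    ; <-trans; <-irrefl; ≮⇒≥; ≰⇒>; _≤?_; _<?_; module ≤-Reasoning)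

  infix 8 -_
  infixl 7 _*_
  infixl 6 _+_ _-_

  -- Opaque copies of the operations on ℚ: unlike the originals they do not reduce,
  -- hence are injective for the unifier.
  opaque
    _+_ _*_ : ℚ → ℚ → ℚ
    _+_ = ℚ._+_
    _*_ = ℚ._*_

    -_ ∣_∣ : ℚ → ℚ
    -_ = ℚ.-_
    ∣_∣ = ℚ.∣_∣

  _-_ : ℚ → ℚ → ℚ
  p - q = p + - q

  opaque
    unfolding _+_

    +≡ : ∀ p q → p + q ≡ p ℚ.+ q
    +≡ p q = refl

    *≡ : ∀ p q → p * q ≡ p ℚ.* q
    *≡ p q = refl

    -≡ : ∀ p → - p ≡ ℚ.- p
    -≡ p = refl

    +-assoc : ∀ p q r → (p + q) + r ≡ p + (q + r)
    +-assoc = ℚP.+-assoc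

    +-comm : ∀ p q → p + q ≡ q + p
    +-comm = ℚP.+-comm

    +-identityˡ : ∀ p → 0ℚ + p ≡ p
    +-identityˡ = ℚP.+-identityˡ

    +-identityʳ : ∀ p → p + 0ℚ ≡ p
    +-identityʳ = ℚP.+-identityʳ

    +-inverseʳ : ∀ p → p + - p ≡ 0ℚ
    +-inverseʳ = ℚP.+-inverseʳ

    *-assoc : ∀ p q r → (p * q) * r ≡ p * (q * r)
    *-assoc = ℚP.*-assoc

    *-comm : ∀ p q → p * q ≡ q * p
    *-comm = ℚP.*-comm

    *-identityˡ : ∀ p → 1ℚ * p ≡ p
    *-identityˡ = ℚP.*-identityˡ

    *-identityʳ : ∀ p → p * 1ℚ ≡ p
    *-identityʳ = ℚP.*-identityʳ

    *-zeroˡ : ∀ p → 0ℚ * p ≡ 0ℚ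
    *-zeroˡ = ℚP.*-zeroˡ

    *-zeroʳ : ∀ p → p * 0ℚ ≡ 0ℚ
    *-zeroʳ = ℚP.*-zeroʳ

    *-distribˡ-+ : ∀ p q r → p * (q + r) ≡ p * q + p * r
    *-distribˡ-+ = ℚP.*-distribˡ-+

    *-distribʳ-+ : ∀ p q r → (q + r) * p ≡ q * p + r * p
    *-distribʳ-+ = ℚP.*-distribʳ-+

    neg-distrib-+ : ∀ p q → - (p + q) ≡ - p + - q
    neg-distrib-+ = ℚP.neg-distrib-+

    isAlmostCommutativeRing : IsAlmostCommutativeRing _≡_ _+_ _*_ -_ 0ℚ 1ℚ
    isAlmostCommutativeRing = AlmostCommutativeRing.isAlmostCommutativeRing
      (fromCommutativeRing ℚP.+-*-commutativeRing)

    +-mono-≤ : ∀ {p q r s} → p ≤ q → r ≤ s → p + r ≤ q + s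
    +-mono-≤ = ℚP.+-mono-≤

    +-monoˡ-≤ : ∀ r {p q} → p ≤ q → p + r ≤ q + r
    +-monoˡ-≤ = ℚP.+-monoˡ-≤

    +-monoʳ-≤ : ∀ r {p q} → p ≤ q → r + p ≤ r + q
    +-monoʳ-≤ = ℚP.+-monoʳ-≤

    +-mono-< : ∀ {p q r s} → p < q → r < s → p + r < q + s
    +-mono-< = ℚP.+-mono-<

    neg-antimono-≤ : ∀ {p q} → p ≤ q → - q ≤ - p
    neg-antimono-≤ = ℚP.neg-antimono-≤

    0≤* : ∀ {p q} → 0ℚ ≤ p → 0ℚ ≤ q → 0ℚ ≤ p * q
    0≤* {p} {q} 0≤p 0≤q = ℚP.nonNegative⁻¹ (p ℚ.* q)
      {{ℚP.nonNeg*nonNeg⇒nonNeg p {{ℚ.nonNegative 0≤p}} q {{ℚ.nonNegative 0≤q}}}}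

    0<* : ∀ {p q} → 0ℚ < p → 0ℚ < q → 0ℚ < p * q
    0<* {p} {q} 0<p 0<q = ℚP.positive⁻¹ (p ℚ.* q)
      {{ℚP.pos*pos⇒pos p {{ℚ.positive 0<p}} q {{ℚ.positive 0<q}}}}

    *-monoˡ : ∀ {p q} r → 0ℚ ≤ r → p ≤ q → r * p ≤ r * q
    *-monoˡ r 0≤r = ℚP.*-monoˡ-≤-nonNeg r {{ℚ.nonNegative 0≤r}}

    *-monoʳ : ∀ {p q} r → 0ℚ ≤ r → p ≤ q → p * r ≤ q * r
    *-monoʳ r 0≤r = ℚP.*-monoʳ-≤-nonNeg r {{ℚ.nonNegative 0≤r}}

    *-monoˡ-< : ∀ {p q} r → 0ℚ < r → p < q → r * p < r * q
    *-monoˡ-< r 0<r = ℚP.*-monoʳ-<-pos r {{ℚ.positive 0<r}}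

    *-cancelˡ-≤ : ∀ r {p q} → 0ℚ < r → r * p ≤ r * q → p ≤ q
    *-cancelˡ-≤ r 0<r = ℚP.*-cancelˡ-≤-pos r {{ℚ.positive 0<r}}

    0≤∣p∣ : ∀ p → 0ℚ ≤ ∣ p ∣
    0≤∣p∣ = ℚP.0≤∣p∣

    0≤p⇒∣p∣≡p : ∀ {p} → 0ℚ ≤ p → ∣ p ∣ ≡ p
    0≤p⇒∣p∣≡p = ℚP.0≤p⇒∣p∣≡p

    ∣-p∣≡∣p∣ : ∀ p → ∣ - p ∣ ≡ ∣ p ∣
    ∣-p∣≡∣p∣ = ℚP.∣-p∣≡∣p∣

    ∣p∣≡p∨∣p∣≡-p : ∀ p → ∣ p ∣ ≡ p ⊎ ∣ p ∣ ≡ - p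
    ∣p∣≡p∨∣p∣≡-p = ℚP.∣p∣≡p∨∣p∣≡-p

    ∣p+q∣≤∣p∣+∣q∣ : ∀ p q → ∣ p + q ∣ ≤ ∣ p ∣ + ∣ q ∣
    ∣p+q∣≤∣p∣+∣q∣ = ℚP.∣p+q∣≤∣p∣+∣q∣

    ∣p*q∣≡∣p∣*∣q∣ : ∀ p q → ∣ p * q ∣ ≡ ∣ p ∣ * ∣ q ∣
    ∣p*q∣≡∣p∣*∣q∣ = ℚP.∣p*q∣≡∣p∣*∣q∣

  ring : AlmostCommutativeRing 0ℓ 0ℓ
  ring = record { isAlmostCommutativeRing = isAlmostCommutativeRing }

  -- Constants are computed with the original operations, which reduce, while the terms of an
  -- equation are built from the opaque copies; this homomorphism connects the two.
  coefficients : ℚ.+-*-rawRing -Raw-AlmostCommutative⟶ ring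
  coefficients = record
    { ⟦_⟧    = λ q → q
    ; +-homo = λ p q → sym (+≡ p q)
    ; *-homo = λ p q → sym (*≡ p q)
    ; -‿homo = λ p → sym (-≡ p)
    ; 0-homo = refl
    ; 1-homo = refl
    }

  open Solver ℚ.+-*-rawRing ring coefficients (λ p q → dec⇒maybe (p ℚP.≟ q)) public
    using (solve; _:=_; con; _:+_; _:*_; _:-_; :-_)

  2ℚ : ℚ
  2ℚ = ℤ.+ 2 ℚ./ 1

  opaque
    unfolding _+_

    ι : ℕ → ℚ
    ι n = ℤ.+ n ℚ./ 1

    -- Junk value: recip 0 = 0.
    recip : ℕ → ℚ
    recip zero    = 0ℚ
    recip (suc n) = ℤ.+ 1 ℚ./ suc n

    ι≡mkℚ : ∀ n → ι n ≡ ℚ.mkℚ (ℤ.+ n) 0 (Coprimality.sym (Coprimality.1-coprimeTo n))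
    ι≡mkℚ n = ℚP.↥p/↧p≡p (ℚ.mkℚ (ℤ.+ n) 0 (Coprimality.sym (Coprimality.1-coprimeTo n)))

    recip≡mkℚ : ∀ n → recip (suc n) ≡ ℚ.mkℚ (ℤ.+ 1) n (Coprimality.1-coprimeTo (suc n))
    recip≡mkℚ n = ℚP.↥p/↧p≡p (ℚ.mkℚ (ℤ.+ 1) n (Coprimality.1-coprimeTo (suc n)))

    ι0 : ι 0 ≡ 0ℚ
    ι0 = refl

    ι1 : ι 1 ≡ 1ℚ
    ι1 = refl

    ι2 : ι 2 ≡ 2ℚ
    ι2 = refl

    ι4 : ι 4 ≡ 2ℚ * 2ℚ
    ι4 = refl

    ι8 : ι 8 ≡ 2ℚ * 2ℚ * 2ℚ
    ι8 = refl

    ι10 : ι 10 ≡ 2ℚ * 2ℚ * 2ℚ + 2ℚ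
    ι10 = refl

    ι16 : ι 16 ≡ 2ℚ * 2ℚ * 2ℚ * 2ℚ
    ι16 = refl

    ι64 : ι 64 ≡ 2ℚ * 2ℚ * 2ℚ * 2ℚ * 2ℚ * 2ℚ
    ι64 = refl

    ι-+ : ∀ m n → ι (m ℕ.+ n) ≡ ι m + ι n
    ι-+ m n rewrite ι≡mkℚ m | ι≡mkℚ n = cong (ℚ._/ 1)
      (cong₂ ℤ._+_ (sym (ℤP.*-identityʳ (ℤ.+ m))) (sym (ℤP.*-identityʳ (ℤ.+ n))))

    ι-* : ∀ m n → ι (m ℕ.* n) ≡ ι m * ι n
    ι-* m n rewrite ι≡mkℚ m | ι≡mkℚ n = cong (ℚ._/ 1) (ℤP.pos-* m n)

    ι*recip : ∀ n .{{_ : ℕ.NonZero n}} → ι n * recip n ≡ 1ℚ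
    ι*recip (suc n) rewrite ι≡mkℚ (suc n) | recip≡mkℚ n = ℚP.*-inverseʳ
      (ℚ.mkℚ (ℤ.+ suc n) 0 (Coprimality.sym (Coprimality.1-coprimeTo (suc n))))

    ι-mono-≤ : ∀ {m n} → m ℕ.≤ n → ι m ≤ ι n
    ι-mono-≤ {m} {n} m≤n rewrite ι≡mkℚ m | ι≡mkℚ n =
      ℚ.*≤* (ℤP.*-monoʳ-≤-nonNeg (ℤ.+ 1) (ℤ.+≤+ m≤n))

    ι-mono-< : ∀ {m n} → m ℕ.< n → ι m < ι n
    ι-mono-< {m} {n} m<n rewrite ι≡mkℚ m | ι≡mkℚ n =
      ℚ.*<* (ℤP.*-monoʳ-<-pos (ℤ.+ 1) (ℤ.+<+ m<n))

    0<recip : ∀ n .{{_ : ℕ.NonZero n}} → 0ℚ < recip n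
    0<recip (suc n) = ℚP.positive⁻¹ _ {{ℚP.normalize-pos 1 (suc n)}}

    0≤recip : ∀ n → 0ℚ ≤ recip n
    0≤recip zero    = ≤-refl
    0≤recip (suc n) = ℚP.nonNegative⁻¹ _ {{ℚP.normalize-nonNeg 1 (suc n)}}

  ι-suc : ∀ n → ι (suc n) ≡ 1ℚ + ι n
  ι-suc n = trans (ι-+ 1 n) (cong (_+ ι n) ι1)

  ι-cancel-≤ : ∀ {m n} → ι m ≤ ι n → m ℕ.≤ n
  ι-cancel-≤ le = ℕP.≮⇒≥ λ n<m → <-irrefl refl (<-≤-trans (ι-mono-< n<m) le)

  ι-cancel-< : ∀ {m n} → ι m < ι n → m ℕ.< n
  ι-cancel-< lt = ℕP.≰⇒> λ n≤m → <-irrefl refl (<-≤-trans lt (ι-mono-≤ n≤m))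

  0≤ι : ∀ n → 0ℚ ≤ ι n
  0≤ι n = subst (_≤ ι n) ι0 (ι-mono-≤ ℕ.z≤n)

  0<ι : ∀ n .{{_ : ℕ.NonZero n}} → 0ℚ < ι n
  0<ι (suc n) = subst (_< ι (suc n)) ι0 (ι-mono-< (ℕ.s≤s ℕ.z≤n))

  infixr 8 _^_

  _^_ : ℚ → ℕ → ℚ
  q ^ zero  = 1ℚ
  q ^ suc n = q * q ^ n

  0≤1 : 0ℚ ≤ 1ℚ
  0≤1 = ℚP.nonNegative⁻¹ 1ℚ

  0<1 : 0ℚ < 1ℚ
  0<1 = ℚP.positive⁻¹ 1ℚ

  0<2 : 0ℚ < 2ℚ
  0<2 = ℚP.positive⁻¹ 2ℚ

  -- The standard way to an inequality below: the difference of the two sides is exhibited as a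
  -- visibly nonnegative expression, and the ring solver checks the identity.
  ≤-by : ∀ {p q r} → q ≡ p + r → 0ℚ ≤ r → p ≤ q
  ≤-by {p} {q} {r} q≡ 0≤r =
    subst₂ _≤_ (+-identityʳ p) (sym q≡) (+-monoʳ-≤ p 0≤r)

  p≤p+q : ∀ {p q} → 0ℚ ≤ q → p ≤ p + q
  p≤p+q = ≤-by refl

  0≤+ : ∀ {p q} → 0ℚ ≤ p → 0ℚ ≤ q → 0ℚ ≤ p + q
  0≤+ {p} {q} 0≤p 0≤q = ≤-trans 0≤p (p≤p+q 0≤q)

  *-mono : ∀ {p q r s} → 0ℚ ≤ p → 0ℚ ≤ r → p ≤ q → r ≤ s → p * r ≤ q * s
  *-mono {p} {q} {r} {s} 0≤p 0≤r p≤q r≤s =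
    ≤-trans (*-monoʳ r 0≤r p≤q) (*-monoˡ q (≤-trans 0≤p p≤q) r≤s)

  -0≡0 : - 0ℚ ≡ 0ℚ
  -0≡0 = -≡ 0ℚ

  sq-neg : ∀ p → (- p) * (- p) ≡ p * p
  sq-neg = solve 1 (λ p → (:- p) :* (:- p) := p :* p) refl

  0≤sq : ∀ p → 0ℚ ≤ p * p
  0≤sq p with ≤-total 0ℚ p
  ... | inj₁ 0≤p = 0≤* 0≤p 0≤p
  ... | inj₂ p≤0 = subst (0ℚ ≤_) (sq-neg p) (0≤* 0≤-p 0≤-p)
    where
    0≤-p : 0ℚ ≤ - p
    0≤-p = subst (_≤ - p) -0≡0 (neg-antimono-≤ p≤0)

  p≤∣p∣ : ∀ p → p ≤ ∣ p ∣
  p≤∣p∣ p with ≤-total 0ℚ p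
  ... | inj₁ 0≤p = ≤-reflexive (sym (0≤p⇒∣p∣≡p 0≤p))
  ... | inj₂ p≤0 = ≤-trans p≤0 (0≤∣p∣ p)

  -p≤∣p∣ : ∀ p → - p ≤ ∣ p ∣
  -p≤∣p∣ p = subst (- p ≤_) (∣-p∣≡∣p∣ p) (p≤∣p∣ (- p))

  ∣∣-≤ : ∀ {p q} → p ≤ q → - p ≤ q → ∣ p ∣ ≤ q
  ∣∣-≤ {p} p≤q -p≤q with ∣p∣≡p∨∣p∣≡-p p
  ... | inj₁ e = ≤-trans (≤-reflexive e) p≤q
  ... | inj₂ e = ≤-trans (≤-reflexive e) -p≤q

  ∣p-q∣≤∣p∣+∣q∣ : ∀ p q → ∣ p - q ∣ ≤ ∣ p ∣ + ∣ q ∣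
  ∣p-q∣≤∣p∣+∣q∣ p q =
    ≤-trans (∣p+q∣≤∣p∣+∣q∣ p (- q)) (≤-reflexive (cong (∣ p ∣ +_) (∣-p∣≡∣p∣ q)))

  ∣∣*∣∣ : ∀ p → ∣ p ∣ * ∣ p ∣ ≡ p * p
  ∣∣*∣∣ p with ∣p∣≡p∨∣p∣≡-p p
  ... | inj₁ e = cong₂ _*_ e e
  ... | inj₂ e = trans (cong₂ _*_ e e) (sq-neg p)

  sq-cancel-≤ : ∀ {p q} → 0ℚ ≤ q → p * p ≤ q * q → ∣ p ∣ ≤ q
  sq-cancel-≤ {p} {q} 0≤q p²≤q² = ≮⇒≥ λ q<∣p∣ →
    <-irrefl refl (≤-<-trans p²≤q² (subst (q * q <_) (∣∣*∣∣ p)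
      (≤-<-trans (*-monoʳ q 0≤q (<⇒≤ q<∣p∣)) (*-monoˡ-< ∣ p ∣ (≤-<-trans 0≤q q<∣p∣) q<∣p∣))))

  0≤^ : ∀ {q} n → 0ℚ ≤ q → 0ℚ ≤ q ^ n
  0≤^ zero    0≤q = 0≤1
  0≤^ (suc n) 0≤q = 0≤* 0≤q (0≤^ n 0≤q)

-- Finite sums and the Cauchy-Schwarz inequality

module Sums where

  open Rat

  private variable
    X Y : Set

  ∑ : List X → (X → ℚ) → ℚ
  ∑ []       f = 0ℚ
  ∑ (x ∷ xs) f = f x + ∑ xs f

  ∑< : ℕ → (ℕ → ℚ) → ℚ
  ∑< n = ∑ (downFrom n)

  private
    shuffle : ∀ a b c d → (a + b) + (c + d) ≡ (a + c) + (b + d)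
    shuffle = solve 4 (λ a b c d → (a :+ b) :+ (c :+ d) := (a :+ c) :+ (b :+ d)) refl
    +-cross : ∀ f g h k → (f * g - h * k) * (f * g - h * k) ≡ f * f * (g * g) + h * h * (k * k) - 2ℚ *
      (f * k * (h * g))
    +-cross = solve 4 (λ f g h k → (f :* g :- h :* k) :* (f :* g :- h :* k) := f :* f :* (g :* g) :+ h
      :* h :* (k :* k) :- (con 2ℚ) :* (f :* k :* (h :* g))) refl

  ∑-cong∈ : ∀ (xs : List X) {f g} → (∀ x → x ∈ xs → f x ≡ g x) → ∑ xs f ≡ ∑ xs g
  ∑-cong∈ []       eq = refl
  ∑-cong∈ (x ∷ xs) eq = cong₂ _+_ (eq x (here refl)) (∑-cong∈ xs λ y y∈ → eq y (there y∈))

  ∑-cong : ∀ (xs : List X) {f g} → (∀ x → f x ≡ g x) → ∑ xs f ≡ ∑ xs g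
  ∑-cong xs eq = ∑-cong∈ xs λ x _ → eq x

  ∑-mono∈ : ∀ (xs : List X) {f g} → (∀ x → x ∈ xs → f x ≤ g x) → ∑ xs f ≤ ∑ xs g
  ∑-mono∈ []       le = ≤-refl
  ∑-mono∈ (x ∷ xs) le = +-mono-≤ (le x (here refl)) (∑-mono∈ xs λ y y∈ → le y (there y∈))

  ∑-mono : ∀ (xs : List X) {f g} → (∀ x → f x ≤ g x) → ∑ xs f ≤ ∑ xs g
  ∑-mono xs le = ∑-mono∈ xs λ x _ → le x

  ∑-0 : ∀ (xs : List X) → ∑ xs (λ _ → 0ℚ) ≡ 0ℚ
  ∑-0 []       = refl
  ∑-0 (x ∷ xs) = trans (+-identityˡ _) (∑-0 xs)

  ∑-nonneg : ∀ (xs : List X) {f} → (∀ x → 0ℚ ≤ f x) → 0ℚ ≤ ∑ xs f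
  ∑-nonneg []       0≤f = ≤-refl
  ∑-nonneg (x ∷ xs) 0≤f = 0≤+ (0≤f x) (∑-nonneg xs 0≤f)

  ∑-+ : ∀ (xs : List X) f g → ∑ xs (λ x → f x + g x) ≡ ∑ xs f + ∑ xs g
  ∑-+ []       f g = sym (+-identityˡ 0ℚ)
  ∑-+ (x ∷ xs) f g =
    trans (cong (f x + g x +_) (∑-+ xs f g)) (shuffle (f x) (g x) (∑ xs f) (∑ xs g))

  ∑-*ˡ : ∀ (xs : List X) c f → ∑ xs (λ x → c * f x) ≡ c * ∑ xs f
  ∑-*ˡ []       c f = sym (*-zeroʳ c)
  ∑-*ˡ (x ∷ xs) c f =
    trans (cong (c * f x +_) (∑-*ˡ xs c f)) (sym (*-distribˡ-+ c (f x) (∑ xs f)))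

  ∑-*ʳ : ∀ (xs : List X) c f → ∑ xs (λ x → f x * c) ≡ ∑ xs f * c
  ∑-*ʳ xs c f =
    trans (∑-cong xs λ x → *-comm (f x) c) (trans (∑-*ˡ xs c f) (*-comm c (∑ xs f)))

  ∑-neg : ∀ (xs : List X) f → ∑ xs (λ x → - f x) ≡ - ∑ xs f
  ∑-neg []       f = sym -0≡0
  ∑-neg (x ∷ xs) f = trans (cong (- f x +_) (∑-neg xs f)) (sym (neg-distrib-+ (f x) (∑ xs f)))

  ∑-- : ∀ (xs : List X) f g → ∑ xs (λ x → f x - g x) ≡ ∑ xs f - ∑ xs g
  ∑-- xs f g = trans (∑-+ xs f (λ x → - g x)) (cong (∑ xs f +_) (∑-neg xs g))

  ∑<-const : ∀ n c → ∑< n (λ _ → c) ≡ ι n * c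
  ∑<-const zero    c = sym (trans (cong (_* c) ι0) (*-zeroˡ c))
  ∑<-const (suc n) c = begin
    c + ∑< n (λ _ → c)   ≡⟨ cong₂ _+_ (sym (*-identityˡ c)) (∑<-const n c) ⟩
    1ℚ * c + ι n * c     ≡⟨ *-distribʳ-+ c 1ℚ (ι n) ⟨
    (1ℚ + ι n) * c       ≡⟨ cong (_* c) (ι-suc n) ⟨
    ι (suc n) * c        ∎
    where open ≡-Reasoning

  ∑-++ : ∀ (xs ys : List X) f → ∑ (xs ++ ys) f ≡ ∑ xs f + ∑ ys f
  ∑-++ []       ys f = sym (+-identityˡ _)
  ∑-++ (x ∷ xs) ys f = trans (cong (f x +_) (∑-++ xs ys f)) (sym (+-assoc (f x) _ _))

  ∑-map : ∀ (h : X → Y) (xs : List X) (f : Y → ℚ) → ∑ (map h xs) f ≡ ∑ xs (λ x → f (h x))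
  ∑-map h []       f = refl
  ∑-map h (x ∷ xs) f = cong (f (h x) +_) (∑-map h xs f)

  ∑-swap : ∀ (xs : List X) (ys : List Y) (f : X → Y → ℚ) →
    ∑ xs (λ x → ∑ ys (f x)) ≡ ∑ ys (λ y → ∑ xs (λ x → f x y))
  ∑-swap []       ys f = sym (∑-0 ys)
  ∑-swap (x ∷ xs) ys f =
    trans (cong (∑ ys (f x) +_) (∑-swap xs ys f)) (sym (∑-+ ys (f x) _))

  ∑-prod : ∀ (xs : List X) (ys : List Y) (f : X → ℚ) (g : Y → ℚ) →
    ∑ xs f * ∑ ys g ≡ ∑ xs (λ x → ∑ ys (λ y → f x * g y))
  ∑-prod xs ys f g =
    trans (sym (∑-*ʳ xs (∑ ys g) f)) (∑-cong xs λ x → sym (∑-*ˡ ys (f x) g))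

  ∣∑∣≤ : ∀ (xs : List X) f → ∣ ∑ xs f ∣ ≤ ∑ xs (λ x → ∣ f x ∣)
  ∣∑∣≤ []       f = ≤-reflexive (0≤p⇒∣p∣≡p ≤-refl)
  ∣∑∣≤ (x ∷ xs) f = ≤-trans (∣p+q∣≤∣p∣+∣q∣ (f x) (∑ xs f)) (+-monoʳ-≤ ∣ f x ∣ (∣∑∣≤ xs f))

  ∑<-mono : ∀ n {f g} → (∀ i → i ℕ.< n → f i ≤ g i) → ∑< n f ≤ ∑< n g
  ∑<-mono n le = ∑-mono∈ (downFrom n) λ i i∈ → le i (∈-downFrom⁻ i∈)

  ∑<-cong : ∀ n {f g} → (∀ i → i ℕ.< n → f i ≡ g i) → ∑< n f ≡ ∑< n g
  ∑<-cong n eq = ∑-cong∈ (downFrom n) λ i i∈ → eq i (∈-downFrom⁻ i∈)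

  ∑<-+ : ∀ m n f → ∑< (m ℕ.+ n) f ≡ ∑< m f + ∑< n (λ i → f (m ℕ.+ i))
  ∑<-+ m zero    f rewrite ℕP.+-identityʳ m = sym (+-identityʳ _)
  ∑<-+ m (suc n) f rewrite ℕP.+-suc m n =
    trans (cong (f (m ℕ.+ n) +_) (∑<-+ m n f))
      (swap (f (m ℕ.+ n)) (∑< m f) (∑< n (λ i → f (m ℕ.+ i))))
    where
    swap : ∀ a b c → a + (b + c) ≡ b + (a + c)
    swap = solve 3 (λ a b c → a :+ (b :+ c) := b :+ (a :+ c)) refl

  ∑<-mono-length : ∀ {m n f} → (∀ i → 0ℚ ≤ f i) → m ℕ.≤ n → ∑< m f ≤ ∑< n f
  ∑<-mono-length {m} {n} {f} 0≤f m≤n = subst (λ n → ∑< m f ≤ ∑< n f) (ℕP.m+[n∸m]≡n m≤n)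
    (≤-by (∑<-+ m (n ℕ.∸ m) f) (∑-nonneg (downFrom (n ℕ.∸ m)) λ i → 0≤f (m ℕ.+ i)))

  -- Lagrange's identity: the double sum of the squares of `f x * g y - f y * g x` is twice the
  -- difference of the two sides.
  cauchy-schwarz : ∀ (xs : List X) (f g : X → ℚ) →
    ∑ xs (λ x → f x * g x) * ∑ xs (λ x → f x * g x) ≤
    ∑ xs (λ x → f x * f x) * ∑ xs (λ x → g x * g x)
  cauchy-schwarz xs f g = *-cancelˡ-≤ 2ℚ 0<2 (≤-by eq (∑-nonneg xs λ x → ∑-nonneg xs λ y →
      0≤sq (f x * g y - f y * g x)))
    where
    open ≡-Reasoning
    S = ∑ xs (λ x → f x * g x)
    F = ∑ xs (λ x → f x * f x)
    G = ∑ xs (λ x → g x * g x)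
    D = ∑ xs λ x → ∑ xs λ y → (f x * g y - f y * g x) * (f x * g y - f y * g x)
    finish : ∀ f g s d → 2ℚ * (f * g) ≡ 2ℚ * (s * s) + (f * g + g * f - 2ℚ * (s * s))
    finish = solve 4 (λ f g s d → (con 2ℚ) :* (f :* g) := (con 2ℚ) :* (s :* s) :+
      (f :* g :+ g :* f :- (con 2ℚ) :* (s :* s))) refl
    D≡ : D ≡ F * G + G * F - 2ℚ * (S * S)
    D≡ = begin
      D
        ≡⟨ ∑-cong xs (λ x → ∑-cong xs λ y → +-cross (f x) (g y) (f y) (g x)) ⟩
      ∑ xs (λ x → ∑ xs λ y → f x * f x * (g y * g y) + f y * f y * (g x * g x)
        - 2ℚ * (f x * g x * (f y * g y)))
        ≡⟨ ∑-cong xs (λ x → trans (∑-- xs _ _) (cong₂ _-_ (∑-+ xs _ _) (∑-*ˡ xs 2ℚ _))) ⟩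
      ∑ xs (λ x → ∑ xs (λ y → f x * f x * (g y * g y)) + ∑ xs (λ y → f y * f y * (g x * g x))
        - 2ℚ * ∑ xs (λ y → f x * g x * (f y * g y)))
        ≡⟨ trans (∑-- xs _ _) (cong₂ _-_ (∑-+ xs _ _) (∑-*ˡ xs 2ℚ _)) ⟩
      ∑ xs (λ x → ∑ xs (λ y → f x * f x * (g y * g y))) +
      ∑ xs (λ x → ∑ xs (λ y → f y * f y * (g x * g x)))
        - 2ℚ * ∑ xs (λ x → ∑ xs (λ y → f x * g x * (f y * g y)))
        ≡⟨ cong₂ (λ u v → u - 2ℚ * v)
             (cong₂ _+_ (sym (∑-prod xs xs _ _))
               (trans (∑-cong xs λ x → ∑-cong xs λ y → *-comm (f y * f y) (g x * g x))
                 (sym (∑-prod xs xs _ _))))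
             (sym (∑-prod xs xs _ _)) ⟩
      F * G + G * F - 2ℚ * (S * S) ∎
    eq : 2ℚ * (F * G) ≡ 2ℚ * (S * S) + D
    eq = trans (finish F G S D) (cong (2ℚ * (S * S) +_) (sym D≡))

-- Sums over integer intervals and their repeated averages

module Average where

  open Rat
  open Sums

  private variable
    X : Set

  run : ℕ → (ℤ → ℚ) → ℤ → ℚ
  run L f n = ∑< L λ t → f (n ℤ.+ ℤ.+ t)

  -- Comparing the windows at `n` and `n + 1` shows that such an `f` has period `m`. Stated for all
  -- windows, the property is visibly invariant under translation, hence passes to sums and averages
  -- of translates.
  HasMean : ℕ → ℚ → (ℤ → ℚ) → Set
  HasMean m μ f = ∀ n → run m f n ≡ ι m * μ

  run-cong : ∀ L {f g} n → (∀ k → f k ≡ g k) → run L f n ≡ run L g n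
  run-cong L n eq = ∑-cong (downFrom L) λ t → eq (n ℤ.+ ℤ.+ t)

  run-split : ∀ a b f n → run (a ℕ.+ b) f n ≡ run a f n + run b f (n ℤ.+ ℤ.+ a)
  run-split a b f n = trans (∑<-+ a b _)
    (cong (run a f n +_) (∑-cong (downFrom b) λ t → cong f (sym (ℤP.+-assoc n (ℤ.+ a) (ℤ.+ t)))))

  run-nonneg : ∀ L f n → (∀ k → 0ℚ ≤ f k) → 0ℚ ≤ run L f n
  run-nonneg L f n 0≤f = ∑-nonneg (downFrom L) λ t → 0≤f (n ℤ.+ ℤ.+ t)

  run-swap : ∀ a b f n → run a (run b f) n ≡ run b (run a f) n
  run-swap a b f n = trans (∑-swap (downFrom a) (downFrom b) _)
    (∑-cong (downFrom b) λ t → ∑-cong (downFrom a) λ s → cong f (comm n (ℤ.+ s) (ℤ.+ t)))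
    where
    comm : ∀ n s t → n ℤ.+ s ℤ.+ t ≡ n ℤ.+ t ℤ.+ s
    comm = solve-∀

  zeroMean-run : ∀ {m f} L → HasMean m 0ℚ f → HasMean m 0ℚ (run L f)
  zeroMean-run {m} {f} L mean n = begin
    run m (run L f) n              ≡⟨ run-swap m L f n ⟩
    run L (run m f) n              ≡⟨ run-cong L n (λ k → trans (mean k) (*-zeroʳ (ι m))) ⟩
    ∑< L (λ _ → 0ℚ)                ≡⟨ ∑-0 (downFrom L) ⟩
    0ℚ                             ≡⟨ *-zeroʳ (ι m) ⟨
    ι m * 0ℚ                       ∎
    where open ≡-Reasoning

  ∣run∣≤ : ∀ {f C} L n → (∀ k → ∣ f k ∣ ≤ C) → ∣ run L f n ∣ ≤ ι L * C
  ∣run∣≤ {f} {C} L n f≤C = begin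
    ∣ run L f n ∣                            ≤⟨ ∣∑∣≤ (downFrom L) _ ⟩
    ∑< L (λ t → ∣ f (n ℤ.+ ℤ.+ t) ∣)         ≤⟨ ∑-mono (downFrom L) (λ t → f≤C (n ℤ.+ ℤ.+ t)) ⟩
    ∑< L (λ _ → C)                           ≡⟨ ∑<-const L C ⟩
    ι L * C                                  ∎
    where open ≤-Reasoning

  -- Complete periods cancel.
  zeroMean⇒∣run∣≤ : ∀ {m f C} .{{_ : ℕ.NonZero m}} → HasMean m 0ℚ f → (∀ k → ∣ f k ∣ ≤ C) →
    ∀ L n → ∣ run L f n ∣ ≤ ι m * C
  zeroMean⇒∣run∣≤ {m@(suc m-1)} {f} {C} mean f≤C = <-rec _ step
    where
    0≤C : 0ℚ ≤ C
    0≤C = ≤-trans (0≤∣p∣ (f ℤ.0ℤ)) (f≤C ℤ.0ℤ)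

    step : ∀ L → (∀ {K} → K ℕ.< L → ∀ n → ∣ run K f n ∣ ≤ ι m * C) → ∀ n → ∣ run L f n ∣ ≤ ι m * C
    step L rec n with m ℕ.≤? L
    ... | no m≰L = ≤-trans (∣run∣≤ L n f≤C) (*-monoʳ C 0≤C (ι-mono-≤ (ℕP.≰⇒≥ m≰L)))
    ... | yes m≤L = subst (λ z → ∣ z ∣ ≤ ι m * C) (sym split) (rec smaller (n ℤ.+ ℤ.+ m))
      where
      smaller : L ℕ.∸ m ℕ.< L
      smaller = ℕP.∸-monoʳ-< {L} {m} {0} (ℕ.s≤s ℕ.z≤n) m≤L
      open ≡-Reasoning
      split : run L f n ≡ run (L ℕ.∸ m) f (n ℤ.+ ℤ.+ m)
      split = begin
        run L f n                                             ≡⟨ cong (λ L → run L f n)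
          (ℕP.m+[n∸m]≡n m≤L) ⟨
        run (m ℕ.+ (L ℕ.∸ m)) f n                             ≡⟨ run-split m (L ℕ.∸ m) f n ⟩
        run m f n + run (L ℕ.∸ m) f (n ℤ.+ ℤ.+ m)             ≡⟨ cong (_+ run (L ℕ.∸ m) f (n ℤ.+ ℤ.+ m))
          (trans (mean n) (*-zeroʳ (ι m))) ⟩
        0ℚ + run (L ℕ.∸ m) f (n ℤ.+ ℤ.+ m)                    ≡⟨ +-identityˡ _ ⟩
        run (L ℕ.∸ m) f (n ℤ.+ ℤ.+ m)                         ∎

  average : ℕ → (ℤ → ℚ) → ℤ → ℚ
  average L f n = recip L * run L f n

  -- The averagings smooth the end points of the interval of summation.
  smoothRun : ℕ → ℕ → ℕ → (ℤ → ℚ) → ℤ → ℚ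
  smoothRun zero    L N f = run N f
  smoothRun (suc j) L N f = average L (smoothRun j L N f)

  smoothRun-cong : ∀ j L N {f g} n → (∀ k → f k ≡ g k) → smoothRun j L N f n ≡ smoothRun j L N g n
  smoothRun-cong zero    L N n eq = run-cong N n eq
  smoothRun-cong (suc j) L N n eq =
    cong (recip L *_) (run-cong L n λ k → smoothRun-cong j L N k eq)

  smoothRun-+ : ∀ j L N f g n →
    smoothRun j L N (λ k → f k + g k) n ≡ smoothRun j L N f n + smoothRun j L N g n
  smoothRun-+ zero    L N f g n = ∑-+ (downFrom N) _ _
  smoothRun-+ (suc j) L N f g n = trans
    (cong (recip L *_) (trans (run-cong L n (smoothRun-+ j L N f g)) (∑-+ (downFrom L) _ _)))
    (*-distribˡ-+ (recip L) _ _)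

  smoothRun-*ˡ : ∀ j L N c f n → smoothRun j L N (λ k → c * f k) n ≡ c * smoothRun j L N f n
  smoothRun-*ˡ zero    L N c f n = ∑-*ˡ (downFrom N) c _
  smoothRun-*ˡ (suc j) L N c f n = trans
    (cong (recip L *_) (trans (run-cong L n (smoothRun-*ˡ j L N c f)) (∑-*ˡ (downFrom L) c _)))
    (swap (recip L) c _)
    where
    swap : ∀ a b c → a * (b * c) ≡ b * (a * c)
    swap = solve 3 (λ a b c → a :* (b :* c) := b :* (a :* c)) refl

  smoothRun-0 : ∀ j L N n → smoothRun j L N (λ _ → 0ℚ) n ≡ 0ℚ
  smoothRun-0 zero    L N n = ∑-0 (downFrom N)
  smoothRun-0 (suc j) L N n = trans
    (cong (recip L *_) (trans (run-cong L n (smoothRun-0 j L N)) (∑-0 (downFrom L))))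
      (*-zeroʳ (recip L))

  smoothRun-∑ : ∀ j L N (xs : List X) (f : X → ℤ → ℚ) n →
    smoothRun j L N (λ k → ∑ xs λ x → f x k) n ≡ ∑ xs λ x → smoothRun j L N (f x) n
  smoothRun-∑ j L N List.[]       f n = smoothRun-0 j L N n
  smoothRun-∑ j L N (x List.∷ xs) f n =
    trans (smoothRun-+ j L N (f x) _ n) (cong (smoothRun j L N (f x) n +_) (smoothRun-∑ j L N xs f n))

  average-const : ∀ L .{{_ : ℕ.NonZero L}} c n → average L (λ _ → c) n ≡ c
  average-const L c n = begin
    recip L * ∑< L (λ _ → c)   ≡⟨ cong (recip L *_) (∑<-const L c) ⟩
    recip L * (ι L * c)        ≡⟨ rot (recip L) (ι L) c ⟩
    ι L * recip L * c          ≡⟨ cong (_* c) (ι*recip L) ⟩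
    1ℚ * c                     ≡⟨ *-identityˡ c ⟩
    c                          ∎
    where
    open ≡-Reasoning
    rot : ∀ a b c → a * (b * c) ≡ b * a * c
    rot = solve 3 (λ a b c → a :* (b :* c) := b :* a :* c) refl

  smoothRun-const : ∀ j L N .{{_ : ℕ.NonZero L}} c n → smoothRun j L N (λ _ → c) n ≡ ι N * c
  smoothRun-const zero    L N c n = ∑<-const N c
  smoothRun-const (suc j) L N c n = trans
    (cong (recip L *_) (run-cong L n (smoothRun-const j L N c))) (average-const L (ι N * c) n)

  zeroMean-smoothRun : ∀ {m f} j L N → HasMean m 0ℚ f → HasMean m 0ℚ (smoothRun j L N f)
  zeroMean-smoothRun {f = f} zero    L N mean = zeroMean-run {f = f} N mean
  zeroMean-smoothRun {m} {f} (suc j) L N mean n = begin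
    run m (average L (smoothRun j L N f)) n          ≡⟨ ∑-*ˡ (downFrom m) (recip L) _ ⟩
    recip L * run m (run L (smoothRun j L N f)) n
      ≡⟨ cong (recip L *_) (zeroMean-run {f = smoothRun j L N f} L (zeroMean-smoothRun j L N mean) n) ⟩
    recip L * (ι m * 0ℚ)                             ≡⟨ cong (recip L *_) (*-zeroʳ (ι m)) ⟩
    recip L * 0ℚ                                     ≡⟨ *-zeroʳ (recip L) ⟩
    0ℚ                                               ≡⟨ *-zeroʳ (ι m) ⟨
    ι m * 0ℚ                                         ∎
    where open ≡-Reasoning

  -- Every averaging gains a factor m / L.
  zeroMean⇒∣smoothRun∣≤ : ∀ {m f C q} .{{_ : ℕ.NonZero m}} j L N →
    HasMean m 0ℚ f → (∀ k → ∣ f k ∣ ≤ C) → recip L * ι m ≤ q →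
    ∀ n → ∣ smoothRun j L N f n ∣ ≤ q ^ j * (ι m * C)
  zeroMean⇒∣smoothRun∣≤ {m} {f} {C} zero L N mean f≤C m/L≤q n =
    subst (∣ run N f n ∣ ≤_) (sym (*-identityˡ _)) (zeroMean⇒∣run∣≤ mean f≤C N n)
  zeroMean⇒∣smoothRun∣≤ {m} {f} {C} {q} (suc j) L N mean f≤C m/L≤q n = begin
    ∣ recip L * run L g n ∣             ≡⟨ ∣p*q∣≡∣p∣*∣q∣ (recip L) (run L g n) ⟩
    ∣ recip L ∣ * ∣ run L g n ∣         ≡⟨ cong (_* ∣ run L g n ∣) (0≤p⇒∣p∣≡p (0≤recip L)) ⟩
    recip L * ∣ run L g n ∣             ≤⟨ *-monoˡ (recip L) (0≤recip L)
                                            (zeroMean⇒∣run∣≤ (zeroMean-smoothRun j L N mean) bound L n)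
                                              ⟩
    recip L * (ι m * D)                 ≡⟨ *-assoc (recip L) (ι m) D ⟨
    recip L * ι m * D                   ≤⟨ *-monoʳ D (≤-trans (0≤∣p∣ (g n)) (bound n)) m/L≤q ⟩
    q * D                               ≡⟨ *-assoc q (q ^ j) (ι m * C) ⟨
    q * q ^ j * (ι m * C)               ∎
    where
    open ≤-Reasoning
    g = smoothRun j L N f
    D = q ^ j * (ι m * C)
    bound : ∀ k → ∣ g k ∣ ≤ D
    bound = zeroMean⇒∣smoothRun∣≤ j L N mean f≤C m/L≤q

  private
    -- Each of the `j` averagings translates by less than `L`, so all runs that enter start within
    -- `j * L` of `n`; a mean of values that are at least `w` is at least `w`.
    smoothRun-≥ : ∀ {w f} j L N .{{_ : ℕ.NonZero L}} n →
      (∀ s → s ℕ.≤ j ℕ.* L → w ≤ run N f (n ℤ.+ ℤ.+ s)) → w ≤ smoothRun j L N f n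
    smoothRun-≥ {w} {f} zero L N n le = subst (λ n → w ≤ run N f n) (ℤP.+-identityʳ n) (le 0 ℕ.z≤n)
    smoothRun-≥ {w} {f} (suc j) L N n le =
      subst (_≤ average L (smoothRun j L N f) n) (average-const L w n)
        (*-monoˡ (recip L) (0≤recip L) (∑<-mono L λ t t<L →
          smoothRun-≥ j L N (n ℤ.+ ℤ.+ t) λ s s≤ →
            subst (λ n → w ≤ run N f n) (sym (ℤP.+-assoc n (ℤ.+ t) (ℤ.+ s)))
              (le (t ℕ.+ s) (ℕP.+-mono-≤ (ℕP.<⇒≤ t<L) s≤))))

  -- Every translate by s ≤ jL of an interval of length jL + W contains the window.
  run≤smoothRun : ∀ {f} j L W .{{_ : ℕ.NonZero L}} n → (∀ k → 0ℚ ≤ f k) →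
    run W f (n ℤ.+ ℤ.+ (j ℕ.* L)) ≤ smoothRun j L (j ℕ.* L ℕ.+ W) f n
  run≤smoothRun {f} j L W n 0≤f = smoothRun-≥ j L (j ℕ.* L ℕ.+ W) n λ s s≤jL →
    let a = j ℕ.* L ℕ.∸ s
        m = n ℤ.+ ℤ.+ s
        jL≡ : s ℕ.+ a ≡ j ℕ.* L
        jL≡ = ℕP.m+[n∸m]≡n s≤jL
        length≡ : j ℕ.* L ℕ.+ W ≡ a ℕ.+ (W ℕ.+ s)
        length≡ = trans (cong (ℕ._+ W) (trans (sym jL≡) (ℕP.+-comm s a)))
          (trans (ℕP.+-assoc a s W) (cong (a ℕ.+_) (ℕP.+-comm s W)))
        start≡ : m ℤ.+ ℤ.+ a ≡ n ℤ.+ ℤ.+ (j ℕ.* L)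
        start≡ = trans (ℤP.+-assoc n (ℤ.+ s) (ℤ.+ a)) (cong (λ k → n ℤ.+ ℤ.+ k) jL≡)
    in begin
      run W f (n ℤ.+ ℤ.+ (j ℕ.* L))         ≡⟨ cong (run W f) start≡ ⟨
      run W f (m ℤ.+ ℤ.+ a)                 ≤⟨ p≤p+q (run-nonneg s f (m ℤ.+ ℤ.+ a ℤ.+ ℤ.+ W) 0≤f) ⟩
      run W f (m ℤ.+ ℤ.+ a) + run s f (m ℤ.+ ℤ.+ a ℤ.+ ℤ.+ W)  ≡⟨ run-split W s f (m ℤ.+ ℤ.+ a) ⟨
      run (W ℕ.+ s) f (m ℤ.+ ℤ.+ a)         ≤⟨ ≤-by (+-comm (run a f m) _) (run-nonneg a f m 0≤f) ⟩
      run a f m + run (W ℕ.+ s) f (m ℤ.+ ℤ.+ a)   ≡⟨ run-split a (W ℕ.+ s) f m ⟨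
      run (a ℕ.+ (W ℕ.+ s)) f m             ≡⟨ cong (λ l → run l f m) length≡ ⟨
      run (j ℕ.* L ℕ.+ W) f m               ∎
    where open ≤-Reasoning

-- Divisibility indicators and the Chinese remainder theorem

module Kernel where

  open Rat
  open Sums
  open Average

  δ : ℕ → ℤ → ℚ
  δ p n = if does (p ∣? ℤ.∣ n ∣) then 1ℚ else 0ℚ

  δ-yes : ∀ {p} n → p ∣ ℤ.∣ n ∣ → δ p n ≡ 1ℚ
  δ-yes {p} n p∣n = cong (if_then 1ℚ else 0ℚ) (dec-true (p ∣? ℤ.∣ n ∣) p∣n)

  δ-no : ∀ {p} n → ¬ p ∣ ℤ.∣ n ∣ → δ p n ≡ 0ℚ
  δ-no {p} n p∤n = cong (if_then 1ℚ else 0ℚ) (dec-false (p ∣? ℤ.∣ n ∣) p∤n)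

  0≤δ : ∀ p n → 0ℚ ≤ δ p n
  0≤δ p n with p ∣? ℤ.∣ n ∣
  ... | yes _ = 0≤1
  ... | no  _ = ≤-refl

  δ-cong : ∀ {p} m n → (p ∣ ℤ.∣ m ∣ → p ∣ ℤ.∣ n ∣) → (p ∣ ℤ.∣ n ∣ → p ∣ ℤ.∣ m ∣) → δ p m ≡ δ p n
  δ-cong {p} m n to from with p ∣? ℤ.∣ m ∣ | p ∣? ℤ.∣ n ∣
  ... | yes _   | yes _   = refl
  ... | yes p∣m | no p∤n  = ⊥-elim (p∤n (to p∣m))
  ... | no p∤m  | yes p∣n = ⊥-elim (p∤m (from p∣n))
  ... | no _    | no _    = refl

  ∣-+ : ∀ {p} m n → p ∣ ℤ.∣ m ∣ → p ∣ ℤ.∣ n ∣ → p ∣ ℤ.∣ m ℤ.+ n ∣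
  ∣-+ {p} m n p∣m p∣n = ∣⇒∣ᵤ {pos p} (ℤD.∣m∣n⇒∣m+n (∣ᵤ⇒∣ {pos p} {m} p∣m) (∣ᵤ⇒∣ {pos p} {n} p∣n))

  ∣-- : ∀ {p} m n → p ∣ ℤ.∣ m ∣ → p ∣ ℤ.∣ n ∣ → p ∣ ℤ.∣ m ℤ.- n ∣
  ∣-- {p} m n p∣m p∣n = ∣⇒∣ᵤ {pos p} (ℤD.∣m∣n⇒∣m-n (∣ᵤ⇒∣ {pos p} {m} p∣m) (∣ᵤ⇒∣ {pos p} {n} p∣n))

  δ-shift : ∀ {p} n k → p ∣ ℤ.∣ k ∣ → δ p (n ℤ.+ k) ≡ δ p n
  δ-shift {p} n k p∣k = δ-cong (n ℤ.+ k) n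
    (λ d → subst (λ z → p ∣ ℤ.∣ z ∣) (cancel n k) (∣-- (n ℤ.+ k) k d p∣k))
    (λ d → ∣-+ n k d p∣k)
    where
    cancel : ∀ n k → (n ℤ.+ k) ℤ.- k ≡ n
    cancel = solve-∀

  δ-neg : ∀ p n → δ p (ℤ.- n) ≡ δ p n
  δ-neg p n = cong (λ m → if does (p ∣? m) then 1ℚ else 0ℚ) (ℤP.∣-i∣≡∣i∣ n)

  ∣-*ˡ : ∀ {p} m s → p ∣ m → p ∣ ℤ.∣ pos (m ℕ.* s) ∣
  ∣-*ˡ m s p∣m = ℕD.∣m⇒∣m*n s p∣m

  inverse-mod : ∀ p M → Coprime p M → ∃ λ (u : ℤ) → p ∣ ℤ.∣ pos M ℤ.* u ℤ.- pos 1 ∣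
  inverse-mod p M coprime with Coprimality.coprime-Bézout coprime
  ... | GCD.Bézout.+- x y eq = ℤ.- pos y , subst (λ z → p ∣ ℤ.∣ z ∣) (sym e)
    (ℕD.∣-trans (ℕD.n∣m*n x) (ℕD.∣-reflexive (sym (ℤP.∣-i∣≡∣i∣ (pos (x ℕ.* p))))))
    where
    e : pos M ℤ.* ℤ.- pos y ℤ.- pos 1 ≡ ℤ.- pos (x ℕ.* p)
    e = trans (rearrange (pos M) (pos y))
      (cong ℤ.-_ (trans (cong (λ z → pos 1 ℤ.+ z) (sym (ℤP.pos-* y M))) (cong pos eq)))
      where
      rearrange : ∀ m y → m ℤ.* ℤ.- y ℤ.- pos 1 ≡ ℤ.- (pos 1 ℤ.+ y ℤ.* m)
      rearrange = solve-∀
  ... | GCD.Bézout.-+ x y eq = pos y , subst (λ z → p ∣ ℤ.∣ z ∣) (sym e) (ℕD.n∣m*n x)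
    where
    e : pos M ℤ.* pos y ℤ.- pos 1 ≡ pos (x ℕ.* p)
    e = trans (cong (ℤ._- pos 1) (trans (ℤP.*-comm (pos M) (pos y)) (trans (sym (ℤP.pos-* y M))
      (cong pos (sym eq)))))
      (rearrange (pos (x ℕ.* p)))
      where
      rearrange : ∀ m → (pos 1 ℤ.+ m) ℤ.- pos 1 ≡ m
      rearrange = solve-∀

  ∑<-single : ∀ p s₀ {f} → s₀ ℕ.< p → (∀ s → s ℕ.< p → s ≢ s₀ → f s ≡ 0ℚ) → ∑< p f ≡ f s₀
  ∑<-single (suc p) s₀ {f} s₀<1+p zeros with s₀ ℕ.≟ p
  ... | yes refl = trans (cong (f p +_) (trans
      (∑<-cong p λ s s<p → zeros s (ℕP.m<n⇒m<1+n s<p) (ℕP.<⇒≢ s<p)) (∑-0 (downFrom p))))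
        (+-identityʳ (f p))
  ... | no s₀≢p = trans (cong₂ _+_ (zeros p ℕP.≤-refl (≢-sym s₀≢p))
      (∑<-single p s₀ (ℕP.≤∧≢⇒< (ℕP.≤-pred s₀<1+p) s₀≢p) λ s s<p → zeros s (ℕP.m<n⇒m<1+n s<p)))
    (+-identityˡ (f s₀))

  private
    residue : ∀ {p} M n u s q → p ∣ ℤ.∣ pos M ℤ.* u ℤ.- pos 1 ∣ →
      ℤ.- (n ℤ.* u) ≡ pos s ℤ.+ q ℤ.* pos p → p ∣ ℤ.∣ n ℤ.+ pos (M ℕ.* s) ∣
    residue {p} M n u s q p∣Mu-1 eq = subst (λ z → p ∣ ℤ.∣ z ∣) (sym e)
      (∣-- (n ℤ.* ℤ.- v) (pos M ℤ.* (q ℤ.* pos p))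
        (subst (p ∣_) (sym (trans (ℤP.abs-* n (ℤ.- v)) (cong (ℤ.∣ n ∣ ℕ.*_) (ℤP.∣-i∣≡∣i∣ v))))
          (ℕD.∣n⇒∣m*n ℤ.∣ n ∣ p∣Mu-1))
        (subst (p ∣_) (sym (trans (ℤP.abs-* (pos M) (q ℤ.* pos p))
          (cong (M ℕ.*_) (ℤP.abs-* q (pos p)))))
          (ℕD.∣n⇒∣m*n M (ℕD.n∣m*n ℤ.∣ q ∣))))
      where
      v = pos M ℤ.* u ℤ.- pos 1
      add : ∀ s t → s ≡ (s ℤ.+ t) ℤ.- t
      add = solve-∀
      expand : ∀ n m u t →
        n ℤ.+ m ℤ.* (ℤ.- (n ℤ.* u) ℤ.- t) ≡ n ℤ.* ℤ.- (m ℤ.* u ℤ.- pos 1) ℤ.- m ℤ.* t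
      expand = solve-∀
      e : n ℤ.+ pos (M ℕ.* s) ≡ n ℤ.* ℤ.- v ℤ.- pos M ℤ.* (q ℤ.* pos p)
      e = trans (cong (λ z → n ℤ.+ z) (ℤP.pos-* M s))
        (trans (cong (λ z → n ℤ.+ pos M ℤ.* z)
            (trans (add (pos s) (q ℤ.* pos p)) (cong (λ z → z ℤ.- q ℤ.* pos p) (sym eq))))
          (expand n (pos M) u (q ℤ.* pos p)))

    -- The solution is the residue of `- (n * u)` modulo `p`, where `u` inverts `M` modulo `p`.
    solution : ∀ {p} .{{_ : ℕ.NonZero p}} M → Coprime p M → ∀ n →
      ∃ λ s → s ℕ.< p × p ∣ ℤ.∣ n ℤ.+ pos (M ℕ.* s) ∣
    solution {p} M coprime n =
      let u , p∣Mu-1 = inverse-mod p M coprime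
          w = ℤ.- (n ℤ.* u)
      in w ℤDM.%ℕ p , ℤDM.n%ℕd<d w p ,
         residue M n u (w ℤDM.%ℕ p) (w ℤDM./ℕ p) p∣Mu-1 (ℤDM.a≡a%ℕn+[a/ℕn]*n w p)

    unique : ∀ {p M} → Coprime p M → ∀ n s s′ → s ℕ.< p →
      p ∣ ℤ.∣ n ℤ.+ pos (M ℕ.* s) ∣ → p ∣ ℤ.∣ n ℤ.+ pos (M ℕ.* s′) ∣ → s′ ℕ.≤ s → s ≡ s′
    unique {p} {M} coprime n s s′ s<p p∣s p∣s′ s′≤s with s ℕ.∸ s′ in eq
    ... | zero  = ℕP.≤-antisym (ℕP.m∸n≡0⇒m≤n eq) s′≤s
    ... | suc d = ⊥-elim (ℕP.<⇒≱ (ℕP.≤-<-trans (subst (ℕ._≤ s) eq (ℕP.m∸n≤m s s′)) s<p) (ℕD.∣⇒≤ p∣d))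
      where
      s≡ : s ≡ s′ ℕ.+ suc d
      s≡ = trans (sym (ℕP.m+[n∸m]≡n s′≤s)) (cong (s′ ℕ.+_) eq)
      rearrange : ∀ n a b → (n ℤ.+ (a ℤ.+ b)) ℤ.- (n ℤ.+ a) ≡ b
      rearrange = solve-∀
      difference : (n ℤ.+ pos (M ℕ.* s)) ℤ.- (n ℤ.+ pos (M ℕ.* s′)) ≡ pos (M ℕ.* suc d)
      difference = trans
        (cong (λ z → (n ℤ.+ pos z) ℤ.- (n ℤ.+ pos (M ℕ.* s′))) (trans (cong (M ℕ.*_) s≡)
          (ℕP.*-distribˡ-+ M s′ (suc d))))
        (rearrange n (pos (M ℕ.* s′)) (pos (M ℕ.* suc d)))
      p∣d : p ∣ suc d
      p∣d = Coprimality.coprime-divisor coprime (subst (λ z → p ∣ ℤ.∣ z ∣) difference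
        (∣-- (n ℤ.+ pos (M ℕ.* s)) (n ℤ.+ pos (M ℕ.* s′)) p∣s p∣s′))

  -- As `M` is invertible modulo `p`, the terms `n + M * s` with `s < p` run through every residue
  -- class exactly once.
  ∑δ≡1 : ∀ {p} .{{_ : ℕ.NonZero p}} M → Coprime p M → ∀ n → ∑< p (λ s → δ p (n ℤ.+ pos (M ℕ.* s))) ≡ 1ℚ
  ∑δ≡1 {p} M coprime n = at (solution M coprime n)
    where
    at : (∃ λ s₀ → s₀ ℕ.< p × p ∣ ℤ.∣ n ℤ.+ pos (M ℕ.* s₀) ∣) → ∑< p (λ s → δ p (n ℤ.+ pos (M ℕ.* s))) ≡
      1ℚ
    at (s₀ , s₀<p , p∣s₀) = trans
      (∑<-single p s₀ s₀<p λ s s<p s≢s₀ → δ-no (n ℤ.+ pos (M ℕ.* s)) λ p∣s → s≢s₀ (same s s<p p∣s))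
      (δ-yes (n ℤ.+ pos (M ℕ.* s₀)) p∣s₀)
      where
      same : ∀ s → s ℕ.< p → p ∣ ℤ.∣ n ℤ.+ pos (M ℕ.* s) ∣ → s ≡ s₀
      same s s<p p∣s with ℕP.≤-total s₀ s
      ... | inj₁ le = unique {p} {M} coprime n s s₀ s<p p∣s p∣s₀ le
      ... | inj₂ le = sym (unique {p} {M} coprime n s₀ s s₀<p p∣s₀ p∣s le)

  ∑<-blocks : ∀ p M f → ∑< (p ℕ.* M) f ≡ ∑< p λ s → ∑< M λ r → f (s ℕ.* M ℕ.+ r)
  ∑<-blocks zero    M f = refl
  ∑<-blocks (suc p) M f = begin
    ∑< (M ℕ.+ p ℕ.* M) f                               ≡⟨ cong (λ L → ∑< L f) (ℕP.+-comm M (p ℕ.* M)) ⟩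
    ∑< (p ℕ.* M ℕ.+ M) f                               ≡⟨ ∑<-+ (p ℕ.* M) M f ⟩
    ∑< (p ℕ.* M) f + ∑< M (λ r → f (p ℕ.* M ℕ.+ r))    ≡⟨ +-comm _ _ ⟩
    ∑< M (λ r → f (p ℕ.* M ℕ.+ r)) + ∑< (p ℕ.* M) f    ≡⟨ cong (∑< M (λ r → f (p ℕ.* M ℕ.+ r)) +_)
      (∑<-blocks p M f) ⟩
    ∑< (suc p) (λ s → ∑< M λ r → f (s ℕ.* M ℕ.+ r))    ∎
    where open ≡-Reasoning

  -- Independence of residues to coprime moduli.
  hasMean-* : ∀ p M {μ ν} (f g : ℤ → ℚ) →
    (∀ n → ∑< p (λ s → f (n ℤ.+ pos (M ℕ.* s))) ≡ ι p * μ) →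
    HasMean M ν g → (∀ n s → g (n ℤ.+ pos (M ℕ.* s)) ≡ g n) →
    HasMean (p ℕ.* M) (μ * ν) (λ n → f n * g n)
  hasMean-* p M {μ} {ν} f g meanᶠ meanᵍ period n = begin
    run (p ℕ.* M) (λ n → f n * g n) n
      ≡⟨ ∑<-blocks p M (λ t → f (n ℤ.+ pos t) * g (n ℤ.+ pos t)) ⟩
    ∑< p (λ s → ∑< M λ r → f (n ℤ.+ pos (s ℕ.* M ℕ.+ r)) * g (n ℤ.+ pos (s ℕ.* M ℕ.+ r)))
      ≡⟨ ∑-swap (downFrom p) (downFrom M) _ ⟩
    ∑< M (λ r → ∑< p λ s → f (n ℤ.+ pos (s ℕ.* M ℕ.+ r)) * g (n ℤ.+ pos (s ℕ.* M ℕ.+ r)))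
      ≡⟨ ∑-cong (downFrom M) (λ r → trans
           (∑-cong (downFrom p) λ s → cong₂ _*_ (cong f (move r s)) (trans (cong g (move r s))
             (period (n ℤ.+ pos r) s)))
           (trans (∑-*ʳ (downFrom p) (g (n ℤ.+ pos r)) (λ s → f (n ℤ.+ pos r ℤ.+ pos (M ℕ.* s))))
             (cong (_* g (n ℤ.+ pos r)) (meanᶠ (n ℤ.+ pos r))))) ⟩
    ∑< M (λ r → ι p * μ * g (n ℤ.+ pos r))
      ≡⟨ ∑-*ˡ (downFrom M) (ι p * μ) _ ⟩
    ι p * μ * run M g n
      ≡⟨ cong (ι p * μ *_) (meanᵍ n) ⟩
    ι p * μ * (ι M * ν)
      ≡⟨ regroup (ι p) μ (ι M) ν ⟩
    ι p * ι M * (μ * ν)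
      ≡⟨ cong (_* (μ * ν)) (ι-* p M) ⟨
    ι (p ℕ.* M) * (μ * ν) ∎
    where
    open ≡-Reasoning
    regroup : ∀ a b c d → a * b * (c * d) ≡ a * c * (b * d)
    regroup = solve 4 (λ a b c d → a :* b :* (c :* d) := a :* c :* (b :* d)) refl
    move : ∀ r s → n ℤ.+ pos (s ℕ.* M ℕ.+ r) ≡ n ℤ.+ pos r ℤ.+ pos (M ℕ.* s)
    move r s = trans (cong (λ z → n ℤ.+ pos z) (trans (ℕP.+-comm (s ℕ.* M) r)
      (cong (r ℕ.+_) (ℕP.*-comm s M))))
      (sym (ℤP.+-assoc n (pos r) (pos (M ℕ.* s))))

-- Squarefree moduli and the orthogonality of Ramanujan sums

module Subsets where

  open Rat
  open Sums
  open Average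
  open Kernel

  DistinctPrimes : List ℕ → Set
  DistinctPrimes Q = All Prime Q × Unique Q

  -- A subset of a list of distinct primes stands for a squarefree integer, its `norm`. Union then
  -- is the least common multiple and `incl` is divisibility, and multiplicativity in the modulus
  -- becomes structural recursion.
  data Sub : List ℕ → Set where
    []   : Sub []
    skip : ∀ {p Q} → Sub Q → Sub (p ∷ Q)
    pick : ∀ {p Q} → Sub Q → Sub (p ∷ Q)

  private variable
    Q : List ℕ

  subs : ∀ Q → List (Sub Q)
  subs []      = [] ∷ []
  subs (p ∷ Q) = map skip (subs Q) ++ map pick (subs Q)

  ∑-subs-∷ : ∀ p Q f → ∑ (subs (p ∷ Q)) f ≡
    ∑ (subs Q) (λ S → f (skip S)) + ∑ (subs Q) (λ S → f (pick S))
  ∑-subs-∷ p Q f = trans (∑-++ (map skip (subs Q)) (map pick (subs Q)) f)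
    (cong₂ _+_ (∑-map skip (subs Q) f) (∑-map pick (subs Q) f))

  norm : Sub Q → ℕ
  norm []               = 1
  norm (skip S)         = norm S
  norm (pick {p = p} S) = p ℕ.* norm S

  inv : Sub Q → ℚ
  inv []               = 1ℚ
  inv (skip S)         = inv S
  inv (pick {p = p} S) = recip p * inv S

  δs : Sub Q → ℤ → ℚ
  δs []               n = 1ℚ
  δs (skip S)         n = δs S n
  δs (pick {p = p} S) n = δ p n * δs S n

  -- The Ramanujan sum c_d for d = norm S.
  cp : ℕ → ℤ → ℚ
  cp p n = ι p * δ p n - 1ℚ

  c : Sub Q → ℤ → ℚ
  c []               n = 1ℚ
  c (skip S)         n = c S n
  c (pick {p = p} S) n = cp p n * c S n

  incl : Sub Q → Sub Q → ℚ
  incl []       []       = 1ℚ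
  incl (skip T) (skip S) = incl T S
  incl (skip T) (pick S) = incl T S
  incl (pick T) (skip S) = 0ℚ
  incl (pick T) (pick S) = incl T S

  _∪_ : Sub Q → Sub Q → Sub Q
  []     ∪ []     = []
  skip S ∪ skip T = skip (S ∪ T)
  skip S ∪ pick T = pick (S ∪ T)
  pick S ∪ skip T = pick (S ∪ T)
  pick S ∪ pick T = pick (S ∪ T)

  norm-nonZero : All Prime Q → (S : Sub Q) → ℕ.NonZero (norm S)
  norm-nonZero []       []       = _
  norm-nonZero (_ ∷ ps) (skip S) = norm-nonZero ps S
  norm-nonZero (p ∷ ps) (pick S) =
    ℕP.m*n≢0 _ (norm S) {{prime⇒nonZero p}} {{norm-nonZero ps S}}

  norm*inv : All Prime Q → (S : Sub Q) → ι (norm S) * inv S ≡ 1ℚ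
  norm*inv []       []       = trans (*-identityʳ (ι 1)) ι1
  norm*inv (_ ∷ ps) (skip S) = norm*inv ps S
  norm*inv {p ∷ Q} (pp ∷ ps) (pick S) = begin
    ι (p ℕ.* norm S) * (recip p * inv S)    ≡⟨ cong (_* (recip p * inv S)) (ι-* p (norm S)) ⟩
    ι p * ι (norm S) * (recip p * inv S)    ≡⟨ regroup (ι p) (ι (norm S)) (recip p) (inv S) ⟩
    (ι p * recip p) * (ι (norm S) * inv S)  ≡⟨ cong₂ _*_ (ι*recip p {{prime⇒nonZero pp}})
      (norm*inv ps S) ⟩
    1ℚ * 1ℚ                                 ≡⟨ *-identityˡ 1ℚ ⟩
    1ℚ                                      ∎
    where
    open ≡-Reasoning
    regroup : ∀ a b c d → a * b * (c * d) ≡ (a * c) * (b * d)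
    regroup = solve 4 (λ a b c d → a :* b :* (c :* d) := (a :* c) :* (b :* d)) refl

  0≤inv : (S : Sub Q) → 0ℚ ≤ inv S
  0≤inv []               = 0≤1
  0≤inv (skip S)         = 0≤inv S
  0≤inv (pick {p = p} S) = 0≤* (0≤recip p) (0≤inv S)

  0≤δs : (S : Sub Q) → ∀ n → 0ℚ ≤ δs S n
  0≤δs []               n = 0≤1
  0≤δs (skip S)         n = 0≤δs S n
  0≤δs (pick {p = p} S) n = 0≤* (0≤δ p n) (0≤δs S n)

  0≤incl : (T S : Sub Q) → 0ℚ ≤ incl T S
  0≤incl []       []       = 0≤1
  0≤incl (skip T) (skip S) = 0≤incl T S
  0≤incl (skip T) (pick S) = 0≤incl T S
  0≤incl (pick T) (skip S) = ≤-refl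
  0≤incl (pick T) (pick S) = 0≤incl T S

  -- For a single prime, `δ p n` is `recip p * (1 + cp p n)`. Multiplying out over the primes of `S`
  -- gives one term for every subset of `S`.
  δs-expand : All Prime Q → (S : Sub Q) → ∀ n →
    δs S n ≡ inv S * ∑ (subs Q) (λ T → incl T S * c T n)
  δs-expand [] [] n = expand 1ℚ
    where
    expand : ∀ a → 1ℚ ≡ 1ℚ * (1ℚ * 1ℚ + 0ℚ)
    expand = solve 1 (λ a → (con 1ℚ) := (con 1ℚ) :* ((con 1ℚ) :* (con 1ℚ) :+ (con 0ℚ))) refl
  δs-expand {p ∷ Q} (_ ∷ ps) (skip S) n = begin
    δs S n
      ≡⟨ δs-expand ps S n ⟩
    inv S * A
      ≡⟨ cong (inv S *_) (sym (trans (∑-subs-∷ p Q _) (trans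
           (cong (A +_) (trans (∑-cong (subs Q) λ T → *-zeroˡ (c (pick {p} T) n)) (∑-0 (subs Q))))
           (+-identityʳ A)))) ⟩
    inv S * ∑ (subs (p ∷ Q)) (λ T → incl T (skip S) * c T n) ∎
    where
    open ≡-Reasoning
    A = ∑ (subs Q) (λ T → incl T S * c T n)
  δs-expand {p ∷ Q} (pp ∷ ps) (pick S) n = begin
    δ p n * δs S n
      ≡⟨ cong₂ _*_ (sym (*-identityˡ (δ p n))) (δs-expand ps S n) ⟩
    1ℚ * δ p n * (inv S * A)
      ≡⟨ cong (λ z → z * δ p n * (inv S * A)) (ι*recip p {{prime⇒nonZero pp}}) ⟨
    ι p * recip p * δ p n * (inv S * A)
      ≡⟨ regroup (ι p) (recip p) (δ p n) (inv S) A ⟩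
    recip p * inv S * (A + cp p n * A)
      ≡⟨ cong (λ z → recip p * inv S * (A + z))
           (trans (sym (∑-*ˡ (subs Q) (cp p n) _)) (∑-cong (subs Q) λ T → swap (cp p n) (incl T S)
             (c T n))) ⟩
    recip p * inv S * (A + ∑ (subs Q) (λ T → incl T S * (cp p n * c T n)))
      ≡⟨ cong (recip p * inv S *_) (∑-subs-∷ p Q _) ⟨
    recip p * inv S * ∑ (subs (p ∷ Q)) (λ T → incl T (pick S) * c T n) ∎
    where
    open ≡-Reasoning
    A = ∑ (subs Q) (λ T → incl T S * c T n)
    regroup : ∀ p r d i a → p * r * d * (i * a) ≡ r * i * (a + (p * d - 1ℚ) * a)
    regroup = solve 5 (λ p r d i a → p :* r :* d :* (i :* a) := r :* i :* (a :+ (p :* d :- (con 1ℚ)) :*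
      a)) refl
    swap : ∀ a b c → a * (b * c) ≡ b * (a * c)
    swap = solve 3 (λ a b c → a :* (b :* c) := b :* (a :* c)) refl

  prime∤norm : ∀ {p} → Prime p → All Prime Q → All (p ≢_) Q → (S : Sub Q) → ¬ p ∣ norm S
  prime∤norm {p = p} pp [] [] [] p∣1 = ℕ.nonTrivial⇒≢1 {{prime⇒nonTrivial pp}} (ℕD.∣1⇒≡1 p∣1)
  prime∤norm pp (_ ∷ ps) (_ ∷ ≢s) (skip S) p∣ = prime∤norm pp ps ≢s S p∣
  prime∤norm {p = p} pp (qp ∷ ps) (p≢q ∷ ≢s) (pick {p = q} S) p∣ with euclidsLemma q (norm S) pp p∣
  ... | inj₂ p∣S = prime∤norm pp ps ≢s S p∣S
  ... | inj₁ p∣q with prime⇒irreducible qp p∣q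
  ...   | inj₁ p≡1 = ℕ.nonTrivial⇒≢1 {{prime⇒nonTrivial pp}} p≡1
  ...   | inj₂ p≡q = p≢q p≡q

  prime∤⇒coprime : ∀ {p m} → Prime p → ¬ p ∣ m → Coprime p m
  prime∤⇒coprime pp p∤m (d∣p , d∣m) with prime⇒irreducible pp d∣p
  ... | inj₁ d≡1 = d≡1
  ... | inj₂ refl = ⊥-elim (p∤m d∣m)

  δs-period : (S : Sub Q) → ∀ {M} → norm S ∣ M → ∀ n s → δs S (n ℤ.+ pos (M ℕ.* s)) ≡ δs S n
  δs-period []       S∣M n s = refl
  δs-period (skip S) S∣M n s = δs-period S S∣M n s
  δs-period (pick {p = p} S) {M} S∣M n s = cong₂ _*_
    (δ-shift n _ (∣-*ˡ M s (ℕD.m*n∣⇒m∣ p (norm S) S∣M))) (δs-period S (ℕD.m*n∣⇒n∣ p (norm S) S∣M) n s)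

  c-period : (S : Sub Q) → ∀ {M} → norm S ∣ M → ∀ n s → c S (n ℤ.+ pos (M ℕ.* s)) ≡ c S n
  c-period []       S∣M n s = refl
  c-period (skip S) S∣M n s = c-period S S∣M n s
  c-period (pick {p = p} S) {M} S∣M n s = cong₂ _*_
    (cong (λ z → ι p * z - 1ℚ) (δ-shift n _ (∣-*ˡ M s (ℕD.m*n∣⇒m∣ p (norm S) S∣M))))
    (c-period S (ℕD.m*n∣⇒n∣ p (norm S) S∣M) n s)

  norm∣∪ˡ : (S T : Sub Q) → norm S ∣ norm (S ∪ T)
  norm∣∪ˡ []       []       = ℕD.∣-refl
  norm∣∪ˡ (skip S) (skip T) = norm∣∪ˡ S T
  norm∣∪ˡ (skip {p = p} S) (pick T) = ℕD.∣n⇒∣m*n p (norm∣∪ˡ S T)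
  norm∣∪ˡ (pick {p = p} S) (skip T) = ℕD.*-monoʳ-∣ p (norm∣∪ˡ S T)
  norm∣∪ˡ (pick {p = p} S) (pick T) = ℕD.*-monoʳ-∣ p (norm∣∪ˡ S T)

  ∪-comm : (S T : Sub Q) → S ∪ T ≡ T ∪ S
  ∪-comm []       []       = refl
  ∪-comm (skip S) (skip T) = cong skip (∪-comm S T)
  ∪-comm (skip S) (pick T) = cong pick (∪-comm S T)
  ∪-comm (pick S) (skip T) = cong pick (∪-comm S T)
  ∪-comm (pick S) (pick T) = cong pick (∪-comm S T)

  norm∣∪ʳ : (S T : Sub Q) → norm T ∣ norm (S ∪ T)
  norm∣∪ʳ S T = subst (λ U → norm T ∣ norm U) (∪-comm T S) (norm∣∪ˡ T S)

  norm-∪-≤ : All Prime Q → (S T : Sub Q) → norm (S ∪ T) ℕ.≤ norm S ℕ.* norm T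
  norm-∪-≤ []       []       []       = ℕP.≤-refl
  norm-∪-≤ (_ ∷ ps) (skip S) (skip T) = norm-∪-≤ ps S T
  norm-∪-≤ {p ∷ Q} (_ ∷ ps) (skip S) (pick T) = ℕP.≤-trans (ℕP.*-monoʳ-≤ p (norm-∪-≤ ps S T))
    (ℕP.≤-reflexive (trans (sym (ℕP.*-assoc p (norm S) (norm T)))
      (trans (cong (ℕ._* norm T) (ℕP.*-comm p (norm S))) (ℕP.*-assoc (norm S) p (norm T)))))
  norm-∪-≤ {p ∷ Q} (_ ∷ ps) (pick S) (skip T) = ℕP.≤-trans (ℕP.*-monoʳ-≤ p (norm-∪-≤ ps S T))
    (ℕP.≤-reflexive (sym (ℕP.*-assoc p (norm S) (norm T))))
  norm-∪-≤ {p ∷ Q} (pp ∷ ps) (pick S) (pick T) = ℕP.≤-trans (ℕP.*-monoʳ-≤ p (norm-∪-≤ ps S T))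
    (ℕP.≤-trans (ℕP.≤-reflexive (sym (ℕP.*-assoc p (norm S) (norm T))))
      (ℕP.*-monoʳ-≤ (p ℕ.* norm S) (ℕP.m≤n*m (norm T) p {{prime⇒nonZero pp}})))

  δs-mean : DistinctPrimes Q → (S : Sub Q) → HasMean (norm S) (inv S) (δs S)
  δs-mean ([] , []) [] n = trans (collapse 1ℚ) (cong (_* 1ℚ) (sym ι1))
    where
    collapse : ∀ a → 1ℚ + 0ℚ ≡ 1ℚ * 1ℚ
    collapse = solve 1 (λ a → (con 1ℚ) :+ (con 0ℚ) := (con 1ℚ) :* (con 1ℚ)) refl
  δs-mean (_ ∷ ps , _ ∷ us) (skip S) = δs-mean (ps , us) S
  δs-mean {p ∷ Q} (pp ∷ ps , ≢s ∷ us) (pick S) =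
    hasMean-* p (norm S) (δ p) (δs S)
      (λ n → trans (∑δ≡1 (norm S) (prime∤⇒coprime pp (prime∤norm pp ps ≢s S)) n) (sym (ι*recip p)))
      (δs-mean (ps , us) S) (δs-period S ℕD.∣-refl)
    where instance _ = prime⇒nonZero pp

  -- The orthogonality relation in recursive form: one prime lying in only one of the two subsets
  -- makes the value 0, and for equal subsets the value is the Ramanujan sum at `k`.
  correlation : Sub Q → Sub Q → ℤ → ℚ
  correlation []       []       k = 1ℚ
  correlation (skip S) (skip T) k = correlation S T k
  correlation (skip S) (pick T) k = 0ℚ
  correlation (pick S) (skip T) k = 0ℚ
  correlation (pick {p = p} S) (pick T) k = cp p k * correlation S T k

  private
    progression-swap : ∀ n b m → n ℤ.+ m ℤ.+ b ≡ n ℤ.+ b ℤ.+ m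
    progression-swap = solve-∀

    cp-mean : ∀ {p} .{{_ : ℕ.NonZero p}} M → Coprime p M → ∀ b n →
      ∑< p (λ s → cp p (n ℤ.+ pos (M ℕ.* s) ℤ.+ b)) ≡ ι p * 0ℚ
    cp-mean {p} M coprime b n = begin
      ∑< p (λ s → ι p * δ p (n ℤ.+ pos (M ℕ.* s) ℤ.+ b) - 1ℚ)
        ≡⟨ ∑-- (downFrom p) _ _ ⟩
      ∑< p (λ s → ι p * δ p (n ℤ.+ pos (M ℕ.* s) ℤ.+ b)) - ∑< p (λ _ → 1ℚ)
        ≡⟨ cong₂ _-_ (∑-*ˡ (downFrom p) (ι p) _) (∑<-const p 1ℚ) ⟩
      ι p * ∑< p (λ s → δ p (n ℤ.+ pos (M ℕ.* s) ℤ.+ b)) - ι p * 1ℚ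
        ≡⟨ cong (λ z → ι p * z - ι p * 1ℚ) (trans
             (∑-cong (downFrom p) λ s → cong (δ p) (progression-swap n b (pos (M ℕ.* s))))
               (∑δ≡1 M coprime (n ℤ.+ b))) ⟩
      ι p * 1ℚ - ι p * 1ℚ
        ≡⟨ cancel (ι p) ⟩
      ι p * 0ℚ ∎
      where
      open ≡-Reasoning
      cancel : ∀ p → p * 1ℚ - p * 1ℚ ≡ p * 0ℚ
      cancel = solve 1 (λ p → p :* (con 1ℚ) :- p :* (con 1ℚ) := p :* (con 0ℚ)) refl

    -- Once `p` divides `m + b`, it divides `m + b′` exactly when it divides the difference. This
    -- makes the product of two indicators linear in the first.
    δ*δ : ∀ p m b b′ → δ p (m ℤ.+ b) * δ p (m ℤ.+ b′) ≡ δ p (m ℤ.+ b) * δ p (b ℤ.- b′)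
    δ*δ p m b b′ with p ∣? ℤ.∣ m ℤ.+ b ∣
    ... | no _ = trans (*-zeroˡ _) (sym (*-zeroˡ _))
    ... | yes d = cong (1ℚ *_) (δ-cong (m ℤ.+ b′) (b ℤ.- b′)
      (λ d′ → subst (λ z → p ∣ ℤ.∣ z ∣) (diff m b b′) (∣-- (m ℤ.+ b) (m ℤ.+ b′) d d′))
      (λ d′ → subst (λ z → p ∣ ℤ.∣ z ∣) (diff′ m b b′) (∣-- (m ℤ.+ b) (b ℤ.- b′) d d′)))
      where
      diff : ∀ m b b′ → (m ℤ.+ b) ℤ.- (m ℤ.+ b′) ≡ b ℤ.- b′
      diff = solve-∀
      diff′ : ∀ m b b′ → (m ℤ.+ b) ℤ.- (b ℤ.- b′) ≡ m ℤ.+ b′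
      diff′ = solve-∀

    cp-cp-mean : ∀ {p} .{{_ : ℕ.NonZero p}} M → Coprime p M → ∀ b b′ n →
      ∑< p (λ s → cp p (n ℤ.+ pos (M ℕ.* s) ℤ.+ b) * cp p (n ℤ.+ pos (M ℕ.* s) ℤ.+ b′)) ≡ ι p * cp p
        (b ℤ.- b′)
    cp-cp-mean {p} M coprime b b′ n = begin
      ∑< p (λ s → cp p (m s ℤ.+ b) * cp p (m s ℤ.+ b′))
        ≡⟨ ∑-cong (downFrom p) (λ s → trans (expand (ι p) (δ p (m s ℤ.+ b)) (δ p (m s ℤ.+ b′)))
             (trans (cong (λ z → ι p * ι p * z - ι p * δ p (m s ℤ.+ b) - cp p (m s ℤ.+ b′))
               (δ*δ p (m s) b b′))
               (regroup (ι p) (δ p (m s ℤ.+ b)) (δ p (b ℤ.- b′)) (cp p (m s ℤ.+ b′))))) ⟩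
      ∑< p (λ s → k * δ p (m s ℤ.+ b) - cp p (m s ℤ.+ b′))
        ≡⟨ trans (∑-- (downFrom p) _ _) (cong (_- ∑< p (λ s → cp p (m s ℤ.+ b′)))
          (∑-*ˡ (downFrom p) k _)) ⟩
      k * ∑< p (λ s → δ p (m s ℤ.+ b)) - ∑< p (λ s → cp p (m s ℤ.+ b′))
        ≡⟨ cong₂ (λ y z → k * y - z) (trans
             (∑-cong (downFrom p) λ s → cong (δ p) (progression-swap n b (pos (M ℕ.* s))))
               (∑δ≡1 M coprime (n ℤ.+ b)))
             (cp-mean M coprime b′ n) ⟩
      k * 1ℚ - ι p * 0ℚ
        ≡⟨ simplify (ι p) (δ p (b ℤ.- b′)) ⟩
      ι p * cp p (b ℤ.- b′) ∎
      where
      open ≡-Reasoning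
      m : ℕ → ℤ
      m s = n ℤ.+ pos (M ℕ.* s)
      k = ι p * ι p * δ p (b ℤ.- b′) - ι p
      expand : ∀ p d e → (p * d - 1ℚ) * (p * e - 1ℚ) ≡ p * p * (d * e) - p * d - (p * e - 1ℚ)
      expand = solve 3 (λ p d e → (p :* d :- (con 1ℚ)) :* (p :* e :- (con 1ℚ)) := p :* p :* (d :* e) :-
        p :* d :- (p :* e :- (con 1ℚ))) refl
      regroup : ∀ p d e z → p * p * (d * e) - p * d - z ≡ (p * p * e - p) * d - z
      regroup = solve 4 (λ p d e z → p :* p :* (d :* e) :- p :* d :- z := (p :* p :* e :- p) :* d :- z)
        refl
      simplify : ∀ p d → (p * p * d - p) * 1ℚ - p * 0ℚ ≡ p * (p * d - 1ℚ)
      simplify = solve 2 (λ p d → (p :* p :* d :- p) :* (con 1ℚ) :- p :* (con 0ℚ) := p :*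
        (p :* d :- (con 1ℚ))) refl

    cc-period : (S T : Sub Q) → ∀ b b′ n s → let k = pos (norm (S ∪ T) ℕ.* s) in
      c S (n ℤ.+ k ℤ.+ b) * c T (n ℤ.+ k ℤ.+ b′) ≡ c S (n ℤ.+ b) * c T (n ℤ.+ b′)
    cc-period S T b b′ n s = cong₂ _*_
      (trans (cong (c S) (progression-swap n b _)) (c-period S (norm∣∪ˡ S T) (n ℤ.+ b) s))
      (trans (cong (c T) (progression-swap n b′ _)) (c-period T (norm∣∪ʳ S T) (n ℤ.+ b′) s))

  -- Residues to different primes are independent, so the mean is a product of local means. A prime
  -- in just one of `S` and `T` contributes the mean 0 of `cp p`; a prime in both contributes the
  -- autocorrelation of `cp p`.
  c-correlation : DistinctPrimes Q → (S T : Sub Q) → ∀ b b′ →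
    HasMean (norm (S ∪ T)) (correlation S T (b ℤ.- b′)) (λ n → c S (n ℤ.+ b) * c T (n ℤ.+ b′))
  c-correlation ([] , []) [] [] b b′ n = trans (collapse 1ℚ) (cong (_* 1ℚ) (sym ι1))
    where
    collapse : ∀ a → 1ℚ * 1ℚ + 0ℚ ≡ 1ℚ * 1ℚ
    collapse = solve 1 (λ a → (con 1ℚ) :* (con 1ℚ) :+ (con 0ℚ) := (con 1ℚ) :* (con 1ℚ)) refl
  c-correlation {p ∷ Q} (pp ∷ ps , ≢s ∷ us) S′ T′ b b′ = go S′ T′
    where
    instance _ = prime⇒nonZero pp
    extend : (S T : Sub Q) (f : ℤ → ℚ) → ∀ {μ} →
      (∀ n → ∑< p (λ s → f (n ℤ.+ pos (norm (S ∪ T) ℕ.* s))) ≡ ι p * μ) →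
      HasMean (p ℕ.* norm (S ∪ T)) (μ * correlation S T (b ℤ.- b′))
        (λ n → f n * (c S (n ℤ.+ b) * c T (n ℤ.+ b′)))
    extend S T f mean = hasMean-* p (norm (S ∪ T)) f (λ n → c S (n ℤ.+ b) * c T (n ℤ.+ b′)) mean
      (c-correlation (ps , us) S T b b′) (cc-period S T b b′)
    coprime : (S T : Sub Q) → Coprime p (norm (S ∪ T))
    coprime S T = prime∤⇒coprime pp (prime∤norm pp ps ≢s (S ∪ T))
    right : ∀ a b c → a * (b * c) ≡ b * (a * c)
    right = solve 3 (λ a b c → a :* (b :* c) := b :* (a :* c)) refl
    left : ∀ a b c → a * (b * c) ≡ a * b * c
    left = solve 3 (λ a b c → a :* (b :* c) := a :* b :* c) refl
    both : ∀ a b c d → (a * b) * (c * d) ≡ a * c * (b * d)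
    both = solve 4 (λ a b c d → (a :* b) :* (c :* d) := a :* c :* (b :* d)) refl
    go : (S T : Sub (p ∷ Q)) →
      HasMean (norm (S ∪ T)) (correlation S T (b ℤ.- b′)) (λ n → c S (n ℤ.+ b) * c T (n ℤ.+ b′))
    go (skip S) (skip T) = c-correlation (ps , us) S T b b′
    go (skip S) (pick T) n = trans
      (run-cong (p ℕ.* norm (S ∪ T)) n λ k → sym (right (cp p (k ℤ.+ b′)) (c S (k ℤ.+ b))
        (c T (k ℤ.+ b′))))
      (trans (extend S T (λ n → cp p (n ℤ.+ b′)) (cp-mean (norm (S ∪ T)) (coprime S T) b′) n)
        (cong (ι (p ℕ.* norm (S ∪ T)) *_) (*-zeroˡ _)))
    go (pick S) (skip T) n = trans
      (run-cong (p ℕ.* norm (S ∪ T)) n λ k → sym (left (cp p (k ℤ.+ b)) (c S (k ℤ.+ b))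
        (c T (k ℤ.+ b′))))
      (trans (extend S T (λ n → cp p (n ℤ.+ b)) (cp-mean (norm (S ∪ T)) (coprime S T) b) n)
        (cong (ι (p ℕ.* norm (S ∪ T)) *_) (*-zeroˡ _)))
    go (pick S) (pick T) n = trans
      (run-cong (p ℕ.* norm (S ∪ T)) n λ k → both (cp p (k ℤ.+ b)) (c S (k ℤ.+ b)) (cp p (k ℤ.+ b′))
        (c T (k ℤ.+ b′)))
      (extend S T (λ n → cp p (n ℤ.+ b) * cp p (n ℤ.+ b′)) (cp-cp-mean (norm (S ∪ T)) (coprime S T) b
        b′) n)

  -- The collapse to the diagonal that orthogonality provides; arbitrary weights `u` are allowed
  -- because the induction on `Q` absorbs the factor `cp p k` into them.
  ∑-correlation : ∀ Q (u : Sub Q → Sub Q → ℚ) k →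
    ∑ (subs Q) (λ S → ∑ (subs Q) λ T → u S T * correlation S T k) ≡ ∑ (subs Q) (λ S → u S S * c S k)
  ∑-correlation [] u k = cong (_+ 0ℚ) (+-identityʳ _)
  ∑-correlation (p ∷ Q) u k = begin
    ∑ (subs (p ∷ Q)) (λ S → ∑ (subs (p ∷ Q)) λ T → u S T * correlation S T k)
      ≡⟨ trans (∑-subs-∷ p Q _) (cong₂ _+_ (∑-cong (subs Q) λ S → ∑-subs-∷ p Q _)
        (∑-cong (subs Q) λ S → ∑-subs-∷ p Q _)) ⟩
    ∑ (subs Q) (λ S → ∑ (subs Q) (λ T → u (skip S) (skip T) * correlation S T k)
      + ∑ (subs Q) (λ T → u (skip S) (pick T) * 0ℚ)) +
    ∑ (subs Q) (λ S → ∑ (subs Q) (λ T → u (pick S) (skip T) * 0ℚ)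
      + ∑ (subs Q) (λ T → u (pick S) (pick T) * (cp p k * correlation S T k)))
      ≡⟨ cong₂ _+_
           (∑-cong (subs Q) λ S → trans
             (cong (∑ (subs Q) (λ T → u (skip S) (skip T) * correlation S T k) +_)
             (vanish (λ T → u (skip S) (pick T)))) (+-identityʳ _))
           (∑-cong (subs Q) λ S → trans (cong₂ _+_ (vanish (λ T → u (pick S) (skip T)))
             (∑-cong (subs Q) λ T → sym (*-assoc (u (pick S) (pick T)) (cp p k) (correlation S T k))))
               (+-identityˡ _)) ⟩
    ∑ (subs Q) (λ S → ∑ (subs Q) (λ T → u (skip S) (skip T) * correlation S T k)) +
    ∑ (subs Q) (λ S → ∑ (subs Q) (λ T → u (pick S) (pick T) * cp p k * correlation S T k))
      ≡⟨ cong₂ _+_ (∑-correlation Q (λ S T → u (skip S) (skip T)) k)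
           (trans (∑-correlation Q (λ S T → u (pick S) (pick T) * cp p k) k)
             (∑-cong (subs Q) λ S → *-assoc (u (pick S) (pick S)) (cp p k) (c S k))) ⟩
    ∑ (subs Q) (λ S → u (skip S) (skip S) * c S k) +
    ∑ (subs Q) (λ S → u (pick S) (pick S) * (cp p k * c S k))
      ≡⟨ ∑-subs-∷ p Q _ ⟨
    ∑ (subs (p ∷ Q)) (λ S → u S S * c S k) ∎
    where
    open ≡-Reasoning
    vanish : (f : Sub Q → ℚ) → ∑ (subs Q) (λ T → f T * 0ℚ) ≡ 0ℚ
    vanish f = trans (∑-cong (subs Q) λ T → *-zeroʳ (f T)) (∑-0 (subs Q))

  correlation-diagonal : (S : Sub Q) → ∀ k → correlation S S k ≡ c S k
  correlation-diagonal []       k = refl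
  correlation-diagonal (skip S) k = correlation-diagonal S k
  correlation-diagonal (pick {p = p} S) k = cong (cp p k *_) (correlation-diagonal S k)

  0≤p-1 : ∀ {p} → Prime p → 0ℚ ≤ ι p - 1ℚ
  0≤p-1 {p} pp = subst (λ z → 0ℚ ≤ ι p - z) ι1 (subst (_≤ ι p - ι 1) (+-inverseʳ (ι 1))
    (+-monoˡ-≤ (- ι 1) (ι-mono-≤ (ℕP.<⇒≤ (ℕ.nonTrivial⇒n>1 p {{prime⇒nonTrivial pp}})))))

  ∣cp∣≤ : ∀ {p} → Prime p → ∀ n → ∣ cp p n ∣ ≤ ι p
  ∣cp∣≤ {p} pp n with p ∣? ℤ.∣ n ∣
  ... | yes _ = ∣∣-≤ (≤-by (up (ι p)) 0≤1) (≤-by (down (ι p)) (0≤+ (0≤+ (0≤p-1 pp) (0≤p-1 pp)) 0≤1))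
    where
    up : ∀ p → p ≡ p * 1ℚ - 1ℚ + 1ℚ
    up = solve 1 (λ p → p := p :* (con 1ℚ) :- (con 1ℚ) :+ (con 1ℚ)) refl
    down : ∀ p → p ≡ - (p * 1ℚ - 1ℚ) + (p - 1ℚ + (p - 1ℚ) + 1ℚ)
    down = solve 1 (λ p → p := :- (p :* (con 1ℚ) :- (con 1ℚ)) :+ (p :- (con 1ℚ) :+ (p :- (con 1ℚ)) :+
      (con 1ℚ))) refl
  ... | no _ = ∣∣-≤ (≤-by (up (ι p)) (0≤+ (0≤ι p) 0≤1)) (≤-by (down (ι p)) (0≤p-1 pp))
    where
    up : ∀ p → p ≡ p * 0ℚ - 1ℚ + (p + 1ℚ)
    up = solve 1 (λ p → p := p :* (con 0ℚ) :- (con 1ℚ) :+ (p :+ (con 1ℚ))) refl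
    down : ∀ p → p ≡ - (p * 0ℚ - 1ℚ) + (p - 1ℚ)
    down = solve 1 (λ p → p := :- (p :* (con 0ℚ) :- (con 1ℚ)) :+ (p :- (con 1ℚ))) refl

  ∣c∣≤norm : All Prime Q → (S : Sub Q) → ∀ n → ∣ c S n ∣ ≤ ι (norm S)
  ∣c∣≤norm []       []       n = ≤-reflexive (trans (0≤p⇒∣p∣≡p 0≤1) (sym ι1))
  ∣c∣≤norm (_ ∷ ps) (skip S) n = ∣c∣≤norm ps S n
  ∣c∣≤norm {p ∷ Q} (pp ∷ ps) (pick S) n = begin
    ∣ cp p n * c S n ∣          ≡⟨ ∣p*q∣≡∣p∣*∣q∣ (cp p n) (c S n) ⟩
    ∣ cp p n ∣ * ∣ c S n ∣      ≤⟨ *-mono (0≤∣p∣ _) (0≤∣p∣ _) (∣cp∣≤ pp n) (∣c∣≤norm ps S n) ⟩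
    ι p * ι (norm S)            ≡⟨ ι-* p (norm S) ⟨
    ι (p ℕ.* norm S)            ∎
    where open ≤-Reasoning

  ∣correlation∣≤norm : All Prime Q → (S T : Sub Q) → ∀ k → ∣ correlation S T k ∣ ≤ ι (norm S)
  ∣correlation∣≤norm [] [] [] k = ≤-reflexive (trans (0≤p⇒∣p∣≡p 0≤1) (sym ι1))
  ∣correlation∣≤norm (_ ∷ ps) (skip S) (skip T) k = ∣correlation∣≤norm ps S T k
  ∣correlation∣≤norm (_ ∷ ps) (skip S) (pick T) k = ≤-trans (≤-reflexive (0≤p⇒∣p∣≡p ≤-refl)) (0≤ι _)
  ∣correlation∣≤norm {p ∷ Q} (_ ∷ ps) (pick S) (skip T) k = ≤-trans (≤-reflexive (0≤p⇒∣p∣≡p ≤-refl))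
    (0≤ι _)
  ∣correlation∣≤norm {p ∷ Q} (pp ∷ ps) (pick S) (pick T) k = begin
    ∣ cp p k * correlation S T k ∣      ≡⟨ ∣p*q∣≡∣p∣*∣q∣ (cp p k) (correlation S T k) ⟩
    ∣ cp p k ∣ * ∣ correlation S T k ∣  ≤⟨ *-mono (0≤∣p∣ _) (0≤∣p∣ _) (∣cp∣≤ pp k)
      (∣correlation∣≤norm ps S T k) ⟩
    ι p * ι (norm S)                    ≡⟨ ι-* p (norm S) ⟨
    ι (p ℕ.* norm S)                    ∎
    where open ≤-Reasoning

-- A large sieve inequality for Ramanujan sums

module LargeSieve where

  open Rat
  open Sums
  open Average
  open Kernel
  open Subsets

  𝟙 : ∀ {P : Set} → Dec P → ℚ
  𝟙 P? = if does P? then 1ℚ else 0ℚ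

  𝟙-yes : ∀ {P : Set} (P? : Dec P) → P → 𝟙 P? ≡ 1ℚ
  𝟙-yes P? p = cong (if_then 1ℚ else 0ℚ) (dec-true P? p)

  𝟙-no : ∀ {P : Set} (P? : Dec P) → ¬ P → 𝟙 P? ≡ 0ℚ
  𝟙-no P? ¬p = cong (if_then 1ℚ else 0ℚ) (dec-false P? ¬p)

  0≤𝟙 : ∀ {P : Set} (P? : Dec P) → 0ℚ ≤ 𝟙 P?
  0≤𝟙 (yes _) = 0≤1
  0≤𝟙 (no  _) = ≤-refl

  𝟙≤1 : ∀ {P : Set} (P? : Dec P) → 𝟙 P? ≤ 1ℚ
  𝟙≤1 (yes _) = ≤-refl
  𝟙≤1 (no  _) = 0≤1

  record Weight (x : ℕ) (β : ℕ → ℚ) : Set where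
    field
      0≤β : ∀ j → 0ℚ ≤ β j
      β≤1 : ∀ j → β j ≤ 1ℚ

  ∑∑ : ∀ x → (ℕ → ℕ → ℚ) → ℚ
  ∑∑ x f = ∑< x λ i → ∑< x λ j → f i j

  module _ {Q : List ℕ} (dp : DistinctPrimes Q) where

    bounded : ℕ → Sub Q → ℚ
    bounded R T = 𝟙 (norm T ℕ.≤? R)

    transform : ∀ x → (ℕ → ℚ) → (ℕ → ℤ) → (Sub Q → ℚ) → ℤ → ℚ
    transform x β b ε n = ∑< x λ j → ∑ (subs Q) λ T → β j * ε T * c T (n ℤ.+ b j)

    pairing : ∀ x → (ℕ → ℚ) → (ℕ → ℤ) → Sub Q → ℚ
    pairing x β b T = ∑∑ x λ i j → β i * β j * c T (b i ℤ.- b j)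

    transform-* : ∀ x β b ε n → transform x β b ε n * transform x β b ε n ≡
      ∑∑ x λ i j → ∑ (subs Q) λ S → ∑ (subs Q) λ T →
        (β i * β j * (ε S * ε T)) * (c S (n ℤ.+ b i) * c T (n ℤ.+ b j))
    transform-* x β b ε n = trans (∑-prod (downFrom x) (downFrom x) _ _)
      (∑-cong (downFrom x) λ i → ∑-cong (downFrom x) λ j → trans (∑-prod (subs Q) (subs Q) _ _)
        (∑-cong (subs Q) λ S → ∑-cong (subs Q) λ T →
          regroup (β i) (ε S) (c S (n ℤ.+ b i)) (β j) (ε T) (c T (n ℤ.+ b j))))
      where
      regroup : ∀ a b c d e f → (a * b * c) * (d * e * f) ≡ (a * d * (b * e)) * (c * f)
      regroup = solve 6 (λ a b c d e f → (a :* b :* c) :* (d :* e :* f) := (a :* d :* (b :* e)) :*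
        (c :* f)) refl

    -- Multiplied by `norm T`, the pairing is a sum of squares: those of Σ β j c_T(n + b j) as n
    -- runs over one period of c_T.
    pairing-nonneg : ∀ x β b T → 0ℚ ≤ pairing x β b T
    pairing-nonneg x β b T = *-cancelˡ-≤ (ι (norm T)) (0<ι (norm T)) (begin
      ι (norm T) * 0ℚ
        ≡⟨ *-zeroʳ (ι (norm T)) ⟩
      0ℚ
        ≤⟨ run-nonneg (norm T) _ ℤ.0ℤ (λ n → 0≤sq (h n)) ⟩
      run (norm T) (λ n → h n * h n) ℤ.0ℤ
        ≡⟨ run-cong (norm T) ℤ.0ℤ (λ n → trans (∑-prod (downFrom x) (downFrom x) _ _)
             (∑-cong (downFrom x) λ i → ∑-cong (downFrom x) λ j →
               regroup (β i) (c T (n ℤ.+ b i)) (β j) (c T (n ℤ.+ b j)))) ⟩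
      run (norm T) (λ n → ∑∑ x λ i j → β i * β j * (c T (n ℤ.+ b i) * c T (n ℤ.+ b j))) ℤ.0ℤ
        ≡⟨ trans (∑-swap (downFrom (norm T)) (downFrom x) _) (∑-cong (downFrom x) λ i →
             trans (∑-swap (downFrom (norm T)) (downFrom x) _) (∑-cong (downFrom x) λ j →
               trans (∑-*ˡ (downFrom (norm T)) (β i * β j) _) (cong (β i * β j *_) (mean i j)))) ⟩
      ∑∑ x (λ i j → β i * β j * (ι (norm T) * c T (b i ℤ.- b j)))
        ≡⟨ trans (∑-cong (downFrom x) λ i → trans (∑-cong (downFrom x) λ j →
               swap (β i * β j) (ι (norm T)) (c T (b i ℤ.- b j))) (∑-*ˡ (downFrom x) (ι (norm T)) _))
             (∑-*ˡ (downFrom x) (ι (norm T)) _) ⟩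
      ι (norm T) * pairing x β b T ∎)
      where
      open ≤-Reasoning
      instance _ = norm-nonZero (proj₁ dp) T
      h : ℤ → ℚ
      h n = ∑< x λ j → β j * c T (n ℤ.+ b j)
      ∪-idem : ∀ {Q} (T : Sub Q) → T ∪ T ≡ T
      ∪-idem []       = refl
      ∪-idem (skip T) = cong skip (∪-idem T)
      ∪-idem (pick T) = cong pick (∪-idem T)
      mean : ∀ i j → run (norm T) (λ n → c T (n ℤ.+ b i) * c T (n ℤ.+ b j)) ℤ.0ℤ ≡ ι (norm T) * c T
        (b i ℤ.- b j)
      mean i j = trans (subst (λ U → run (norm U) (λ n → c T (n ℤ.+ b i) * c T (n ℤ.+ b j)) ℤ.0ℤ ≡
                                 ι (norm U) * correlation T T (b i ℤ.- b j)) (∪-idem T)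
                          (c-correlation dp T T (b i) (b j) ℤ.0ℤ))
        (cong (ι (norm T) *_) (correlation-diagonal T (b i ℤ.- b j)))
      regroup : ∀ a b c d → (a * b) * (c * d) ≡ a * c * (b * d)
      regroup = solve 4 (λ a b c d → (a :* b) :* (c :* d) := a :* c :* (b :* d)) refl
      swap : ∀ a b c → a * (b * c) ≡ b * (a * c)
      swap = solve 3 (λ a b c → a :* (b :* c) := b :* (a :* c)) refl

    -- Bounds the smoothed sum of a centred product of two Ramanujan sums to moduli up to `R`: its
    -- period is at most `R * R`, its values are at most `R * R + R`, and each of the `J` averagings
    -- gains `q`.
    error : ℕ → ℕ → ℚ → ℚ
    error R J q = q ^ J * (ι (R ℕ.* R) * (ι (R ℕ.* R) + ι R))

    module _ (x R J L : ℕ) .{{_ : ℕ.NonZero L}} (q : ℚ) (R²/L≤q : recip L * ι (R ℕ.* R) ≤ q) where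

      private
        E = error R J q

        0≤q : 0ℚ ≤ q
        0≤q = ≤-trans (0≤* (0≤recip L) (0≤ι (R ℕ.* R))) R²/L≤q

      -- After subtraction of its mean, the product has zero mean over a period of at most `R * R`,
      -- so the gain from every averaging applies.
      smoothRun-correlation : ∀ N (S T : Sub Q) → norm S ℕ.≤ R → norm T ℕ.≤ R → ∀ b b′ n →
        ∣ smoothRun J L N (λ k → c S (k ℤ.+ b) * c T (k ℤ.+ b′)) n - ι N * correlation S T (b ℤ.- b′)
          ∣ ≤ E
      smoothRun-correlation N S T S≤R T≤R b b′ n = begin
        ∣ smoothRun J L N f n - ι N * μ ∣
          ≡⟨ cong ∣_∣ (trans (cong (smoothRun J L N f n +_)
            (trans (neg (ι N) μ) (sym (smoothRun-const J L N (- μ) n))))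
               (sym (smoothRun-+ J L N f (λ _ → - μ) n))) ⟩
        ∣ smoothRun J L N (λ k → f k - μ) n ∣
          ≤⟨ zeroMean⇒∣smoothRun∣≤ J L N zero-mean bound
               (≤-trans (*-monoˡ (recip L) (0≤recip L) (ι-mono-≤ norm≤)) R²/L≤q) n ⟩
        q ^ J * (ι (norm (S ∪ T)) * C)
          ≤⟨ *-monoˡ (q ^ J) (0≤^ J 0≤q) (*-monoʳ C (0≤+ (0≤ι _) (0≤ι R)) (ι-mono-≤ norm≤)) ⟩
        E ∎
        where
        open ≤-Reasoning
        f : ℤ → ℚ
        f k = c S (k ℤ.+ b) * c T (k ℤ.+ b′)
        μ = correlation S T (b ℤ.- b′)
        C = ι (R ℕ.* R) + ι R
        instance _ = norm-nonZero (proj₁ dp) (S ∪ T)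
        norm≤ : norm (S ∪ T) ℕ.≤ R ℕ.* R
        norm≤ = ℕP.≤-trans (norm-∪-≤ (proj₁ dp) S T) (ℕP.*-mono-≤ S≤R T≤R)
        neg : ∀ a b → - (a * b) ≡ a * (- b)
        neg = solve 2 (λ a b → :- (a :* b) := a :* (:- b)) refl
        vanish : ∀ a b → a * b + a * (- b) ≡ a * 0ℚ
        vanish = solve 2 (λ a b → a :* b :+ a :* (:- b) := a :* (con 0ℚ)) refl
        zero-mean : HasMean (norm (S ∪ T)) 0ℚ (λ k → f k - μ)
        zero-mean k = trans (∑-+ (downFrom (norm (S ∪ T))) _ _)
          (trans (cong₂ _+_ (c-correlation dp S T b b′ k) (∑<-const (norm (S ∪ T)) (- μ)))
            (vanish (ι (norm (S ∪ T))) μ))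
        bound : ∀ k → ∣ f k - μ ∣ ≤ C
        bound k = begin
          ∣ f k - μ ∣                 ≤⟨ ∣p-q∣≤∣p∣+∣q∣ (f k) μ ⟩
          ∣ f k ∣ + ∣ μ ∣             ≡⟨ cong (_+ ∣ μ ∣) (∣p*q∣≡∣p∣*∣q∣ _ _) ⟩
          ∣ c S (k ℤ.+ b) ∣ * ∣ c T (k ℤ.+ b′) ∣ + ∣ μ ∣
            ≤⟨ +-mono-≤ (*-mono (0≤∣p∣ _) (0≤∣p∣ _)
                 (≤-trans (∣c∣≤norm (proj₁ dp) S (k ℤ.+ b)) (ι-mono-≤ S≤R))
                 (≤-trans (∣c∣≤norm (proj₁ dp) T (k ℤ.+ b′)) (ι-mono-≤ T≤R)))
               (≤-trans (∣correlation∣≤norm (proj₁ dp) S T _) (ι-mono-≤ S≤R)) ⟩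
          ι R * ι R + ι R             ≡⟨ cong (_+ ι R) (ι-* R R) ⟨
          C                           ∎

      module _ (β : ℕ → ℚ) (0≤β : ∀ j → 0ℚ ≤ β j) (b : ℕ → ℤ)
               (ε : Sub Q → ℚ) (∣ε∣≤ : ∀ T → ∣ ε T ∣ ≤ bounded R T) where

        private
          ε-bound : ∀ S T i j → let f = λ k → c S (k ℤ.+ b i) * c T (k ℤ.+ b j) in ∀ N n →
            β i * β j * (ε S * ε T) * smoothRun J L N f n ≤
            ι N * (β i * β j * (ε S * ε T) * correlation S T (b i ℤ.- b j)) +
            β i * β j * (bounded R S * bounded R T) * E
          ε-bound S T i j N n = begin
            κ * s
              ≡⟨ split κ s (ι N) μ ⟩
            ι N * (κ * μ) + κ * (s - ι N * μ)
              ≤⟨ +-monoʳ-≤ (ι N * (κ * μ)) (≤-trans (p≤∣p∣ _) (≤-trans (≤-reflexive abs)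
                   (*-monoˡ (β i * β j) (0≤* (0≤β i) (0≤β j)) last))) ⟩
            ι N * (κ * μ) + β i * β j * (bounded R S * bounded R T * E)
              ≡⟨ cong (ι N * (κ * μ) +_) (sym (*-assoc (β i * β j) _ E)) ⟩
            ι N * (κ * μ) + β i * β j * (bounded R S * bounded R T) * E ∎
            where
            open ≤-Reasoning
            κ = β i * β j * (ε S * ε T)
            s = smoothRun J L N (λ k → c S (k ℤ.+ b i) * c T (k ℤ.+ b j)) n
            μ = correlation S T (b i ℤ.- b j)
            split : ∀ k s n m → k * s ≡ n * (k * m) + k * (s - n * m)
            split = solve 4 (λ k s n m → k :* s := n :* (k :* m) :+ k :* (s :- n :* m)) refl
            abs : ∣ κ * (s - ι N * μ) ∣ ≡ β i * β j * (∣ ε S ∣ * ∣ ε T ∣ * ∣ s - ι N * μ ∣)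
            abs = trans (∣p*q∣≡∣p∣*∣q∣ κ _) (trans (cong (_* ∣ s - ι N * μ ∣)
              (trans (∣p*q∣≡∣p∣*∣q∣ (β i * β j) _)
                (cong₂ _*_ (0≤p⇒∣p∣≡p (0≤* (0≤β i) (0≤β j))) (∣p*q∣≡∣p∣*∣q∣ (ε S) (ε T)))))
              (*-assoc (β i * β j) _ _))
            last : ∣ ε S ∣ * ∣ ε T ∣ * ∣ s - ι N * μ ∣ ≤ bounded R S * bounded R T * E
            last = go (norm S ℕ.≤? R) (norm T ℕ.≤? R)
              where
              ∣ε∣≤0 : ∀ U → ¬ norm U ℕ.≤ R → ∣ ε U ∣ ≡ 0ℚ
              ∣ε∣≤0 U U≰R = ≤-antisym (≤-trans (∣ε∣≤ U) (≤-reflexive (𝟙-no (norm U ℕ.≤? R) U≰R)))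
                (0≤∣p∣ _)
              0≤rhs : 0ℚ ≤ bounded R S * bounded R T * E
              0≤rhs = 0≤* (0≤* (0≤𝟙 (norm S ℕ.≤? R)) (0≤𝟙 (norm T ℕ.≤? R)))
                (0≤* (0≤^ J 0≤q) (0≤* (0≤ι _) (0≤+ (0≤ι _) (0≤ι _))))
              zeroˡ : ∀ a b → 0ℚ * a * b ≡ 0ℚ
              zeroˡ = solve 2 (λ a b → (con 0ℚ) :* a :* b := (con 0ℚ)) refl
              zeroʳ : ∀ a b → a * 0ℚ * b ≡ 0ℚ
              zeroʳ = solve 2 (λ a b → a :* (con 0ℚ) :* b := (con 0ℚ)) refl
              go : Dec (norm S ℕ.≤ R) → Dec (norm T ℕ.≤ R) →
                ∣ ε S ∣ * ∣ ε T ∣ * ∣ s - ι N * μ ∣ ≤ bounded R S * bounded R T * E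
              go (yes S≤R) (yes T≤R) = *-mono (0≤* (0≤∣p∣ _) (0≤∣p∣ _)) (0≤∣p∣ _)
                (*-mono (0≤∣p∣ _) (0≤∣p∣ _) (∣ε∣≤ S) (∣ε∣≤ T))
                (smoothRun-correlation N S T S≤R T≤R (b i) (b j) n)
              go (no S≰R) _ = subst (_≤ bounded R S * bounded R T * E)
                (sym (trans (cong (λ z → z * ∣ ε T ∣ * ∣ s - ι N * μ ∣) (∣ε∣≤0 S S≰R)) (zeroˡ _ _)))
                  0≤rhs
              go (yes _) (no T≰R) = subst (_≤ bounded R S * bounded R T * E)
                (sym (trans (cong (λ z → ∣ ε S ∣ * z * ∣ s - ι N * μ ∣) (∣ε∣≤0 T T≰R)) (zeroʳ _ _)))
                  0≤rhs

        -- When the square is opened, pairs of different moduli have correlation 0, so up to the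
        -- error only `ε T * ε T * pairing x β b T` remains. Since the pairings are nonnegative, the
        -- coefficients may then be replaced by their bound.
        smoothRun-transform² : ∀ N n → smoothRun J L N (λ k → transform x β b ε k * transform x β b ε k)
          n ≤
          ι N * ∑ (subs Q) (λ T → bounded R T * pairing x β b T) +
          (∑< x β * ∑< x β) * (∑ (subs Q) (bounded R) * ∑ (subs Q) (bounded R)) * E
        smoothRun-transform² N n = begin
          smoothRun J L N (λ k → transform x β b ε k * transform x β b ε k) n
            ≡⟨ smoothRun-cong J L N n (transform-* x β b ε) ⟩
          smoothRun J L N (λ k → ∑∑ x λ i j → ∑ (subs Q) λ S → ∑ (subs Q) λ T → κ i j S T * cc i j S T
            k) n
            ≡⟨ trans (smoothRun-∑ J L N (downFrom x) _ n) (∑-cong (downFrom x) λ i →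
                 trans (smoothRun-∑ J L N (downFrom x) _ n) (∑-cong (downFrom x) λ j →
                   trans (smoothRun-∑ J L N (subs Q) _ n) (∑-cong (subs Q) λ S →
                     trans (smoothRun-∑ J L N (subs Q) _ n) (∑-cong (subs Q) λ T →
                       smoothRun-*ˡ J L N (κ i j S T) _ n)))) ⟩
          (∑∑ x λ i j → ∑ (subs Q) λ S → ∑ (subs Q) λ T → κ i j S T * smoothRun J L N (cc i j S T) n)
            ≤⟨ ∑-mono (downFrom x) (λ i → ∑-mono (downFrom x) λ j → ∑-mono (subs Q) λ S → ∑-mono
              (subs Q) λ T →
                 ε-bound S T i j N n) ⟩
          (∑∑ x λ i j → ∑ (subs Q) λ S → ∑ (subs Q) λ T → ι N * main i j S T + rest i j S T)
            ≡⟨ trans (∑-cong (downFrom x) λ i → trans (∑-cong (downFrom x) λ j →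
                 trans (∑-cong (subs Q) λ S → ∑-+ (subs Q) _ _) (∑-+ (subs Q) _ _))
                   (∑-+ (downFrom x) _ _))
                 (∑-+ (downFrom x) _ _) ⟩
          (∑∑ x λ i j → ∑ (subs Q) λ S → ∑ (subs Q) λ T → ι N * main i j S T) +
          (∑∑ x λ i j → ∑ (subs Q) λ S → ∑ (subs Q) λ T → rest i j S T)
            ≡⟨ cong₂ _+_ main≡ rest≡ ⟩
          ι N * ∑ (subs Q) (λ T → ε T * ε T * pairing x β b T) + (B * B) * (W * W) * E
            ≤⟨ +-monoˡ-≤ ((B * B) * (W * W) * E) (*-monoˡ (ι N) (0≤ι N) (∑-mono (subs Q) λ T →
                 *-monoʳ (pairing x β b T) (pairing-nonneg x β b T) (ε² T))) ⟩
          ι N * ∑ (subs Q) (λ T → bounded R T * pairing x β b T) + (B * B) * (W * W) * E ∎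
          where
          open ≤-Reasoning
          B = ∑< x β
          W = ∑ (subs Q) (bounded R)
          κ : ℕ → ℕ → Sub Q → Sub Q → ℚ
          κ i j S T = β i * β j * (ε S * ε T)
          cc : ℕ → ℕ → Sub Q → Sub Q → ℤ → ℚ
          cc i j S T k = c S (k ℤ.+ b i) * c T (k ℤ.+ b j)
          main rest : ℕ → ℕ → Sub Q → Sub Q → ℚ
          main i j S T = κ i j S T * correlation S T (b i ℤ.- b j)
          rest i j S T = β i * β j * (bounded R S * bounded R T) * E
          ε² : ∀ T → ε T * ε T ≤ bounded R T
          ε² T = begin
            ε T * ε T                    ≡⟨ ∣∣*∣∣ (ε T) ⟨
            ∣ ε T ∣ * ∣ ε T ∣            ≤⟨ *-mono (0≤∣p∣ _) (0≤∣p∣ _) (∣ε∣≤ T) (∣ε∣≤ T) ⟩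
            bounded R T * bounded R T    ≤⟨ *-monoˡ (bounded R T) (0≤𝟙 (norm T ℕ.≤? R))
              (𝟙≤1 (norm T ℕ.≤? R)) ⟩
            bounded R T * 1ℚ             ≡⟨ *-identityʳ _ ⟩
            bounded R T                  ∎
          reorder : ∀ a b e c → a * b * (e * e) * c ≡ e * e * (a * b * c)
          reorder = solve 4 (λ a b e c → a :* b :* (e :* e) :* c := e :* e :* (a :* b :* c)) refl
          main≡ : (∑∑ x λ i j → ∑ (subs Q) λ S → ∑ (subs Q) λ T → ι N * main i j S T) ≡
            ι N * ∑ (subs Q) (λ T → ε T * ε T * pairing x β b T)
          main≡ = trans (trans (∑-cong (downFrom x) λ i → trans (∑-cong (downFrom x) λ j →
              trans (∑-cong (subs Q) λ S → ∑-*ˡ (subs Q) (ι N) _) (∑-*ˡ (subs Q) (ι N) _))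
                (∑-*ˡ (downFrom x) (ι N) _))
              (∑-*ˡ (downFrom x) (ι N) _))
            (cong (ι N *_) (trans
              (∑-cong (downFrom x) λ i → trans (∑-cong (downFrom x) λ j → trans
                (∑-correlation Q (κ i j) (b i ℤ.- b j))
                (∑-cong (subs Q) λ T → reorder (β i) (β j) (ε T) (c T (b i ℤ.- b j))))
                (∑-swap (downFrom x) (subs Q) _))
              (trans (∑-swap (downFrom x) (subs Q) _) (∑-cong (subs Q) λ T →
                trans (∑-cong (downFrom x) λ i → ∑-*ˡ (downFrom x) (ε T * ε T) _)
                  (∑-*ˡ (downFrom x) (ε T * ε T) _)))))
          rest≡ : (∑∑ x λ i j → ∑ (subs Q) λ S → ∑ (subs Q) λ T → rest i j S T) ≡ (B * B) * (W * W) * E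
          rest≡ = trans (trans (∑-cong (downFrom x) λ i → trans (∑-cong (downFrom x) λ j →
              trans (∑-cong (subs Q) λ S → ∑-*ʳ (subs Q) E _) (∑-*ʳ (subs Q) E _))
                (∑-*ʳ (downFrom x) E _))
              (∑-*ʳ (downFrom x) E _))
            (cong (_* E) (trans
              (∑-cong (downFrom x) λ i → trans (∑-cong (downFrom x) λ j → trans
                (∑-cong (subs Q) λ S → ∑-*ˡ (subs Q) (β i * β j) _)
                (trans (∑-*ˡ (subs Q) (β i * β j) _)
                  (cong (β i * β j *_) (sym (∑-prod (subs Q) (subs Q) _ _)))))
                (∑-*ʳ (downFrom x) (W * W) _))
              (trans (∑-*ʳ (downFrom x) (W * W) _)
                (cong (_* (W * W)) (sym (∑-prod (downFrom x) (downFrom x) β β))))))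

      private
        N = J ℕ.* L ℕ.+ x
        W = ∑ (subs Q) (bounded R)

      -- Cauchy-Schwarz in `i` removes `α`. The remaining square is nonnegative, so its sum over
      -- [1, x] only grows when replaced by a smoothed sum over a longer interval.
      bilinear-≤ : ∀ {α β} → Weight x α → ∀ b ε → let Y = ∑< x λ i → α i * transform x β b ε (pos (suc i)) in
        Y * Y ≤ ∑< x α * smoothRun J L N (λ k → transform x β b ε k * transform x β b ε k)
          (pos 1 ℤ.- pos (J ℕ.* L))
      bilinear-≤ {α} {β} wα b ε = begin
        Y * Y
          ≤⟨ cauchy-schwarz (downFrom x) α (λ i → H (pos (suc i))) ⟩
        ∑< x (λ i → α i * α i) * run x H² (pos 1)
          ≤⟨ *-mono (∑-nonneg (downFrom x) λ i → 0≤sq (α i)) (run-nonneg x H² (pos 1) 0≤H²)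
               (∑-mono (downFrom x) α²≤α)
               (subst (λ n → run x H² n ≤ smoothRun J L N H² n₀) n₀+JL (run≤smoothRun J L x n₀ 0≤H²)) ⟩
        ∑< x α * smoothRun J L N H² n₀ ∎
        where
        open ≤-Reasoning
        open Weight wα renaming (0≤β to 0≤α; β≤1 to α≤1)
        H = transform x β b ε
        H² : ℤ → ℚ
        H² k = H k * H k
        Y = ∑< x λ i → α i * H (pos (suc i))
        -- The averagings translate by up to `J * L`; starting that far to the left, every translate
        -- still contains [1, x].
        n₀ = pos 1 ℤ.- pos (J ℕ.* L)
        0≤H² : ∀ k → 0ℚ ≤ H² k
        0≤H² k = 0≤sq (H k)
        α²≤α : ∀ i → α i * α i ≤ α i
        α²≤α i = subst (α i * α i ≤_) (*-identityʳ (α i)) (*-monoˡ (α i) (0≤α i) (α≤1 i))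
        n₀+JL : n₀ ℤ.+ pos (J ℕ.* L) ≡ pos 1
        n₀+JL = cancel (pos 1) (pos (J ℕ.* L))
          where
          cancel : ∀ a b → (a ℤ.- b) ℤ.+ b ≡ a
          cancel = solve-∀

      energy : (ℕ → ℚ) → (ℕ → ℤ) → ℚ
      energy β b = ∑ (subs Q) λ T → bounded R T * pairing x β b T

      -- The assumption makes the total error of all pairs of moduli at most `ι N`, so it costs no
      -- more than adding 1 to the energy.
      bilinear-energy : (ι x * ι x) * (W * W) * E ≤ ι N →
        ∀ {α β} → Weight x α → Weight x β → ∀ b ε → (∀ T → ∣ ε T ∣ ≤ bounded R T) →
        let Y = ∑< x λ i → α i * transform x β b ε (pos (suc i)) in
        Y * Y ≤ ∑< x α * (ι N * (energy β b + 1ℚ))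
      bilinear-energy small {α} {β} wα wβ b ε ∣ε∣≤ = begin
        Y * Y
          ≤⟨ bilinear-≤ wα b ε ⟩
        ∑< x α * smoothRun J L N (λ k → transform x β b ε k * transform x β b ε k)
          (pos 1 ℤ.- pos (J ℕ.* L))
          ≤⟨ *-monoˡ (∑< x α) 0≤A (smoothRun-transform² β 0≤β b ε ∣ε∣≤ N _) ⟩
        ∑< x α * (ι N * energy β b + (B * B) * (W * W) * E)
          ≤⟨ *-monoˡ (∑< x α) 0≤A (+-monoʳ-≤ (ι N * energy β b) (≤-trans
               (*-monoʳ E 0≤E (*-monoʳ (W * W) (0≤sq W) (*-mono 0≤B 0≤B B≤x B≤x))) small)) ⟩
        ∑< x α * (ι N * energy β b + ι N)
          ≡⟨ cong (∑< x α *_) (factor (ι N) (energy β b)) ⟩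
        ∑< x α * (ι N * (energy β b + 1ℚ)) ∎
        where
        open ≤-Reasoning
        open Weight wβ
        B = ∑< x β
        Y = ∑< x λ i → α i * transform x β b ε (pos (suc i))
        0≤A = ∑-nonneg (downFrom x) (Weight.0≤β wα)
        0≤B = ∑-nonneg (downFrom x) 0≤β
        0≤E : 0ℚ ≤ E
        0≤E = 0≤* (0≤^ J 0≤q) (0≤* (0≤ι _) (0≤+ (0≤ι _) (0≤ι _)))
        B≤x : B ≤ ι x
        B≤x = subst (B ≤_) (trans (∑<-const x 1ℚ) (*-identityʳ (ι x))) (∑-mono (downFrom x) β≤1)
        factor : ∀ a b → a * b + a ≡ a * (b + 1ℚ)
        factor = solve 2 (λ a b → a :* b :+ a := a :* (b :+ (con 1ℚ))) refl

      -- A Ramanujan sum sees its argument only through divisibility by primes. Sums and differences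
      -- therefore lead to the same energy.
      pairing-cong : ∀ β b b′ → (∀ p i j → δ p (b i ℤ.- b j) ≡ δ p (b′ i ℤ.- b′ j)) →
        ∀ T → pairing x β b T ≡ pairing x β b′ T
      pairing-cong β b b′ eq T = ∑-cong (downFrom x) λ i → ∑-cong (downFrom x) λ j →
        cong (β i * β j *_) (c-cong T i j)
        where
        c-cong : ∀ {Q} (T : Sub Q) i j → c T (b i ℤ.- b j) ≡ c T (b′ i ℤ.- b′ j)
        c-cong []               i j = refl
        c-cong (skip T)         i j = c-cong T i j
        c-cong (pick {p = p} T) i j = cong₂ _*_ (cong (λ z → ι p * z - 1ℚ) (eq p i j)) (c-cong T i j)

      private
        ≤-quadratic : ∀ {X D} → 1ℚ ≤ D → X * X ≤ D * (X + 1ℚ) → X ≤ 2ℚ * D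
        ≤-quadratic {X} {D} 1≤D X²≤ with ≤-total X 1ℚ
        ... | inj₁ X≤1 = ≤-trans X≤1 (≤-trans 1≤D (≤-by (two D) 0≤D))
          where
          0≤D = ≤-trans 0≤1 1≤D
          two : ∀ d → 2ℚ * d ≡ d + d
          two = solve 1 (λ d → (con 2ℚ) :* d := d :+ d) refl
        ... | inj₂ 1≤X = *-cancelˡ-≤ X (<-≤-trans 0<1 1≤X) (≤-trans X²≤
            (≤-trans (*-monoˡ D (≤-trans 0≤1 1≤D) (+-monoʳ-≤ X 1≤X)) (≤-reflexive (two X D))))
          where
          two : ∀ x d → d * (x + x) ≡ x * (2ℚ * d)
          two = solve 2 (λ x d → d :* (x :+ x) := x :* ((con 2ℚ) :* d)) refl

      -- A bootstrap: the energy X is itself a bilinear form of the same kind, with `α` equal to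
      -- `β`, coefficients `bounded R` and shifts `- (j + 1)`. The previous bound applied to it
      -- reads X² ≤ B N (X + 1), hence X ≤ 2 B N, and inserting this into the bound for Y gives 2 +
      -- 1 times A B N².
      large-sieve : (ι x * ι x) * (W * W) * E ≤ ι N → 1 ℕ.≤ N →
        ∀ {α β} → Weight x α → Weight x β → 1ℚ ≤ ∑< x β →
        ∀ b → (∀ p i j → δ p (b i ℤ.- b j) ≡ δ p (pos i ℤ.- pos j)) →
        ∀ ε → (∀ T → ∣ ε T ∣ ≤ bounded R T) →
        let Y = ∑< x λ i → α i * transform x β b ε (pos (suc i)) in
        Y * Y ≤ (2ℚ + 1ℚ) * (∑< x α * ∑< x β) * (ι N * ι N)
      large-sieve small 1≤N {α} {β} wα wβ 1≤B b eq ε ∣ε∣≤ = begin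
        Y * Y
          ≤⟨ bilinear-energy small wα wβ b ε ∣ε∣≤ ⟩
        A * (ι N * (X + 1ℚ))
          ≤⟨ *-monoˡ A 0≤A (*-monoˡ (ι N) (0≤ι N) (+-mono-≤ X≤ 1≤BN)) ⟩
        A * (ι N * (2ℚ * (B * ι N) + B * ι N))
          ≡⟨ finish A B (ι N) ⟩
        (2ℚ + 1ℚ) * (A * B) * (ι N * ι N) ∎
        where
        open ≤-Reasoning
        A = ∑< x α
        B = ∑< x β
        X = energy β b
        Y = ∑< x λ i → α i * transform x β b ε (pos (suc i))
        0≤A = ∑-nonneg (downFrom x) (Weight.0≤β wα)
        -suc : ℕ → ℤ
        -suc j = ℤ.- pos (suc j)
        1≤BN : 1ℚ ≤ B * ι N
        1≤BN = subst (_≤ B * ι N) (*-identityˡ 1ℚ)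
          (*-mono 0≤1 0≤1 1≤B (subst (_≤ ι N) ι1 (ι-mono-≤ 1≤N)))
        self : ∑< x (λ i → β i * transform x β -suc (bounded R) (pos (suc i))) ≡ X
        self = trans
          (∑-cong (downFrom x) λ i → trans (sym (∑-*ˡ (downFrom x) (β i) _))
            (trans (∑-cong (downFrom x) λ j →
            trans (sym (∑-*ˡ (subs Q) (β i) _)) (∑-cong (subs Q) λ T →
              regroup (β i) (β j) (bounded R T) (c T (pos (suc i) ℤ.+ -suc j))))
                (∑-swap (downFrom x) (subs Q) _)))
          (trans (∑-swap (downFrom x) (subs Q) _) (∑-cong (subs Q) λ T →
            trans (∑-cong (downFrom x) λ i → ∑-*ˡ (downFrom x) (bounded R T) _)
            (trans (∑-*ˡ (downFrom x) (bounded R T) _)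
              (cong (bounded R T *_) (pairing-cong β (λ i → pos (suc i)) b
                (λ p i j → trans (cong (δ p) (cancel (pos i) (pos j))) (sym (eq p i j))) T)))))
          where
          regroup : ∀ a b w z → a * (b * w * z) ≡ w * (a * b * z)
          regroup = solve 4 (λ a b w z → a :* (b :* w :* z) := w :* (a :* b :* z)) refl
          cancel : ∀ i j → (pos 1 ℤ.+ i) ℤ.- (pos 1 ℤ.+ j) ≡ i ℤ.- j
          cancel = solve-∀
        X² : X * X ≤ B * ι N * (X + 1ℚ)
        X² = begin
          X * X
            ≤⟨ subst (λ z → z * z ≤ B * (ι N * (energy β -suc + 1ℚ))) self
                 (bilinear-energy small wβ wβ -suc (bounded R) λ T → ≤-reflexive
                   (0≤p⇒∣p∣≡p (0≤𝟙 (norm T ℕ.≤? R)))) ⟩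
          B * (ι N * (energy β -suc + 1ℚ))
            ≡⟨ cong (λ z → B * (ι N * (z + 1ℚ))) (∑-cong (subs Q) λ T → cong (bounded R T *_)
                 (pairing-cong β -suc b (λ p i j → trans (trans (cong (δ p) (flip (pos i) (pos j)))
                   (δ-neg p (pos i ℤ.- pos j))) (sym (eq p i j))) T)) ⟩
          B * (ι N * (X + 1ℚ))
            ≡⟨ *-assoc B (ι N) (X + 1ℚ) ⟨
          B * ι N * (X + 1ℚ) ∎
          where
          flip : ∀ i j → ℤ.- (pos 1 ℤ.+ i) ℤ.- (ℤ.- (pos 1 ℤ.+ j)) ≡ ℤ.- (i ℤ.- j)
          flip = solve-∀
        X≤ : X ≤ 2ℚ * (B * ι N)
        X≤ = ≤-quadratic 1≤BN X²
        finish : ∀ a b n → a * (n * (2ℚ * (b * n) + b * n)) ≡ (2ℚ + 1ℚ) * (a * b) * (n * n)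
        finish = solve 3 (λ a b n → a :* (n :* ((con 2ℚ) :* (b :* n) :+ b :* n)) :=
          ((con 2ℚ) :+ (con 1ℚ)) :* (a :* b) :* (n :* n)) refl

-- Counting the divisors composed of large primes

module Divisors where

  open Rat
  open Sums
  open Average
  open Kernel
  open Subsets
  open LargeSieve
  open import Data.Nat.LCM using (lcm; lcm-least)

  private variable
    Q : List ℕ

  divisors : ∀ Q → ℤ → Sub Q
  divisors []      n = []
  divisors (p ∷ Q) n with p ∣? ℤ.∣ n ∣
  ... | yes _ = pick (divisors Q n)
  ... | no  _ = skip (divisors Q n)

  size : Sub Q → ℕ
  size []       = 0
  size (skip S) = size S
  size (pick S) = suc (size S)

  coprime-*-∣ : ∀ {m n k} → Coprime m n → m ∣ k → n ∣ k → m ℕ.* n ∣ k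
  coprime-*-∣ {m} {n} {k} coprime m∣k (ℕD.divides q refl) =
    ℕD.*-monoˡ-∣ n (Coprimality.coprime-divisor coprime (subst (m ∣_) (ℕP.*-comm q n) m∣k))

  norm-divisors-∣ : DistinctPrimes Q → ∀ n → norm (divisors Q n) ∣ ℤ.∣ n ∣
  norm-divisors-∣ ([] , []) n = ℕD.1∣ ℤ.∣ n ∣
  norm-divisors-∣ {p ∷ Q} (pp ∷ ps , ≢s ∷ us) n with p ∣? ℤ.∣ n ∣
  ... | yes p∣n = coprime-*-∣ (prime∤⇒coprime pp (prime∤norm pp ps ≢s (divisors Q n))) p∣n
                    (norm-divisors-∣ (ps , us) n)
  ... | no _ = norm-divisors-∣ (ps , us) n

  δs-zero-or : (S : Sub Q) → ∀ n → δs S n ≡ 0ℚ ⊎ (δs S n ≡ 1ℚ × norm S ∣ norm (divisors Q n))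
  δs-zero-or [] n = inj₂ (refl , ℕD.∣-refl)
  δs-zero-or {p ∷ Q} (skip S) n with p ∣? ℤ.∣ n ∣ | δs-zero-or S n
  ... | _     | inj₁ z         = inj₁ z
  ... | yes _ | inj₂ (o , S∣)  = inj₂ (o , ℕD.∣n⇒∣m*n p S∣)
  ... | no _  | inj₂ (o , S∣)  = inj₂ (o , S∣)
  δs-zero-or {p ∷ Q} (pick S) n with p ∣? ℤ.∣ n ∣ | δs-zero-or S n
  ... | no _  | _              = inj₁ (*-zeroˡ (δs S n))
  ... | yes _ | inj₁ z         = inj₁ (trans (cong (1ℚ *_) z) (*-zeroʳ 1ℚ))
  ... | yes _ | inj₂ (o , S∣)  = inj₂ (trans (cong (1ℚ *_) o) (*-identityˡ 1ℚ) , ℕD.*-monoʳ-∣ p S∣)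

  ∑-δs : ∀ Q n → ∑ (subs Q) (λ S → δs S n) ≡ ι (2 ℕ.^ size (divisors Q n))
  ∑-δs []      n = trans (+-identityʳ 1ℚ) (sym ι1)
  ∑-δs (p ∷ Q) n = trans (∑-subs-∷ p Q _) step
    where
    A = ∑ (subs Q) (λ S → δs S n)
    step : A + ∑ (subs Q) (λ S → δ p n * δs S n) ≡ ι (2 ℕ.^ size (divisors (p ∷ Q) n))
    step with p ∣? ℤ.∣ n ∣
    ... | yes _ = trans (cong (A +_) (trans (∑-*ˡ (subs Q) 1ℚ _) (*-identityˡ A)))
        (trans (cong₂ _+_ (∑-δs Q n) (∑-δs Q n))
          (trans (sym (ι-+ d d)) (cong (λ e → ι (d ℕ.+ e)) (sym (ℕP.+-identityʳ d)))))
      where d = 2 ℕ.^ size (divisors Q n)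
    ... | no _ = trans (cong (A +_) (trans (∑-*ˡ (subs Q) 0ℚ _) (*-zeroˡ A)))
      (trans (+-identityʳ A) (∑-δs Q n))

  ^size≤norm : ∀ {τ} → All (τ ℕ.≤_) Q → (S : Sub Q) → τ ℕ.^ size S ℕ.≤ norm S
  ^size≤norm []        []       = ℕP.≤-refl
  ^size≤norm (_ ∷ ≤s)  (skip S) = ^size≤norm ≤s S
  ^size≤norm (τ≤p ∷ ≤s) (pick S) = ℕP.*-mono-≤ τ≤p (^size≤norm ≤s S)

  size-divisors-< : DistinctPrimes Q → ∀ {τ} .{{_ : ℕ.NonZero τ}} → All (τ ℕ.≤_) Q →
    ∀ n κ → .{{_ : ℕ.NonZero ℤ.∣ n ∣}} → ℤ.∣ n ∣ ℕ.< τ ℕ.^ κ → size (divisors Q n) ℕ.< κ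
  size-divisors-< {Q} dp {τ} ≤s n κ n<τ^κ = ℕP.≰⇒> λ κ≤size → ℕP.<-irrefl refl (begin-strict
    ℤ.∣ n ∣                            <⟨ n<τ^κ ⟩
    τ ℕ.^ κ                            ≤⟨ ℕP.^-monoʳ-≤ τ κ≤size ⟩
    τ ℕ.^ size (divisors Q n)          ≤⟨ ^size≤norm ≤s (divisors Q n) ⟩
    norm (divisors Q n)                ≤⟨ ℕD.∣⇒≤ (norm-divisors-∣ dp n) ⟩
    ℤ.∣ n ∣                            ∎)
    where open ℕP.≤-Reasoning

  ∑-δs-≤ : DistinctPrimes Q → ∀ {τ} .{{_ : ℕ.NonZero τ}} → All (τ ℕ.≤_) Q →
    ∀ n κ → .{{_ : ℕ.NonZero ℤ.∣ n ∣}} → ℤ.∣ n ∣ ℕ.< τ ℕ.^ κ → ∑ (subs Q) (λ S → δs S n) ≤ ι (2 ℕ.^ κ)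
  ∑-δs-≤ {Q} dp ≤s n κ n<τ^κ = ≤-trans (≤-reflexive (∑-δs Q n))
    (ι-mono-≤ (ℕP.^-monoʳ-≤ 2 (ℕP.<⇒≤ (size-divisors-< dp ≤s n κ n<τ^κ))))

  ∣p-q∣≤1 : ∀ {p q} → 0ℚ ≤ p → p ≤ 1ℚ → 0ℚ ≤ q → q ≤ 1ℚ → ∣ p - q ∣ ≤ 1ℚ
  ∣p-q∣≤1 {p} {q} 0≤p p≤1 0≤q q≤1 = ∣∣-≤
    (≤-trans (+-monoʳ-≤ p (subst (- q ≤_) -0≡0 (neg-antimono-≤ 0≤q)))
      (≤-trans (≤-reflexive (+-identityʳ p)) p≤1))
    (≤-trans (≤-reflexive (swap p q)) (≤-trans (+-monoʳ-≤ q (subst (- p ≤_) -0≡0 (neg-antimono-≤ 0≤p)))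
      (≤-trans (≤-reflexive (+-identityʳ q)) q≤1)))
    where
    swap : ∀ p q → - (p - q) ≡ q - p
    swap = solve 2 (λ p q → :- (p :- q) := q :- p) refl

  -- Every complete period has mass exactly 1, so removing one changes neither side of the
  -- difference. For less than a period both terms lie between 0 and 1.
  run-count : ∀ {m μ f} .{{_ : ℕ.NonZero m}} → HasMean m μ f → ι m * μ ≡ 1ℚ → (∀ k → 0ℚ ≤ f k) →
    ∀ L n → ∣ run L f n - ι L * μ ∣ ≤ 1ℚ
  run-count {m@(suc m-1)} {μ} {f} mean mμ≡1 0≤f = <-rec _ step
    where
    0≤μ : 0ℚ ≤ μ
    0≤μ = *-cancelˡ-≤ (ι m) (0<ι m) (subst₂ _≤_ (sym (*-zeroʳ (ι m))) (sym mμ≡1) 0≤1)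
    step : ∀ L → (∀ {K} → K ℕ.< L → ∀ n → ∣ run K f n - ι K * μ ∣ ≤ 1ℚ) →
      ∀ n → ∣ run L f n - ι L * μ ∣ ≤ 1ℚ
    step L rec n with m ℕ.≤? L
    ... | no m≰L = ∣p-q∣≤1 (run-nonneg L f n 0≤f)
        (≤-trans (∑<-mono-length (λ t → 0≤f (n ℤ.+ pos t)) L≤m) (≤-reflexive (trans (mean n) mμ≡1)))
        (0≤* (0≤ι L) 0≤μ) (≤-trans (*-monoʳ μ 0≤μ (ι-mono-≤ L≤m)) (≤-reflexive mμ≡1))
      where L≤m = ℕP.≰⇒≥ m≰L
    ... | yes m≤L = subst (λ z → ∣ z ∣ ≤ 1ℚ) (sym split) (rec smaller (n ℤ.+ pos m))
      where
      open ≡-Reasoning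
      smaller : L ℕ.∸ m ℕ.< L
      smaller = ℕP.∸-monoʳ-< {L} {m} {0} (ℕ.s≤s ℕ.z≤n) m≤L
      cancel : ∀ a b c d → (a * b + c) - (a + d) * b ≡ c - d * b
      cancel = solve 4 (λ a b c d → (a :* b :+ c) :- (a :+ d) :* b := c :- d :* b) refl
      split : run L f n - ι L * μ ≡ run (L ℕ.∸ m) f (n ℤ.+ pos m) - ι (L ℕ.∸ m) * μ
      split = begin
        run L f n - ι L * μ
          ≡⟨ cong (λ L → run L f n - ι L * μ) (ℕP.m+[n∸m]≡n m≤L) ⟨
        run (m ℕ.+ (L ℕ.∸ m)) f n - ι (m ℕ.+ (L ℕ.∸ m)) * μ
          ≡⟨ cong₂ (λ y z → y - z * μ) (trans (run-split m (L ℕ.∸ m) f n)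
               (cong (_+ run (L ℕ.∸ m) f (n ℤ.+ pos m)) (mean n))) (ι-+ m (L ℕ.∸ m)) ⟩
        (ι m * μ + run (L ℕ.∸ m) f (n ℤ.+ pos m)) - (ι m + ι (L ℕ.∸ m)) * μ
          ≡⟨ cancel (ι m) μ _ _ ⟩
        run (L ℕ.∸ m) f (n ℤ.+ pos m) - ι (L ℕ.∸ m) * μ ∎

  δs-count : DistinctPrimes Q → (S : Sub Q) → ∀ L n → ∣ run L (δs S) n - ι L * inv S ∣ ≤ 1ℚ
  δs-count dp S L n = run-count {{norm-nonZero (proj₁ dp) S}} (δs-mean dp S) (norm*inv (proj₁ dp) S)
    (0≤δs S) L n

  module _ {Q : List ℕ} (dp : DistinctPrimes Q) where

    -- Among the integers up to z = 2D, a modulus d ≤ D has at least z / d - 1 ≥ z / (2d) multiples.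
    -- Summation over d counts the divisors of each n ≤ z, and there are at most 2 ^ κ, since n < τ
    -- ^ κ has fewer than κ prime factors from τ on.
    harmonic : ∀ {τ} .{{_ : ℕ.NonZero τ}} → All (τ ℕ.≤_) Q → ∀ D κ .{{_ : ℕ.NonZero D}} →
      2 ℕ.* D ℕ.< τ ℕ.^ κ → ∑ (subs Q) (λ U → bounded dp D U * inv U) ≤ ι (2 ℕ.^ suc κ)
    harmonic {τ} ≤s D κ 2D<τ^κ = *-cancelˡ-≤ (ι z) (0<ι z) (begin
      ι z * ∑ (subs Q) (λ U → bounded dp D U * inv U)
        ≡⟨ ∑-*ˡ (subs Q) (ι z) _ ⟨
      ∑ (subs Q) (λ U → ι z * (bounded dp D U * inv U))
        ≤⟨ ∑-mono (subs Q) term ⟩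
      ∑ (subs Q) (λ U → 2ℚ * run z (δs U) (pos 1))
        ≡⟨ trans (∑-*ˡ (subs Q) 2ℚ _) (cong (2ℚ *_) (∑-swap (subs Q) (downFrom z) _)) ⟩
      2ℚ * ∑< z (λ n → ∑ (subs Q) (λ U → δs U (pos (suc n))))
        ≤⟨ *-monoˡ 2ℚ (<⇒≤ 0<2) (∑<-mono z λ n n<z → ∑-δs-≤ dp ≤s (pos (suc n)) κ
          (ℕP.≤-<-trans n<z 2D<τ^κ)) ⟩
      2ℚ * ∑< z (λ _ → ι (2 ℕ.^ κ))
        ≡⟨ cong (2ℚ *_) (∑<-const z _) ⟩
      2ℚ * (ι z * ι (2 ℕ.^ κ))
        ≡⟨ swap 2ℚ (ι z) _ ⟩
      ι z * (2ℚ * ι (2 ℕ.^ κ))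
        ≡⟨ cong (ι z *_) (trans (cong (_* ι (2 ℕ.^ κ)) (sym ι2)) (sym (ι-* 2 (2 ℕ.^ κ)))) ⟩
      ι z * ι (2 ℕ.^ suc κ) ∎)
      where
      open ≤-Reasoning
      z = 2 ℕ.* D
      instance _ = ℕP.m*n≢0 2 D
      swap : ∀ a b c → a * (b * c) ≡ b * (a * c)
      swap = solve 3 (λ a b c → a :* (b :* c) := b :* (a :* c)) refl
      term : ∀ U → ι z * (bounded dp D U * inv U) ≤ 2ℚ * run z (δs U) (pos 1)
      term U = go (norm U ℕ.≤? D)
        where
        r = run z (δs U) (pos 1)
        0≤r : 0ℚ ≤ r
        0≤r = run-nonneg z (δs U) (pos 1) (0≤δs U)
        X = ι z * inv U
        zeros : ∀ a b → a * (0ℚ * b) ≡ 0ℚ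
        zeros = solve 2 (λ a b → a :* ((con 0ℚ) :* b) := (con 0ℚ)) refl
        ones : ∀ a b → a * (1ℚ * b) ≡ a * b
        ones = solve 2 (λ a b → a :* ((con 1ℚ) :* b) := a :* b) refl
        rearrange : ∀ x r → 2ℚ * r ≡ x + ((r - x + 1ℚ) + (r - x + 1ℚ) + (x - 2ℚ))
        rearrange = solve 2 (λ x r → (con 2ℚ) :* r := x :+ ((r :- x :+ (con 1ℚ)) :+ (r :- x :+ (con 1ℚ))
          :+ (x :- (con 2ℚ)))) refl
        regroup : ∀ a b c → a * b * c ≡ a * (b * c)
        regroup = solve 3 (λ a b c → a :* b :* c := a :* (b :* c)) refl
        go : Dec (norm U ℕ.≤ D) → ι z * (bounded dp D U * inv U) ≤ 2ℚ * r
        go (no U≰D) = subst (_≤ 2ℚ * r)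
          (sym (trans (cong (λ w → ι z * (w * inv U)) (𝟙-no (norm U ℕ.≤? D) U≰D))
          (zeros (ι z) (inv U)))) (0≤* (<⇒≤ 0<2) 0≤r)
        go (yes U≤D) = subst (_≤ 2ℚ * r)
          (sym (trans (cong (λ w → ι z * (w * inv U)) (𝟙-yes (norm U ℕ.≤? D) U≤D))
            (ones (ι z) (inv U)))) (≤-by (rearrange X r) (0≤+ (0≤+ 0≤ 0≤) 2≤X))
          where
          0≤ : 0ℚ ≤ r - X + 1ℚ
          0≤ = subst (_≤ r - X + 1ℚ) (cancel (- (r - X)))
            (≤-trans (≤-reflexive (move (r - X)))
              (+-monoʳ-≤ (r - X) (≤-trans (-p≤∣p∣ (r - X)) (δs-count dp U z (pos 1)))))
            where
            cancel : ∀ a → a - a ≡ 0ℚ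
            cancel = solve 1 (λ a → a :- a := (con 0ℚ)) refl
            move : ∀ a → - a - - a ≡ a + - a
            move = solve 1 (λ a → :- a :- :- a := a :+ :- a) refl
          2≤X : 0ℚ ≤ X - 2ℚ
          2≤X = subst (_≤ X - 2ℚ) (+-inverseʳ 2ℚ) (+-monoˡ-≤ (- 2ℚ) (begin
            2ℚ                          ≡⟨ trans (sym (*-identityʳ 2ℚ))
              (cong (2ℚ *_) (sym (norm*inv (proj₁ dp) U))) ⟩
            2ℚ * (ι (norm U) * inv U)   ≤⟨ *-monoˡ 2ℚ (<⇒≤ 0<2) (*-monoʳ (inv U) (0≤inv U)
              (ι-mono-≤ U≤D)) ⟩
            2ℚ * (ι D * inv U)          ≡⟨ regroup 2ℚ (ι D) (inv U) ⟨
            2ℚ * ι D * inv U            ≡⟨ cong (_* inv U) (trans (cong (_* ι D) (sym ι2))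
              (sym (ι-* 2 D))) ⟩
            X                           ∎))

    -- From `harmonic`, because 1 is at most `D` times the inverse of a modulus up to `D`.
    ∑-bounded-≤ : ∀ {τ} .{{_ : ℕ.NonZero τ}} → All (τ ℕ.≤_) Q → ∀ D κ .{{_ : ℕ.NonZero D}} →
      2 ℕ.* D ℕ.< τ ℕ.^ κ → ∑ (subs Q) (bounded dp D) ≤ ι D * ι (2 ℕ.^ suc κ)
    ∑-bounded-≤ ≤s D κ 2D<τ^κ = begin
      ∑ (subs Q) (bounded dp D)                           ≤⟨ ∑-mono (subs Q) term ⟩
      ∑ (subs Q) (λ U → ι D * (bounded dp D U * inv U))   ≡⟨ ∑-*ˡ (subs Q) (ι D) _ ⟩
      ι D * ∑ (subs Q) (λ U → bounded dp D U * inv U)     ≤⟨ *-monoˡ (ι D) (0≤ι D)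
        (harmonic ≤s D κ 2D<τ^κ) ⟩
      ι D * ι (2 ℕ.^ suc κ)                               ∎
      where
      open ≤-Reasoning
      term : ∀ U → bounded dp D U ≤ ι D * (bounded dp D U * inv U)
      term U = go (norm U ℕ.≤? D)
        where
        zeros : ∀ a b → a * (0ℚ * b) ≡ 0ℚ
        zeros = solve 2 (λ a b → a :* ((con 0ℚ) :* b) := (con 0ℚ)) refl
        ones : ∀ a b → a * (1ℚ * b) ≡ a * b
        ones = solve 2 (λ a b → a :* ((con 1ℚ) :* b) := a :* b) refl
        go : Dec (norm U ℕ.≤ D) → bounded dp D U ≤ ι D * (bounded dp D U * inv U)
        go (no U≰D) = ≤-reflexive
          (trans e (sym (trans (cong (λ w → ι D * (w * inv U)) e) (zeros (ι D) (inv U)))))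
          where e = 𝟙-no (norm U ℕ.≤? D) U≰D
        go (yes U≤D) = subst₂ _≤_ (sym e)
          (sym (trans (cong (λ w → ι D * (w * inv U)) e) (ones (ι D) (inv U))))
          (subst (_≤ ι D * inv U) (norm*inv (proj₁ dp) U) (*-monoʳ (inv U) (0≤inv U) (ι-mono-≤ U≤D)))
          where e = 𝟙-yes (norm U ℕ.≤? D) U≤D

-- Ramanujan expansions of truncated divisor sums

module Equidistribution where

  open Rat
  open Sums
  open Subsets
  open LargeSieve

  private variable
    Q : List ℕ

  ∅ : ∀ Q → Sub Q
  ∅ []      = []
  ∅ (p ∷ Q) = skip (∅ Q)

  c-∅ : ∀ Q n → c (∅ Q) n ≡ 1ℚ
  c-∅ []      n = refl
  c-∅ (p ∷ Q) n = c-∅ Q n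

  incl-∅ : (S : Sub Q) → incl (∅ Q) S ≡ 1ℚ
  incl-∅ []       = refl
  incl-∅ (skip S) = incl-∅ S
  incl-∅ (pick S) = incl-∅ S

  incl-norm : All Prime Q → (T S : Sub Q) → incl T S ≡ 0ℚ ⊎ norm T ℕ.≤ norm S
  incl-norm []       []       []       = inj₂ ℕP.≤-refl
  incl-norm (_ ∷ ps) (skip T) (skip S) = incl-norm ps T S
  incl-norm {p ∷ Q} (pp ∷ ps) (skip T) (pick S) with incl-norm ps T S
  ... | inj₁ z = inj₁ z
  ... | inj₂ T≤S = inj₂ (ℕP.≤-trans T≤S (ℕP.m≤n*m (norm S) p {{prime⇒nonZero pp}}))
  incl-norm (_ ∷ ps) (pick T) (skip S) = inj₁ refl
  incl-norm {p ∷ Q} (_ ∷ ps) (pick T) (pick S) with incl-norm ps T S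
  ... | inj₁ z = inj₁ z
  ... | inj₂ T≤S = inj₂ (ℕP.*-monoʳ-≤ p T≤S)

  private
    scaled : ℕ → ℕ → Sub Q → ℚ
    scaled k D U = 𝟙 (k ℕ.* norm U ℕ.≤? D)

    𝟙-mono : ∀ {P R : Set} (P? : Dec P) (R? : Dec R) → (P → R) → 𝟙 P? ≤ 𝟙 R?
    𝟙-mono (yes p) (yes r) f = ≤-refl
    𝟙-mono (yes p) (no ¬r) f = ⊥-elim (¬r (f p))
    𝟙-mono (no ¬p) R?      f = 0≤𝟙 R?

    -- Removing `T` from a superset `S` leaves a set whose inverse norm is that of `S` divided by
    -- `inv T` and whose norm still satisfies the bound. The factor `k` carries the norm of the
    -- primes of `S` outside `T` already met, so that the bound `D` survives the induction on `Q`.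
    incl-∑-scaled : All Prime Q → ∀ k D (T : Sub Q) →
      ∑ (subs Q) (λ S → incl T S * (scaled k D S * inv S)) ≤ inv T * ∑ (subs Q)
        (λ U → scaled k D U * inv U)
    incl-∑-scaled [] k D [] = ≤-reflexive (collapse (scaled k D []))
      where
      collapse : ∀ w → 1ℚ * (w * 1ℚ) + 0ℚ ≡ 1ℚ * (w * 1ℚ + 0ℚ)
      collapse = solve 1 (λ w → (con 1ℚ) :* (w :* (con 1ℚ)) :+ (con 0ℚ) := (con 1ℚ) :*
        (w :* (con 1ℚ) :+ (con 0ℚ))) refl
    incl-∑-scaled {p ∷ Q} (pp ∷ ps) k D (skip T) = begin
      ∑ (subs (p ∷ Q)) (λ S → incl (skip T) S * (scaled k D S * inv S))
        ≡⟨ ∑-subs-∷ p Q _ ⟩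
      ∑ (subs Q) (λ S → incl T S * (scaled k D S * inv S)) +
      ∑ (subs Q) (λ S → incl T S * (scaled k D (pick {p} S) * (recip p * inv S)))
        ≡⟨ cong (∑ (subs Q) (λ S → incl T S * (scaled k D S * inv S)) +_) (trans
             (∑-cong (subs Q) λ S → trans (cong (λ w → incl T S * (w * (recip p * inv S))) (rescale S))
               (pull (incl T S) (scaled (k ℕ.* p) D S) (recip p) (inv S)))
             (∑-*ˡ (subs Q) (recip p) _)) ⟩
      ∑ (subs Q) (λ S → incl T S * (scaled k D S * inv S)) +
      recip p * ∑ (subs Q) (λ S → incl T S * (scaled (k ℕ.* p) D S * inv S))
        ≤⟨ +-mono-≤ (incl-∑-scaled ps k D T) (*-monoˡ (recip p) (0≤recip p) (incl-∑-scaled ps (k ℕ.* p)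
          D T)) ⟩
      inv T * A + recip p * (inv T * B)
        ≡⟨ factor (inv T) A (recip p) B ⟩
      inv T * (A + recip p * B)
        ≡⟨ cong (λ z → inv T * (A + z)) (trans (sym (∑-*ˡ (subs Q) (recip p) _)) (∑-cong (subs Q) λ S →
             trans (swap (recip p) (scaled (k ℕ.* p) D S) (inv S)) (cong (_* (recip p * inv S))
               (sym (rescale S))))) ⟩
      inv T * (A + ∑ (subs Q) (λ U → scaled k D (pick {p} U) * (recip p * inv U)))
        ≡⟨ cong (inv T *_) (∑-subs-∷ p Q _) ⟨
      inv T * ∑ (subs (p ∷ Q)) (λ U → scaled k D U * inv U) ∎
      where
      open ≤-Reasoning
      A = ∑ (subs Q) (λ U → scaled k D U * inv U)
      B = ∑ (subs Q) (λ U → scaled (k ℕ.* p) D U * inv U)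
      rescale : ∀ S → scaled k D (pick {p} S) ≡ scaled (k ℕ.* p) D S
      rescale S = cong (λ m → 𝟙 (m ℕ.≤? D)) (sym (ℕP.*-assoc k p (norm S)))
      pull : ∀ i w r v → i * (w * (r * v)) ≡ r * (i * (w * v))
      pull = solve 4 (λ i w r v → i :* (w :* (r :* v)) := r :* (i :* (w :* v))) refl
      factor : ∀ i a r b → i * a + r * (i * b) ≡ i * (a + r * b)
      factor = solve 4 (λ i a r b → i :* a :+ r :* (i :* b) := i :* (a :+ r :* b)) refl
      swap : ∀ a b c → a * (b * c) ≡ b * (a * c)
      swap = solve 3 (λ a b c → a :* (b :* c) := b :* (a :* c)) refl
    incl-∑-scaled {p ∷ Q} (pp ∷ ps) k D (pick T) = begin
      ∑ (subs (p ∷ Q)) (λ S → incl (pick T) S * (scaled k D S * inv S))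
        ≡⟨ ∑-subs-∷ p Q _ ⟩
      ∑ (subs Q) (λ S → 0ℚ * (scaled k D S * inv S)) +
      ∑ (subs Q) (λ S → incl T S * (scaled k D (pick {p} S) * (recip p * inv S)))
        ≡⟨ trans (cong₂ _+_ (trans (∑-cong (subs Q) λ S → *-zeroˡ _) (∑-0 (subs Q)))
             (trans (∑-cong (subs Q) λ S → pull (incl T S) (scaled k D (pick {p} S)) (recip p) (inv S))
               (∑-*ˡ (subs Q) (recip p) _)))
             (+-identityˡ _) ⟩
      recip p * ∑ (subs Q) (λ S → incl T S * (scaled k D (pick {p} S) * inv S))
        ≤⟨ *-monoˡ (recip p) (0≤recip p) (∑-mono (subs Q) λ S → *-monoˡ (incl T S) (0≤incl T S)
          (*-monoʳ (inv S) (0≤inv S)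
             (𝟙-mono (k ℕ.* (p ℕ.* norm S) ℕ.≤? D) (k ℕ.* norm S ℕ.≤? D) (ℕP.≤-trans
               (ℕP.*-monoʳ-≤ k (ℕP.m≤n*m (norm S) p {{prime⇒nonZero pp}})))))) ⟩
      recip p * ∑ (subs Q) (λ S → incl T S * (scaled k D S * inv S))
        ≤⟨ *-monoˡ (recip p) (0≤recip p) (incl-∑-scaled ps k D T) ⟩
      recip p * (inv T * A)
        ≡⟨ *-assoc (recip p) (inv T) A ⟨
      recip p * inv T * A
        ≤⟨ *-monoˡ (recip p * inv T) (0≤* (0≤recip p) (0≤inv T)) (≤-by (∑-subs-∷ p Q _)
             (∑-nonneg (subs Q) λ U → 0≤* (0≤𝟙 (k ℕ.* (p ℕ.* norm U) ℕ.≤? D))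
               (0≤* (0≤recip p) (0≤inv U)))) ⟩
      recip p * inv T * ∑ (subs (p ∷ Q)) (λ U → scaled k D U * inv U) ∎
      where
      open ≤-Reasoning
      A = ∑ (subs Q) (λ U → scaled k D U * inv U)
      pull : ∀ i w r v → i * (w * (r * v)) ≡ r * (i * (w * v))
      pull = solve 4 (λ i w r v → i :* (w :* (r :* v)) := r :* (i :* (w :* v))) refl

  module _ {Q : List ℕ} (dp : DistinctPrimes Q) where

    incl-∑ : ∀ D (T : Sub Q) → ∑ (subs Q) (λ S → incl T S * (bounded dp D S * inv S)) ≤
      inv T * ∑ (subs Q) (λ U → bounded dp D U * inv U)
    incl-∑ D T = subst₂ _≤_
      (∑-cong (subs Q) λ S → cong (λ w → incl T S * (w * inv S)) (same S))
      (cong (inv T *_) (∑-cong (subs Q) λ S → cong (_* inv S) (same S)))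
      (incl-∑-scaled (proj₁ dp) 1 D T)
      where
      same : ∀ S → scaled 1 D S ≡ bounded dp D S
      same S = cong (λ m → 𝟙 (m ℕ.≤? D)) (ℕP.*-identityˡ (norm S))

    ∑-norm≤1 : ∀ f → ∑ (subs Q) (λ T → 𝟙 (norm T ℕ.≤? 1) * f T) ≡ f (∅ Q)
    ∑-norm≤1 = go Q (proj₁ dp)
      where
      go : ∀ Q → All Prime Q → ∀ f → ∑ (subs Q) (λ T → 𝟙 (norm T ℕ.≤? 1) * f T) ≡ f (∅ Q)
      go [] [] f = collapse (f [])
        where
        collapse : ∀ a → 1ℚ * a + 0ℚ ≡ a
        collapse = solve 1 (λ a → (con 1ℚ) :* a :+ (con 0ℚ) := a) refl
      go (p ∷ Q) (pp ∷ ps) f = trans (∑-subs-∷ p Q _) (trans (cong₂ _+_ (go Q ps λ T → f (skip T))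
        (trans (∑-cong (subs Q) λ T → trans
          (cong (_* f (pick T)) (𝟙-no (p ℕ.* norm T ℕ.≤? 1) (large T)))
          (*-zeroˡ (f (pick T)))) (∑-0 (subs Q)))) (+-identityʳ _))
        where
        large : ∀ T → ¬ p ℕ.* norm T ℕ.≤ 1
        large T = ℕP.<⇒≱ (ℕP.<-≤-trans (ℕ.nonTrivial⇒n>1 p {{prime⇒nonTrivial pp}})
          (ℕP.m≤m*n p (norm T) {{norm-nonZero ps T}}))

    divisorSum : (Sub Q → ℚ) → ℤ → ℚ
    divisorSum μ n = ∑ (subs Q) λ S → μ S * δs S n

    mean : (Sub Q → ℚ) → ℚ
    mean μ = ∑ (subs Q) λ S → μ S * inv S

    -- The Ramanujan coefficient: Σ μ(d) / d over the multiples d of the norm of `T`.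
    coefficient : (Sub Q → ℚ) → Sub Q → ℚ
    coefficient μ T = ∑ (subs Q) λ S → incl T S * (μ S * inv S)

    divisorSum-expand : ∀ μ n → divisorSum μ n ≡ ∑ (subs Q) λ T → coefficient μ T * c T n
    divisorSum-expand μ n = trans
      (∑-cong (subs Q) λ S → trans (cong (μ S *_) (δs-expand (proj₁ dp) S n))
        (trans (sym (*-assoc (μ S) (inv S) _)) (trans (sym (∑-*ˡ (subs Q) (μ S * inv S) _))
          (∑-cong (subs Q) λ T → regroup (μ S * inv S) (incl T S) (c T n)))))
      (trans (∑-swap (subs Q) (subs Q) _) (∑-cong (subs Q) λ T → ∑-*ʳ (subs Q) (c T n) _))
      where
      regroup : ∀ a b c → a * (b * c) ≡ b * a * c
      regroup = solve 3 (λ a b c → a :* (b :* c) := b :* a :* c) refl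

    coefficient-∅ : ∀ μ → coefficient μ (∅ Q) ≡ mean μ
    coefficient-∅ μ = ∑-cong (subs Q) λ S → trans (cong (_* (μ S * inv S)) (incl-∅ S)) (*-identityˡ _)

    module _ (μ : Sub Q → ℚ) (D : ℕ) (∣μ∣≤ : ∀ S → ∣ μ S ∣ ≤ bounded dp D S) where

      private
        ∣coefficient∣≤∑ : ∀ T → ∣ coefficient μ T ∣ ≤ ∑ (subs Q)
          (λ S → incl T S * (bounded dp D S * inv S))
        ∣coefficient∣≤∑ T = ≤-trans (∣∑∣≤ (subs Q) _) (∑-mono (subs Q) λ S → ≤-trans
          (≤-reflexive (trans (∣p*q∣≡∣p∣*∣q∣ (incl T S) _) (cong₂ _*_ (0≤p⇒∣p∣≡p (0≤incl T S))
            (trans (∣p*q∣≡∣p∣*∣q∣ (μ S) (inv S)) (cong (∣ μ S ∣ *_) (0≤p⇒∣p∣≡p (0≤inv S)))))))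
          (*-monoˡ (incl T S) (0≤incl T S) (*-monoʳ (inv S) (0≤inv S) (∣μ∣≤ S))))

      ∣coefficient∣≤ : ∀ T → ∣ coefficient μ T ∣ ≤ inv T * ∑ (subs Q) (λ U → bounded dp D U * inv U)
      ∣coefficient∣≤ T = ≤-trans (∣coefficient∣≤∑ T) (incl-∑ D T)

      -- A superset of `T` has at least the norm of `T`, which is beyond the support of `μ`.
      coefficient-large : ∀ T → D ℕ.< norm T → coefficient μ T ≡ 0ℚ
      coefficient-large T D<T = trans (∑-cong (subs Q) vanish) (∑-0 (subs Q))
        where
        vanish : ∀ S → incl T S * (μ S * inv S) ≡ 0ℚ
        vanish S with incl-norm (proj₁ dp) T S
        ... | inj₁ z = trans (cong (_* (μ S * inv S)) z) (*-zeroˡ _)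
        ... | inj₂ T≤S = trans (cong (λ m → incl T S * (m * inv S)) μ≡0)
          (trans (cong (incl T S *_) (*-zeroˡ (inv S))) (*-zeroʳ _))
          where
          ∣μ∣≤0 : ∣ μ S ∣ ≤ 0ℚ
          ∣μ∣≤0 = subst (∣ μ S ∣ ≤_) (𝟙-no (norm S ℕ.≤? D) (ℕP.<⇒≱ (ℕP.<-≤-trans D<T T≤S))) (∣μ∣≤ S)
          μ≡0 : μ S ≡ 0ℚ
          μ≡0 = ≤-antisym (≤-trans (p≤∣p∣ (μ S)) ∣μ∣≤0)
            (subst₂ _≤_ -0≡0 (neg-neg (μ S)) (neg-antimono-≤ (≤-trans (-p≤∣p∣ (μ S)) ∣μ∣≤0)))
            where
            neg-neg : ∀ a → - (- a) ≡ a
            neg-neg = solve 1 (λ a → :- (:- a) := a) refl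

-- Equidistribution of divisor sums, one range of moduli at a time

module Levels where

  open Rat
  open Sums
  open Kernel
  open Subsets
  open LargeSieve
  open Divisors
  open Equidistribution

  ι*-≤1⇒≤recip : ∀ {a p} .{{_ : ℕ.NonZero a}} → ι a * p ≤ 1ℚ → p ≤ recip a
  ι*-≤1⇒≤recip {a} {p} le = *-cancelˡ-≤ (ι a) (0<ι a) (≤-trans le (≤-reflexive (sym (ι*recip a))))

  recip-*-≤ : ∀ {a p q} .{{_ : ℕ.NonZero a}} → p ≤ ι a * q → recip a * p ≤ q
  recip-*-≤ {a} {p} {q} le = *-cancelˡ-≤ (ι a) (0<ι a) (≤-trans (≤-reflexive
    (trans (sym (*-assoc (ι a) (recip a) p)) (trans (cong (_* p) (ι*recip a)) (*-identityˡ p)))) le)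

  recip^*ι^ : ∀ a .{{_ : ℕ.NonZero a}} n → recip a ^ n * ι (a ℕ.^ n) ≡ 1ℚ
  recip^*ι^ a zero    = trans (*-identityˡ _) ι1
  recip^*ι^ a (suc n) = begin
    recip a * recip a ^ n * ι (a ℕ.* a ℕ.^ n)        ≡⟨ cong (recip a * recip a ^ n *_)
      (ι-* a (a ℕ.^ n)) ⟩
    recip a * recip a ^ n * (ι a * ι (a ℕ.^ n))      ≡⟨ regroup (recip a) (recip a ^ n) (ι a)
      (ι (a ℕ.^ n)) ⟩
    ι a * recip a * (recip a ^ n * ι (a ℕ.^ n))      ≡⟨ cong₂ _*_ (ι*recip a) (recip^*ι^ a n) ⟩
    1ℚ * 1ℚ                                          ≡⟨ *-identityˡ 1ℚ ⟩
    1ℚ                                               ∎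
    where
    open ≡-Reasoning
    regroup : ∀ a b c d → a * b * (c * d) ≡ c * a * (b * d)
    regroup = solve 4 (λ a b c d → a :* b :* (c :* d) := c :* a :* (b :* d)) refl

  module _ {Q : List ℕ} (dp : DistinctPrimes Q) (t i h : ℕ) .{{t≢0 : ℕ.NonZero t}} where

    private
      K = i ℕ.+ h
      -- The number of averagings: the errors add up to at most t ^ (8K + 3) before averaging
      -- (`size-bound`), and each averaging divides by t.
      J = 8 ℕ.* K ℕ.+ 3

    module Level
      (3≤i : 3 ℕ.≤ i) (large : All (t ℕ.^ i ℕ.≤_) Q)
      (4^≤t : 4 ℕ.^ (K ℕ.+ 2) ℕ.≤ t)
      (margin≤t : 2 ℕ.* K ℕ.* (2 ℕ.^ suc K ℕ.* suc J) ℕ.≤ t)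
      (x : ℕ) (x≤ : x ℕ.≤ t ℕ.^ suc K)
      (l : ℕ) (i≤l : i ℕ.≤ l) (l≤ : l ℕ.≤ h ℕ.+ 2)
      where

      private
        R = t ℕ.^ suc l
        -- This is `t * (R * R)`: longer by the factor `t` than the period of any product of two
        -- Ramanujan sums on the level, which gives `q = recip t`.
        L = t ℕ.^ (2 ℕ.* l ℕ.+ 3)
        N = J ℕ.* L ℕ.+ x
        q = recip t
        W = ∑ (subs Q) (bounded dp R)
        instance
          L≢0 : ℕ.NonZero L
          L≢0 = ℕP.m^n≢0 t (2 ℕ.* l ℕ.+ 3)
          R≢0 : ℕ.NonZero R
          R≢0 = ℕP.m^n≢0 t (suc l)

        t^-mono : ∀ {m n} → m ℕ.≤ n → t ℕ.^ m ℕ.≤ t ℕ.^ n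
        t^-mono = ℕP.^-monoʳ-≤ t

        1<t : 1 ℕ.< t
        1<t = ℕP.<-≤-trans (ℕP.<-≤-trans (ℕ.s≤s (ℕ.s≤s ℕ.z≤n))
          (ℕP.^-monoʳ-≤ 4 {x = 1} (ℕP.≤-trans (ℕ.s≤s ℕ.z≤n) (ℕP.m≤n+m 2 K)))) 4^≤t

        l+1≤K : suc l ℕ.≤ K
        l+1≤K = ℕP.≤-trans (ℕ.s≤s l≤) (ℕP.≤-trans (ℕP.≤-reflexive (sym (ℕP.+-suc h 2)))
          (ℕP.≤-trans (ℕP.+-monoʳ-≤ h 3≤i) (ℕP.≤-reflexive (ℕP.+-comm h i))))

        tR²≡L : t ℕ.* (R ℕ.* R) ≡ L
        tR²≡L = trans (cong (t ℕ.*_) (sym (ℕP.^-distribˡ-+-* t (suc l) (suc l))))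
          (cong (t ℕ.^_) (exponent l))
          where
          exponent : ∀ l → suc (suc l ℕ.+ suc l) ≡ 2 ℕ.* l ℕ.+ 3
          exponent = solve-ℕ

        R²/L≤q : recip L * ι (R ℕ.* R) ≤ q
        R²/L≤q = ι*-≤1⇒≤recip (≤-reflexive (trans (swap (ι t) (recip L) (ι (R ℕ.* R)))
          (trans (cong (_* recip L) (trans (sym (ι-* t (R ℕ.* R))) (cong ι tR²≡L))) (ι*recip L))))
          where
          swap : ∀ a b c → a * (b * c) ≡ a * c * b
          swap = solve 3 (λ a b c → a :* (b :* c) := a :* c :* b) refl

        R≤t^K : R ℕ.≤ t ℕ.^ K
        R≤t^K = t^-mono l+1≤K

        2R<τ^K : 2 ℕ.* R ℕ.< (t ℕ.^ i) ℕ.^ K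
        2R<τ^K = begin-strict
          2 ℕ.* R                ≤⟨ ℕP.*-mono-≤ 1<t R≤t^K ⟩
          t ℕ.^ suc K            <⟨ ℕP.^-monoʳ-< t 1<t (ℕP.≤-trans (ℕP.+-monoʳ-≤ 2 (ℕP.m≤m+n K 0))
            bound) ⟩
          t ℕ.^ (i ℕ.* K)        ≡⟨ ℕP.^-*-assoc t i K ⟨
          (t ℕ.^ i) ℕ.^ K        ∎
          where
          open ℕP.≤-Reasoning
          bound : 2 ℕ.+ (K ℕ.+ 0) ℕ.≤ i ℕ.* K
          bound = ℕP.≤-trans (ℕP.≤-trans (ℕP.+-mono-≤ (ℕP.≤-trans (ℕP.≤-trans (ℕ.s≤s (ℕ.s≤s ℕ.z≤n)) 3≤i)
            (ℕP.m≤m+n i h))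
            (ℕP.≤-refl {K ℕ.+ 0})) ℕP.≤-refl) (ℕP.*-monoˡ-≤ K {2} {i} (ℕP.≤-trans (ℕ.s≤s (ℕ.s≤s ℕ.z≤n))
              3≤i))

        W≤ : W ≤ ι (R ℕ.* 2 ℕ.^ suc K)
        W≤ = ≤-trans (∑-bounded-≤ dp {{ℕP.m^n≢0 t i}} large R K 2R<τ^K)
          (≤-reflexive (sym (ι-* R (2 ℕ.^ suc K))))

        -- With P = t ^ K, each of x / t, R and the number of moduli divided by 2 ^ (K + 1) is at
        -- most P. There are eight such factors in all, two further factors t come from x, and one
        -- more absorbs the constants.
        size-bound : x ℕ.* x ℕ.* ((R ℕ.* 2 ℕ.^ suc K) ℕ.* (R ℕ.* 2 ℕ.^ suc K)) ℕ.*
          (R ℕ.* R ℕ.* (R ℕ.* R ℕ.+ R)) ℕ.≤ t ℕ.^ J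
        size-bound = begin
          x ℕ.* x ℕ.* ((R ℕ.* c₁) ℕ.* (R ℕ.* c₁)) ℕ.* (R ℕ.* R ℕ.* (R ℕ.* R ℕ.+ R))
            ≤⟨ ℕP.*-mono-≤ (ℕP.*-mono-≤ (ℕP.*-mono-≤ x≤ x≤) (ℕP.*-mono-≤ (ℕP.*-monoˡ-≤ c₁ R≤t^K)
              (ℕP.*-monoˡ-≤ c₁ R≤t^K)))
                 (ℕP.*-mono-≤ (ℕP.*-mono-≤ R≤t^K R≤t^K) (ℕP.+-mono-≤ (ℕP.*-mono-≤ R≤t^K R≤t^K)
                   (ℕP.≤-trans R≤t^K (ℕP.m≤m*n P P {{ℕP.m^n≢0 t K}})))) ⟩
          (t ℕ.* P) ℕ.* (t ℕ.* P) ℕ.* ((P ℕ.* c₁) ℕ.* (P ℕ.* c₁)) ℕ.*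
            (P ℕ.* P ℕ.* (P ℕ.* P ℕ.+ P ℕ.* P))
            ≡⟨ collect t P c₁ ⟩
          (2 ℕ.* (c₁ ℕ.* c₁)) ℕ.* (t ℕ.* t ℕ.* P⁸ P)
            ≤⟨ ℕP.*-monoˡ-≤ (t ℕ.* t ℕ.* P⁸ P) (ℕP.≤-trans c₁²≤ 4^≤t) ⟩
          t ℕ.* (t ℕ.* t ℕ.* P⁸ P)
            ≡⟨ powers ⟩
          t ℕ.^ J ∎
          where
          open ℕP.≤-Reasoning
          P = t ℕ.^ K
          c₁ = 2 ℕ.^ suc K
          P⁸ : ℕ → ℕ
          P⁸ p = p ℕ.* p ℕ.* (p ℕ.* p) ℕ.* (p ℕ.* p ℕ.* (p ℕ.* p))
          collect : ∀ t p c → (t ℕ.* p) ℕ.* (t ℕ.* p) ℕ.* ((p ℕ.* c) ℕ.* (p ℕ.* c)) ℕ.*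
            (p ℕ.* p ℕ.* (p ℕ.* p ℕ.+ p ℕ.* p)) ≡
            (2 ℕ.* (c ℕ.* c)) ℕ.* (t ℕ.* t ℕ.* (p ℕ.* p ℕ.* (p ℕ.* p) ℕ.* (p ℕ.* p ℕ.* (p ℕ.* p))))
          collect = solve-ℕ
          c₁²≤ : 2 ℕ.* (c₁ ℕ.* c₁) ℕ.≤ 4 ℕ.^ (K ℕ.+ 2)
          c₁²≤ = ℕP.≤-trans (ℕP.*-monoˡ-≤ (c₁ ℕ.* c₁) {2} {4} (ℕ.s≤s (ℕ.s≤s ℕ.z≤n)))
            (ℕP.≤-reflexive (trans (cong (4 ℕ.*_) (trans (sym (ℕP.^-distribˡ-+-* 2 (suc K) (suc K)))
              (trans (cong (2 ℕ.^_) (double K)) (sym (ℕP.^-*-assoc 2 2 (suc K))))))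
                (cong (4 ℕ.^_) (ℕP.+-comm 2 K))))
            where
            double : ∀ k → suc k ℕ.+ suc k ≡ 2 ℕ.* suc k
            double = solve-ℕ
          powers : t ℕ.* (t ℕ.* t ℕ.* P⁸ P) ≡ t ℕ.^ J
          powers = trans (assoc t (P⁸ P)) (trans (cong (λ z → t ℕ.* t ℕ.* t ℕ.* z) p8)
            (trans (cong (ℕ._* t ℕ.^ (8 ℕ.* K)) (cube t)) (trans (sym (ℕP.^-distribˡ-+-* t 3 (8 ℕ.* K)))
              (cong (t ℕ.^_) (ℕP.+-comm 3 (8 ℕ.* K))))))
            where
            assoc : ∀ t z → t ℕ.* (t ℕ.* t ℕ.* z) ≡ t ℕ.* t ℕ.* t ℕ.* z
            assoc = solve-ℕ
            cube : ∀ t → t ℕ.* t ℕ.* t ≡ t ℕ.* (t ℕ.* (t ℕ.* 1))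
            cube = solve-ℕ
            sq : ∀ m → t ℕ.^ m ℕ.* t ℕ.^ m ≡ t ℕ.^ (m ℕ.+ m)
            sq m = sym (ℕP.^-distribˡ-+-* t m m)
            eight : ∀ k → ((k ℕ.+ k) ℕ.+ (k ℕ.+ k)) ℕ.+ ((k ℕ.+ k) ℕ.+ (k ℕ.+ k)) ≡ 8 ℕ.* k
            eight = solve-ℕ
            p8 : P⁸ P ≡ t ℕ.^ (8 ℕ.* K)
            p8 = trans (cong (λ z → z ℕ.* z ℕ.* (z ℕ.* z)) (sq K))
              (trans (cong (λ z → z ℕ.* z) (sq (K ℕ.+ K)))
              (trans (sq ((K ℕ.+ K) ℕ.+ (K ℕ.+ K))) (cong (t ℕ.^_) (eight K))))

        1≤N : 1 ℕ.≤ N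
        1≤N = ℕP.≤-trans (ℕP.*-mono-≤ {1} {J} {1} {L} (ℕP.≤-trans (ℕ.s≤s ℕ.z≤n) (ℕP.m≤n+m 3 (8 ℕ.* K)))
          (ℕ.>-nonZero⁻¹ L)) (ℕP.m≤m+n (J ℕ.* L) x)

        small : (ι x * ι x) * (W * W) * error dp R J q ≤ ι N
        small = begin
          (ι x * ι x) * (W * W) * (q ^ J * (ι (R ℕ.* R) * (ι (R ℕ.* R) + ι R)))
            ≤⟨ *-monoʳ _ 0≤E (*-monoˡ (ι x * ι x) (0≤sq (ι x)) (*-mono 0≤W 0≤W W≤ W≤)) ⟩
          (ι x * ι x) * (ι c₂ * ι c₂) * (q ^ J * (ι (R ℕ.* R) * (ι (R ℕ.* R) + ι R)))
            ≡⟨ regroup (ι x * ι x) (ι c₂ * ι c₂) (q ^ J) _ ⟩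
          q ^ J * ((ι x * ι x) * (ι c₂ * ι c₂) * (ι (R ℕ.* R) * (ι (R ℕ.* R) + ι R)))
            ≡⟨ cong (q ^ J *_) (sym casts) ⟩
          q ^ J * ι (x ℕ.* x ℕ.* (c₂ ℕ.* c₂) ℕ.* (R ℕ.* R ℕ.* (R ℕ.* R ℕ.+ R)))
            ≤⟨ *-monoˡ (q ^ J) (0≤^ J (0≤recip t)) (ι-mono-≤ size-bound) ⟩
          q ^ J * ι (t ℕ.^ J)
            ≡⟨ recip^*ι^ t J ⟩
          1ℚ
            ≤⟨ subst (_≤ ι N) ι1 (ι-mono-≤ 1≤N) ⟩
          ι N ∎
          where
          open ≤-Reasoning
          c₂ = R ℕ.* 2 ℕ.^ suc K
          0≤W : 0ℚ ≤ W
          0≤W = ∑-nonneg (subs Q) λ T → 0≤𝟙 (norm T ℕ.≤? R)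
          0≤E : 0ℚ ≤ error dp R J q
          0≤E = 0≤* (0≤^ J (0≤recip t)) (0≤* (0≤ι _) (0≤+ (0≤ι _) (0≤ι _)))
          regroup : ∀ a b c d → a * b * (c * d) ≡ c * (a * b * d)
          regroup = solve 4 (λ a b c d → a :* b :* (c :* d) := c :* (a :* b :* d)) refl
          casts : ι (x ℕ.* x ℕ.* (c₂ ℕ.* c₂) ℕ.* (R ℕ.* R ℕ.* (R ℕ.* R ℕ.+ R))) ≡
            (ι x * ι x) * (ι c₂ * ι c₂) * (ι (R ℕ.* R) * (ι (R ℕ.* R) + ι R))
          casts = trans (ι-* _ _) (cong₂ _*_ (trans (ι-* _ _) (cong₂ _*_ (ι-* x x) (ι-* c₂ c₂)))
            (trans (ι-* _ _) (cong (ι (R ℕ.* R) *_) (ι-+ (R ℕ.* R) R))))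

      -- The number of primes ≥ t ^ i is bounded in terms of K, so the total mass
      -- of the coefficients on this level is at most 2 ^ (K + 1).
      level-bound : ∀ {α β} → Weight x α → Weight x β →
        ι (t ℕ.^ (h ℕ.+ 7)) ≤ ∑< x α → ι (t ℕ.^ (h ℕ.+ 7)) ≤ ∑< x β →
        ∀ b → (∀ p i j → δ p (b i ℤ.- b j) ≡ δ p (pos i ℤ.- pos j)) →
        ∀ ε → (∀ T → ι (t ℕ.^ l) * ∣ ε T ∣ ≤ ι (2 ℕ.^ suc K) * bounded dp R T) →
        ∣ ∑< x (λ i → α i * transform dp x β b ε (pos (suc i))) ∣ ≤ recip (t ℕ.* K) * (∑< x α * ∑< x β)
      level-bound {α} {β} wα wβ A≥ B≥ b eq ε ε≤ = sq-cancel-≤ (0≤* (0≤recip (t ℕ.* K)) 0≤AB) (begin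
        Y * Y
          ≡⟨ trans (sym (*-identityˡ (Y * Y)))
            (cong (_* (Y * Y)) (sym (trans (cong₂ _*_ vu≡1 vu≡1) (*-identityˡ 1ℚ)))) ⟩
        (v * u) * (v * u) * (Y * Y)
          ≡⟨ regroup v u Y ⟩
        (v * v) * ((u * Y) * (u * Y))
          ≤⟨ *-monoˡ (v * v) (0≤sq v) sieve ⟩
        (v * v) * ((2ℚ + 1ℚ) * (A * B) * (ι N * ι N))
          ≡⟨ regroup₂ v (2ℚ + 1ℚ) (A * B) (ι N) ⟩
        (2ℚ + 1ℚ) * (v * ι N * (v * ι N)) * (A * B)
          ≤⟨ *-monoʳ (A * B) 0≤AB (*-mono (<⇒≤ 0<3) (0≤sq (v * ι N)) 3≤4 (*-mono 0≤vN 0≤vN vN≤ vN≤)) ⟩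
        2ℚ * 2ℚ * (ι V * ι V) * (A * B)
          ≡⟨ cong (_* (A * B)) (regroup₃ 2ℚ (ι V)) ⟩
        (2ℚ * ι V) * (2ℚ * ι V) * (A * B)
          ≤⟨ *-monoʳ (A * B) 0≤AB (*-mono 0≤2V 0≤2V 2V≤ 2V≤) ⟩
        (g * ι H) * (g * ι H) * (A * B)
          ≡⟨ cong (_* (A * B)) (regroup₃′ g (ι H)) ⟩
        (g * g) * (ι H * ι H) * (A * B)
          ≤⟨ *-monoʳ (A * B) 0≤AB (*-monoˡ (g * g) (0≤sq g) (*-mono (0≤ι H) (0≤ι H) A≥ B≥)) ⟩
        (g * g) * (A * B) * (A * B)
          ≡⟨ regroup₄ g (A * B) ⟩
        g * (A * B) * (g * (A * B)) ∎)
        where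
        open ≤-Reasoning
        A = ∑< x α
        B = ∑< x β
        H = t ℕ.^ (h ℕ.+ 7)
        Y = ∑< x (λ i → α i * transform dp x β b ε (pos (suc i)))
        cK = 2 ℕ.^ suc K
        V = cK ℕ.* (suc J ℕ.* t ℕ.^ (h ℕ.+ 5))
        instance
          t^l≢0 : ℕ.NonZero (t ℕ.^ l)
          t^l≢0 = ℕP.m^n≢0 t l
          cK≢0 : ℕ.NonZero cK
          cK≢0 = ℕP.m^n≢0 2 (suc K)
          K≢0 : ℕ.NonZero K
          K≢0 = ℕ.>-nonZero (ℕP.<-≤-trans (ℕP.<-≤-trans (ℕ.s≤s ℕ.z≤n) 3≤i) (ℕP.m≤m+n i h))
          tK≢0 : ℕ.NonZero (t ℕ.* K)
          tK≢0 = ℕP.m*n≢0 t K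
          H≢0 : ℕ.NonZero H
          H≢0 = ℕP.m^n≢0 t (h ℕ.+ 7)
        g = recip (t ℕ.* K)
        -- The coefficients on the level are at most 2 ^ (K + 1) / t ^ l. Multiplication by `u`
        -- brings them down to the normalisation of `large-sieve`, and `v` undoes it.
        u = ι (t ℕ.^ l) * recip cK
        v = ι cK * recip (t ℕ.^ l)
        vu≡1 : v * u ≡ 1ℚ
        vu≡1 = trans (pairs (ι cK) (recip (t ℕ.^ l)) (ι (t ℕ.^ l)) (recip cK))
          (trans (cong₂ _*_ (ι*recip cK) (ι*recip (t ℕ.^ l))) (*-identityˡ 1ℚ))
          where
          pairs : ∀ a b c d → (a * b) * (c * d) ≡ (a * d) * (c * b)
          pairs = solve 4 (λ a b c d → (a :* b) :* (c :* d) := (a :* d) :* (c :* b)) refl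
        0≤A = ∑-nonneg (downFrom x) (Weight.0≤β wα)
        0≤B = ∑-nonneg (downFrom x) (Weight.0≤β wβ)
        0≤AB = 0≤* 0≤A 0≤B
        0<3 : 0ℚ < 2ℚ + 1ℚ
        0<3 = subst (_< 2ℚ + 1ℚ) (+-identityˡ 0ℚ) (+-mono-< 0<2 0<1)
        3≤4 : 2ℚ + 1ℚ ≤ 2ℚ * 2ℚ
        3≤4 = ≤-by (four 1ℚ) 0≤1
          where
          four : ∀ a → 2ℚ * 2ℚ ≡ 2ℚ + 1ℚ + 1ℚ
          four = solve 1 (λ a → (con 2ℚ) :* (con 2ℚ) := (con 2ℚ) :+ (con 1ℚ) :+ (con 1ℚ)) refl
        0≤u : 0ℚ ≤ u
        0≤u = 0≤* (0≤ι _) (0≤recip cK)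
        0≤vN : 0ℚ ≤ v * ι N
        0≤vN = 0≤* (0≤* (0≤ι cK) (0≤recip _)) (0≤ι N)
        0≤2V : 0ℚ ≤ 2ℚ * ι V
        0≤2V = 0≤* (<⇒≤ 0<2) (0≤ι V)
        regroup : ∀ v u y → (v * u) * (v * u) * (y * y) ≡ (v * v) * ((u * y) * (u * y))
        regroup = solve 3 (λ v u y → (v :* u) :* (v :* u) :* (y :* y) := (v :* v) :*
          ((u :* y) :* (u :* y))) refl
        regroup₂ : ∀ v k a n → (v * v) * (k * a * (n * n)) ≡ k * (v * n * (v * n)) * a
        regroup₂ = solve 4 (λ v k a n → (v :* v) :* (k :* a :* (n :* n)) := k :* (v :* n :* (v :* n)) :*
          a) refl
        regroup₃ : ∀ a b → a * a * (b * b) ≡ (a * b) * (a * b)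
        regroup₃ = solve 2 (λ a b → a :* a :* (b :* b) := (a :* b) :* (a :* b)) refl
        regroup₃′ : ∀ a b → (a * b) * (a * b) ≡ a * a * (b * b)
        regroup₃′ = solve 2 (λ a b → (a :* b) :* (a :* b) := a :* a :* (b :* b)) refl
        regroup₄ : ∀ a b → (a * a) * b * b ≡ a * b * (a * b)
        regroup₄ = solve 2 (λ a b → (a :* a) :* b :* b := a :* b :* (a :* b)) refl
        1≤B : 1ℚ ≤ B
        1≤B = ≤-trans (subst (_≤ ι H) ι1 (ι-mono-≤ (ℕ.>-nonZero⁻¹ H))) B≥
        uε≤ : ∀ T → ∣ u * ε T ∣ ≤ bounded dp R T
        uε≤ T = begin
          ∣ u * ε T ∣                                  ≡⟨ trans (∣p*q∣≡∣p∣*∣q∣ u (ε T))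
            (cong (_* ∣ ε T ∣) (0≤p⇒∣p∣≡p 0≤u)) ⟩
          u * ∣ ε T ∣                                  ≡⟨ swap (ι (t ℕ.^ l)) (recip cK) ∣ ε T ∣ ⟩
          recip cK * (ι (t ℕ.^ l) * ∣ ε T ∣)           ≤⟨ recip-*-≤ {cK} (ε≤ T) ⟩
          bounded dp R T                               ∎
          where
          swap : ∀ a b c → a * b * c ≡ b * (a * c)
          swap = solve 3 (λ a b c → a :* b :* c := b :* (a :* c)) refl
        sieve : (u * Y) * (u * Y) ≤ (2ℚ + 1ℚ) * (A * B) * (ι N * ι N)
        sieve = subst (λ z → z * z ≤ (2ℚ + 1ℚ) * (A * B) * (ι N * ι N)) (sym scale)
          (large-sieve dp x R J L q R²/L≤q small 1≤N wα wβ 1≤B b eq (λ T → u * ε T) uε≤)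
          where
          pull : ∀ b u e c → b * (u * e) * c ≡ u * (b * e * c)
          pull = solve 4 (λ b u e c → b :* (u :* e) :* c := u :* (b :* e :* c)) refl
          pull′ : ∀ u a z → u * (a * z) ≡ a * (u * z)
          pull′ = solve 3 (λ u a z → u :* (a :* z) := a :* (u :* z)) refl
          scale : u * Y ≡ ∑< x (λ i → α i * transform dp x β b (λ T → u * ε T) (pos (suc i)))
          scale = trans (sym (∑-*ˡ (downFrom x) u _)) (∑-cong (downFrom x) λ i → trans (pull′ u (α i) _)
            (cong (α i *_) (trans (sym (∑-*ˡ (downFrom x) u _)) (∑-cong (downFrom x) λ j →
              trans (sym (∑-*ˡ (subs Q) u _)) (∑-cong (subs Q) λ T → sym (pull (β j) u (ε T) _))))))
        -- Both ends of the range of `l` enter: l ≤ h + 2 gives 2l + 3 ≤ l + (h + 5) for the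
        -- averaging length, and i ≤ l gives K + 1 ≤ l + (h + 5) for `x`.
        N≤ : N ℕ.≤ t ℕ.^ l ℕ.* (suc J ℕ.* t ℕ.^ (h ℕ.+ 5))
        N≤ = ℕP.≤-trans (ℕP.+-mono-≤ (ℕP.*-monoʳ-≤ J L≤) x≤′)
          (ℕP.≤-reflexive (collect J (t ℕ.^ l) (t ℕ.^ (h ℕ.+ 5))))
          where
          collect : ∀ j a b → j ℕ.* (a ℕ.* b) ℕ.+ a ℕ.* b ≡ a ℕ.* (suc j ℕ.* b)
          collect = solve-ℕ
          L≤ : L ℕ.≤ t ℕ.^ l ℕ.* t ℕ.^ (h ℕ.+ 5)
          L≤ = ℕP.≤-trans (t^-mono (ℕP.≤-trans (ℕP.≤-reflexive (e l)) (ℕP.+-monoʳ-≤ l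
              (ℕP.≤-trans (ℕP.+-monoˡ-≤ 3 l≤) (ℕP.≤-reflexive (ℕP.+-assoc h 2 3))))))
            (ℕP.≤-reflexive (ℕP.^-distribˡ-+-* t l (h ℕ.+ 5)))
            where
            e : ∀ l → 2 ℕ.* l ℕ.+ 3 ≡ l ℕ.+ (l ℕ.+ 3)
            e = solve-ℕ
          x≤′ : x ℕ.≤ t ℕ.^ l ℕ.* t ℕ.^ (h ℕ.+ 5)
          x≤′ = ℕP.≤-trans x≤ (ℕP.≤-trans (t^-mono (ℕP.≤-trans (ℕP.≤-reflexive (sym (ℕP.+-suc i h)))
              (ℕP.+-mono-≤ i≤l (ℕP.≤-trans (ℕP.≤-reflexive (ℕP.+-comm 1 h))
                (ℕP.+-monoʳ-≤ h (ℕ.s≤s ℕ.z≤n))))))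
            (ℕP.≤-reflexive (ℕP.^-distribˡ-+-* t l (h ℕ.+ 5))))
        vN≤ : v * ι N ≤ ι V
        vN≤ = begin
          v * ι N
            ≤⟨ *-monoˡ v (0≤* (0≤ι cK) (0≤recip _)) (ι-mono-≤ N≤) ⟩
          v * ι (t ℕ.^ l ℕ.* w)
            ≡⟨ cong (v *_) (ι-* (t ℕ.^ l) w) ⟩
          ι cK * recip (t ℕ.^ l) * (ι (t ℕ.^ l) * ι w)
            ≡⟨ regroup₅ (ι cK) (recip (t ℕ.^ l)) (ι (t ℕ.^ l)) (ι w) ⟩
          (ι (t ℕ.^ l) * recip (t ℕ.^ l)) * (ι cK * ι w)
            ≡⟨ trans (cong₂ _*_ (ι*recip (t ℕ.^ l)) (sym (ι-* cK w))) (*-identityˡ _) ⟩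
          ι V ∎
          where
          w = suc J ℕ.* t ℕ.^ (h ℕ.+ 5)
          regroup₅ : ∀ a b c d → a * b * (c * d) ≡ (c * b) * (a * d)
          regroup₅ = solve 4 (λ a b c d → a :* b :* (c :* d) := (c :* b) :* (a :* d)) refl
        -- Going from h + 5 to h + 7 leaves two powers of `t`: one is the factor 1 / t of the claim,
        -- the other pays for all constants through `margin≤t`.
        2V≤ : 2ℚ * ι V ≤ g * ι H
        2V≤ = *-cancelˡ-≤ (ι (t ℕ.* K)) (0<ι (t ℕ.* K)) (begin
          ι (t ℕ.* K) * (2ℚ * ι V)
            ≡⟨ cong (λ z → ι (t ℕ.* K) * (z * ι V)) (sym ι2) ⟩
          ι (t ℕ.* K) * (ι 2 * ι V)
            ≡⟨ trans (ι-* (t ℕ.* K) (2 ℕ.* V)) (cong (ι (t ℕ.* K) *_) (ι-* 2 V)) ⟨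
          ι (t ℕ.* K ℕ.* (2 ℕ.* V))
            ≤⟨ ι-mono-≤ (ℕP.≤-trans (ℕP.≤-reflexive (collect t K cK (suc J) (t ℕ.^ (h ℕ.+ 5))))
                 (ℕP.≤-trans (ℕP.*-monoˡ-≤ (t ℕ.* t ℕ.^ (h ℕ.+ 5)) margin≤t) (ℕP.≤-reflexive power))) ⟩
          ι H
            ≡⟨ trans (sym (*-identityˡ (ι H))) (trans (cong (_* ι H) (sym (ι*recip (t ℕ.* K))))
              (*-assoc _ _ _)) ⟩
          ι (t ℕ.* K) * (g * ι H) ∎)
          where
          collect : ∀ t k c j p → t ℕ.* k ℕ.* (2 ℕ.* (c ℕ.* (j ℕ.* p))) ≡ 2 ℕ.* k ℕ.* (c ℕ.* j) ℕ.*
            (t ℕ.* p)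
          collect = solve-ℕ
          power : t ℕ.* (t ℕ.* t ℕ.^ (h ℕ.+ 5)) ≡ H
          power = cong (t ℕ.^_) (trans (sym (ℕP.+-suc (suc h) 5)) (sym (ℕP.+-suc h 6)))

    module _
      (4≤i : 4 ℕ.≤ i) (i≤h : i ℕ.≤ h) (large : All (t ℕ.^ i ℕ.≤_) Q)
      (4^≤t : 4 ℕ.^ (K ℕ.+ 2) ℕ.≤ t)
      (margin≤t : 2 ℕ.* K ℕ.* (2 ℕ.^ suc K ℕ.* suc J) ℕ.≤ t)
      (x : ℕ) (x≤ : x ℕ.≤ t ℕ.^ suc K)
      where

      private
        D = t ℕ.^ (h ℕ.+ 2)
        m = h ℕ.+ 3 ℕ.∸ i
        3≤i = ℕP.≤-trans (ℕP.n≤1+n 3) 4≤i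
        instance
          D≢0 : ℕ.NonZero D
          D≢0 = ℕP.m^n≢0 t (h ℕ.+ 2)

        i+m≡ : i ℕ.+ m ≡ h ℕ.+ 3
        i+m≡ = ℕP.m+[n∸m]≡n (ℕP.≤-trans i≤h (ℕP.m≤m+n h 3))

        m≤K : m ℕ.≤ K
        m≤K = ℕP.≤-trans (ℕP.∸-monoʳ-≤ (h ℕ.+ 3) 3≤i) (ℕP.≤-trans (ℕP.≤-reflexive (ℕP.m+n∸n≡m h 3))
          (ℕP.m≤n+m h i))

        1<t : 1 ℕ.< t
        1<t = ℕP.<-≤-trans (ℕP.<-≤-trans (ℕ.s≤s (ℕ.s≤s ℕ.z≤n))
          (ℕP.^-monoʳ-≤ 4 {x = 1} (ℕP.≤-trans (ℕ.s≤s ℕ.z≤n) (ℕP.m≤n+m 2 K)))) 4^≤t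

        1<t^i : 1 ℕ.< t ℕ.^ i
        1<t^i = ℕP.^-monoʳ-< t 1<t (ℕP.≤-trans (ℕ.s≤s ℕ.z≤n) 4≤i)

        2D<τ^K : 2 ℕ.* D ℕ.< (t ℕ.^ i) ℕ.^ K
        2D<τ^K = begin-strict
          2 ℕ.* D                 ≤⟨ ℕP.*-monoˡ-≤ D 1<t ⟩
          t ℕ.^ suc (h ℕ.+ 2)     <⟨ ℕP.^-monoʳ-< t 1<t bound ⟩
          t ℕ.^ (i ℕ.* K)         ≡⟨ ℕP.^-*-assoc t i K ⟨
          (t ℕ.^ i) ℕ.^ K         ∎
          where
          open ℕP.≤-Reasoning
          bound : suc (h ℕ.+ 2) ℕ.< i ℕ.* K
          bound = ℕP.≤-trans (ℕP.≤-reflexive (trans (cong (λ z → suc (suc z)) (ℕP.+-comm h 2)) refl))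
            (ℕP.≤-trans (ℕP.+-monoˡ-≤ h 4≤i)
              (ℕP.m≤n*m K i {{ℕ.>-nonZero (ℕP.≤-trans (ℕ.s≤s ℕ.z≤n) 4≤i)}}))

        -- A nonempty product of primes from t ^ i on is at least t ^ i, so apart from the trivial
        -- modulus the levels start at `i`.
        norm-gap : ∀ {Q} → All (t ℕ.^ i ℕ.≤_) Q → (T : Sub Q) → norm T ≡ 1 ⊎ t ℕ.^ i ℕ.≤ norm T
        norm-gap []       []       = inj₁ refl
        norm-gap (_ ∷ ≤s) (skip T) = norm-gap ≤s T
        norm-gap {p ∷ Q} (τ≤p ∷ ≤s) (pick T) with norm-gap ≤s T
        ... | inj₁ e = inj₂ (subst (t ℕ.^ i ℕ.≤_) (sym (trans (cong (p ℕ.*_) e) (ℕP.*-identityʳ p)))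
          τ≤p)
        ... | inj₂ τ≤T = inj₂
          (ℕP.≤-trans τ≤p (ℕP.m≤m*n p (norm T)
            {{ℕ.>-nonZero (ℕP.<-≤-trans (ℕP.<-trans (ℕ.s≤s ℕ.z≤n) 1<t^i) τ≤T)}}))

        above : ℕ → Sub Q → ℚ
        above l T = 𝟙 (t ℕ.^ l ℕ.≤? norm T)

        -- The indicator of t ^ l ≤ norm T < t ^ (l + 1), written as a difference so that sums over
        -- `l` telescope.
        on-level : ℕ → Sub Q → ℚ
        on-level l T = above l T - above (suc l) T

        telescope : ∀ m T → ∑< m (λ l → on-level (i ℕ.+ l) T) ≡ above i T - above (i ℕ.+ m) T
        telescope zero T = trans (sym (+-inverseʳ (above i T))) (cong (λ l → above i T - above l T)
          (sym (ℕP.+-identityʳ i)))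
        telescope (suc m) T = trans (cong (on-level (i ℕ.+ m) T +_) (telescope m T))
          (trans (cancel (above (i ℕ.+ m) T) (above (suc (i ℕ.+ m)) T) (above i T))
            (cong (λ l → above i T - above l T) (sym (ℕP.+-suc i m))))
          where
          cancel : ∀ a b z → (a - b) + (z - a) ≡ z - b
          cancel = solve 3 (λ a b z → (a :- b) :+ (z :- a) := z :- b) refl

      -- The trivial modulus yields the main term, since its coefficient is the mean. All other
      -- moduli in the support lie on `m` levels, `m` is at most `K`, and each level contributes at
      -- most A B / (t K).
      equidistribution : ∀ {α β} → Weight x α → Weight x β →
        ι (t ℕ.^ (h ℕ.+ 7)) ≤ ∑< x α → ι (t ℕ.^ (h ℕ.+ 7)) ≤ ∑< x β →
        ∀ b → (∀ p i j → δ p (b i ℤ.- b j) ≡ δ p (pos i ℤ.- pos j)) →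
        ∀ μ → (∀ S → ∣ μ S ∣ ≤ bounded dp D S) →
        ∣ ∑∑ x (λ i j → α i * β j * divisorSum dp μ (pos (suc i) ℤ.+ b j)) - ∑< x α * ∑< x β * mean dp μ
          ∣
          ≤ recip t * (∑< x α * ∑< x β)
      equidistribution {α} {β} wα wβ A≥ B≥ b eq μ ∣μ∣≤ = begin
        ∣ ∑∑ x (λ i j → α i * β j * divisorSum dp μ (pos (suc i) ℤ.+ b j)) - A * B * mean dp μ ∣
          ≡⟨ cong (λ z → ∣ z - A * B * mean dp μ ∣) (trans as-form decompose) ⟩
        ∣ (A * B * mean dp μ + ∑< m (λ l → form (ε l))) - A * B * mean dp μ ∣
          ≡⟨ cong ∣_∣ (cancel (A * B * mean dp μ) _) ⟩
        ∣ ∑< m (λ l → form (ε l)) ∣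
          ≤⟨ ∣∑∣≤ (downFrom m) _ ⟩
        ∑< m (λ l → ∣ form (ε l) ∣)
          ≤⟨ ∑<-mono m (λ l l<m → Level.level-bound 3≤i large 4^≤t margin≤t x x≤ (i ℕ.+ l)
            (ℕP.m≤m+n i l) (top l l<m)
               wα wβ A≥ B≥ b eq (ε l) (ε-bound l)) ⟩
        ∑< m (λ _ → recip (t ℕ.* K) * (A * B))
          ≡⟨ trans (∑<-const m _) (sym (*-assoc (ι m) (recip (t ℕ.* K)) (A * B))) ⟩
        ι m * recip (t ℕ.* K) * (A * B)
          ≤⟨ *-monoʳ (A * B) 0≤AB m/tK≤ ⟩
        recip t * (A * B) ∎
        where
        open ≤-Reasoning
        A = ∑< x α
        B = ∑< x β
        0≤AB = 0≤* (∑-nonneg (downFrom x) (Weight.0≤β wα)) (∑-nonneg (downFrom x) (Weight.0≤β wβ))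
        form : (Sub Q → ℚ) → ℚ
        form ε = ∑< x λ i → α i * transform dp x β b ε (pos (suc i))
        κ = coefficient dp μ
        ε : ℕ → Sub Q → ℚ
        ε l T = κ T * on-level (i ℕ.+ l) T
        cancel : ∀ a b → (a + b) - a ≡ b
        cancel = solve 2 (λ a b → (a :+ b) :- a := b) refl
        top : ∀ l → l ℕ.< m → i ℕ.+ l ℕ.≤ h ℕ.+ 2
        top l l<m = ℕP.≤-pred (ℕP.≤-trans (ℕP.≤-reflexive (sym (ℕP.+-suc i l)))
          (ℕP.≤-trans (ℕP.+-monoʳ-≤ i l<m) (ℕP.≤-reflexive (trans i+m≡ (ℕP.+-suc h 2)))))
        instance
          K≢0 : ℕ.NonZero K
          K≢0 = ℕ.>-nonZero (ℕP.<-≤-trans (ℕP.<-≤-trans (ℕ.s≤s ℕ.z≤n) 3≤i) (ℕP.m≤m+n i h))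
          tK≢0 : ℕ.NonZero (t ℕ.* K)
          tK≢0 = ℕP.m*n≢0 t K
        m/tK≤ : ι m * recip (t ℕ.* K) ≤ recip t
        m/tK≤ = ι*-≤1⇒≤recip (begin
          ι t * (ι m * recip (t ℕ.* K))     ≡⟨ *-assoc (ι t) (ι m) _ ⟨
          ι t * ι m * recip (t ℕ.* K)       ≤⟨ *-monoʳ _ (0≤recip (t ℕ.* K))
            (*-monoˡ (ι t) (0≤ι t) (ι-mono-≤ m≤K)) ⟩
          ι t * ι K * recip (t ℕ.* K)       ≡⟨ cong (_* recip (t ℕ.* K)) (ι-* t K) ⟨
          ι (t ℕ.* K) * recip (t ℕ.* K)     ≡⟨ ι*recip (t ℕ.* K) ⟩
          1ℚ                                ∎)

        as-form : ∑∑ x (λ i j → α i * β j * divisorSum dp μ (pos (suc i) ℤ.+ b j)) ≡ form κ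
        as-form = ∑-cong (downFrom x) λ i → trans (∑-cong (downFrom x) λ j →
            trans (*-assoc (α i) (β j) _)
              (cong (α i *_) (trans (cong (β j *_) (divisorSum-expand dp μ _))
              (trans (sym (∑-*ˡ (subs Q) (β j) _)) (∑-cong (subs Q) λ T → sym
                (*-assoc (β j) (κ T) _))))))
          (∑-*ˡ (downFrom x) (α i) _)

        split : ∀ T → κ T ≡ 𝟙 (norm T ℕ.≤? 1) * κ T + ∑< m (λ l → ε l T)
        split T = trans (go (norm T ℕ.≤? D)) (cong (𝟙 (norm T ℕ.≤? 1) * κ T +_)
          (sym (∑-*ˡ (downFrom m) (κ T) _)))
          where
          s = ∑< m (λ l → on-level (i ℕ.+ l) T)
          zeros : ∀ a b → 0ℚ ≡ a * 0ℚ + 0ℚ * b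
          zeros = solve 2 (λ a b → (con 0ℚ) := a :* (con 0ℚ) :+ (con 0ℚ) :* b) refl
          small : ∀ k → k ≡ 1ℚ * k + k * (0ℚ - 0ℚ)
          small = solve 1 (λ k → k := (con 1ℚ) :* k :+ k :* ((con 0ℚ) :- (con 0ℚ))) refl
          large′ : ∀ k → k ≡ 0ℚ * k + k * (1ℚ - 0ℚ)
          large′ = solve 1 (λ k → k := (con 0ℚ) :* k :+ k :* ((con 1ℚ) :- (con 0ℚ))) refl
          go : Dec (norm T ℕ.≤ D) → κ T ≡ 𝟙 (norm T ℕ.≤? 1) * κ T + κ T * s
          go (no T≰D) = subst (λ k → k ≡ 𝟙 (norm T ℕ.≤? 1) * k + k * s)
            (sym (coefficient-large dp μ D ∣μ∣≤ T (ℕP.≰⇒> T≰D))) (zeros _ s)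
          go (yes T≤D) = trans (gap (norm-gap large T)) (cong (λ z → 𝟙 (norm T ℕ.≤? 1) * κ T + κ T * z)
            (sym s≡))
            where
            not-above : above (i ℕ.+ m) T ≡ 0ℚ
            not-above = 𝟙-no (t ℕ.^ (i ℕ.+ m) ℕ.≤? norm T) (ℕP.<⇒≱ (ℕP.≤-<-trans T≤D
              (ℕP.^-monoʳ-< t 1<t (subst (h ℕ.+ 2 ℕ.<_) (sym i+m≡) (ℕP.+-monoʳ-< h (ℕP.n<1+n 2))))))
            s≡ : s ≡ above i T - 0ℚ
            s≡ = trans (telescope m T) (cong (λ z → above i T - z) not-above)
            gap : norm T ≡ 1 ⊎ t ℕ.^ i ℕ.≤ norm T → κ T ≡ 𝟙 (norm T ℕ.≤? 1) * κ T + κ T *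
              (above i T - 0ℚ)
            gap (inj₁ e) = trans (small (κ T)) (sym (cong₂ (λ y z → y * κ T + κ T * (z - 0ℚ))
              (𝟙-yes (norm T ℕ.≤? 1) (ℕP.≤-reflexive e))
              (𝟙-no (t ℕ.^ i ℕ.≤? norm T) (ℕP.<⇒≱ (subst (ℕ._< t ℕ.^ i) (sym e) 1<t^i)))))
            gap (inj₂ τ≤T) = trans (large′ (κ T)) (sym (cong₂ (λ y z → y * κ T + κ T * (z - 0ℚ))
              (𝟙-no (norm T ℕ.≤? 1) (ℕP.<⇒≱ (ℕP.<-≤-trans 1<t^i τ≤T)))
              (𝟙-yes (t ℕ.^ i ℕ.≤? norm T) τ≤T)))

        decompose : form κ ≡ A * B * mean dp μ + ∑< m (λ l → form (ε l))
        decompose = trans (∑-cong (downFrom x) λ i → trans (cong (α i *_) (point (pos (suc i))))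
              (*-distribˡ-+ (α i) _ _))
            (trans (∑-+ (downFrom x) _ _) (cong₂ _+_
              (trans (∑-*ʳ (downFrom x) (B * mean dp μ) α) (sym (*-assoc A B _)))
              (trans (∑-cong (downFrom x) λ i → sym (∑-*ˡ (downFrom m) (α i) _))
                (∑-swap (downFrom x) (downFrom m) _))))
          where
          point : ∀ n → transform dp x β b κ n ≡ B * mean dp μ + ∑< m (λ l → transform dp x β b (ε l) n)
          point n = trans (∑-cong (downFrom x) inner) (trans (∑-+ (downFrom x) _ _) (cong₂ _+_
            (∑-*ʳ (downFrom x) (mean dp μ) β) (∑-swap (downFrom x) (downFrom m) _)))
            where
            expand : ∀ b y k c → b * (y * k) * c ≡ y * (b * k * c)
            expand = solve 4 (λ b y k c → b :* (y :* k) :* c := y :* (b :* k :* c)) refl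
            inner : ∀ j → ∑ (subs Q) (λ T → β j * κ T * c T (n ℤ.+ b j)) ≡
              β j * mean dp μ + ∑< m (λ l → ∑ (subs Q) (λ T → β j * ε l T * c T (n ℤ.+ b j)))
            inner j = trans (∑-cong (subs Q) λ T → trans (cong (λ k → β j * k * c T (n ℤ.+ b j))
              (split T))
                (trans (cong (_* c T (n ℤ.+ b j)) (*-distribˡ-+ (β j) _ _))
                  (*-distribʳ-+ (c T (n ℤ.+ b j)) _ _)))
              (trans (∑-+ (subs Q) _ _) (cong₂ _+_
                (trans (∑-cong (subs Q) λ T → expand (β j) (𝟙 (norm T ℕ.≤? 1)) (κ T) _)
                  (trans (∑-norm≤1 dp (λ T → β j * κ T * c T (n ℤ.+ b j)))
                    (trans (cong₂ (λ y z → β j * y * z) (coefficient-∅ dp μ) (c-∅ Q _))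
                      (*-identityʳ _))))
                (trans (∑-cong (subs Q) λ T → trans (cong (_* c T (n ℤ.+ b j))
                  (sym (∑-*ˡ (downFrom m) (β j) _)))
                  (sym (∑-*ʳ (downFrom m) _ _))) (∑-swap (subs Q) (downFrom m) _))))

        -- On this level t ^ l is at most the norm of `T`, and the coefficient is at most `inv T`
        -- times the harmonic sum, which `harmonic` bounds by 2 ^ (K + 1).
        ε-bound : ∀ l T → ι (t ℕ.^ (i ℕ.+ l)) * ∣ ε l T ∣ ≤ ι (2 ℕ.^ suc K) * bounded dp
          (t ℕ.^ suc (i ℕ.+ l)) T
        ε-bound l T = go (t ℕ.^ l′ ℕ.≤? norm T) (t ℕ.^ suc l′ ℕ.≤? norm T)
          where
          l′ = i ℕ.+ l
          rhs = ι (2 ℕ.^ suc K) * bounded dp (t ℕ.^ suc l′) T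
          0≤rhs : 0ℚ ≤ rhs
          0≤rhs = 0≤* (0≤ι (2 ℕ.^ suc K)) (0≤𝟙 (norm T ℕ.≤? t ℕ.^ suc l′))
          0-0 : ∀ k → k * (0ℚ - 0ℚ) ≡ 0ℚ
          0-0 = solve 1 (λ k → k :* ((con 0ℚ) :- (con 0ℚ)) := (con 0ℚ)) refl
          1-1 : ∀ k → k * (1ℚ - 1ℚ) ≡ 0ℚ
          1-1 = solve 1 (λ k → k :* ((con 1ℚ) :- (con 1ℚ)) := (con 0ℚ)) refl
          1-0 : ∀ k → k * (1ℚ - 0ℚ) ≡ k
          1-0 = solve 1 (λ k → k :* ((con 1ℚ) :- (con 0ℚ)) := k) refl
          zero-case : ε l T ≡ 0ℚ → ι (t ℕ.^ l′) * ∣ ε l T ∣ ≤ rhs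
          zero-case e = subst (_≤ rhs) (sym (trans (cong (λ z → ι (t ℕ.^ l′) * ∣ z ∣) e)
            (trans (cong (ι (t ℕ.^ l′) *_) (0≤p⇒∣p∣≡p ≤-refl)) (*-zeroʳ _)))) 0≤rhs
          go : Dec (t ℕ.^ l′ ℕ.≤ norm T) → Dec (t ℕ.^ suc l′ ℕ.≤ norm T) → ι (t ℕ.^ l′) * ∣ ε l T ∣ ≤
            rhs
          go (no ≰₁) _ = zero-case (trans (cong₂ (λ y z → κ T * (y - z))
            (𝟙-no (t ℕ.^ l′ ℕ.≤? norm T) ≰₁) (𝟙-no (t ℕ.^ suc l′ ℕ.≤? norm T)
              (λ ≤₂ → ≰₁ (ℕP.≤-trans (ℕP.^-monoʳ-≤ t (ℕP.n≤1+n l′)) ≤₂)))) (0-0 (κ T)))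
          go (yes ≤₁) (yes ≤₂) = zero-case (trans (cong₂ (λ y z → κ T * (y - z))
            (𝟙-yes (t ℕ.^ l′ ℕ.≤? norm T) ≤₁) (𝟙-yes (t ℕ.^ suc l′ ℕ.≤? norm T) ≤₂)) (1-1 (κ T)))
          go (yes ≤₁) (no ≰₂) = begin
            ι (t ℕ.^ l′) * ∣ ε l T ∣
              ≡⟨ cong (λ z → ι (t ℕ.^ l′) * ∣ z ∣) (trans (cong₂ (λ y z → κ T * (y - z))
                   (𝟙-yes (t ℕ.^ l′ ℕ.≤? norm T) ≤₁) (𝟙-no (t ℕ.^ suc l′ ℕ.≤? norm T) ≰₂)) (1-0 (κ T)))
                     ⟩
            ι (t ℕ.^ l′) * ∣ κ T ∣
              ≤⟨ *-mono (0≤ι _) (0≤∣p∣ _) (ι-mono-≤ ≤₁) (≤-trans (∣coefficient∣≤ dp μ D ∣μ∣≤ T)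
                   (*-monoˡ (inv T) (0≤inv T) (harmonic dp {{ℕP.m^n≢0 t i}} large D K 2D<τ^K))) ⟩
            ι (norm T) * (inv T * ι (2 ℕ.^ suc K))
              ≡⟨ trans (sym (*-assoc (ι (norm T)) (inv T) _))
                (trans (cong (_* ι (2 ℕ.^ suc K)) (norm*inv (proj₁ dp) T)) (*-comm 1ℚ _)) ⟩
            ι (2 ℕ.^ suc K) * 1ℚ
              ≡⟨ cong (ι (2 ℕ.^ suc K) *_) (𝟙-yes (norm T ℕ.≤? t ℕ.^ suc l′) (ℕP.<⇒≤ (ℕP.≰⇒> ≰₂))) ⟨
            rhs ∎

-- Turán weights and the error of truncating the sieve

module Truncation where

  open Rat
  open Sums
  open Kernel
  open Subsets
  open LargeSieve
  open Divisors
  open Equidistribution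

  private variable
    P Q : List ℕ

  -- A common form of `δs` and `inv`: the same identity for symmetric functions then gives both the
  -- pointwise value and the mean of a divisor sum whose weights depend on the size only.
  val : (ℕ → ℚ) → Sub Q → ℚ
  val x []               = 1ℚ
  val x (skip S)         = val x S
  val x (pick {p = p} S) = x p * val x S

  δs≡val : (S : Sub Q) → ∀ n → δs S n ≡ val (λ p → δ p n) S
  δs≡val []       n = refl
  δs≡val (skip S) n = δs≡val S n
  δs≡val (pick {p = p} S) n = cong (δ p n *_) (δs≡val S n)

  inv≡val : (S : Sub Q) → inv S ≡ val recip S
  inv≡val []       = refl
  inv≡val (skip S) = inv≡val S
  inv≡val (pick {p = p} S) = cong (recip p *_) (inv≡val S)

  private
    module _ (x : ℕ → ℚ) where

      symmetric₀ : ∀ Q (k : ℕ → ℚ) → (∀ m → k (suc m) ≡ 0ℚ) → ∑ (subs Q) (λ S → k (size S) * val x S) ≡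
        k 0
      symmetric₀ []      k k≡0 = collapse (k 0)
        where
        collapse : ∀ a → a * 1ℚ + 0ℚ ≡ a
        collapse = solve 1 (λ a → a :* (con 1ℚ) :+ (con 0ℚ) := a) refl
      symmetric₀ (p ∷ Q) k k≡0 = trans (∑-subs-∷ p Q _) (trans (cong₂ _+_ (symmetric₀ Q k k≡0)
        (trans (∑-cong (subs Q) λ S → trans (cong (_* (x p * val x S)) (k≡0 (size S))) (*-zeroˡ _))
          (∑-0 (subs Q))))
        (+-identityʳ (k 0)))

      pick-∑ : ∀ p Q (k : ℕ → ℚ) → ∑ (subs Q) (λ S → k (suc (size S)) * (x p * val x S)) ≡
        x p * ∑ (subs Q) (λ S → k (suc (size S)) * val x S)
      pick-∑ p Q k = trans (∑-cong (subs Q) λ S → swap (k (suc (size S))) (x p) (val x S))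
        (∑-*ˡ (subs Q) (x p) _)
        where
        swap : ∀ a b c → a * (b * c) ≡ b * (a * c)
        swap = solve 3 (λ a b c → a :* (b :* c) := b :* (a :* c)) refl

      symmetric₁ : ∀ Q (k : ℕ → ℚ) → (∀ m → k (2 ℕ.+ m) ≡ 0ℚ) →
        ∑ (subs Q) (λ S → k (size S) * val x S) ≡ k 0 + k 1 * ∑ Q x
      symmetric₁ []      k k≡0 = collapse (k 0) (k 1)
        where
        collapse : ∀ a b → a * 1ℚ + 0ℚ ≡ a + b * 0ℚ
        collapse = solve 2 (λ a b → a :* (con 1ℚ) :+ (con 0ℚ) := a :+ b :* (con 0ℚ)) refl
      symmetric₁ (p ∷ Q) k k≡0 = trans (∑-subs-∷ p Q _) (trans (cong₂ _+_ (symmetric₁ Q k k≡0)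
        (trans (pick-∑ p Q k) (cong (x p *_) (symmetric₀ Q (λ m → k (suc m)) k≡0))))
          (collect (k 0) (k 1) (x p) (∑ Q x)))
        where
        collect : ∀ a b y e → a + b * e + y * b ≡ a + b * (y + e)
        collect = solve 4 (λ a b y e → a :+ b :* e :+ y :* b := a :+ b :* (y :+ e)) refl

      -- The subsets of size j add up to the elementary symmetric function e_j of the values of `x`,
      -- and 2 e₂ is the square of the sum minus the sum of squares. The factor 2 avoids a division.
      symmetric₂ : ∀ Q (k : ℕ → ℚ) → (∀ m → k (3 ℕ.+ m) ≡ 0ℚ) → 2ℚ * ∑ (subs Q)
        (λ S → k (size S) * val x S) ≡
        2ℚ * k 0 + 2ℚ * k 1 * ∑ Q x + k 2 * (∑ Q x * ∑ Q x - ∑ Q (λ p → x p * x p))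
      symmetric₂ []      k k≡0 = collapse (k 0) (k 1) (k 2)
        where
        collapse : ∀ a b c → 2ℚ * (a * 1ℚ + 0ℚ) ≡ 2ℚ * a + 2ℚ * b * 0ℚ + c * (0ℚ * 0ℚ - 0ℚ)
        collapse = solve 3 (λ a b c → (con 2ℚ) :* (a :* (con 1ℚ) :+ (con 0ℚ)) := (con 2ℚ) :* a :+
          (con 2ℚ) :* b :* (con 0ℚ) :+ c :* ((con 0ℚ) :* (con 0ℚ) :- (con 0ℚ))) refl
      symmetric₂ (p ∷ Q) k k≡0 = trans (cong (2ℚ *_) (∑-subs-∷ p Q _)) (trans (*-distribˡ-+ 2ℚ _ _)
        (trans
        (cong₂ _+_ (symmetric₂ Q k k≡0)
          (cong (2ℚ *_) (trans (pick-∑ p Q k) (cong (x p *_) (symmetric₁ Q (λ m → k (suc m)) k≡0)))))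
        (collect (k 0) (k 1) (k 2) (x p) (∑ Q x) (∑ Q (λ p → x p * x p)))))
        where
        collect : ∀ a b c y e s → 2ℚ * a + 2ℚ * b * e + c * (e * e - s) + 2ℚ * (y * (b + c * e)) ≡ 2ℚ *
          a + 2ℚ * b * (y + e) + c * ((y + e) * (y + e) - (y * y + s))
        collect = solve 6 (λ a b c y e s → (con 2ℚ) :* a :+ (con 2ℚ) :* b :* e :+ c :* (e :* e :- s) :+
          (con 2ℚ) :* (y :* (b :+ c :* e)) := (con 2ℚ) :* a :+ (con 2ℚ) :* b :* (y :+ e) :+ c :*
            ((y :+ e) :* (y :+ e) :- (y :* y :+ s))) refl

  δ² : ∀ p n → δ p n * δ p n ≡ δ p n
  δ² p n with p ∣? ℤ.∣ n ∣
  ... | yes _ = *-identityˡ 1ℚ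
  ... | no  _ = *-zeroˡ 0ℚ

  -- The Turán weight (1 - ω / M)², where ω counts the divisors in P and M is the
  -- expected value of ω.
  module Turán {P : List ℕ} (dp : DistinctPrimes P) (r : ℚ) (rM≡1 : r * ∑ P recip ≡ 1ℚ) where

    ω : ℤ → ℚ
    ω n = ∑ P λ p → δ p n

    turán : ℤ → ℚ
    turán n = (1ℚ - r * ω n) * (1ℚ - r * ω n)

    -- The coefficients of (1 - r ω)² in terms of the elementary symmetric functions of the
    -- indicators: these are idempotent, so ω² = ω + 2 e₂.
    weight : ℕ → ℚ
    weight 0 = 1ℚ
    weight 1 = r * r - 2ℚ * r
    weight 2 = 2ℚ * (r * r)
    weight (suc (suc (suc _))) = 0ℚ

    private
      half : ∀ {p q} → 2ℚ * p ≡ 2ℚ * q → p ≡ q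
      half e = ≤-antisym (*-cancelˡ-≤ 2ℚ 0<2 (≤-reflexive e)) (*-cancelˡ-≤ 2ℚ 0<2 (≤-reflexive (sym e)))

    turán-divisorSum : ∀ n → divisorSum dp (λ S → weight (size S)) n ≡ turán n
    turán-divisorSum n = half
      (trans (cong (2ℚ *_) (∑-cong (subs P) λ S → cong (weight (size S) *_) (δs≡val S n)))
      (trans (symmetric₂ (λ p → δ p n) P weight (λ _ → refl))
        (trans (cong (λ z → 2ℚ * 1ℚ + 2ℚ * (r * r - 2ℚ * r) * ω n + 2ℚ * (r * r) * (ω n * ω n - z))
          (∑-cong P λ p → δ² p n))
          (square r (ω n)))))
      where
      square : ∀ r w → 2ℚ * 1ℚ + 2ℚ * (r * r - 2ℚ * r) * w + 2ℚ * (r * r) * (w * w - w) ≡ 2ℚ *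
        ((1ℚ - r * w) * (1ℚ - r * w))
      square = solve 2 (λ r w → (con 2ℚ) :* (con 1ℚ) :+ (con 2ℚ) :* (r :* r :- (con 2ℚ) :* r) :* w :+
        (con 2ℚ) :* (r :* r) :* (w :* w :- w) := (con 2ℚ) :*
          (((con 1ℚ) :- r :* w) :* ((con 1ℚ) :- r :* w))) refl

    -- Because r M = 1, the mean equals r - r² Σ 1 / p². This is the fact that the variance of ω is
    -- at most its expectation M, divided by M².
    turán-mean : 0ℚ ≤ r → mean dp (λ S → weight (size S)) ≤ r
    turán-mean 0≤r = *-cancelˡ-≤ 2ℚ 0<2 (≤-trans (≤-reflexive
        (trans (cong (2ℚ *_) (∑-cong (subs P) λ S → cong (weight (size S) *_) (inv≡val S)))
          (symmetric₂ recip P weight (λ _ → refl))))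
        (≤-by (sym (trans (collect r M s)
          (trans (cong (λ y → 2ℚ + 2ℚ * r * y - 2ℚ * 2ℚ * y + 2ℚ * (y * y)) rM≡1) (simplify r))))
          (0≤* (0≤* (<⇒≤ 0<2) (0≤sq r)) (∑-nonneg P λ p → 0≤sq (recip p)))))
      where
      M = ∑ P recip
      s = ∑ P (λ p → recip p * recip p)
      collect : ∀ r m s → 2ℚ * 1ℚ + 2ℚ * (r * r - 2ℚ * r) * m + 2ℚ * (r * r) * (m * m - s) + 2ℚ *
        (r * r) * s ≡ 2ℚ + 2ℚ * r * (r * m) - 2ℚ * 2ℚ * (r * m) + 2ℚ * ((r * m) * (r * m))
      collect = solve 3 (λ r m s → (con 2ℚ) :* (con 1ℚ) :+ (con 2ℚ) :* (r :* r :- (con 2ℚ) :* r) :* m :+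
        (con 2ℚ) :* (r :* r) :* (m :* m :- s) :+ (con 2ℚ) :* (r :* r) :* s := (con 2ℚ) :+ (con 2ℚ) :* r
          :* (r :* m) :- (con 2ℚ) :* (con 2ℚ) :* (r :* m) :+ (con 2ℚ) :* ((r :* m) :* (r :* m))) refl
      simplify : ∀ r → 2ℚ + 2ℚ * r * 1ℚ - 2ℚ * 2ℚ * 1ℚ + 2ℚ * (1ℚ * 1ℚ) ≡ 2ℚ * r
      simplify = solve 1 (λ r → (con 2ℚ) :+ (con 2ℚ) :* r :* (con 1ℚ) :- (con 2ℚ) :* (con 2ℚ) :*
        (con 1ℚ) :+ (con 2ℚ) :* ((con 1ℚ) :* (con 1ℚ)) := (con 2ℚ) :* r) refl

    ∣weight∣≤1 : 0ℚ ≤ r → 2ℚ * r ≤ 1ℚ → ∀ k → ∣ weight k ∣ ≤ 1ℚ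
    ∣weight∣≤1 0≤r 2r≤1 0 = ≤-reflexive (0≤p⇒∣p∣≡p 0≤1)
    ∣weight∣≤1 0≤r 2r≤1 1 = ∣∣-≤ (≤-by (up r) (0≤+ (0≤+ (0≤* 0≤r 0≤1-2r) 0≤1) (0≤* 0≤r 0≤3)))
        (≤-by (down r) (0≤sq (1ℚ - r)))
      where
      0≤1-2r : 0ℚ ≤ 1ℚ - 2ℚ * r
      0≤1-2r = subst (_≤ 1ℚ - 2ℚ * r) (+-inverseʳ (2ℚ * r)) (+-monoˡ-≤ (- (2ℚ * r)) 2r≤1)
      0≤3 : 0ℚ ≤ 1ℚ + r
      0≤3 = 0≤+ 0≤1 0≤r
      up : ∀ r → 1ℚ ≡ (r * r - 2ℚ * r) + (r * (1ℚ - 2ℚ * r) + 1ℚ + r * (1ℚ + r))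
      up = solve 1 (λ r → (con 1ℚ) := (r :* r :- (con 2ℚ) :* r) :+ (r :* ((con 1ℚ) :- (con 2ℚ) :* r) :+
        (con 1ℚ) :+ r :* ((con 1ℚ) :+ r))) refl
      down : ∀ r → 1ℚ ≡ - (r * r - 2ℚ * r) + (1ℚ - r) * (1ℚ - r)
      down = solve 1 (λ r → (con 1ℚ) := :- (r :* r :- (con 2ℚ) :* r) :+ ((con 1ℚ) :- r) :*
        ((con 1ℚ) :- r)) refl
    ∣weight∣≤1 0≤r 2r≤1 2 = ≤-trans (≤-reflexive (0≤p⇒∣p∣≡p (0≤* (<⇒≤ 0<2) (0≤sq r))))
      (≤-trans (≤-reflexive (sym (*-assoc 2ℚ r r)))
      (≤-trans (*-mono (0≤* (<⇒≤ 0<2) 0≤r) 0≤r 2r≤1 r≤1) (≤-reflexive (*-identityˡ 1ℚ))))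
      where
      r≤1 : r ≤ 1ℚ
      r≤1 = ≤-trans (≤-by (double r) 0≤r) 2r≤1
        where
        double : ∀ r → 2ℚ * r ≡ r + r
        double = solve 1 (λ r → (con 2ℚ) :* r := r :+ r) refl
    ∣weight∣≤1 0≤r 2r≤1 (suc (suc (suc _))) = ≤-trans (≤-reflexive (0≤p⇒∣p∣≡p ≤-refl)) 0≤1

  norm≤^size : ∀ {b} .{{_ : ℕ.NonZero b}} → All (ℕ._≤ b) Q → (S : Sub Q) → norm S ℕ.≤ b ℕ.^ size S
  norm≤^size []         []       = ℕP.≤-refl
  norm≤^size (_ ∷ ≤s)   (skip S) = norm≤^size ≤s S
  norm≤^size (p≤b ∷ ≤s) (pick S) = ℕP.*-mono-≤ p≤b (norm≤^size ≤s S)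

  sign : Sub Q → ℚ
  sign []       = 1ℚ
  sign (skip S) = sign S
  sign (pick S) = - sign S

  ∣sign∣≡1 : (S : Sub Q) → ∣ sign S ∣ ≡ 1ℚ
  ∣sign∣≡1 []       = 0≤p⇒∣p∣≡p 0≤1
  ∣sign∣≡1 (skip S) = ∣sign∣≡1 S
  ∣sign∣≡1 (pick S) = trans (∣-p∣≡∣p∣ (sign S)) (∣sign∣≡1 S)

  sifted : List ℕ → ℤ → ℚ
  sifted []      n = 1ℚ
  sifted (p ∷ Q) n = (1ℚ - δ p n) * sifted Q n

  legendre : ∀ Q n → ∑ (subs Q) (λ S → sign S * δs S n) ≡ sifted Q n
  legendre []      n = collapse 1ℚ
    where
    collapse : ∀ a → 1ℚ * 1ℚ + 0ℚ ≡ 1ℚ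
    collapse = solve 1 (λ a → (con 1ℚ) :* (con 1ℚ) :+ (con 0ℚ) := (con 1ℚ)) refl
  legendre (p ∷ Q) n = begin
    ∑ (subs (p ∷ Q)) (λ S → sign S * δs S n)
      ≡⟨ ∑-subs-∷ p Q _ ⟩
    A + ∑ (subs Q) (λ S → - sign S * (δ p n * δs S n))
      ≡⟨ cong (A +_) (trans (∑-cong (subs Q) λ S → swap (sign S) (δ p n) (δs S n))
        (∑-*ˡ (subs Q) (- δ p n) _)) ⟩
    A + - δ p n * A
      ≡⟨ factor A (δ p n) ⟩
    (1ℚ - δ p n) * A
      ≡⟨ cong ((1ℚ - δ p n) *_) (legendre Q n) ⟩
    sifted (p ∷ Q) n ∎
    where
    open ≡-Reasoning
    A = ∑ (subs Q) (λ S → sign S * δs S n)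
    swap : ∀ a b c → (- a) * (b * c) ≡ (- b) * (a * c)
    swap = solve 3 (λ a b c → (:- a) :* (b :* c) := (:- b) :* (a :* c)) refl
    factor : ∀ a d → a + (- d) * a ≡ (1ℚ - d) * a
    factor = solve 2 (λ a d → a :+ (:- d) :* a := ((con 1ℚ) :- d) :* a) refl

  norm-divisors-++ : ∀ P Q n → norm (divisors (P ++ Q) n) ≡ norm (divisors P n) ℕ.* norm (divisors Q n)
  norm-divisors-++ []      Q n = sym (ℕP.+-identityʳ _)
  norm-divisors-++ (p ∷ P) Q n with p ∣? ℤ.∣ n ∣
  ... | yes _ = trans (cong (p ℕ.*_) (norm-divisors-++ P Q n)) (sym (ℕP.*-assoc p _ _))
  ... | no  _ = norm-divisors-++ P Q n

  divisors-empty : ∀ {τ} → 1 ℕ.< τ → All (τ ℕ.≤_) P → ∀ n → norm (divisors P n) ℕ.< τ → ∑ P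
    (λ p → δ p n) ≡ 0ℚ
  divisors-empty {[]}    1<τ []         n <τ = refl
  divisors-empty {p ∷ P} {τ} 1<τ (τ≤p ∷ ≤s) n <τ with p ∣? ℤ.∣ n ∣
  ... | no _ = trans (+-identityˡ _) (divisors-empty 1<τ ≤s n <τ)
  ... | yes _ = ⊥-elim (ℕP.<⇒≱ <τ (ℕP.≤-trans τ≤p (ℕP.m≤m*n p (norm (divisors P n)) {{ℕ.>-nonZero
      (ℕP.≤-trans (ℕP.m^n>0 τ {{ℕ.>-nonZero (ℕP.<-trans (ℕ.s≤s ℕ.z≤n) 1<τ)}} (size (divisors P n)))
        (^size≤norm ≤s (divisors P n)))}})))

  -- If d ∣ n with d composed of primes of Q and d > D, then no prime of P divides n:
  -- the Turán weight of P therefore dominates the effect of truncating at D.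
  truncation-error : ∀ {P Q} (dpP : DistinctPrimes P) (dpQ : DistinctPrimes Q)
    (dp : DistinctPrimes (P ++ Q))
    r rM≡1 → let open Turán dpP r rM≡1 in
    ∀ {τ D} → 1 ℕ.< τ → All (τ ℕ.≤_) P → All (τ ℕ.≤_) Q → ∀ σ .{{_ : ℕ.NonZero σ}} → All (σ ℕ.≤_) Q →
    ∀ κ n .{{_ : ℕ.NonZero ℤ.∣ n ∣}} → ℤ.∣ n ∣ ℕ.< τ ℕ.* D → ℤ.∣ n ∣ ℕ.< σ ℕ.^ κ →
    ∣ divisorSum dpQ (λ S → sign S * bounded dpQ D S) n - sifted Q n ∣ ≤ ι (2 ℕ.^ κ) * turán n
  truncation-error {P} {Q} dpP dpQ dp r rM≡1 {τ} {D} 1<τ ≤P ≤Q σ σ≤Q κ n n<τD n<σ^κ = begin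
    ∣ divisorSum dpQ (λ S → sign S * bounded dpQ D S) n - sifted Q n ∣
      ≡⟨ cong ∣_∣ (trans (cong (λ z → divisorSum dpQ (λ S → sign S * bounded dpQ D S) n - z)
        (sym (legendre Q n)))
           (sym (∑-- (subs Q) _ _))) ⟩
    ∣ ∑ (subs Q) (λ S → sign S * bounded dpQ D S * δs S n - sign S * δs S n) ∣
      ≤⟨ ∣∑∣≤ (subs Q) _ ⟩
    ∑ (subs Q) (λ S → ∣ sign S * bounded dpQ D S * δs S n - sign S * δs S n ∣)
      ≤⟨ ∑-mono (subs Q) term ⟩
    ∑ (subs Q) (λ S → turán n * δs S n)
      ≡⟨ ∑-*ˡ (subs Q) (turán n) _ ⟩
    turán n * ∑ (subs Q) (λ S → δs S n)
      ≤⟨ *-monoˡ (turán n) (0≤sq _) (∑-δs-≤ dpQ σ≤Q n κ n<σ^κ) ⟩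
    turán n * ι (2 ℕ.^ κ)
      ≡⟨ *-comm _ _ ⟩
    ι (2 ℕ.^ κ) * turán n ∎
    where
    open ≤-Reasoning
    open Turán dpP r rM≡1
    term : ∀ S → ∣ sign S * bounded dpQ D S * δs S n - sign S * δs S n ∣ ≤ turán n * δs S n
    term S = go (norm S ℕ.≤? D) (δs-zero-or S n)
      where
      collapse-yes : ∀ a b → a * 1ℚ * b - a * b ≡ 0ℚ
      collapse-yes = solve 2 (λ a b → a :* (con 1ℚ) :* b :- a :* b := (con 0ℚ)) refl
      collapse-no : ∀ a b → a * 0ℚ * b - a * b ≡ - (a * b)
      collapse-no = solve 2 (λ a b → a :* (con 0ℚ) :* b :- a :* b := :- (a :* b)) refl
      collapse-δ : ∀ a b → a * b * 0ℚ - a * 0ℚ ≡ 0ℚ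
      collapse-δ = solve 2 (λ a b → a :* b :* (con 0ℚ) :- a :* (con 0ℚ) := (con 0ℚ)) refl
      0≤rhs : 0ℚ ≤ turán n * δs S n
      0≤rhs = 0≤* (0≤sq _) (0≤δs S n)
      vanishing : ∀ {z} → z ≡ 0ℚ → ∣ z ∣ ≤ turán n * δs S n
      vanishing e = ≤-trans (≤-reflexive (trans (cong ∣_∣ e) (0≤p⇒∣p∣≡p ≤-refl))) 0≤rhs
      go : Dec (norm S ℕ.≤ D) → δs S n ≡ 0ℚ ⊎ (δs S n ≡ 1ℚ × norm S ∣ norm (divisors Q n)) →
        ∣ sign S * bounded dpQ D S * δs S n - sign S * δs S n ∣ ≤ turán n * δs S n
      go (yes S≤D) _ = vanishing (trans (cong (λ w → sign S * w * δs S n - sign S * δs S n)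
        (𝟙-yes (norm S ℕ.≤? D) S≤D))
        (collapse-yes (sign S) (δs S n)))
      go (no S≰D) (inj₁ z) = vanishing (trans (cong (λ d → sign S * bounded dpQ D S * d - sign S * d) z)
        (collapse-δ (sign S) (bounded dpQ D S)))
      go (no S≰D) (inj₂ (one , S∣)) = begin
        ∣ sign S * bounded dpQ D S * δs S n - sign S * δs S n ∣
          ≡⟨ cong ∣_∣ (trans (cong (λ w → sign S * w * δs S n - sign S * δs S n)
            (𝟙-no (norm S ℕ.≤? D) S≰D))
               (collapse-no (sign S) (δs S n))) ⟩
        ∣ - (sign S * δs S n) ∣
          ≡⟨ trans (∣-p∣≡∣p∣ _) (trans (∣p*q∣≡∣p∣*∣q∣ (sign S) (δs S n))
            (cong₂ _*_ (∣sign∣≡1 S) (0≤p⇒∣p∣≡p (0≤δs S n)))) ⟩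
        1ℚ * δs S n
          ≡⟨ cong (_* δs S n) (trans (sym (simplify r)) (cong (λ w → (1ℚ - r * w) * (1ℚ - r * w))
            (sym none))) ⟩
        turán n * δs S n ∎
        where
        simplify : ∀ r → (1ℚ - r * 0ℚ) * (1ℚ - r * 0ℚ) ≡ 1ℚ
        simplify = solve 1 (λ r → ((con 1ℚ) :- r :* (con 0ℚ)) :* ((con 1ℚ) :- r :* (con 0ℚ)) :=
          (con 1ℚ)) refl
        d = norm (divisors P n)
        e = norm (divisors Q n)
        instance
          e≢0 : ℕ.NonZero e
          e≢0 = norm-nonZero (proj₁ dpQ) (divisors Q n)
        -- The parts `d` and `e` of `n` composed of `P` and of `Q` have a product dividing `n`, and
        -- `e` is at least the norm of `S`, which exceeds `D`. So d ≥ τ would contradict |n| < τ D.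
        d<τ : d ℕ.< τ
        d<τ = ℕP.≰⇒> λ τ≤d → ℕP.<⇒≱ n<τD
          (ℕP.≤-trans (ℕP.*-mono-≤ τ≤d (ℕP.≤-trans (ℕP.<⇒≤ (ℕP.≰⇒> S≰D)) (ℕD.∣⇒≤ S∣)))
            (ℕP.≤-trans (ℕP.≤-reflexive (sym (norm-divisors-++ P Q n)))
              (ℕD.∣⇒≤ (norm-divisors-∣ dp n))))
        none : ω n ≡ 0ℚ
        none = divisors-empty 1<τ ≤P n d<τ

-- Lower bounds for sums of reciprocals of primes

module PrimeSums where

  open Rat
  open Sums
  open Average
  open Kernel
  open Subsets
  open LargeSieve
  open Divisors

  private variable
    X : Set
    Q : List ℕ

  primesUpTo : ∀ {D : ℕ → Set} → Decidable D → ℕ → List ℕ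
  primesUpTo D? b = filter (λ p → prime? p ×-dec D? p) (downFrom (suc b))

  module _ {D : ℕ → Set} (D? : Decidable D) (b : ℕ) where

    primesUpTo-distinct : DistinctPrimes (primesUpTo D? b)
    primesUpTo-distinct =
      All.map proj₁ (AllP.all-filter (λ p → prime? p ×-dec D? p) (downFrom (suc b))) ,
      UniqueP.filter⁺ (λ p → prime? p ×-dec D? p) (UniqueP.downFrom⁺ (suc b))

    ∈-primesUpTo⁺ : ∀ {p} → Prime p → D p → p ℕ.≤ b → p ∈ primesUpTo D? b
    ∈-primesUpTo⁺ pp d p≤b = ∈-filter⁺ (λ p → prime? p ×-dec D? p) (∈-downFrom⁺ (ℕ.s≤s p≤b)) (pp , d)

    ∈-primesUpTo⁻ : ∀ {p} → p ∈ primesUpTo D? b → Prime p × D p × p ℕ.≤ b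
    ∈-primesUpTo⁻ p∈ with ∈-filter⁻ (λ p → prime? p ×-dec D? p) {xs = downFrom (suc b)} p∈
    ... | p∈′ , pp , d = pp , d , ℕP.≤-pred (∈-downFrom⁻ p∈′)

  ∑-filter : ∀ {R : X → Set} (R? : Decidable R) xs f →
    ∑ (filter R? xs) f ≡ ∑ xs (λ x → 𝟙 (R? x) * f x)
  ∑-filter R? []       f = refl
  ∑-filter R? (x ∷ xs) f with R? x
  ... | yes _ = cong₂ _+_ (sym (*-identityˡ (f x))) (∑-filter R? xs f)
  ... | no  _ = trans (∑-filter R? xs f) (trans (sym (+-identityˡ _))
    (cong (_+ _) (sym (*-zeroˡ (f x)))))

  multiples : ℕ → ℕ → ℚ
  multiples d N = run N (δ d) (pos 1)

  δ-mean : ∀ d .{{_ : ℕ.NonZero d}} n → run d (δ d) n ≡ 1ℚ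
  δ-mean d n = trans (∑-cong (downFrom d) λ s → cong (λ m → δ d (n ℤ.+ pos m)) (sym (ℕP.*-identityˡ s)))
    (∑δ≡1 1 (Coprimality.sym (Coprimality.1-coprimeTo d)) n)

  multiples-small : ∀ d N → N ℕ.< d → multiples d N ≡ 0ℚ
  multiples-small d N N<d = trans (∑<-cong N λ i i<N → δ-no (pos (suc i)) λ d∣ →
    ℕP.<⇒≱ (ℕP.≤-<-trans i<N N<d) (ℕD.∣⇒≤ d∣)) (∑-0 (downFrom N))

  multiples-≤ : ∀ d .{{_ : ℕ.NonZero d}} N → multiples d N ≤ ι N * recip d
  multiples-≤ d@(suc d-1) = <-rec _ step
    where
    step : ∀ N → (∀ {M} → M ℕ.< N → multiples d M ≤ ι M * recip d) → multiples d N ≤ ι N * recip d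
    step N rec = go (d ℕ.≤? N)
      where
      go : Dec (d ℕ.≤ N) → multiples d N ≤ ι N * recip d
      go (no d≰N) = ≤-trans (≤-reflexive (multiples-small d N (ℕP.≰⇒> d≰N))) (0≤* (0≤ι N) (0≤recip d))
      go (yes d≤N) = begin
        multiples d N
          ≡⟨ cong (multiples d) (ℕP.m+[n∸m]≡n d≤N) ⟨
        multiples d (d ℕ.+ M)
          ≡⟨ run-split d M (δ d) (pos 1) ⟩
        run d (δ d) (pos 1) + run M (δ d) (pos 1 ℤ.+ pos d)
          ≡⟨ cong₂ _+_ (δ-mean d (pos 1)) (∑-cong (downFrom M) λ i → trans (cong (δ d) (swap i))
            (δ-shift (pos (suc i)) (pos d) ℕD.∣-refl)) ⟩
        1ℚ + multiples d M
          ≤⟨ +-mono-≤ (≤-reflexive (sym (ι*recip d))) (rec smaller) ⟩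
        ι d * recip d + ι M * recip d
          ≡⟨ *-distribʳ-+ (recip d) (ι d) (ι M) ⟨
        (ι d + ι M) * recip d
          ≡⟨ cong (_* recip d) (trans (sym (ι-+ d M)) (cong ι (ℕP.m+[n∸m]≡n d≤N))) ⟩
        ι N * recip d ∎
        where
        open ≤-Reasoning
        M = N ℕ.∸ d
        smaller : M ℕ.< N
        smaller = ℕP.∸-monoʳ-< {N} {d} {0} (ℕ.s≤s ℕ.z≤n) d≤N
        swap : ∀ i → pos 1 ℤ.+ pos d ℤ.+ pos i ≡ pos (suc i) ℤ.+ pos d
        swap i = cong pos (cong suc (ℕP.+-comm d i))

  -- Since z / p ≤ 2 ⌊ z / p ⌋ for p ≤ z.
  multiples-≥ : ∀ d .{{_ : ℕ.NonZero d}} z → d ℕ.≤ z → ι z * recip d ≤ 2ℚ * multiples d z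
  multiples-≥ d z d≤z = ≤-by (rearrange (ι z * recip d) m) (0≤+ near 1≤m)
    where
    m = multiples d z
    rearrange : ∀ x m → 2ℚ * m ≡ x + ((m - x + 1ℚ) + (m - 1ℚ))
    rearrange = solve 2 (λ x m → (con 2ℚ) :* m := x :+ ((m :- x :+ (con 1ℚ)) :+ (m :- (con 1ℚ)))) refl
    near : 0ℚ ≤ m - ι z * recip d + 1ℚ
    near = subst (_≤ m - ι z * recip d + 1ℚ) (+-inverseʳ (m - ι z * recip d))
      (+-monoʳ-≤ (m - ι z * recip d) (≤-trans (-p≤∣p∣ (m - ι z * recip d)) (run-count
        (λ n → trans (δ-mean d n) (sym (ι*recip d))) (ι*recip d) (0≤δ d) z (pos 1))))
    1≤m : 0ℚ ≤ m - 1ℚ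
    1≤m = subst (_≤ m - 1ℚ) (+-inverseʳ 1ℚ) (+-monoˡ-≤ (- 1ℚ) (subst (λ z → 1ℚ ≤ multiples d z)
      (ℕP.m+[n∸m]≡n d≤z)
      (≤-by (trans (run-split d (z ℕ.∸ d) (δ d) (pos 1))
        (cong (_+ run (z ℕ.∸ d) (δ d) (pos 1 ℤ.+ pos d)) (δ-mean d (pos 1))))
        (run-nonneg (z ℕ.∸ d) (δ d) (pos 1 ℤ.+ pos d) (0≤δ d)))))

  private
    lg-step : ∀ {P : Set} → ℕ → Dec P → ℕ
    lg-step l (yes _) = suc l
    lg-step l (no  _) = l

  -- ⌊log₂ n⌋, with the junk value lg 0 = 0.
  lg : ℕ → ℕ
  lg zero    = 0
  lg (suc n) = lg-step (lg n) (2 ℕ.^ suc (lg n) ℕ.≤? suc n)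

  private
    lg-step-bounds : ∀ l n → 2 ℕ.^ l ℕ.≤ n → n ℕ.< 2 ℕ.^ suc l → (d : Dec (2 ℕ.^ suc l ℕ.≤ suc n)) →
      2 ℕ.^ lg-step l d ℕ.≤ suc n × suc n ℕ.< 2 ℕ.^ suc (lg-step l d)
    lg-step-bounds l n lower upper (yes le) = le , ℕP.≤-<-trans upper (ℕP.^-monoʳ-< 2 ℕP.≤-refl
      (ℕP.n<1+n (suc l)))
    lg-step-bounds l n lower upper (no ¬le) = ℕP.≤-trans lower (ℕP.n≤1+n n) , ℕP.≰⇒> ¬le

  lg-bounds : ∀ n .{{_ : ℕ.NonZero n}} → 2 ℕ.^ lg n ℕ.≤ n × n ℕ.< 2 ℕ.^ suc (lg n)
  lg-bounds (suc zero)    = ℕP.≤-refl , ℕP.≤-refl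
  lg-bounds (suc (suc n)) = let lower , upper = lg-bounds (suc n) in
    lg-step-bounds (lg (suc n)) (suc n) lower upper (2 ℕ.^ suc (lg (suc n)) ℕ.≤? suc (suc n))

  lg-unique-≤ : ∀ {k n} → .{{_ : ℕ.NonZero n}} → 2 ℕ.^ k ℕ.≤ n → k ℕ.≤ lg n
  lg-unique-≤ {k} {n} le = ℕP.≮⇒≥ λ lg<k → ℕP.<⇒≱ (proj₂ (lg-bounds n))
    (ℕP.≤-trans (ℕP.^-monoʳ-≤ 2 lg<k) le)

  lg-mono : ∀ {m n} .{{_ : ℕ.NonZero m}} .{{_ : ℕ.NonZero n}} → m ℕ.≤ n → lg m ℕ.≤ lg n
  lg-mono {m} {n} m≤n = lg-unique-≤ {lg m} {n} (ℕP.≤-trans (proj₁ (lg-bounds m)) m≤n)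

  lg-superadditive : ∀ m n .{{_ : ℕ.NonZero m}} .{{_ : ℕ.NonZero n}} → lg m ℕ.+ lg n ℕ.≤ lg (m ℕ.* n)
  lg-superadditive m n = lg-unique-≤ {{ℕP.m*n≢0 m n}}
    (ℕP.≤-trans (ℕP.≤-reflexive (ℕP.^-distribˡ-+-* 2 (lg m) (lg n)))
    (ℕP.*-mono-≤ (proj₁ (lg-bounds m)) (proj₁ (lg-bounds n))))

  lg-* : ∀ m n .{{_ : ℕ.NonZero m}} .{{_ : ℕ.NonZero n}} → lg (m ℕ.* n) ℕ.≤ suc (lg m) ℕ.+ lg n
  lg-* m n = ℕP.≤-pred (ℕP.≰⇒> λ le → ℕP.<⇒≱
    (ℕP.*-mono-< (proj₂ (lg-bounds m)) (proj₂ (lg-bounds n)))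
    (ℕP.≤-trans (ℕP.≤-reflexive (sym (ℕP.^-distribˡ-+-* 2 (suc (lg m)) (suc (lg n)))))
      (ℕP.≤-trans (ℕP.^-monoʳ-≤ 2 (ℕP.≤-trans (ℕP.≤-reflexive (ℕP.+-suc (suc (lg m)) (lg n))) le))
        (proj₁ (lg-bounds (m ℕ.* n) {{ℕP.m*n≢0 m n}})))))

  lg-^ : ∀ z .{{_ : ℕ.NonZero z}} k → k ℕ.* lg z ℕ.≤ lg (z ℕ.^ k)
  lg-^ z zero    = ℕ.z≤n
  lg-^ z (suc k) = ℕP.≤-trans (ℕP.+-monoʳ-≤ (lg z) (lg-^ z k)) (lg-superadditive z (z ℕ.^ k) {{it}}
    {{ℕP.m^n≢0 z k}})
    where
    it : ℕ.NonZero z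
    it = ℕ.≢-nonZero (ℕ.≢-nonZero⁻¹ z)

  lg-prime>0 : ∀ {p} → Prime p → 1 ℕ.≤ lg p
  lg-prime>0 {p} pp = lg-unique-≤ {1} {{prime⇒nonZero pp}} (ℕ.nonTrivial⇒n>1 p {{prime⇒nonTrivial pp}})

  -- An additive substitute for the logarithm of norm S.
  logsum : Sub Q → ℕ
  logsum []               = 0
  logsum (skip S)         = logsum S
  logsum (pick {p = p} S) = lg p ℕ.+ logsum S

  logsum≤lg : All Prime Q → (S : Sub Q) → logsum S ℕ.≤ lg (norm S)
  logsum≤lg []       []       = ℕ.z≤n
  logsum≤lg (_ ∷ ps) (skip S) = logsum≤lg ps S
  logsum≤lg {p ∷ Q} (pp ∷ ps) (pick S) = ℕP.≤-trans (ℕP.+-monoʳ-≤ (lg p) (logsum≤lg ps S))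
    (lg-superadditive p (norm S) {{prime⇒nonZero pp}} {{norm-nonZero ps S}})

  lg≤2logsum : All Prime Q → (S : Sub Q) → lg (norm S) ℕ.≤ 2 ℕ.* logsum S
  lg≤2logsum []       []       = ℕP.≤-refl
  lg≤2logsum (_ ∷ ps) (skip S) = lg≤2logsum ps S
  lg≤2logsum {p ∷ Q} (pp ∷ ps) (pick S) = begin
    lg (p ℕ.* norm S)                        ≤⟨ lg-* p (norm S) {{prime⇒nonZero pp}}
      {{norm-nonZero ps S}} ⟩
    suc (lg p) ℕ.+ lg (norm S)               ≤⟨ ℕP.+-mono-≤ (ℕP.+-monoˡ-≤ (lg p) (lg-prime>0 pp))
      (lg≤2logsum ps S) ⟩
    lg p ℕ.+ lg p ℕ.+ 2 ℕ.* logsum S         ≡⟨ collect (lg p) (logsum S) ⟩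
    2 ℕ.* (lg p ℕ.+ logsum S)                ∎
    where
    open ℕP.≤-Reasoning
    collect : ∀ a b → a ℕ.+ a ℕ.+ 2 ℕ.* b ≡ 2 ℕ.* (a ℕ.+ b)
    collect = solve-ℕ

  ∑-logsum : ∀ Q n → ∑ Q (λ p → ι (lg p) * δ p n) ≡ ι (logsum (divisors Q n))
  ∑-logsum []      n = sym ι0
  ∑-logsum (p ∷ Q) n with p ∣? ℤ.∣ n ∣
  ... | yes _ = trans (cong₂ _+_ (*-identityʳ _) (∑-logsum Q n)) (sym (ι-+ (lg p) _))
  ... | no  _ = trans (cong₂ _+_ (*-zeroʳ _) (∑-logsum Q n)) (+-identityˡ _)

  ∈⇒∣norm-divisors : ∀ {p} n → p ∈ Q → p ∣ ℤ.∣ n ∣ → p ∣ norm (divisors Q n)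
  ∈⇒∣norm-divisors {q ∷ Q} n p∈ p∣n with q ∣? ℤ.∣ n ∣
  ∈⇒∣norm-divisors {q ∷ Q} n (here refl) p∣n | yes _   = ℕD.m∣m*n (norm (divisors Q n))
  ∈⇒∣norm-divisors {q ∷ Q} n (there p∈)  p∣n | yes _   = ℕD.∣n⇒∣m*n q (∈⇒∣norm-divisors n p∈ p∣n)
  ∈⇒∣norm-divisors {q ∷ Q} n (here refl) p∣n | no q∤n  = ⊥-elim (q∤n p∣n)
  ∈⇒∣norm-divisors {q ∷ Q} n (there p∈)  p∣n | no _    = ∈⇒∣norm-divisors n p∈ p∣n

  squarefree⇒unique : ∀ {ps} → All Prime ps → (∀ q → Prime q → ¬ q ℕ.* q ∣ product ps) → Unique ps
  squarefree⇒unique []                      free = []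
  squarefree⇒unique {p ∷ ps} (pp ∷ primes)  free =
    All.tabulate (λ {q} q∈ p≡q → free p pp (ℕD.*-monoʳ-∣ p (∈⇒∣product (subst (_∈ ps) (sym p≡q) q∈)))) ∷
    squarefree⇒unique primes λ q qp q²∣ → free q qp (ℕD.∣n⇒∣m*n p q²∣)

  product-∣ : ∀ {ps m} → All Prime ps → Unique ps → All (_∣ m) ps → product ps ∣ m
  product-∣ []            []         []        = ℕD.1∣ _
  product-∣ {p ∷ ps} (pp ∷ primes) (≢s ∷ u) (p∣m ∷ ∣s) = coprime-*-∣ (prime∤⇒coprime pp λ p∣ →
    All.lookup ≢s (factorisationHasAllPrimeFactors pp p∣ primes) refl) p∣m (product-∣ primes u ∣s)

  -- The prime factorisation of a squarefree `n` has no repetitions, and distinct primes that divide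
  -- `m` have a product that divides `m`.
  squarefree⇒∣ : ∀ n m .{{_ : ℕ.NonZero n}} → (∀ q → Prime q → ¬ q ℕ.* q ∣ n) →
    (∀ p → Prime p → p ∣ n → p ∣ m) → n ∣ m
  squarefree⇒∣ n m free dvd = subst (_∣ m) (sym isF) (product-∣ primes
    (squarefree⇒unique primes λ q qp q²∣ → free q qp (subst (q ℕ.* q ∣_) (sym isF) q²∣))
    (All.tabulate λ {p} p∈ → dvd p (All.lookup primes p∈) (subst (p ∣_) (sym isF) (∈⇒∣product p∈))))
    where
    open Factorisation.PrimeFactorisation (factorise n) renaming (isFactorisation to isF; factorsPrime
      to primes)

  ∑-indicators : ∀ (xs : List X) (f : X → ℕ) n → ∑ xs (λ x → δ (f x) n) ≡ 0ℚ × (∀ {x} → x ∈ xs → ¬ f x ∣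
    ℤ.∣ n ∣)
    ⊎ 1ℚ ≤ ∑ xs (λ x → δ (f x) n)
  ∑-indicators []       f n = inj₁ (refl , λ ())
  ∑-indicators (x ∷ xs) f n with f x ∣? ℤ.∣ n ∣ | ∑-indicators xs f n
  ... | yes _ | _               = inj₂ (p≤p+q (∑-nonneg xs λ x → 0≤δ (f x) n))
  ... | no _  | inj₂ 1≤         = inj₂ (≤-trans 1≤ (≤-reflexive (sym (+-identityˡ _))))
  ... | no x∤ | inj₁ (e , none) = inj₁ (trans (+-identityˡ _) e , λ { (here refl) → x∤ ; (there x∈) → none x∈ })

  -- Σ 1 / q² ≤ 3 / 4 - 1 / (k + 1) over 2 ≤ q < k + 2, by telescoping.
  ∑-recip-squares : ∀ k → 2ℚ * (2ℚ * ∑< k (λ i → recip ((2 ℕ.+ i) ℕ.* (2 ℕ.+ i)))) ≤ 2ℚ + 1ℚ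
  ∑-recip-squares zero    = ≤-trans (≤-reflexive (zeros 1ℚ)) (0≤+ (<⇒≤ 0<2) 0≤1)
    where
    zeros : ∀ a → 2ℚ * (2ℚ * 0ℚ) ≡ 0ℚ
    zeros = solve 1 (λ a → (con 2ℚ) :* ((con 2ℚ) :* (con 0ℚ)) := (con 0ℚ)) refl
  ∑-recip-squares (suc k) = ≤-trans
    (*-monoˡ 2ℚ (<⇒≤ 0<2) (*-monoˡ 2ℚ (<⇒≤ 0<2) (p≤p+q (0≤recip (2 ℕ.+ k))))) (telescope k)
    where
    recip-* : ∀ m n .{{_ : ℕ.NonZero m}} .{{_ : ℕ.NonZero n}} → recip (m ℕ.* n) ≡ recip m * recip n
    recip-* m n = begin
      recip (m ℕ.* n)
        ≡⟨ trans (sym (*-identityˡ _)) (cong (_* recip (m ℕ.* n))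
          (sym (trans (cong₂ _*_ (ι*recip m) (ι*recip n)) (*-identityˡ 1ℚ)))) ⟩
      ι m * recip m * (ι n * recip n) * recip (m ℕ.* n)
        ≡⟨ regroup (ι m) (recip m) (ι n) (recip n) (recip (m ℕ.* n)) ⟩
      ι m * ι n * recip (m ℕ.* n) * (recip m * recip n)
        ≡⟨ cong (_* (recip m * recip n)) (trans (cong (_* recip (m ℕ.* n)) (sym (ι-* m n)))
          (ι*recip (m ℕ.* n) {{ℕP.m*n≢0 m n}})) ⟩
      1ℚ * (recip m * recip n)
        ≡⟨ *-identityˡ _ ⟩
      recip m * recip n ∎
      where
      open ≡-Reasoning
      regroup : ∀ a b c d e → a * b * (c * d) * e ≡ a * c * e * (b * d)
      regroup = solve 5 (λ a b c d e → a :* b :* (c :* d) :* e := a :* c :* e :* (b :* d)) refl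
    telescope : ∀ k → 2ℚ * (2ℚ * (∑< (suc k) (λ i → recip ((2 ℕ.+ i) ℕ.* (2 ℕ.+ i))) + recip (2 ℕ.+ k)))
      ≤ 2ℚ + 1ℚ
    telescope zero = ≤-reflexive (trans (cong (λ y → 2ℚ * (2ℚ * (y + 0ℚ + recip 2))) (recip-* 2 2))
      (trans (expand (recip 2))
      (trans (cong (λ y → y * y + 2ℚ * y) (trans (cong (_* recip 2) (sym ι2)) (ι*recip 2)))
        (three 1ℚ))))
      where
      expand : ∀ a → 2ℚ * (2ℚ * (a * a + 0ℚ + a)) ≡ 2ℚ * a * (2ℚ * a) + 2ℚ * (2ℚ * a)
      expand = solve 1 (λ a → (con 2ℚ) :* ((con 2ℚ) :* (a :* a :+ (con 0ℚ) :+ a)) := (con 2ℚ) :* a :*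
        ((con 2ℚ) :* a) :+ (con 2ℚ) :* ((con 2ℚ) :* a)) refl
      three : ∀ a → 1ℚ * 1ℚ + 2ℚ * 1ℚ ≡ 2ℚ + 1ℚ
      three = solve 1 (λ a → (con 1ℚ) :* (con 1ℚ) :+ (con 2ℚ) :* (con 1ℚ) := (con 2ℚ) :+ (con 1ℚ)) refl
    telescope (suc k) = ≤-trans (*-monoˡ 2ℚ (<⇒≤ 0<2) (*-monoˡ 2ℚ (<⇒≤ 0<2) (begin
        recip (m ℕ.* m) + s + recip m
          ≡⟨ cong (λ y → y + s + recip m) (recip-* m m) ⟩
        recip m * recip m + s + recip m
          ≤⟨ +-monoˡ-≤ (recip m) (+-monoˡ-≤ s (*-monoʳ (recip m) (0≤recip m) b≤a)) ⟩
        recip (2 ℕ.+ k) * recip m + s + recip m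
          ≡⟨ cong (λ y → y + s + recip m) difference ⟩
        recip (2 ℕ.+ k) - recip m + s + recip m
          ≡⟨ cancel (recip (2 ℕ.+ k)) (recip m) s ⟩
        s + recip (2 ℕ.+ k) ∎))) (telescope k)
      where
      open ≤-Reasoning
      m = 3 ℕ.+ k
      s = ∑< (suc k) (λ i → recip ((2 ℕ.+ i) ℕ.* (2 ℕ.+ i)))
      cancel : ∀ a b s → a - b + s + b ≡ s + a
      cancel = solve 3 (λ a b s → a :- b :+ s :+ b := s :+ a) refl
      spread : ∀ a b n → a * b ≡ a * b * ((1ℚ + n) - n)
      spread = solve 3 (λ a b n → a :* b := a :* b :* (((con 1ℚ) :+ n) :- n)) refl
      spread′ : ∀ a b n n′ → a * b * (n′ - n) ≡ a * (n′ * b) - (n * a) * b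
      spread′ = solve 4 (λ a b n n′ → a :* b :* (n′ :- n) := a :* (n′ :* b) :- (n :* a) :* b) refl
      spread″ : ∀ a b → a * 1ℚ - 1ℚ * b ≡ a - b
      spread″ = solve 2 (λ a b → a :* (con 1ℚ) :- (con 1ℚ) :* b := a :- b) refl
      difference : recip (2 ℕ.+ k) * recip m ≡ recip (2 ℕ.+ k) - recip m
      difference = trans (spread (recip (2 ℕ.+ k)) (recip m) (ι (2 ℕ.+ k)))
        (trans (cong (λ y → recip (2 ℕ.+ k) * recip m * (y - ι (2 ℕ.+ k))) (sym (ι-suc (2 ℕ.+ k))))
          (trans (spread′ (recip (2 ℕ.+ k)) (recip m) (ι (2 ℕ.+ k)) (ι m))
            (trans (cong₂ (λ y y′ → recip (2 ℕ.+ k) * y - y′ * recip m) (ι*recip m) (ι*recip (2 ℕ.+ k)))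
              (spread″ (recip (2 ℕ.+ k)) (recip m)))))
      b≤a : recip m ≤ recip (2 ℕ.+ k)
      b≤a = ≤-by (rearrange (recip (2 ℕ.+ k)) (recip m)) (subst (0ℚ ≤_) difference
        (0≤* (0≤recip (2 ℕ.+ k)) (0≤recip m)))
        where
        rearrange : ∀ a b → a ≡ b + (a - b)
        rearrange = solve 2 (λ a b → a := b :+ (a :- b)) refl

  -- If the primes in (z, z ^ 65] had a small reciprocal sum, then a positive
  -- proportion of the n ≤ z ^ 65 would be squarefree without prime factors > z,
  -- which contradicts the bound 2 lg z for the mean of the sum of lg p over the
  -- primes p ≤ z dividing n.
  module _ (z : ℕ) (16≤z : 16 ℕ.≤ z) where

    private
      instance
        z≢0 : ℕ.NonZero z
        z≢0 = ℕ.>-nonZero (ℕP.<-≤-trans (ℕ.s≤s ℕ.z≤n) 16≤z)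
      N = z ℕ.^ 65
      Z = z ℕ.^ 64
      instance
        N≢0 : ℕ.NonZero N
        N≢0 = ℕP.m^n≢0 z 65
        Z≢0 : ℕ.NonZero Z
        Z≢0 = ℕP.m^n≢0 z 64
      small? : Decidable {A = ℕ} (λ _ → ⊤)
      small? _ = yes tt
      Pˢ = primesUpTo small? z
      Pˡ = primesUpTo (z ℕ.<?_) N
      primesˢ = proj₁ (primesUpTo-distinct small? z)
      primesˡ = proj₁ (primesUpTo-distinct (z ℕ.<?_) N)
      Λ = ι (lg z)
      -- A lower bound for `lg n` as soon as n > z ^ 64.
      C = ι 64 * Λ
      squares : ℤ → ℚ
      squares n = ∑ (downFrom N) λ i → δ ((2 ℕ.+ i) ℕ.* (2 ℕ.+ i)) n
      short : ℕ → ℚ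
      short m = 𝟙 (suc m ℕ.≤? Z)
      logs : ℤ → ℚ
      logs n = ∑ Pˢ λ p → ι (lg p) * δ p n

      0≤C : 0ℚ ≤ C
      0≤C = 0≤* (0≤ι 64) (0≤ι (lg z))

      -- A square factor makes the left side nonpositive; a prime factor above `z`, or n ≤ z ^ 64,
      -- puts a full `C` on the right. In the remaining case n divides the product of its primes up
      -- to `z`, so `C`, being at most `lg n`, is at most twice the sum of `lg p` over these primes.
      pointwise : ∀ m → m ℕ.< N → let n = pos (suc m) in
        C * (1ℚ - squares n) ≤ C * (∑ Pˡ (λ p → δ p n) + short m) + 2ℚ * logs n
      pointwise m m<N = go (∑-indicators (downFrom N) (λ i → (2 ℕ.+ i) ℕ.* (2 ℕ.+ i)) n)
                           (∑-indicators Pˡ (λ p → p) n) (suc m ℕ.≤? Z)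
        where
        n = pos (suc m)
        large = ∑ Pˡ (λ p → δ p n)
        0≤large : 0ℚ ≤ large
        0≤large = ∑-nonneg Pˡ λ p → 0≤δ p n
        0≤short : 0ℚ ≤ short m
        0≤short = 0≤𝟙 (suc m ℕ.≤? Z)
        0≤logs : 0ℚ ≤ logs n
        0≤logs = ∑-nonneg Pˢ λ p → 0≤* (0≤ι (lg p)) (0≤δ p n)
        0≤squares : 0ℚ ≤ squares n
        0≤squares = ∑-nonneg (downFrom N) λ i → 0≤δ ((2 ℕ.+ i) ℕ.* (2 ℕ.+ i)) n
        lhs≤C : C * (1ℚ - squares n) ≤ C
        lhs≤C = ≤-by (drop C (squares n)) (0≤* 0≤C 0≤squares)
          where
          drop : ∀ c s → c ≡ c * (1ℚ - s) + c * s
          drop = solve 2 (λ c s → c := c :* ((con 1ℚ) :- s) :+ c :* s) refl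
        C≤rhs : 1ℚ ≤ large + short m → C ≤ C * (large + short m) + 2ℚ * logs n
        C≤rhs 1≤ = ≤-trans (≤-trans (≤-reflexive (sym (*-identityʳ C))) (*-monoˡ C 0≤C 1≤))
          (p≤p+q (0≤* (<⇒≤ 0<2) 0≤logs))
        go : _ → _ → Dec (suc m ℕ.≤ Z) → C * (1ℚ - squares n) ≤ C * (large + short m) + 2ℚ * logs n
        go (inj₂ 1≤s) _ _ = ≤-trans (≤-trans (*-monoˡ C 0≤C 1-s≤0) (≤-reflexive (*-zeroʳ C)))
            (0≤+ (0≤* 0≤C (0≤+ 0≤large 0≤short)) (0≤* (<⇒≤ 0<2) 0≤logs))
          where
          1-s≤0 : 1ℚ - squares n ≤ 0ℚ
          1-s≤0 = subst (1ℚ - squares n ≤_) (+-inverseʳ (squares n)) (+-monoˡ-≤ (- squares n) 1≤s)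
        go (inj₁ _) (inj₂ 1≤l) _ = ≤-trans lhs≤C (C≤rhs (≤-trans 1≤l (p≤p+q 0≤short)))
        go (inj₁ _) (inj₁ _) (yes le) = ≤-trans lhs≤C (C≤rhs (≤-trans
          (≤-reflexive (sym (𝟙-yes (suc m ℕ.≤? Z) le))) (≤-by (+-comm large (short m)) 0≤large)))
        go (inj₁ (_ , free)) (inj₁ (_ , none)) (no ≰Z) = ≤-trans lhs≤C (begin
          C                                       ≡⟨ ι-* 64 (lg z) ⟨
          ι (64 ℕ.* lg z)
            ≤⟨ ι-mono-≤ (ℕP.≤-trans (lg-^ z 64) (ℕP.≤-trans (lg-mono (ℕP.<⇒≤ (ℕP.≰⇒> ≰Z)))
                                                       (ℕP.≤-trans (lg-mono {{_}}
                                                         {{norm-nonZero primesˢ (divisors Pˢ n)}}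
                                                           (ℕD.∣⇒≤ {{norm-nonZero primesˢ
                                                             (divisors Pˢ n)}} n∣))
                                                               (lg≤2logsum primesˢ (divisors Pˢ n))))) ⟩
          ι (2 ℕ.* logsum (divisors Pˢ n))
            ≡⟨ trans (ι-* 2 _) (cong₂ _*_ ι2 (sym (∑-logsum Pˢ n))) ⟩
          2ℚ * logs n                             ≤⟨ ≤-by (+-comm _ (2ℚ * logs n))
            (0≤* 0≤C (0≤+ 0≤large 0≤short)) ⟩
          C * (large + short m) + 2ℚ * logs n     ∎)
          where
          open ≤-Reasoning
          n∣ : suc m ∣ norm (divisors Pˢ n)
          n∣ = squarefree⇒∣ (suc m) (norm (divisors Pˢ n)) square-free divide
            where
            square-free : ∀ q → Prime q → ¬ q ℕ.* q ∣ suc m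
            square-free zero qp _ = ℕP.<⇒≱ (ℕ.nonTrivial⇒n>1 0 {{prime⇒nonTrivial qp}}) ℕ.z≤n
            square-free (suc zero) qp _ = ℕP.<⇒≱ (ℕ.nonTrivial⇒n>1 1 {{prime⇒nonTrivial qp}}) ℕP.≤-refl
            square-free q@(suc (suc i)) qp q²∣ = free
              (∈-downFrom⁺ (ℕP.<-≤-trans (ℕP.<-≤-trans (ℕP.n<1+n i) (ℕP.n≤1+n (suc i)))
              (ℕP.≤-trans (ℕP.m≤m*n q q) (ℕP.≤-trans (ℕD.∣⇒≤ q²∣) m<N)))) q²∣
            divide : ∀ p → Prime p → p ∣ suc m → p ∣ norm (divisors Pˢ n)
            divide p pp p∣ = ∈⇒∣norm-divisors n (∈-primesUpTo⁺ small? z pp tt (ℕP.≮⇒≥ λ z<p →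
              none (∈-primesUpTo⁺ (z ℕ.<?_) N pp z<p (ℕP.≤-trans (ℕD.∣⇒≤ p∣) m<N)) p∣)) p∣

      σ = ∑ Pˡ recip

      ∑-large : ∑< N (λ m → ∑ Pˡ (λ p → δ p (pos (suc m)))) ≤ ι N * σ
      ∑-large = ≤-trans (≤-reflexive (∑-swap (downFrom N) Pˡ _)) (≤-trans
        (∑-mono∈ Pˡ (λ p p∈ → multiples-≤ p {{prime⇒nonZero (All.lookup primesˡ p∈)}} N))
          (≤-reflexive (∑-*ˡ Pˡ (ι N) recip)))

      ∑-short : ∀ N → ∑< N short ≤ ι (N ℕ.⊓ Z)
      ∑-short zero = ≤-reflexive (sym ι0)
      ∑-short (suc N) = go (suc N ℕ.≤? Z)
        where
        go : Dec (suc N ℕ.≤ Z) → short N + ∑< N short ≤ ι (suc N ℕ.⊓ Z)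
        go (yes le) = ≤-trans (+-mono-≤ (𝟙≤1 (suc N ℕ.≤? Z)) (∑-short N)) (≤-trans
          (≤-reflexive (sym (ι-suc (N ℕ.⊓ Z)))) (ι-mono-≤ (ℕP.⊓-glb (ℕ.s≤s (ℕP.m⊓n≤m N Z))
            (ℕP.≤-trans (ℕ.s≤s (ℕP.m⊓n≤m N Z)) le))))
        go (no ≰) = ≤-trans (≤-reflexive (trans (cong (_+ ∑< N short) (𝟙-no (suc N ℕ.≤? Z) ≰))
          (+-identityˡ _)))
          (≤-trans (∑-short N) (ι-mono-≤ (ℕP.⊓-monoˡ-≤ Z (ℕP.n≤1+n N))))

      ∑-squares : 2ℚ * (2ℚ * ∑< N (λ m → squares (pos (suc m)))) ≤ ι N * (2ℚ + 1ℚ)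
      ∑-squares = ≤-trans (*-monoˡ 2ℚ (<⇒≤ 0<2)
        (*-monoˡ 2ℚ (<⇒≤ 0<2) (≤-trans (≤-reflexive (∑-swap (downFrom N) (downFrom N) _))
          (≤-trans (∑-mono (downFrom N) λ i → multiples-≤ ((2 ℕ.+ i) ℕ.* (2 ℕ.+ i)) N)
            (≤-reflexive (∑-*ˡ (downFrom N) (ι N) _))))))
        (≤-trans (≤-reflexive (rot (ι N) _)) (*-monoˡ (ι N) (0≤ι N) (∑-recip-squares N)))
        where
        rot : ∀ n s → 2ℚ * (2ℚ * (n * s)) ≡ n * (2ℚ * (2ℚ * s))
        rot = solve 2 (λ n s → (con 2ℚ) :* ((con 2ℚ) :* (n :* s)) := n :* ((con 2ℚ) :* ((con 2ℚ) :* s)))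
          refl

      -- A weak form of Mertens' first theorem. For n ≤ z the sum of `lg p` over the primes dividing
      -- n is at most `lg z`; summed over n, a prime p ≤ z is counted at least z / (2p) times.
      ∑-lg-recip : ∑ Pˢ (λ p → ι (lg p) * recip p) ≤ 2ℚ * Λ
      ∑-lg-recip = *-cancelˡ-≤ (ι z) (0<ι z) (begin
        ι z * ∑ Pˢ (λ p → ι (lg p) * recip p)
          ≡⟨ trans (sym (∑-*ˡ Pˢ (ι z) _)) (∑-cong Pˢ λ p → swap (ι z) (ι (lg p)) (recip p)) ⟩
        ∑ Pˢ (λ p → ι (lg p) * (ι z * recip p))
          ≤⟨ ∑-mono∈ Pˢ (λ p p∈ → *-monoˡ (ι (lg p)) (0≤ι (lg p))
            (multiples-≥ p {{prime⇒nonZero (All.lookup primesˢ p∈)}} z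
               (proj₂ (proj₂ (∈-primesUpTo⁻ small? z p∈))))) ⟩
        ∑ Pˢ (λ p → ι (lg p) * (2ℚ * multiples p z))
          ≡⟨ trans (∑-cong Pˢ λ p → trans (swap (ι (lg p)) 2ℚ _)
            (cong (2ℚ *_) (sym (∑-*ˡ (downFrom z) (ι (lg p)) _))))
               (trans (∑-*ˡ Pˢ 2ℚ _) (cong (2ℚ *_) (∑-swap Pˢ (downFrom z) _))) ⟩
        2ℚ * ∑< z (λ m → logs (pos (suc m)))
          ≤⟨ *-monoˡ 2ℚ (<⇒≤ 0<2) (∑<-mono z λ m m<z → ≤-trans (≤-reflexive (∑-logsum Pˢ (pos (suc m))))
            (ι-mono-≤
               (ℕP.≤-trans (logsum≤lg primesˢ (divisors Pˢ (pos (suc m)))) (ℕP.≤-trans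
                 (lg-mono {{norm-nonZero primesˢ (divisors Pˢ (pos (suc m)))}}
                   (ℕD.∣⇒≤ (norm-divisors-∣ (primesUpTo-distinct small? z) (pos (suc m)))))
                     (lg-mono m<z))))) ⟩
        2ℚ * ∑< z (λ _ → Λ)
          ≡⟨ trans (cong (2ℚ *_) (∑<-const z Λ)) (swap 2ℚ (ι z) Λ) ⟩
        ι z * (2ℚ * Λ) ∎)
        where
        open ≤-Reasoning
        swap : ∀ a b c → a * (b * c) ≡ b * (a * c)
        swap = solve 3 (λ a b c → a :* (b :* c) := b :* (a :* c)) refl

      ∑-logs : ∑< N (λ m → logs (pos (suc m))) ≤ ι N * (2ℚ * Λ)
      ∑-logs = begin
        ∑< N (λ m → logs (pos (suc m)))
          ≡⟨ trans (∑-swap (downFrom N) Pˢ _) (∑-cong Pˢ λ p → ∑-*ˡ (downFrom N) (ι (lg p)) _) ⟩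
        ∑ Pˢ (λ p → ι (lg p) * multiples p N)
          ≤⟨ ∑-mono∈ Pˢ (λ p p∈ → *-monoˡ (ι (lg p)) (0≤ι (lg p))
            (multiples-≤ p {{prime⇒nonZero (All.lookup primesˢ p∈)}} N)) ⟩
        ∑ Pˢ (λ p → ι (lg p) * (ι N * recip p))
          ≡⟨ trans (∑-cong Pˢ λ p → swap (ι (lg p)) (ι N) (recip p)) (∑-*ˡ Pˢ (ι N) _) ⟩
        ι N * ∑ Pˢ (λ p → ι (lg p) * recip p)
          ≤⟨ *-monoˡ (ι N) (0≤ι N) ∑-lg-recip ⟩
        ι N * (2ℚ * Λ) ∎
        where
        open ≤-Reasoning
        swap : ∀ a b c → a * (b * c) ≡ b * (a * c)
        swap = solve 3 (λ a b c → a :* (b :* c) := b :* (a :* c)) refl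

      summed : C * (ι N - ∑< N (λ m → squares (pos (suc m)))) ≤ C * (ι N * σ + ι Z) + 2ℚ *
        (ι N * (2ℚ * Λ))
      summed = begin
        C * (ι N - ∑< N (λ m → squares (pos (suc m))))
          ≡⟨ trans (∑-*ˡ (downFrom N) C _)
            (cong (C *_) (trans (∑-- (downFrom N) _ _) (cong (_- ∑< N (λ m → squares (pos (suc m))))
               (trans (∑<-const N 1ℚ) (*-identityʳ (ι N)))))) ⟨
        ∑< N (λ m → C * (1ℚ - squares (pos (suc m))))
          ≤⟨ ∑<-mono N pointwise ⟩
        ∑< N (λ m → C * (∑ Pˡ (λ p → δ p (pos (suc m))) + short m) + 2ℚ * logs (pos (suc m)))
          ≡⟨ trans (∑-+ (downFrom N) _ _)
            (cong₂ _+_ (trans (∑-*ˡ (downFrom N) C _) (cong (C *_) (∑-+ (downFrom N) _ _)))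
               (∑-*ˡ (downFrom N) 2ℚ _)) ⟩
        C * (∑< N (λ m → ∑ Pˡ (λ p → δ p (pos (suc m)))) + ∑< N short) + 2ℚ * ∑< N
          (λ m → logs (pos (suc m)))
          ≤⟨ +-mono-≤ (*-monoˡ C 0≤C (+-mono-≤ ∑-large (≤-trans (∑-short N) (ι-mono-≤ (ℕP.m⊓n≤n N Z)))))
               (*-monoˡ 2ℚ (<⇒≤ 0<2) ∑-logs) ⟩
        C * (ι N * σ + ι Z) + 2ℚ * (ι N * (2ℚ * Λ)) ∎
        where open ≤-Reasoning

    -- Divided by `C * ι N`, the summed inequality says 1 / 4 ≤ σ + 1 / z + 4 / 64: squares remove
    -- at most 3 / 4 of the integers, and each of the last two terms is at most 1 / 16. The exponent
    -- 64 and the bound 16 are chosen for this.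
    1≤8∑recip : 1ℚ ≤ 2ℚ * (2ℚ * (2ℚ * σ))
    1≤8∑recip = *-cancelˡ-≤ (2ℚ * (ι N * C)) (0<* 0<2 (0<* (0<ι N) 0<C)) (begin
      2ℚ * (ι N * C) * 1ℚ
        ≡⟨ expand₁ (ι N) C ⟩
      (2ℚ * 2ℚ) * (2ℚ * 2ℚ * (C * ι N) - C * (ι N * (2ℚ + 1ℚ))) - 2ℚ * (ι N * C)
        ≤⟨ +-monoˡ-≤ (- (2ℚ * (ι N * C))) (*-monoˡ (2ℚ * 2ℚ) (<⇒≤ (0<* 0<2 0<2))
             (+-monoʳ-≤ (2ℚ * 2ℚ * (C * ι N)) (neg-antimono-≤ (*-monoˡ C 0≤C ∑-squares)))) ⟩
      (2ℚ * 2ℚ) * (2ℚ * 2ℚ * (C * ι N) - C * (2ℚ * (2ℚ * s))) - 2ℚ * (ι N * C)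
        ≡⟨ expand₂ C (ι N) s ⟩
      (2ℚ * 2ℚ) * (2ℚ * 2ℚ * (C * (ι N - s))) - 2ℚ * (ι N * C)
        ≤⟨ +-monoˡ-≤ (- (2ℚ * (ι N * C))) (*-monoˡ (2ℚ * 2ℚ) (<⇒≤ (0<* 0<2 0<2))
             (*-monoˡ (2ℚ * 2ℚ) (<⇒≤ (0<* 0<2 0<2)) summed)) ⟩
      (2ℚ * 2ℚ) * (2ℚ * 2ℚ * (C * (ι N * σ + ι Z) + 2ℚ * (ι N * (2ℚ * Λ)))) - 2ℚ * (ι N * C)
        ≡⟨ expand₃ C (ι N) σ (ι Z) Λ ⟩
      2ℚ * (ι N * C) * (2ℚ * (2ℚ * (2ℚ * σ))) + (C * (2ℚ * (2ℚ * (2ℚ * (2ℚ * ι Z)))) + ι N *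
        (2ℚ * (2ℚ * (2ℚ * (2ℚ * (2ℚ * (2ℚ * Λ)))))) - 2ℚ * (ι N * C))
        ≡⟨ cong₂ (λ y w → 2ℚ * (ι N * C) * (2ℚ * (2ℚ * (2ℚ * σ))) + (C * y + ι N * w - 2ℚ * (ι N * C)))
             (trans (sym (expand₁₆ (ι Z))) (trans (cong (_* ι Z) (sym ι16)) (sym (ι-* 16 Z))))
             (trans (sym (expand₆₄ Λ)) (cong (_* Λ) (sym ι64))) ⟩
      2ℚ * (ι N * C) * (2ℚ * (2ℚ * (2ℚ * σ))) + (C * ι (16 ℕ.* Z) + ι N * C - 2ℚ * (ι N * C))
        ≤⟨ +-monoʳ-≤ (2ℚ * (ι N * C) * (2ℚ * (2ℚ * (2ℚ * σ)))) (+-monoˡ-≤ (- (2ℚ * (ι N * C)))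
             (+-monoˡ-≤ (ι N * C) (*-monoˡ C 0≤C (ι-mono-≤ (ℕP.*-monoˡ-≤ Z 16≤z))))) ⟩
      2ℚ * (ι N * C) * (2ℚ * (2ℚ * (2ℚ * σ))) + (C * ι N + ι N * C - 2ℚ * (ι N * C))
        ≡⟨ finish (2ℚ * (ι N * C) * (2ℚ * (2ℚ * (2ℚ * σ)))) C (ι N) ⟩
      2ℚ * (ι N * C) * (2ℚ * (2ℚ * (2ℚ * σ))) ∎)
      where
      open ≤-Reasoning
      s = ∑< N (λ m → squares (pos (suc m)))
      0<C : 0ℚ < C
      0<C = 0<* (0<ι 64) (0<ι (lg z)
        {{ℕ.>-nonZero (lg-unique-≤ {1} {z} (ℕP.≤-trans (ℕ.s≤s (ℕ.s≤s ℕ.z≤n)) 16≤z))}})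
      expand₁ : ∀ n c → 2ℚ * (n * c) * 1ℚ ≡ (2ℚ * 2ℚ) * (2ℚ * 2ℚ * (c * n) - c * (n * (2ℚ + 1ℚ))) - 2ℚ *
        (n * c)
      expand₁ = solve 2 (λ n c → (con 2ℚ) :* (n :* c) :* (con 1ℚ) := ((con 2ℚ) :* (con 2ℚ)) :*
        ((con 2ℚ) :* (con 2ℚ) :* (c :* n) :- c :* (n :* ((con 2ℚ) :+ (con 1ℚ)))) :- (con 2ℚ) :*
          (n :* c)) refl
      expand₂ : ∀ c n s → (2ℚ * 2ℚ) * (2ℚ * 2ℚ * (c * n) - c * (2ℚ * (2ℚ * s))) - 2ℚ * (n * c) ≡
        (2ℚ * 2ℚ) * (2ℚ * 2ℚ * (c * (n - s))) - 2ℚ * (n * c)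
      expand₂ = solve 3 (λ c n s → ((con 2ℚ) :* (con 2ℚ)) :* ((con 2ℚ) :* (con 2ℚ) :* (c :* n) :- c :*
        ((con 2ℚ) :* ((con 2ℚ) :* s))) :- (con 2ℚ) :* (n :* c) := ((con 2ℚ) :* (con 2ℚ)) :*
          ((con 2ℚ) :* (con 2ℚ) :* (c :* (n :- s))) :- (con 2ℚ) :* (n :* c)) refl
      expand₃ : ∀ c n s z l → (2ℚ * 2ℚ) * (2ℚ * 2ℚ * (c * (n * s + z) + 2ℚ * (n * (2ℚ * l)))) - 2ℚ *
        (n * c) ≡ 2ℚ * (n * c) * (2ℚ * (2ℚ * (2ℚ * s))) + (c * (2ℚ * (2ℚ * (2ℚ * (2ℚ * z)))) + n *
          (2ℚ * (2ℚ * (2ℚ * (2ℚ * (2ℚ * (2ℚ * l)))))) - 2ℚ * (n * c))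
      expand₃ = solve 5 (λ c n s z l → ((con 2ℚ) :* (con 2ℚ)) :*
        ((con 2ℚ) :* (con 2ℚ) :* (c :* (n :* s :+ z) :+ (con 2ℚ) :* (n :* ((con 2ℚ) :* l)))) :- (con 2ℚ)
          :* (n :* c) := (con 2ℚ) :* (n :* c) :* ((con 2ℚ) :* ((con 2ℚ) :* ((con 2ℚ) :* s))) :+
            (c :* ((con 2ℚ) :* ((con 2ℚ) :* ((con 2ℚ) :* ((con 2ℚ) :* z)))) :+ n :*
              ((con 2ℚ) :* ((con 2ℚ) :* ((con 2ℚ) :* ((con 2ℚ) :* ((con 2ℚ) :* ((con 2ℚ) :* l)))))) :-
                (con 2ℚ) :* (n :* c))) refl
      expand₁₆ : ∀ z → (2ℚ * 2ℚ * 2ℚ * 2ℚ) * z ≡ 2ℚ * (2ℚ * (2ℚ * (2ℚ * z)))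
      expand₁₆ = solve 1 (λ z → ((con 2ℚ) :* (con 2ℚ) :* (con 2ℚ) :* (con 2ℚ)) :* z := (con 2ℚ) :*
        ((con 2ℚ) :* ((con 2ℚ) :* ((con 2ℚ) :* z)))) refl
      expand₆₄ : ∀ z → (2ℚ * 2ℚ * 2ℚ * 2ℚ * 2ℚ * 2ℚ) * z ≡ 2ℚ * (2ℚ * (2ℚ * (2ℚ * (2ℚ * (2ℚ * z)))))
      expand₆₄ = solve 1 (λ z → ((con 2ℚ) :* (con 2ℚ) :* (con 2ℚ) :* (con 2ℚ) :* (con 2ℚ) :* (con 2ℚ))
        :* z := (con 2ℚ) :* ((con 2ℚ) :* ((con 2ℚ) :* ((con 2ℚ) :* ((con 2ℚ) :* ((con 2ℚ) :* z))))))
          refl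
      finish : ∀ y c n → y + (c * n + n * c - 2ℚ * (n * c)) ≡ y
      finish = solve 3 (λ y c n → y :+ (c :* n :+ n :* c :- (con 2ℚ) :* (n :* c)) := y) refl

  interval-∑ : ∀ {a b c} → a ℕ.≤ b → b ℕ.≤ c →
    ∑ (primesUpTo (a ℕ.<?_) b) recip + ∑ (primesUpTo (b ℕ.<?_) c) recip ≤ ∑ (primesUpTo (a ℕ.<?_) c)
      recip
  interval-∑ {a} {b} {c} a≤b b≤c = begin
    ∑ (primesUpTo (a ℕ.<?_) b) recip + ∑ (primesUpTo (b ℕ.<?_) c) recip
      ≡⟨ cong₂ _+_ (∑-filter _ (downFrom (suc b)) recip) (trans (∑-filter _ (downFrom (suc c)) recip)
        (split b)) ⟩
    ∑< (suc b) (f a) + (∑< (suc b) (f b) + ∑< (c ℕ.∸ b) (λ i → f b (suc b ℕ.+ i)))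
      ≤⟨ +-monoʳ-≤ (∑< (suc b) (f a))
        (+-mono-≤ (≤-reflexive (trans (∑<-cong (suc b) low) (∑-0 (downFrom (suc b)))))
           (∑-mono (downFrom (c ℕ.∸ b)) λ i → high (suc b ℕ.+ i))) ⟩
    ∑< (suc b) (f a) + (0ℚ + ∑< (c ℕ.∸ b) (λ i → f a (suc b ℕ.+ i)))
      ≡⟨ cong (∑< (suc b) (f a) +_) (+-identityˡ _) ⟩
    ∑< (suc b) (f a) + ∑< (c ℕ.∸ b) (λ i → f a (suc b ℕ.+ i))
      ≡⟨ trans (∑-filter _ (downFrom (suc c)) recip) (split a) ⟨
    ∑ (primesUpTo (a ℕ.<?_) c) recip ∎
    where
    open ≤-Reasoning
    f : ℕ → ℕ → ℚ
    f a p = 𝟙 (prime? p ×-dec (a ℕ.<? p)) * recip p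
    split : ∀ a → ∑< (suc c) (f a) ≡ ∑< (suc b) (f a) + ∑< (c ℕ.∸ b) (λ i → f a (suc b ℕ.+ i))
    split a = trans (cong (λ n → ∑< n (f a)) (cong suc (sym (ℕP.m+[n∸m]≡n b≤c))))
      (∑<-+ (suc b) (c ℕ.∸ b) (f a))
    low : ∀ i → i ℕ.< suc b → f b i ≡ 0ℚ
    low i i<1+b = trans (cong (_* recip i) (𝟙-no (prime? i ×-dec (b ℕ.<? i)) λ (_ , b<i) → ℕP.<⇒≱ b<i
      (ℕP.≤-pred i<1+b)))
      (*-zeroˡ (recip i))
    high : ∀ i → f b i ≤ f a i
    high i = go (prime? i ×-dec (b ℕ.<? i))
      where
      go : Dec (Prime i × b ℕ.< i) → f b i ≤ f a i
      go (yes (ip , b<i)) = ≤-reflexive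
        (cong (_* recip i) (trans (𝟙-yes (prime? i ×-dec (b ℕ.<? i)) (ip , b<i))
        (sym (𝟙-yes (prime? i ×-dec (a ℕ.<? i)) (ip , ℕP.≤-<-trans a≤b b<i)))))
      go (no ¬p) = ≤-trans (≤-reflexive (trans (cong (_* recip i) (𝟙-no (prime? i ×-dec (b ℕ.<? i)) ¬p))
        (*-zeroˡ (recip i))))
        (0≤* (0≤𝟙 (prime? i ×-dec (a ℕ.<? i))) (0≤recip i))

  -- The interval splits into `s` disjoint ones of the form (y, y ^ 65], and each of them
  -- contributes at least 1 / 8.
  ∑recip-≥ : ∀ z → 16 ℕ.≤ z → ∀ s → ι s ≤ 2ℚ * (2ℚ * (2ℚ * ∑ (primesUpTo (z ℕ.<?_) (z ℕ.^ (65 ℕ.^ s)))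
    recip))
  ∑recip-≥ z 16≤z zero = ≤-trans (≤-reflexive ι0) (0≤* (<⇒≤ 0<2) (0≤* (<⇒≤ 0<2) (0≤* (<⇒≤ 0<2)
    (∑-nonneg (primesUpTo (z ℕ.<?_) (z ℕ.^ (65 ℕ.^ 0))) 0≤recip))))
  ∑recip-≥ z 16≤z (suc s) = begin
    ι (suc s)
      ≡⟨ trans (ι-suc s) (+-comm 1ℚ (ι s)) ⟩
    ι s + 1ℚ
      ≤⟨ +-mono-≤ (∑recip-≥ z 16≤z s) (1≤8∑recip y (ℕP.≤-trans 16≤z z≤y)) ⟩
    2ℚ * (2ℚ * (2ℚ * ∑ (primesUpTo (z ℕ.<?_) y) recip)) + 2ℚ *
      (2ℚ * (2ℚ * ∑ (primesUpTo (y ℕ.<?_) (y ℕ.^ 65)) recip))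
      ≡⟨ collect (∑ (primesUpTo (z ℕ.<?_) y) recip) (∑ (primesUpTo (y ℕ.<?_) (y ℕ.^ 65)) recip) ⟩
    2ℚ * (2ℚ * (2ℚ * (∑ (primesUpTo (z ℕ.<?_) y) recip + ∑ (primesUpTo (y ℕ.<?_) (y ℕ.^ 65)) recip)))
      ≤⟨ *-monoˡ 2ℚ (<⇒≤ 0<2) (*-monoˡ 2ℚ (<⇒≤ 0<2) (*-monoˡ 2ℚ (<⇒≤ 0<2) (interval-∑ z≤y y≤y^65))) ⟩
    2ℚ * (2ℚ * (2ℚ * ∑ (primesUpTo (z ℕ.<?_) (y ℕ.^ 65)) recip))
      ≡⟨ cong (λ c → 2ℚ * (2ℚ * (2ℚ * ∑ (primesUpTo (z ℕ.<?_) c) recip)))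
        (trans (ℕP.^-*-assoc z (65 ℕ.^ s) 65) (cong (z ℕ.^_) (ℕP.*-comm (65 ℕ.^ s) 65))) ⟩
    2ℚ * (2ℚ * (2ℚ * ∑ (primesUpTo (z ℕ.<?_) (z ℕ.^ (65 ℕ.^ suc s))) recip)) ∎
    where
    open ≤-Reasoning
    y = z ℕ.^ (65 ℕ.^ s)
    instance
      z≢0 : ℕ.NonZero z
      z≢0 = ℕ.>-nonZero (ℕP.<-≤-trans (ℕ.s≤s ℕ.z≤n) 16≤z)
      y≢0 : ℕ.NonZero y
      y≢0 = ℕP.m^n≢0 z (65 ℕ.^ s)
    z≤y : z ℕ.≤ y
    z≤y = ℕP.≤-trans (ℕP.≤-reflexive (sym (ℕP.*-identityʳ z)))
      (ℕP.^-monoʳ-≤ z {1} (ℕ.>-nonZero⁻¹ (65 ℕ.^ s) {{ℕP.m^n≢0 65 s}}))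
    y≤y^65 : y ℕ.≤ y ℕ.^ 65
    y≤y^65 = ℕP.≤-trans (ℕP.≤-reflexive (sym (ℕP.*-identityʳ y)))
      (ℕP.^-monoʳ-≤ y {1} {65} (ℕ.s≤s ℕ.z≤n))
    collect : ∀ a b → 2ℚ * (2ℚ * (2ℚ * a)) + 2ℚ * (2ℚ * (2ℚ * b)) ≡ 2ℚ * (2ℚ * (2ℚ * (a + b)))
    collect = solve 2 (λ a b → (con 2ℚ) :* ((con 2ℚ) :* ((con 2ℚ) :* a)) :+ (con 2ℚ) :*
      ((con 2ℚ) :* ((con 2ℚ) :* b)) := (con 2ℚ) :* ((con 2ℚ) :* ((con 2ℚ) :* (a :+ b)))) refl

-- Comparing the sifted sums with the sifted integers

module Comparison where

  open Rat
  open Sums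
  open Average
  open Kernel
  open Subsets
  open LargeSieve
  open Divisors
  open Equidistribution
  open Levels
  open Truncation
  open import Algebra.Properties.AbelianGroup ℤP.+-0-abelianGroup using () renaming
    (∙-cancelˡ to +-cancelˡ)

  isZero : ℤ → ℚ
  isZero n = 𝟙 (n ℤ.≟ ℤ.0ℤ)

  -- The value 0 gets a factor of its own: if `Q` is empty then `sifted` is 1 everywhere, but 0 is
  -- not smooth.
  free : List ℕ → ℤ → ℚ
  free Q n = (1ℚ - isZero n) * sifted Q n

  -- `P` holds the test primes and `Q` the primes to be sifted out. By `2J≤`, a product of two test
  -- primes does not pass the cut-off t ^ (h + 2), and by `K+2≤Jκ` a nonzero integer up to 2x has
  -- fewer than `κ` prime factors in `Q`.
  module _
    (t i h J κ : ℕ) .{{t≢0 : ℕ.NonZero t}}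
    (4≤i : 4 ℕ.≤ i) (i≤h : i ℕ.≤ h) (2J≤ : 2 ℕ.* J ℕ.≤ h ℕ.+ 2) (K+2≤Jκ : 2 ℕ.+ (i ℕ.+ h) ℕ.≤ J ℕ.* κ)
    (4^≤t : 4 ℕ.^ (i ℕ.+ h ℕ.+ 2) ℕ.≤ t)
    (margin≤t : 2 ℕ.* (i ℕ.+ h) ℕ.* (2 ℕ.^ suc (i ℕ.+ h) ℕ.* suc (8 ℕ.* (i ℕ.+ h) ℕ.+ 3)) ℕ.≤ t)
    (x : ℕ) (t^K≤x : t ℕ.^ (i ℕ.+ h) ℕ.≤ x) (x≤ : x ℕ.≤ t ℕ.^ suc (i ℕ.+ h))
    {P Q : List ℕ} (dpP : DistinctPrimes P) (dpQ : DistinctPrimes Q) (dp : DistinctPrimes (P ++ Q))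
    (P≥ : All (t ℕ.^ i ℕ.≤_) P) (P≤ : All (ℕ._≤ t ℕ.^ J) P)
    (Q≥i : All (t ℕ.^ i ℕ.≤_) Q) (Q≥J : All (t ℕ.^ J ℕ.≤_) Q)
    (r : ℚ) (rM≡1 : r * ∑ P recip ≡ 1ℚ) (0≤r : 0ℚ ≤ r) (2r≤1 : 2ℚ * r ≤ 1ℚ)
    where

    open Turán dpP r rM≡1

    private
      K = i ℕ.+ h
      D = t ℕ.^ (h ℕ.+ 2)
      μ : Sub Q → ℚ
      μ S = sign S * bounded dpQ D S
      F = divisorSum dpQ μ
      C = ι (2 ℕ.^ κ)
      -- Bounds the number of moduli up to `D` composed of primes from t ^ i on, hence any divisor
      -- sum that is truncated at `D` and has weights at most 1.
      W = ι D * ι (2 ℕ.^ suc K)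
      m = mean dpQ μ
      q = recip t
      ν : Sub P → ℚ
      ν S = weight (size S)
      instance
        D≢0 : ℕ.NonZero D
        D≢0 = ℕP.m^n≢0 t (h ℕ.+ 2)
        t^i≢0 : ℕ.NonZero (t ℕ.^ i)
        t^i≢0 = ℕP.m^n≢0 t i
        t^J≢0 : ℕ.NonZero (t ℕ.^ J)
        t^J≢0 = ℕP.m^n≢0 t J
        x≢0 : ℕ.NonZero x
        x≢0 = ℕ.>-nonZero (ℕP.<-≤-trans (ℕ.>-nonZero⁻¹ (t ℕ.^ K) {{ℕP.m^n≢0 t K}}) t^K≤x)

      4≤t : 4 ℕ.≤ t
      4≤t = ℕP.≤-trans (ℕP.^-monoʳ-≤ 4 {1} (ℕP.≤-trans (ℕ.s≤s ℕ.z≤n) (ℕP.m≤n+m 2 K))) 4^≤t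

      2^≤t : 2 ℕ.^ suc K ℕ.≤ t
      2^≤t = ℕP.≤-trans (ℕP.≤-trans (ℕP.^-monoˡ-≤ (suc K) {2} {4} (ℕ.s≤s (ℕ.s≤s ℕ.z≤n)))
        (ℕP.^-monoʳ-≤ 4 (ℕP.≤-trans (ℕP.n≤1+n (suc K)) (ℕP.≤-reflexive (ℕP.+-comm 2 K))))) 4^≤t

      1<t^i : 1 ℕ.< t ℕ.^ i
      1<t^i = ℕP.^-monoʳ-< t (ℕP.<-≤-trans (ℕ.s≤s (ℕ.s≤s ℕ.z≤n)) 4≤t) {0} {i} (ℕP.≤-trans (ℕ.s≤s ℕ.z≤n)
        4≤i)

      2D<τ^K : 2 ℕ.* D ℕ.< (t ℕ.^ i) ℕ.^ K
      2D<τ^K = begin-strict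
        2 ℕ.* D                 ≤⟨ ℕP.*-monoˡ-≤ D (ℕP.≤-trans (ℕ.s≤s (ℕ.s≤s ℕ.z≤n)) 4≤t) ⟩
        t ℕ.^ suc (h ℕ.+ 2)     <⟨ ℕP.^-monoʳ-< t (ℕP.<-≤-trans (ℕ.s≤s (ℕ.s≤s ℕ.z≤n)) 4≤t) bound ⟩
        t ℕ.^ (i ℕ.* K)         ≡⟨ ℕP.^-*-assoc t i K ⟨
        (t ℕ.^ i) ℕ.^ K         ∎
        where
        open ℕP.≤-Reasoning
        bound : suc (h ℕ.+ 2) ℕ.< i ℕ.* K
        bound = ℕP.≤-trans (ℕP.≤-reflexive (cong (λ z → suc (suc z)) (ℕP.+-comm h 2)))
          (ℕP.≤-trans (ℕP.+-monoˡ-≤ h 4≤i)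
            (ℕP.m≤n*m K i {{ℕ.>-nonZero (ℕP.≤-trans (ℕ.s≤s ℕ.z≤n) 4≤i)}}))

      tD2^≤ : t ℕ.* (D ℕ.* 2 ℕ.^ suc K) ℕ.≤ t ℕ.^ (h ℕ.+ 4)
      tD2^≤ = ℕP.≤-trans (ℕP.*-monoʳ-≤ t (ℕP.*-monoʳ-≤ D 2^≤t)) (ℕP.≤-reflexive (trans (rot t D)
        (cong (t ℕ.^_) (e h))))
        where
        rot : ∀ t d → t ℕ.* (d ℕ.* t) ≡ t ℕ.* (t ℕ.* d)
        rot = solve-ℕ
        e : ∀ h → 2 ℕ.+ (h ℕ.+ 2) ≡ h ℕ.+ 4
        e = solve-ℕ

      W≤ : ∀ {y} → ι (t ℕ.^ (h ℕ.+ 4)) ≤ y → W ≤ y * q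
      W≤ {y} le = *-cancelˡ-≤ (ι t) (0<ι t) (begin
        ι t * W                              ≡⟨ trans (ι-* t _) (cong (ι t *_) (ι-* D _)) ⟨
        ι (t ℕ.* (D ℕ.* 2 ℕ.^ suc K))        ≤⟨ ≤-trans (ι-mono-≤ tD2^≤) le ⟩
        y                                    ≡⟨ trans (sym (*-identityˡ y))
          (trans (cong (_* y) (sym (ι*recip t))) (rearrange (ι t) q y)) ⟩
        ι t * (y * q)                        ∎)
        where
        open ≤-Reasoning
        rearrange : ∀ a b c → a * b * c ≡ a * (c * b)
        rearrange = solve 3 (λ a b c → a :* b :* c := a :* (c :* b)) refl

      ∑-bounded≤W : ∀ {R} (dpR : DistinctPrimes R) → All (t ℕ.^ i ℕ.≤_) R → ∑ (subs R) (bounded dpR D) ≤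
        W
      ∑-bounded≤W dpR R≥ = ∑-bounded-≤ dpR R≥ D K 2D<τ^K

      δs≤1 : ∀ {R} (S : Sub R) n → δs S n ≤ 1ℚ
      δs≤1 S n with δs-zero-or S n
      ... | inj₁ z       = ≤-trans (≤-reflexive z) 0≤1
      ... | inj₂ (o , _) = ≤-reflexive o

      ∣μ∣≤ : ∀ S → ∣ μ S ∣ ≤ bounded dpQ D S
      ∣μ∣≤ S = ≤-reflexive (trans (∣p*q∣≡∣p∣*∣q∣ (sign S) _)
        (trans (cong₂ _*_ (∣sign∣≡1 S) (0≤p⇒∣p∣≡p (0≤𝟙 (norm S ℕ.≤? D))))
        (*-identityˡ _)))

      -- Turán weights vanish beyond two primes, and two primes up to t ^ J have a product of at
      -- most t ^ (2J) ≤ D. So the Turán weight is a truncated divisor sum like `F`, and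
      -- equidistribution applies to it.
      ∣ν∣≤ : ∀ S → ∣ ν S ∣ ≤ bounded dpP D S
      ∣ν∣≤ S = go (norm S ℕ.≤? D)
        where
        go : Dec (norm S ℕ.≤ D) → ∣ ν S ∣ ≤ bounded dpP D S
        go (yes S≤D) = ≤-trans (∣weight∣≤1 0≤r 2r≤1 (size S))
          (≤-reflexive (sym (𝟙-yes (norm S ℕ.≤? D) S≤D)))
        go (no S≰D) = ≤-trans (≤-reflexive (trans (cong ∣_∣ (large (size S) refl)) (0≤p⇒∣p∣≡p ≤-refl)))
          (0≤𝟙 (norm S ℕ.≤? D))
          where
          small-size : size S ℕ.≤ 2 → norm S ℕ.≤ D
          small-size le = ℕP.≤-trans (norm≤^size P≤ S) (ℕP.≤-trans (ℕP.^-monoʳ-≤ (t ℕ.^ J) le)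
            (ℕP.≤-trans (ℕP.≤-reflexive (ℕP.^-*-assoc t J 2))
              (ℕP.^-monoʳ-≤ t (ℕP.≤-trans (ℕP.≤-reflexive (ℕP.*-comm J 2)) 2J≤))))
          large : ∀ k → k ≡ size S → weight k ≡ 0ℚ
          large (suc (suc (suc k))) _ = refl
          large 0 e = ⊥-elim (S≰D (small-size (subst (ℕ._≤ 2) e ℕ.z≤n)))
          large 1 e = ⊥-elim (S≰D (small-size (subst (ℕ._≤ 2) e (ℕ.s≤s ℕ.z≤n))))
          large 2 e = ⊥-elim (S≰D (small-size (subst (ℕ._≤ 2) e ℕP.≤-refl)))

      2x<t^K+2 : 2 ℕ.* x ℕ.< t ℕ.^ (2 ℕ.+ K)
      2x<t^K+2 = ℕP.≤-<-trans (ℕP.*-monoʳ-≤ 2 x≤) (ℕP.*-monoˡ-< (t ℕ.^ suc K) {{ℕP.m^n≢0 t (suc K)}}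
        (ℕP.<-≤-trans (ℕ.s≤s (ℕ.s≤s (ℕ.s≤s ℕ.z≤n))) 4≤t))

      -- For n ≠ 0 this is `truncation-error`, with |n| ≤ 2x < t ^ (K + 2), which is both t ^ i
      -- times `D` and at most (t ^ J) ^ κ. At 0, divisible by everything, only the trivial bound
      -- `W` is available.
      F≈free : ∀ n → ℤ.∣ n ∣ ℕ.≤ 2 ℕ.* x → ∣ F n - free Q n ∣ ≤ C * turán n + W * isZero n
      F≈free n ∣n∣≤2x = go (n ℤ.≟ ℤ.0ℤ)
        where
        at-zero : ∀ f s → f - (1ℚ - 1ℚ) * s ≡ f
        at-zero = solve 2 (λ f s → f :- ((con 1ℚ) :- (con 1ℚ)) :* s := f) refl
        off-zero : ∀ f s → f - (1ℚ - 0ℚ) * s ≡ f - s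
        off-zero = solve 2 (λ f s → f :- ((con 1ℚ) :- (con 0ℚ)) :* s := f :- s) refl
        go : Dec (n ≡ ℤ.0ℤ) → ∣ F n - free Q n ∣ ≤ C * turán n + W * isZero n
        go (yes n≡0) = begin
          ∣ F n - free Q n ∣
            ≡⟨ cong ∣_∣ (trans (cong (λ z → F n - (1ℚ - z) * sifted Q n) (𝟙-yes (n ℤ.≟ ℤ.0ℤ) n≡0))
              (at-zero (F n) (sifted Q n))) ⟩
          ∣ F n ∣
            ≤⟨ ≤-trans (∣∑∣≤ (subs Q) _) (∑-mono (subs Q) λ S → ≤-trans
              (≤-reflexive (trans (∣p*q∣≡∣p∣*∣q∣ (μ S) _)
                 (cong (∣ μ S ∣ *_) (0≤p⇒∣p∣≡p (0≤δs S n)))))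
                 (≤-trans (*-mono (0≤∣p∣ _) (0≤δs S n) (∣μ∣≤ S) (δs≤1 S n))
                   (≤-reflexive (*-identityʳ _)))) ⟩
          ∑ (subs Q) (bounded dpQ D)
            ≤⟨ ∑-bounded≤W dpQ Q≥i ⟩
          W
            ≡⟨ trans (cong (W *_) (𝟙-yes (n ℤ.≟ ℤ.0ℤ) n≡0)) (*-identityʳ W) ⟨
          W * isZero n
            ≤⟨ ≤-by (+-comm (C * turán n) _) (0≤* (0≤ι _) (0≤sq _)) ⟩
          C * turán n + W * isZero n ∎
          where open ≤-Reasoning
        go (no n≢0) = begin
          ∣ F n - free Q n ∣
            ≡⟨ cong ∣_∣ (trans (cong (λ z → F n - (1ℚ - z) * sifted Q n) (𝟙-no (n ℤ.≟ ℤ.0ℤ) n≢0))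
              (off-zero (F n) (sifted Q n))) ⟩
          ∣ F n - sifted Q n ∣
            ≤⟨ truncation-error dpP dpQ dp r rM≡1 1<t^i P≥ Q≥i (t ℕ.^ J) Q≥J κ n
                 (ℕP.<-≤-trans ∣n∣< (ℕP.≤-reflexive (trans (cong (t ℕ.^_) (e i h))
                   (ℕP.^-distribˡ-+-* t i (h ℕ.+ 2)))))
                 (ℕP.<-≤-trans ∣n∣< (ℕP.≤-trans (ℕP.^-monoʳ-≤ t K+2≤Jκ)
                   (ℕP.≤-reflexive (sym (ℕP.^-*-assoc t J κ))))) ⟩
          C * turán n
            ≤⟨ p≤p+q (0≤* (0≤* (0≤ι _) (0≤ι _)) (0≤𝟙 (n ℤ.≟ ℤ.0ℤ))) ⟩
          C * turán n + W * isZero n ∎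
          where
          open ≤-Reasoning
          instance
            n≢0′ : ℕ.NonZero ℤ.∣ n ∣
            n≢0′ = ℕ.≢-nonZero λ ∣n∣≡0 → n≢0 (ℤP.∣i∣≡0⇒i≡0 ∣n∣≡0)
          ∣n∣< = ℕP.≤-<-trans ∣n∣≤2x 2x<t^K+2
          e : ∀ i h → 2 ℕ.+ (i ℕ.+ h) ≡ i ℕ.+ (h ℕ.+ 2)
          e = solve-ℕ

      -- Not the exponent of the theorem but a relative error: `C` times the bound for the mean of
      -- the Turán weight.
      θ = C * (r + q)

    -- For the integers up to `x` no large sieve is required: every modulus has x / d multiples up
    -- to an error of 1, and `W` is small against `x`. This serves both for `F` and for the Turán
    -- weight that controls the passage from `F` to `free Q`.
    uniform : ∣ run x (free Q) (pos 1) - ι x * m ∣ ≤ ι x * (θ + q)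
    uniform = begin
      ∣ U - ι x * m ∣
        ≡⟨ cong ∣_∣ (regroup U (run x F (pos 1)) (ι x * m)) ⟩
      ∣ - (run x F (pos 1) - U) + (run x F (pos 1) - ι x * m) ∣
        ≤⟨ ∣p+q∣≤∣p∣+∣q∣ _ _ ⟩
      ∣ - (run x F (pos 1) - U) ∣ + ∣ run x F (pos 1) - ι x * m ∣
        ≤⟨ +-mono-≤ (≤-trans (≤-reflexive (∣-p∣≡∣p∣ _)) first) (≤-trans (counting dpQ Q≥i μ ∣μ∣≤) W≤x) ⟩
      C * (ι x * r + ι x * q) + ι x * q
        ≡⟨ collect C (ι x) r q ⟩
      ι x * (θ + q) ∎
      where
      open ≤-Reasoning
      U = run x (free Q) (pos 1)
      regroup : ∀ u f m → u - m ≡ - (f - u) + (f - m)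
      regroup = solve 3 (λ u f m → u :- m := :- (f :- u) :+ (f :- m)) refl
      collect : ∀ c x r q → c * (x * r + x * q) + x * q ≡ x * (c * (r + q) + q)
      collect = solve 4 (λ c x r q → c :* (x :* r :+ x :* q) :+ x :* q := x :* (c :* (r :+ q) :+ q))
        refl
      W≤x : W ≤ ι x * q
      W≤x = W≤ (ι-mono-≤ (ℕP.≤-trans (ℕP.^-monoʳ-≤ t (ℕP.≤-trans (ℕP.≤-reflexive (ℕP.+-comm h 4))
        (ℕP.+-monoˡ-≤ h 4≤i))) t^K≤x))
      counting : ∀ {R} (dpR : DistinctPrimes R) → All (t ℕ.^ i ℕ.≤_) R → ∀ ρ →
        (∀ S → ∣ ρ S ∣ ≤ bounded dpR D S) →
        ∣ run x (divisorSum dpR ρ) (pos 1) - ι x * mean dpR ρ ∣ ≤ W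
      counting {R} dpR R≥ ρ ∣ρ∣≤ = begin
        ∣ run x (divisorSum dpR ρ) (pos 1) - ι x * mean dpR ρ ∣
          ≡⟨ cong ∣_∣ (trans (cong₂ _-_ (trans (∑-swap (downFrom x) (subs R) _)
            (∑-cong (subs R) λ S → ∑-*ˡ (downFrom x) (ρ S) _))
               (sym (∑-*ˡ (subs R) (ι x) _))) (trans (sym (∑-- (subs R) _ _)) (∑-cong (subs R) λ S →
                 factor (ρ S) (run x (δs S) (pos 1)) (ι x) (inv S)))) ⟩
        ∣ ∑ (subs R) (λ S → ρ S * (run x (δs S) (pos 1) - ι x * inv S)) ∣
          ≤⟨ ≤-trans (∣∑∣≤ (subs R) _) (∑-mono (subs R) λ S → ≤-trans
            (≤-reflexive (∣p*q∣≡∣p∣*∣q∣ (ρ S) _))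
               (≤-trans (*-mono (0≤∣p∣ _) (0≤∣p∣ _) (∣ρ∣≤ S) (δs-count dpR S x (pos 1)))
                 (≤-reflexive (*-identityʳ _)))) ⟩
        ∑ (subs R) (bounded dpR D)
          ≤⟨ ∑-bounded≤W dpR R≥ ⟩
        W ∎
        where
        factor : ∀ a b c d → a * b - c * (a * d) ≡ a * (b - c * d)
        factor = solve 4 (λ a b c d → a :* b :- c :* (a :* d) := a :* (b :- c :* d)) refl
      turán-total : run x turán (pos 1) ≤ ι x * r + ι x * q
      turán-total = begin
        run x turán (pos 1)
          ≡⟨ run-cong x (pos 1) (λ n → sym (turán-divisorSum n)) ⟩
        run x (divisorSum dpP ν) (pos 1)
          ≡⟨ split (run x (divisorSum dpP ν) (pos 1)) (ι x * mean dpP ν) ⟩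
        ι x * mean dpP ν + (run x (divisorSum dpP ν) (pos 1) - ι x * mean dpP ν)
          ≤⟨ +-mono-≤ (*-monoˡ (ι x) (0≤ι x) (turán-mean 0≤r))
            (≤-trans (p≤∣p∣ _) (≤-trans (counting dpP P≥ ν ∣ν∣≤) W≤x)) ⟩
        ι x * r + ι x * q ∎
        where
        split : ∀ a b → a ≡ b + (a - b)
        split = solve 2 (λ a b → a := b :+ (a :- b)) refl
      first : ∣ run x F (pos 1) - U ∣ ≤ C * (ι x * r + ι x * q)
      first = begin
        ∣ run x F (pos 1) - U ∣
          ≡⟨ cong ∣_∣ (sym (∑-- (downFrom x) _ _)) ⟩
        ∣ ∑< x (λ k → F (pos (suc k)) - free Q (pos (suc k))) ∣
          ≤⟨ ≤-trans (∣∑∣≤ (downFrom x) _) (∑<-mono x λ k k<x → ≤-trans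
               (F≈free (pos (suc k)) (ℕP.≤-trans k<x (ℕP.m≤n*m x 2)))
                 (≤-reflexive (trans (cong (λ z → C * turán (pos (suc k)) + W * z)
                 (𝟙-no (pos (suc k) ℤ.≟ ℤ.0ℤ) λ ())) (drop C _ W)))) ⟩
        ∑< x (λ k → C * turán (pos (suc k)))
          ≡⟨ ∑-*ˡ (downFrom x) C _ ⟩
        C * run x turán (pos 1)
          ≤⟨ *-monoˡ C (0≤ι _) turán-total ⟩
        C * (ι x * r + ι x * q) ∎
        where
        drop : ∀ c u w → c * u + w * 0ℚ ≡ c * u
        drop = solve 3 (λ c u w → c :* u :+ w :* (con 0ℚ) := c :* u) refl

    module _
      {α β : ℕ → ℚ} (wα : Weight x α) (wβ : Weight x β)
      (A≥ : ι (t ℕ.^ (h ℕ.+ 7)) ≤ ∑< x α) (B≥ : ι (t ℕ.^ (h ℕ.+ 7)) ≤ ∑< x β)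
      (b : ℕ → ℤ) (b-δ : ∀ p i j → δ p (b i ℤ.- b j) ≡ δ p (pos i ℤ.- pos j))
      (b-injective : ∀ i j → b i ≡ b j → i ≡ j) (∣b∣≤ : ∀ j → j ℕ.< x → ℤ.∣ b j ∣ ℕ.≤ x)
      where

      private
        A = ∑< x α
        B = ∑< x β
        0≤A = ∑-nonneg (downFrom x) (Weight.0≤β wα)
        0≤B = ∑-nonneg (downFrom x) (Weight.0≤β wβ)
        0≤AB = 0≤* 0≤A 0≤B
        average-over : (ℤ → ℚ) → ℚ
        average-over f = ∑∑ x λ i j → α i * β j * f (pos (suc i) ℤ.+ b j)

        zeros : ∀ y n → ∑< y (λ j → isZero (n ℤ.+ b j)) ≤ 1ℚ
        zeros zero    n = 0≤1
        zeros (suc y) n = go (n ℤ.+ b y ℤ.≟ ℤ.0ℤ)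
          where
          go : Dec (n ℤ.+ b y ≡ ℤ.0ℤ) → isZero (n ℤ.+ b y) + ∑< y (λ j → isZero (n ℤ.+ b j)) ≤ 1ℚ
          go (no ≢0) = ≤-trans (≤-reflexive
            (trans (cong (_+ ∑< y (λ j → isZero (n ℤ.+ b j))) (𝟙-no (n ℤ.+ b y ℤ.≟ ℤ.0ℤ) ≢0))
            (+-identityˡ _))) (zeros y n)
          go (yes ≡0) = ≤-reflexive
            (trans (cong₂ _+_ (𝟙-yes (n ℤ.+ b y ℤ.≟ ℤ.0ℤ) ≡0) (trans (∑<-cong y λ j j<y →
            𝟙-no (n ℤ.+ b j ℤ.≟ ℤ.0ℤ) λ ≡0′ → ℕP.<⇒≢ j<y
              (b-injective j y (+-cancelˡ n (b j) (b y) (trans ≡0′ (sym ≡0)))))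
            (∑-0 (downFrom y)))) (+-identityʳ 1ℚ))

        -- By injectivity of `b`, every `i` has at most one `j` with sum 0. The factor `W` that such
        -- a pair costs is at most B / t, so these pairs are harmless.
        zero-total : average-over isZero ≤ A
        zero-total = ∑-mono (downFrom x) λ i → begin
          ∑< x (λ j → α i * β j * isZero (pos (suc i) ℤ.+ b j))
            ≤⟨ ∑-mono (downFrom x) (λ j → *-monoʳ _ (0≤𝟙 (pos (suc i) ℤ.+ b j ℤ.≟ ℤ.0ℤ))
              (≤-trans (*-monoˡ (α i) (Weight.0≤β wα i) (Weight.β≤1 wβ j))
                 (≤-reflexive (*-identityʳ (α i))))) ⟩
          ∑< x (λ j → α i * isZero (pos (suc i) ℤ.+ b j))
            ≡⟨ ∑-*ˡ (downFrom x) (α i) _ ⟩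
          α i * ∑< x (λ j → isZero (pos (suc i) ℤ.+ b j))
            ≤⟨ *-monoˡ (α i) (Weight.0≤β wα i) (zeros x (pos (suc i))) ⟩
          α i * 1ℚ
            ≡⟨ *-identityʳ (α i) ⟩
          α i ∎
          where open ≤-Reasoning

        -- The mean of the Turán weight is at most `r`; the deviation of its average over the sums
        -- from this mean is at most `q * (A * B)` by `equidistribution`.
        turán-average : average-over turán ≤ (A * B) * (r + q)
        turán-average = begin
          average-over turán
            ≡⟨ ∑-cong (downFrom x) (λ i → ∑-cong (downFrom x) λ j → cong (α i * β j *_)
              (sym (turán-divisorSum _))) ⟩
          average-over (divisorSum dpP ν)
            ≡⟨ split (average-over (divisorSum dpP ν)) (A * B * mean dpP ν) ⟩
          A * B * mean dpP ν + (average-over (divisorSum dpP ν) - A * B * mean dpP ν)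
            ≤⟨ +-mono-≤ (*-monoˡ (A * B) 0≤AB (turán-mean 0≤r)) (≤-trans (p≤∣p∣ _)
                 (equidistribution dpP t i h 4≤i i≤h P≥ 4^≤t margin≤t x x≤ wα wβ A≥ B≥ b b-δ ν ∣ν∣≤)) ⟩
          A * B * r + q * (A * B)
            ≡⟨ collect (A * B) r q ⟩
          (A * B) * (r + q) ∎
          where
          open ≤-Reasoning
          split : ∀ a b → a ≡ b + (a - b)
          split = solve 2 (λ a b → a := b :+ (a :- b)) refl
          collect : ∀ a r q → a * r + q * a ≡ a * (r + q)
          collect = solve 3 (λ a r q → a :* r :+ q :* a := a :* (r :+ q)) refl

        first : ∣ average-over F - average-over (free Q) ∣ ≤ (A * B) * (θ + q)
        first = begin
          ∣ average-over F - average-over (free Q) ∣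
            ≡⟨ cong ∣_∣ (trans (sym (∑-- (downFrom x) _ _)) (∑-cong (downFrom x) λ i → trans
              (sym (∑-- (downFrom x) _ _))
                 (∑-cong (downFrom x) λ j → sym (distrib (α i * β j) _ _)))) ⟩
          ∣ average-over (λ n → F n - free Q n) ∣
            ≤⟨ ≤-trans (∣∑∣≤ (downFrom x) _) (∑<-mono x λ i i<x → ≤-trans (∣∑∣≤ (downFrom x) _)
              (∑<-mono x λ j j<x →
                 ≤-trans (≤-reflexive (trans (∣p*q∣≡∣p∣*∣q∣ (α i * β j) _)
                   (cong (_* ∣ _ ∣) (0≤p⇒∣p∣≡p (0≤αβ i j)))))
                   (*-monoˡ (α i * β j) (0≤αβ i j) (F≈free (pos (suc i) ℤ.+ b j)
                     (∣sum∣≤ i j i<x j<x))))) ⟩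
          average-over (λ n → C * turán n + W * isZero n)
            ≡⟨ trans (∑-cong (downFrom x) λ i → trans (∑-cong (downFrom x) λ j → expand (α i * β j) C _
              W _) (∑-+ (downFrom x) _ _))
                 (trans (∑-+ (downFrom x) _ _) (cong₂ _+_ (pull C turán) (pull W isZero))) ⟩
          C * average-over turán + W * average-over isZero
            ≤⟨ +-mono-≤ (*-monoˡ C (0≤ι _) turán-average) (*-mono (0≤* (0≤ι _) (0≤ι _)) 0≤zeros
              (W≤ (≤-trans
                 (ι-mono-≤ (ℕP.^-monoʳ-≤ t (ℕP.+-monoʳ-≤ h (ℕP.m≤m+n 4 3)))) B≥)) zero-total) ⟩
          C * ((A * B) * (r + q)) + B * q * A
            ≡⟨ collect C A B r q ⟩
          (A * B) * (θ + q) ∎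
          where
          open ≤-Reasoning
          0≤αβ : ∀ i j → 0ℚ ≤ α i * β j
          0≤αβ i j = 0≤* (Weight.0≤β wα i) (Weight.0≤β wβ j)
          0≤zeros : 0ℚ ≤ average-over isZero
          0≤zeros = ∑-nonneg (downFrom x) λ i → ∑-nonneg (downFrom x) λ j → 0≤* (0≤αβ i j)
            (0≤𝟙 (pos (suc i) ℤ.+ b j ℤ.≟ ℤ.0ℤ))
          ∣sum∣≤ : ∀ i j → i ℕ.< x → j ℕ.< x → ℤ.∣ pos (suc i) ℤ.+ b j ∣ ℕ.≤ 2 ℕ.* x
          ∣sum∣≤ i j i<x j<x = ℕP.≤-trans (ℤP.∣i+j∣≤∣i∣+∣j∣ (pos (suc i)) (b j))
            (ℕP.≤-trans (ℕP.+-mono-≤ i<x (∣b∣≤ j j<x))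
            (ℕP.≤-reflexive (cong (x ℕ.+_) (sym (ℕP.+-identityʳ x)))))
          pull : ∀ k f → ∑∑ x (λ i j → k * (α i * β j * f (pos (suc i) ℤ.+ b j))) ≡ k * average-over f
          pull k f = trans (∑-cong (downFrom x) λ i → ∑-*ˡ (downFrom x) k _) (∑-*ˡ (downFrom x) k _)
          distrib : ∀ a f g → a * (f - g) ≡ a * f - a * g
          distrib = solve 3 (λ a f g → a :* (f :- g) := a :* f :- a :* g) refl
          expand : ∀ a c u w v → a * (c * u + w * v) ≡ c * (a * u) + w * (a * v)
          expand = solve 5 (λ a c u w v → a :* (c :* u :+ w :* v) := c :* (a :* u) :+ w :* (a :* v))
            refl
          collect : ∀ c a b r q → c * ((a * b) * (r + q)) + b * q * a ≡ (a * b) * (c * (r + q) + q)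
          collect = solve 5 (λ c a b r q → c :* ((a :* b) :* (r :+ q)) :+ b :* q :* a := (a :* b) :*
            (c :* (r :+ q) :+ q)) refl

      sums : ∣ average-over (free Q) - (A * B) * m ∣ ≤ (A * B) * (θ + q + q)
      sums = begin
        ∣ S - (A * B) * m ∣
          ≡⟨ cong ∣_∣ (regroup S (average-over F) ((A * B) * m)) ⟩
        ∣ - (average-over F - S) + (average-over F - (A * B) * m) ∣
          ≤⟨ ∣p+q∣≤∣p∣+∣q∣ _ _ ⟩
        ∣ - (average-over F - S) ∣ + ∣ average-over F - (A * B) * m ∣
          ≤⟨ +-mono-≤ (≤-trans (≤-reflexive (∣-p∣≡∣p∣ _)) first)
               (equidistribution dpQ t i h 4≤i i≤h Q≥i 4^≤t margin≤t x x≤ wα wβ A≥ B≥ b b-δ μ ∣μ∣≤) ⟩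
        (A * B) * (θ + q) + q * (A * B)
          ≡⟨ collect (A * B) θ q ⟩
        (A * B) * (θ + q + q) ∎
        where
        open ≤-Reasoning
        S = average-over (free Q)
        regroup : ∀ u f m → u - m ≡ - (f - u) + (f - m)
        regroup = solve 3 (λ u f m → u :- m := :- (f :- u) :+ (f :- m)) refl
        collect : ∀ a u q → a * (u + q) + q * a ≡ a * (u + q + q)
        collect = solve 3 (λ a u q → a :* (u :+ q) :+ q :* a := a :* (u :+ q :+ q)) refl

      -- Cross multiplication eliminates the common mean `m`: the left side is `ι x` times the error
      -- for the sums minus `A * B` times the error for the integers.
      comparison : ∣ ι x * ∑∑ x (λ i j → α i * β j * free Q (pos (suc i) ℤ.+ b j)) - (A * B) * run x
        (free Q) (pos 1) ∣
        ≤ ι x * (A * B) * (2ℚ * (ι (2 ℕ.^ κ) * (r + recip t)) + (recip t + recip t + recip t))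
      comparison = begin
        ∣ ι x * S - (A * B) * U ∣
          ≡⟨ cong ∣_∣ (regroup (ι x) S (A * B) m U) ⟩
        ∣ ι x * (S - (A * B) * m) - (A * B) * (U - ι x * m) ∣
          ≤⟨ ∣p-q∣≤∣p∣+∣q∣ _ _ ⟩
        ∣ ι x * (S - (A * B) * m) ∣ + ∣ (A * B) * (U - ι x * m) ∣
          ≡⟨ cong₂ _+_ (trans (∣p*q∣≡∣p∣*∣q∣ (ι x) _) (cong (_* ∣ S - (A * B) * m ∣)
            (0≤p⇒∣p∣≡p (0≤ι x))))
               (trans (∣p*q∣≡∣p∣*∣q∣ (A * B) _) (cong (_* ∣ U - ι x * m ∣) (0≤p⇒∣p∣≡p 0≤AB))) ⟩
        ι x * ∣ S - (A * B) * m ∣ + (A * B) * ∣ U - ι x * m ∣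
          ≤⟨ +-mono-≤ (*-monoˡ (ι x) (0≤ι x) sums) (*-monoˡ (A * B) 0≤AB uniform) ⟩
        ι x * ((A * B) * (θ + q + q)) + (A * B) * (ι x * (θ + q))
          ≡⟨ collect (ι x) (A * B) θ q ⟩
        ι x * (A * B) * (2ℚ * θ + (q + q + q)) ∎
        where
        open ≤-Reasoning
        S = average-over (free Q)
        U = run x (free Q) (pos 1)
        regroup : ∀ x s a m u → x * s - a * u ≡ x * (s - a * m) - a * (u - x * m)
        regroup = solve 5 (λ x s a m u → x :* s :- a :* u := x :* (s :- a :* m) :- a :* (u :- x :* m))
          refl
        collect : ∀ x a u q → x * (a * (u + q + q)) + a * (x * (u + q)) ≡ x * a * (2ℚ * u + (q + q + q))
        collect = solve 4 (λ x a u q → x :* (a :* (u :+ q :+ q)) :+ a :* (x :* (u :+ q)) := x :* a :*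
          ((con 2ℚ) :* u :+ (q :+ q :+ q))) refl

-- Choice of the parameters

module Parameters where

  open Rat
  open Sums
  open Average
  open Kernel
  open Subsets using (DistinctPrimes; Sub)
  open LargeSieve
  open Levels using (ι*-≤1⇒≤recip)
  open PrimeSums
  open Comparison

  opaque
    unfolding _*_

    inverse : ∀ M → 0ℚ < M → ∃ λ r → r * M ≡ 1ℚ × 0ℚ < r
    inverse M 0<M = (ℚ.1/ M) {{M≢0}} , ℚP.*-inverseˡ M {{M≢0}} ,
      ℚP.positive⁻¹ _ {{ℚP.1/pos⇒pos M {{ℚ.positive 0<M}}}}
      where
      M≢0 : ℚ.NonZero M
      M≢0 = ℚP.pos⇒nonZero M {{ℚ.positive 0<M}}

  ^-distribʳ-* : ∀ a b n → (a ℕ.* b) ℕ.^ n ≡ a ℕ.^ n ℕ.* b ℕ.^ n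
  ^-distribʳ-* a b zero    = refl
  ^-distribʳ-* a b (suc n) = trans (cong (a ℕ.* b ℕ.*_) (^-distribʳ-* a b n))
    (regroup a b (a ℕ.^ n) (b ℕ.^ n))
    where
    regroup : ∀ a b c d → a ℕ.* b ℕ.* (c ℕ.* d) ≡ a ℕ.* c ℕ.* (b ℕ.* d)
    regroup = solve-ℕ

  -- The exponents for the scale x ≈ t ^ K. All bad primes exceed t ^ J = t ^ (K / v),
  -- all test primes lie in (t ^ 8, t ^ J].
  module _ (v G : ℕ) where

    κ s J K : ℕ
    -- Then t ^ (J κ) = t ^ (K + J) exceeds 2x, so a nonzero integer in question has at most `v`
    -- prime factors above t ^ J.
    κ = suc v
    -- As each of the `s` intervals contributes 1 / 8, the reciprocal sum of the test primes is at
    -- least 4 · 2 ^ κ · G.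
    s = 32 ℕ.* (2 ℕ.^ κ ℕ.* G)
    J = 8 ℕ.* 65 ℕ.^ s
    K = v ℕ.* J

    -- The first two summands absorb the constants in the treatment of a single level; the last
    -- makes the terms with `recip t` smaller than half of the admissible error.
    t₀ : ℕ
    t₀ = 4 ℕ.^ (K ℕ.+ 2) ℕ.+ 2 ℕ.* K ℕ.* (2 ℕ.^ suc K ℕ.* suc (8 ℕ.* K ℕ.+ 3)) ℕ.+ 10 ℕ.*
      (2 ℕ.^ κ ℕ.* G)

    module _ (3≤v : 3 ℕ.≤ v) .{{G≢0 : ℕ.NonZero G}} where

      private
        instance
          65^s≢0 : ℕ.NonZero (65 ℕ.^ s)
          65^s≢0 = ℕP.m^n≢0 65 s
          2^κ≢0 : ℕ.NonZero (2 ℕ.^ κ)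
          2^κ≢0 = ℕP.m^n≢0 2 κ

        8≤J : 8 ℕ.≤ J
        8≤J = ℕP.m≤m*n 8 (65 ℕ.^ s)

        3J≤K : 3 ℕ.* J ℕ.≤ K
        3J≤K = ℕP.*-monoˡ-≤ J 3≤v

        h : ℕ
        h = K ℕ.∸ 8

        8≤K : 8 ℕ.≤ K
        8≤K = ℕP.≤-trans 8≤J (ℕP.≤-trans (ℕP.m≤n*m J 3) 3J≤K)

        8+h≡K : 8 ℕ.+ h ≡ K
        8+h≡K = ℕP.m+[n∸m]≡n 8≤K

        2J≤h : 2 ℕ.* J ℕ.≤ h
        2J≤h = ℕP.+-cancelˡ-≤ 8 (2 ℕ.* J) h (ℕP.≤-trans (ℕP.+-monoˡ-≤ (2 ℕ.* J) 8≤J)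
          (ℕP.≤-trans (ℕP.≤-reflexive (e J)) (ℕP.≤-trans 3J≤K (ℕP.≤-reflexive (sym 8+h≡K)))))
          where
          e : ∀ j → j ℕ.+ 2 ℕ.* j ≡ 3 ℕ.* j
          e = solve-ℕ

        8≤h : 8 ℕ.≤ h
        8≤h = ℕP.≤-trans 8≤J (ℕP.≤-trans (ℕP.m≤n*m J 2) 2J≤h)

      -- The sets must have t ^ (h + 7) elements, and 8 is the least value of `i` for which this
      -- stays below t ^ (i + h): hence the 8 in `J` and in `h`.
      K-1≡ : K ℕ.∸ 1 ≡ h ℕ.+ 7
      K-1≡ = trans (cong (ℕ._∸ 1) (sym 8+h≡K)) (ℕP.+-comm 7 h)

      module _ (t : ℕ) (t₀≤t : t₀ ℕ.≤ t) (x : ℕ) (t^K≤x : t ℕ.^ K ℕ.≤ x) (x<[1+t]^K : x ℕ.< suc t ℕ.^ K) where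

        private
          c = 2 ℕ.^ κ ℕ.* G
          instance
            c≢0 : ℕ.NonZero c
            c≢0 = ℕP.m*n≢0 (2 ℕ.^ κ) G

          4^≤t : 4 ℕ.^ (K ℕ.+ 2) ℕ.≤ t
          4^≤t = ℕP.≤-trans (ℕP.≤-trans (ℕP.m≤m+n _ _) (ℕP.m≤m+n _ _)) t₀≤t

          margin≤t : 2 ℕ.* K ℕ.* (2 ℕ.^ suc K ℕ.* suc (8 ℕ.* K ℕ.+ 3)) ℕ.≤ t
          margin≤t = ℕP.≤-trans (ℕP.≤-trans (ℕP.m≤n+m _ (4 ℕ.^ (K ℕ.+ 2))) (ℕP.m≤m+n _ _)) t₀≤t

          10c≤t : 10 ℕ.* c ℕ.≤ t
          10c≤t = ℕP.≤-trans (ℕP.m≤n+m (10 ℕ.* c) (4 ℕ.^ (K ℕ.+ 2) ℕ.+ 2 ℕ.* K ℕ.*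
            (2 ℕ.^ suc K ℕ.* suc (8 ℕ.* K ℕ.+ 3)))) t₀≤t

          4≤t : 4 ℕ.≤ t
          4≤t = ℕP.≤-trans (ℕP.^-monoʳ-≤ 4 {1} {K ℕ.+ 2} (ℕP.≤-trans (ℕ.s≤s ℕ.z≤n) (ℕP.m≤n+m 2 K))) 4^≤t

          instance
            t≢0 : ℕ.NonZero t
            t≢0 = ℕ.>-nonZero (ℕP.<-≤-trans (ℕ.s≤s ℕ.z≤n) 4≤t)

          x≤ : x ℕ.≤ t ℕ.^ suc K
          x≤ = begin
            x                                   <⟨ x<[1+t]^K ⟩
            suc t ℕ.^ K
              ≤⟨ ℕP.^-monoˡ-≤ K (ℕP.≤-trans (ℕP.+-monoˡ-≤ t (ℕP.<-≤-trans (ℕ.s≤s ℕ.z≤n) 4≤t))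
                                                     (ℕP.≤-reflexive (cong (t ℕ.+_)
                                                       (sym (ℕP.+-identityʳ t))))) ⟩
            (2 ℕ.* t) ℕ.^ K                     ≡⟨ ^-distribʳ-* 2 t K ⟩
            2 ℕ.^ K ℕ.* t ℕ.^ K                 ≤⟨ ℕP.*-monoˡ-≤ (t ℕ.^ K) (ℕP.≤-trans (ℕP.≤-trans
                                                     (ℕP.^-monoˡ-≤ K {2} {4} (ℕ.s≤s (ℕ.s≤s ℕ.z≤n)))
                                                     (ℕP.^-monoʳ-≤ 4 (ℕP.m≤m+n K 2))) 4^≤t) ⟩
            t ℕ.^ suc K                         ∎
            where open ℕP.≤-Reasoning

          z : ℕ
          z = t ℕ.^ 8

          16≤z : 16 ℕ.≤ z
          16≤z = ℕP.≤-trans (ℕP.^-monoˡ-≤ 2 4≤t) (ℕP.^-monoʳ-≤ t {2} {8} (ℕ.s≤s (ℕ.s≤s ℕ.z≤n)))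

          P : List ℕ
          P = primesUpTo (z ℕ.<?_) (z ℕ.^ (65 ℕ.^ s))

          z^≡ : z ℕ.^ (65 ℕ.^ s) ≡ t ℕ.^ J
          z^≡ = ℕP.^-*-assoc t 8 (65 ℕ.^ s)

          dpP = primesUpTo-distinct (z ℕ.<?_) (z ℕ.^ (65 ℕ.^ s))

          M = ∑ P recip

          M≥ : ι (4 ℕ.* c) ≤ M
          M≥ = *-cancelˡ-≤ (2ℚ * 2ℚ * 2ℚ) (0<* (0<* 0<2 0<2) 0<2) (≤-trans (≤-reflexive
            (trans (cong (_* ι (4 ℕ.* c)) (sym ι8)) (trans (sym (ι-* 8 (4 ℕ.* c)))
              (cong ι (sym (ℕP.*-assoc 8 4 c))))))
            (≤-trans (∑recip-≥ z 16≤z s) (≤-reflexive (reassociate M))))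
            where
            reassociate : ∀ m → 2ℚ * (2ℚ * (2ℚ * m)) ≡ 2ℚ * 2ℚ * 2ℚ * m
            reassociate = solve 1 (λ m → (con 2ℚ) :* ((con 2ℚ) :* ((con 2ℚ) :* m)) := (con 2ℚ) :*
              (con 2ℚ) :* (con 2ℚ) :* m) refl

          4c≢0 : ℕ.NonZero (4 ℕ.* c)
          4c≢0 = ℕP.m*n≢0 4 c

          inv-M = inverse M (<-≤-trans (0<ι (4 ℕ.* c) {{4c≢0}}) M≥)
          r = proj₁ inv-M
          rM≡1 = proj₁ (proj₂ inv-M)
          0≤r = <⇒≤ (proj₂ (proj₂ inv-M))

          4cr≤1 : ι (4 ℕ.* c) * r ≤ 1ℚ
          4cr≤1 = ≤-trans (*-monoʳ r 0≤r M≥) (≤-reflexive (trans (*-comm M r) rM≡1))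

          2r≤1 : 2ℚ * r ≤ 1ℚ
          2r≤1 = ≤-trans (*-monoʳ r 0≤r (≤-trans (≤-reflexive (sym ι2))
            (ι-mono-≤ (ℕP.≤-trans {2} {4} (ℕ.s≤s (ℕ.s≤s ℕ.z≤n))
            (ℕP.m≤m*n 4 c))))) 4cr≤1

        module _ {D : ℕ → Set} (D? : Decidable D) (D-large : ∀ p → D p → t ℕ.^ J ℕ.< p) (bound : ℕ) where

          private
            Q = primesUpTo D? bound
            dpQ = primesUpTo-distinct D? bound

            t^8≤t^J : t ℕ.^ 8 ℕ.≤ t ℕ.^ J
            t^8≤t^J = ℕP.^-monoʳ-≤ t 8≤J

            Q≥J : All (t ℕ.^ J ℕ.≤_) Q
            Q≥J = All.tabulate λ {p} p∈ → ℕP.<⇒≤ (D-large p (proj₁ (proj₂ (∈-primesUpTo⁻ D? bound p∈))))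

            P≤ : All (ℕ._≤ t ℕ.^ J) P
            P≤ = All.tabulate λ {p} p∈ → ℕP.≤-trans (proj₂ (proj₂ (∈-primesUpTo⁻ (z ℕ.<?_) (z ℕ.^ (65 ℕ.^ s)) p∈))) (ℕP.≤-reflexive z^≡)

            dp : DistinctPrimes (P ++ Q)
            dp = AllP.++⁺ (proj₁ dpP) (proj₁ dpQ) , UniqueP.++⁺ (proj₂ dpP) (proj₂ dpQ) λ {p} (p∈P , p∈Q) →
              ℕP.<⇒≱ (D-large p (proj₁ (proj₂ (∈-primesUpTo⁻ D? bound p∈Q)))) (All.lookup P≤ p∈P)

          sieve : ∀ {α β} → Weight x α → Weight x β →
            ι (t ℕ.^ (K ℕ.∸ 1)) ≤ ∑< x α → ι (t ℕ.^ (K ℕ.∸ 1)) ≤ ∑< x β →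
            ∀ b → (∀ p i j → δ p (b i ℤ.- b j) ≡ δ p (pos i ℤ.- pos j)) →
            (∀ i j → b i ≡ b j → i ≡ j) → (∀ j → j ℕ.< x → ℤ.∣ b j ∣ ℕ.≤ x) →
            ∣ ι x * ∑∑ x (λ i j → α i * β j * free Q (pos (suc i) ℤ.+ b j)) - (∑< x α * ∑< x β) * run x
              (free Q) (pos 1) ∣
              ≤ ι x * (∑< x α * ∑< x β) * recip G
          sieve {α} {β} wα wβ A≥ B≥ b b-δ b-inj ∣b∣≤ = ≤-trans
            (comparison t 8 h J κ (ℕ.s≤s (ℕ.s≤s (ℕ.s≤s (ℕ.s≤s ℕ.z≤n)))) 8≤h
              (ℕP.≤-trans 2J≤h (ℕP.m≤m+n h 2)) K+2≤Jκ
              (subst (λ k → 4 ℕ.^ (k ℕ.+ 2) ℕ.≤ t) (sym 8+h≡K) 4^≤t)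
              (subst (λ k → 2 ℕ.* k ℕ.* (2 ℕ.^ suc k ℕ.* suc (8 ℕ.* k ℕ.+ 3)) ℕ.≤ t) (sym 8+h≡K)
                margin≤t)
              x (subst (λ k → t ℕ.^ k ℕ.≤ x) (sym 8+h≡K) t^K≤x) (subst (λ k → x ℕ.≤ t ℕ.^ suc k)
                (sym 8+h≡K) x≤)
              dpP dpQ dp
              (All.tabulate λ {p} p∈ → ℕP.<⇒≤ (proj₁ (proj₂ (∈-primesUpTo⁻ (z ℕ.<?_) (z ℕ.^ (65 ℕ.^ s)) p∈)))) P≤
              (All.map (ℕP.≤-trans t^8≤t^J) Q≥J) Q≥J r rM≡1 0≤r 2r≤1
              wα wβ (subst (λ k → ι (t ℕ.^ k) ≤ ∑< x α) K-1≡ A≥) (subst (λ k → ι (t ℕ.^ k) ≤ ∑< x β)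
                K-1≡ B≥) b b-δ b-inj ∣b∣≤)
            (*-monoˡ (ι x * (∑< x α * ∑< x β)) (0≤* (0≤ι x) (0≤* (∑-nonneg (downFrom x) (Weight.0≤β wα))
              (∑-nonneg (downFrom x) (Weight.0≤β wβ)))) margin)
            where
            K+2≤Jκ : 2 ℕ.+ (8 ℕ.+ h) ℕ.≤ J ℕ.* κ
            K+2≤Jκ = ℕP.≤-trans (ℕP.+-mono-≤ (ℕP.≤-trans (ℕ.s≤s (ℕ.s≤s ℕ.z≤n)) 8≤J)
              (ℕP.≤-reflexive 8+h≡K))
              (ℕP.≤-reflexive (trans (cong (J ℕ.+_) (ℕP.*-comm v J)) (sym (ℕP.*-suc J v))))
            C = ι (2 ℕ.^ κ)
            q = recip t
            g = ι G
            1≤C : 1ℚ ≤ C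
            1≤C = ≤-trans (≤-reflexive (sym ι1)) (ι-mono-≤ (ℕ.>-nonZero⁻¹ (2 ℕ.^ κ)))
            10cq≤1 : ι (10 ℕ.* c) * q ≤ 1ℚ
            10cq≤1 = ≤-trans (*-monoʳ q (0≤recip t) (ι-mono-≤ 10c≤t)) (≤-reflexive (ι*recip t))
            -- Half of 1 / G is reserved for the terms with `r`, through `4cr≤1`, and half for those
            -- with `q`, through `10cq≤1`.
            margin : 2ℚ * (C * (r + q)) + (q + q + q) ≤ recip G
            margin = ι*-≤1⇒≤recip {G} (*-cancelˡ-≤ 2ℚ 0<2 (begin
              2ℚ * (g * (2ℚ * (C * (r + q)) + (q + q + q)))
                ≤⟨ *-monoˡ 2ℚ (<⇒≤ 0<2) (*-monoˡ g (0≤ι G) (+-monoʳ-≤ (2ℚ * (C * (r + q)))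
                  (≤-trans (≤-reflexive (sym (*-identityˡ _)))
                     (*-monoʳ (q + q + q) (0≤+ (0≤+ (0≤recip t) (0≤recip t)) (0≤recip t)) 1≤C)))) ⟩
              2ℚ * (g * (2ℚ * (C * (r + q)) + C * (q + q + q)))
                ≡⟨ expand C g r q ⟩
              (2ℚ * 2ℚ) * (C * g) * r + (2ℚ * 2ℚ * 2ℚ + 2ℚ) * (C * g) * q
                ≡⟨ cong₂ (λ y w → y * r + w * q)
                     (trans (cong₂ _*_ (sym ι4) (sym (ι-* (2 ℕ.^ κ) G))) (sym (ι-* 4 c)))
                     (trans (cong₂ _*_ (sym ι10) (sym (ι-* (2 ℕ.^ κ) G))) (sym (ι-* 10 c))) ⟩
              ι (4 ℕ.* c) * r + ι (10 ℕ.* c) * q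
                ≤⟨ +-mono-≤ 4cr≤1 10cq≤1 ⟩
              1ℚ + 1ℚ
                ≡⟨ two 1ℚ ⟩
              2ℚ * 1ℚ ∎))
              where
              open ≤-Reasoning
              expand : ∀ c g r q → 2ℚ * (g * (2ℚ * (c * (r + q)) + c * (q + q + q))) ≡ (2ℚ * 2ℚ) *
                (c * g) * r + (2ℚ * 2ℚ * 2ℚ + 2ℚ) * (c * g) * q
              expand = solve 4 (λ c g r q → (con 2ℚ) :*
                (g :* ((con 2ℚ) :* (c :* (r :+ q)) :+ c :* (q :+ q :+ q))) := ((con 2ℚ) :* (con 2ℚ)) :*
                  (c :* g) :* r :+ ((con 2ℚ) :* (con 2ℚ) :* (con 2ℚ) :+ (con 2ℚ)) :* (c :* g) :* q) refl
              two : ∀ a → 1ℚ + 1ℚ ≡ 2ℚ * 1ℚ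
              two = solve 1 (λ a → (con 1ℚ) :+ (con 1ℚ) := (con 2ℚ) :* (con 1ℚ)) refl

-- From cardinalities to sums of indicator values

module Counting where

  open Rat
  open Sums
  open LargeSieve
  open Truncation using (sifted)

  private variable
    X Y : Set

  unique-⊆-length : ∀ {xs ys : List X} → Unique xs → (∀ {x} → x ∈ xs → x ∈ ys) → length xs ℕ.≤ length ys
  unique-⊆-length []                  sub = ℕ.z≤n
  unique-⊆-length {xs = x ∷ xs} (≢s ∷ unique) sub with ∈-∃++ (sub (here refl))
  ... | as , bs , refl = ℕP.≤-trans (ℕ.s≤s (unique-⊆-length unique sub′)) (ℕP.≤-reflexive (sym length≡))
    where
    length≡ : length (as ++ x ∷ bs) ≡ suc (length (as ++ bs))
    length≡ = trans (ListP.length-++ as) (trans (ℕP.+-suc (length as) (length bs))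
      (cong suc (sym (ListP.length-++ as))))
    sub′ : ∀ {y} → y ∈ xs → y ∈ as ++ bs
    sub′ {y} y∈ with ∈-++⁻ as (sub (there y∈))
    ... | inj₁ y∈as          = ∈-++⁺ˡ y∈as
    ... | inj₂ (there y∈bs)  = ∈-++⁺ʳ as y∈bs
    ... | inj₂ (here refl)   = ⊥-elim (All.lookup ≢s y∈ refl)

  ι-length-filter : ∀ {R : X → Set} (R? : Decidable R) xs → ι (length (filter R? xs)) ≡ ∑ xs λ x → 𝟙
    (R? x)
  ι-length-filter R? []       = ι0
  ι-length-filter R? (x ∷ xs) with R? x
  ... | yes _ = trans (ι-suc _) (cong (1ℚ +_) (ι-length-filter R? xs))
  ... | no  _ = trans (ι-length-filter R? xs) (sym (+-identityˡ _))

  -- Bundles a decision of `R x` with the corresponding value of `v`. The decision and the value are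
  -- obtained from the same case distinction, and `v` remains a formula that can be summed.
  Indicates : (X → Set) → (X → ℚ) → Set
  Indicates R v = ∀ x → (R x × v x ≡ 1ℚ) ⊎ (¬ R x × v x ≡ 0ℚ)

  module _ {R : X → Set} {v : X → ℚ} (ind : Indicates R v) where

    indicates⇒dec : Decidable R
    indicates⇒dec x with ind x
    ... | inj₁ (r , _)  = yes r
    ... | inj₂ (¬r , _) = no ¬r

    indicates⇒𝟙 : ∀ x → 𝟙 (indicates⇒dec x) ≡ v x
    indicates⇒𝟙 x with ind x
    ... | inj₁ (_ , v≡1) = sym v≡1
    ... | inj₂ (_ , v≡0) = sym v≡0

    ι-length-indicated : ∀ ys → ι (length (filter indicates⇒dec ys)) ≡ ∑ ys v
    ι-length-indicated ys = trans (ι-length-filter indicates⇒dec ys) (∑-cong ys indicates⇒𝟙)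

    -- The given list and the list filtered out of a complete enumeration have the same members
    -- without repetition, hence the same length.
    ι-cardinality : ∀ {xs ys} → Unique xs → (∀ x → x ∈ xs ⇔ R x) → Unique ys → (∀ x → x ∈ ys) →
      ι (length xs) ≡ ∑ ys v
    ι-cardinality {xs} {ys} xs! ∈⇔ ys! complete = trans (cong ι (ℕP.≤-antisym
        (unique-⊆-length xs! λ {x} x∈ → ∈-filter⁺ indicates⇒dec (complete x) (Equivalence.to (∈⇔ x) x∈))
        (unique-⊆-length (UniqueP.filter⁺ indicates⇒dec ys!) λ {x} x∈ →
          Equivalence.from (∈⇔ x) (proj₂ (∈-filter⁻ indicates⇒dec {xs = ys} x∈)))))
      (ι-length-indicated ys)

  ∑-cartesianProduct : ∀ (xs : List X) (ys : List Y) (f : X × Y → ℚ) →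
    ∑ (cartesianProduct xs ys) f ≡ ∑ xs λ x → ∑ ys λ y → f (x , y)
  ∑-cartesianProduct []       ys f = refl
  ∑-cartesianProduct (x ∷ xs) ys f = trans (∑-++ (map (x ,_) ys) (cartesianProduct xs ys) f)
    (cong₂ _+_ (∑-map (x ,_) ys f) (∑-cartesianProduct xs ys f))

  ∑<-suc : ∀ n f → ∑< (suc n) f ≡ f 0 + ∑< n (λ i → f (suc i))
  ∑<-suc n f = trans (∑<-+ 1 n f) (cong (_+ ∑< n (λ i → f (suc i))) (+-identityʳ (f 0)))

  ∑-allFin : ∀ n (f : ℕ → ℚ) → ∑ (allFin n) (λ i → f (toℕ i)) ≡ ∑< n f
  ∑-allFin zero    f = refl
  ∑-allFin (suc n) f = trans (cong (f 0 +_) (trans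
      (cong (λ is → ∑ is (λ i → f (toℕ i))) (sym (ListP.map-tabulate {n = n} (λ i → i) Fin.suc)))
      (trans (∑-map Fin.suc (allFin n) (λ i → f (toℕ i))) (∑-allFin n (λ i → f (suc i))))))
    (sym (∑<-suc n f))

  weightOf : ∀ {n} → Subset n → ℕ → ℚ
  weightOf []      _       = 0ℚ
  weightOf (s ∷ A) zero    = if s then 1ℚ else 0ℚ
  weightOf (s ∷ A) (suc i) = weightOf A i

  weightOf-0or1 : ∀ {n} (A : Subset n) i → weightOf A i ≡ 0ℚ ⊎ weightOf A i ≡ 1ℚ
  weightOf-0or1 []          _       = inj₁ refl
  weightOf-0or1 (true  ∷ A) zero    = inj₂ refl
  weightOf-0or1 (false ∷ A) zero    = inj₁ refl
  weightOf-0or1 (_     ∷ A) (suc i) = weightOf-0or1 A i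

  weightOf-weight : ∀ {n} (A : Subset n) → Weight n (weightOf A)
  weightOf-weight A .Weight.0≤β j with weightOf-0or1 A j
  ... | inj₁ e = ≤-reflexive (sym e)
  ... | inj₂ e = ≤-trans 0≤1 (≤-reflexive (sym e))
  weightOf-weight A .Weight.β≤1 j with weightOf-0or1 A j
  ... | inj₁ e = ≤-trans (≤-reflexive e) 0≤1
  ... | inj₂ e = ≤-reflexive e

  weightOf-∈ : ∀ {n} (A : Subset n) → Indicates (Subset._∈ A) (λ i → weightOf A (toℕ i))
  weightOf-∈ (true  ∷ A) Fin.zero    = inj₁ (Vec.here , refl)
  weightOf-∈ (false ∷ A) Fin.zero    = inj₂ ((λ ()) , refl)
  weightOf-∈ (_     ∷ A) (Fin.suc i) with weightOf-∈ A i
  ... | inj₁ (i∈ , e) = inj₁ (Vec.there i∈ , e)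
  ... | inj₂ (i∉ , e) = inj₂ ((λ { (Vec.there i∈) → i∉ i∈ }) , e)

  ∑-weightOf : ∀ {n} (A : Subset n) → ∑< n (weightOf A) ≡ ι Subset.∣ A ∣
  ∑-weightOf []          = sym ι0
  ∑-weightOf {suc n} (true  ∷ A) = trans (∑<-suc n (weightOf (true ∷ A)))
    (trans (cong (1ℚ +_) (∑-weightOf A)) (sym (ι-suc Subset.∣ A ∣)))
  ∑-weightOf {suc n} (false ∷ A) = trans (∑<-suc n (weightOf (false ∷ A)))
    (trans (cong (0ℚ +_) (∑-weightOf A)) (+-identityˡ _))

  sifted-indicates : ∀ Q n → ((∀ {p} → p ∈ Q → ¬ p ∣ ℤ.∣ n ∣) × sifted Q n ≡ 1ℚ) ⊎
    ((∃ λ p → p ∈ Q × p ∣ ℤ.∣ n ∣) × sifted Q n ≡ 0ℚ)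
  sifted-indicates []      n = inj₁ ((λ ()) , refl)
  sifted-indicates (p ∷ Q) n with p ∣? ℤ.∣ n ∣ | sifted-indicates Q n
  ... | yes p∣ | _ = inj₂ ((p , here refl , p∣) , vanish (sifted Q n))
    where
    vanish : ∀ a → (1ℚ - 1ℚ) * a ≡ 0ℚ
    vanish = solve 1 (λ a → ((con 1ℚ) :- (con 1ℚ)) :* a := (con 0ℚ)) refl
  ... | no _   | inj₂ ((q , q∈ , q∣) , e) = inj₂ ((q , there q∈ , q∣) , trans (cong ((1ℚ - 0ℚ) *_) e)
    (*-zeroʳ _))
  ... | no p∤  | inj₁ (none , e) = inj₁ ((λ { (here refl) → p∤ ; (there q∈) → none q∈ }) ,
      trans (cong ((1ℚ - 0ℚ) *_) e) (unit 1ℚ))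
    where
    unit : ∀ a → (1ℚ - 0ℚ) * 1ℚ ≡ 1ℚ
    unit = solve 1 (λ a → ((con 1ℚ) :- (con 0ℚ)) :* (con 1ℚ) := (con 1ℚ)) refl

-- Real numbers, real powers and their integer counterparts

module Reals where

  open Rat
  import Data.Rational.Unnormalised as ℚᵘ
  import Data.Rational.Unnormalised.Properties as ℚᵘP
  open import Algebra.Definitions.RawSemiring ℚ.+-*-rawSemiring using () renaming (_^_ to _^ℚ_)
  import Defs as R
  open R using (ℝ; fromℕ; fromℚ)
  open ℝ using (seq; cauchy)

  opaque
    unfolding _+_ ι recip

    ι^ : ∀ x m → (pos x ℚ./ 1) ^ℚ m ≡ ι (x ℕ.^ m)
    ι^ x zero    = refl
    ι^ x (suc m) = trans (cong ((pos x ℚ./ 1) ℚ.*_) (ι^ x m)) (sym (ι-* x (x ℕ.^ m)))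

    /≡ι*recip : ∀ m n → pos m ℚ./ suc n ≡ ι m * recip (suc n)
    /≡ι*recip m n = ℚP.toℚᵘ-injective (ℚᵘP.≃-trans (ℚP.toℚᵘ-fromℚᵘ (ℚᵘ.mkℚᵘ (pos m) n))
      (ℚᵘP.≃-sym (ℚᵘP.≃-trans (ℚP.toℚᵘ-homo-* (pos m ℚ./ 1) (pos 1 ℚ./ suc n))
        (ℚᵘP.≃-trans (ℚᵘP.*-cong (ℚP.toℚᵘ-fromℚᵘ (ℚᵘ.mkℚᵘ (pos m) 0))
          (ℚP.toℚᵘ-fromℚᵘ (ℚᵘ.mkℚᵘ (pos 1) n)))
          (ℚᵘ.*≡* (cong₂ ℤ._*_ (ℤP.*-identityʳ (pos m)) (cong (λ k → pos (suc k))
            (sym (ℕP.+-identityʳ n)))))))))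

    -- A positive fraction is at least the reciprocal of its denominator. The extra 3 serves the
    -- condition 3 ≤ v.
    archimedean : ∀ q → 0ℚ < q → ∃ λ v → 3 ℕ.≤ v × 1ℚ ≤ ι v * q
    archimedean q@(ℚ.mkℚ (pos zero)    d _) (ℚ.*<* lt) = ⊥-elim
      (ℤP.<-irrefl refl (subst₂ ℤ._<_ refl (ℤP.*-zeroˡ (pos 1)) lt))
    archimedean q@(ℚ.mkℚ (ℤ.-[1+ a ]) d _) (ℚ.*<* lt) = ⊥-elim (not-neg lt)
      where
      not-neg : ¬ (pos 0 ℤ.* pos (suc d) ℤ.< ℤ.-[1+ a ] ℤ.* pos 1)
      not-neg ()
    archimedean q@(ℚ.mkℚ (pos (suc a)) d _) 0<q = 3 ℕ.+ suc d , ℕP.m≤m+n 3 (suc d) , (begin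
      1ℚ                        ≡⟨ ι*recip (suc d) ⟨
      ι (suc d) * recip (suc d) ≤⟨ *-mono (0≤ι (suc d)) (0≤recip (suc d))
        (ι-mono-≤ (ℕP.m≤n+m (suc d) 3)) recip≤q ⟩
      ι (3 ℕ.+ suc d) * q       ∎)
      where
      open ≤-Reasoning
      recip≤q : recip (suc d) ≤ q
      recip≤q = subst (_≤ q) (sym (recip≡mkℚ d))
        (ℚ.*≤* (ℤP.*-monoʳ-≤-nonNeg (pos (suc d)) {pos 1} {pos (suc a)} (ℤ.+≤+ (ℕ.s≤s ℕ.z≤n))))

  ≺⇒ℕ : ∀ {x p} {ϑ : ℝ} → (x R.^ ϑ) R.≺ p → ∃₂ λ m n → ϑ R.< fromℚ (pos m ℚ./ suc n) × x ℕ.^ m ℕ.< p ℕ.^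
    suc n
  ≺⇒ℕ {x} {p} (_ , m , n , ϑ< , lt) = m , n , ϑ< , ι-cancel-< (subst₂ _<_ (ι^ x m) (ι^ p (suc n)) lt)

  opaque
    unfolding ι

    ℕ⇒≺ : ∀ {x p} {ϑ : ℝ} .{{_ : ℕ.NonZero p}} m n → ϑ R.< fromℚ (pos m ℚ./ suc n) → x ℕ.^ m ℕ.< p ℕ.^
      suc n →
      (x R.^ ϑ) R.≺ p
    ℕ⇒≺ {x} {p} m n ϑ< lt = 0<ι p , m , n , ϑ< , subst₂ _<_ (sym (ι^ x m)) (sym (ι^ p (suc n)))
      (ι-mono-< lt)

  -- Turns a real exponent into the integer exponent u of t: every admissible m / n is at least u /
  -- w, so p ≤ t ^ u would give p ^ n ≤ t ^ (u n) ≤ t ^ (w m) ≤ x ^ m.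
  root-< : ∀ {x t p u w} {ϑ : ℝ} .{{_ : ℕ.NonZero t}} →
    (∀ m n → ϑ R.< fromℚ (pos m ℚ./ suc n) → u ℕ.* suc n ℕ.≤ w ℕ.* m) →
    t ℕ.^ w ℕ.≤ x → (x R.^ ϑ) R.≺ p → t ℕ.^ u ℕ.< p
  root-< {x} {t} {p} {u} {w} {ϑ} u/w≤ϑ t^w≤x x^ϑ≺p = go (≺⇒ℕ {x} {p} {ϑ} x^ϑ≺p)
    where
    open ℕP.≤-Reasoning
    go : (∃₂ λ m n → ϑ R.< fromℚ (pos m ℚ./ suc n) × x ℕ.^ m ℕ.< p ℕ.^ suc n) → t ℕ.^ u ℕ.< p
    go (m , n , ϑ< , x^m<p^n) = ℕP.≰⇒> λ p≤t^u → ℕP.<-irrefl refl (begin-strict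
      p ℕ.^ suc n                   ≤⟨ ℕP.^-monoˡ-≤ (suc n) p≤t^u ⟩
      (t ℕ.^ u) ℕ.^ suc n           ≡⟨ ℕP.^-*-assoc t u (suc n) ⟩
      t ℕ.^ (u ℕ.* suc n)           ≤⟨ ℕP.^-monoʳ-≤ t (u/w≤ϑ m n ϑ<) ⟩
      t ℕ.^ (w ℕ.* m)               ≡⟨ ℕP.^-*-assoc t w m ⟨
      (t ℕ.^ w) ℕ.^ m               ≤⟨ ℕP.^-monoˡ-≤ m t^w≤x ⟩
      x ℕ.^ m                       <⟨ x^m<p^n ⟩
      p ℕ.^ suc n                   ∎)

  -- Sequences are not identified, so 1 / (1 / θ) is not `θ` itself. It has the same tail, however,
  -- and order, hence also powers, depend on tails only.
  EventuallyEqual : ℝ → ℝ → Set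
  EventuallyEqual x y = ∃ λ M → ∀ n → M ℕ.≤ n → seq x n ≡ seq y n

  <-respˡ-eventually : ∀ {x y z} → EventuallyEqual x y → x R.< z → y R.< z
  <-respˡ-eventually {z = z} (M , eq) (c , 0<c , N , le) = c , 0<c , M ℕ.⊔ N , λ n M⊔N≤n →
    subst (λ q → q ℚ.+ c ≤ seq z n) (eq n (ℕP.m⊔n≤o⇒m≤o M N M⊔N≤n)) (le n (ℕP.m⊔n≤o⇒n≤o M N M⊔N≤n))

  ^-resp-eventually : ∀ {X x y q} → EventuallyEqual x y → (X R.^ x) q → (X R.^ y) q
  ^-resp-eventually {x = x} {y} eq (0<q , m , n , x< , lt) =
    0<q , m , n , <-respˡ-eventually {x} {y} {fromℚ (pos m ℚ./ suc n)} eq x< , lt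

  -- From the index in the positivity proof on, the cut-off in the definition of the inverse is
  -- inactive.
  1/-inverse : ∀ x (0<x : fromℕ 0 R.< x) → ∃ λ M → ∀ n → M ℕ.≤ n → seq (R.1/ x 0<x) n ℚ.* seq x n ≡ 1ℚ
  1/-inverse x (c , 0<c , N , c≤x) = N , λ n N≤n →
    let cut≡x = ℚP.p≤q⇒p⊔q≡q (subst (_≤ seq x n) (ℚP.+-identityˡ c) (c≤x n N≤n))
        0<cut = ℚP.<-≤-trans 0<c (ℚP.p≤p⊔q c (seq x n))
        cut≢0 = ℚP.pos⇒nonZero (c ℚ.⊔ seq x n) {{ℚ.positive 0<cut}}
    in trans (cong ((ℚ.1/ (c ℚ.⊔ seq x n)) {{cut≢0}} ℚ.*_) (sym cut≡x)) (ℚP.*-inverseˡ (c ℚ.⊔ seq x n)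
      {{cut≢0}})

  1/1/-eventually : ∀ x (0<x : fromℕ 0 R.< x) → EventuallyEqual
    (R.1/ (R.1/ x 0<x) (R.1/-positive x 0<x)) x
  1/1/-eventually x 0<x = go (1/-inverse x 0<x) (1/-inverse (R.1/ x 0<x) (R.1/-positive x 0<x))
    where
    y = R.1/ x 0<x
    y′ = R.1/ y (R.1/-positive x 0<x)
    go : (∃ λ M → ∀ n → M ℕ.≤ n → seq y n ℚ.* seq x n ≡ 1ℚ) → (∃ λ M → ∀ n → M ℕ.≤ n → seq y′ n ℚ.* seq
      y n ≡ 1ℚ) →
      EventuallyEqual y′ x
    go (M , yx≡1) (M′ , y′y≡1) = M ℕ.⊔ M′ , λ n le → begin
      seq y′ n                              ≡⟨ ℚP.*-identityʳ (seq y′ n) ⟨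
      seq y′ n ℚ.* 1ℚ                       ≡⟨ cong (seq y′ n ℚ.*_) (yx≡1 n (ℕP.m⊔n≤o⇒m≤o M M′ le)) ⟨
      seq y′ n ℚ.* (seq y n ℚ.* seq x n)    ≡⟨ ℚP.*-assoc (seq y′ n) (seq y n) (seq x n) ⟨
      seq y′ n ℚ.* seq y n ℚ.* seq x n      ≡⟨ cong (ℚ._* seq x n) (y′y≡1 n (ℕP.m⊔n≤o⇒n≤o M M′ le)) ⟩
      1ℚ ℚ.* seq x n                        ≡⟨ ℚP.*-identityˡ (seq x n) ⟩
      seq x n                               ∎
      where open ≡-Reasoning

  sym-eventually : ∀ {x y} → EventuallyEqual x y → EventuallyEqual y x
  sym-eventually (M , eq) = M , λ n M≤n → sym (eq n M≤n)

  opaque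
    unfolding _+_ ι

    lower-bound : ∀ {x} → fromℕ 0 R.< x → ∃ λ q → 0ℚ < q × ∃ λ N → ∀ n → N ℕ.≤ n → q ≤ seq x n
    lower-bound {x} (q , 0<q , N , le) = q , 0<q , N , λ n N≤n → subst (_≤ seq x n) (ℚP.+-identityˡ q)
      (le n N≤n)

    <fromℚ⇒ : ∀ {x q a N} → (∀ n → N ℕ.≤ n → a ≤ seq x n) → x R.< fromℚ q → a ≤ q
    <fromℚ⇒ {x} {q} {a} {N} a≤x (c , 0<c , N′ , le) = ≤-trans (a≤x (N ℕ.⊔ N′) (ℕP.m≤m⊔n N N′))
      (≤-trans (p≤p+q (<⇒≤ 0<c)) (le (N ℕ.⊔ N′) (ℕP.m≤n⊔m N N′)))

    0<fromℚ : ∀ {q} → 0ℚ < q → fromℕ 0 R.< fromℚ q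
    0<fromℚ {q} 0<q = q , 0<q , 0 , λ _ _ → ≤-reflexive (+-identityˡ q)

    fromℚ<1 : ∀ {q c} → 0ℚ < c → q + c ≡ 1ℚ → fromℚ q R.< fromℕ 1
    fromℚ<1 {q} {c} 0<c e = c , 0<c , 0 , λ _ _ → ≤-reflexive e

    modulus : ∀ r {e} → 0ℚ < e → ∃ λ N → ∀ m n → N ℕ.≤ m → N ℕ.≤ n → ∣ seq r m - seq r n ∣ ≤ e
    modulus r {e} 0<e with cauchy r e 0<e
    ... | N , close = N , λ m n N≤m N≤n → <⇒≤ (close m n N≤m N≤n)

    -- The hypothesis is a mere negation, while the conclusion needs a witness. Closeness of the
    -- terms to within 1 / 4 supplies it: a term above 1 + 1 / 4 + 1 / 8 would force 1 < x with gap
    -- 1 / 8, so late terms are at most 1 + 5 / 8.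
    <2 : ∀ {x} → x R.≤ fromℕ 1 → x R.< fromℚ (pos 2 ℚ./ 1)
    <2 {x} x≤1 = go (modulus x (ℚP.positive⁻¹ ¼))
      where
      ¼ ⅛ : ℚ
      ¼ = ½ ℚ.* ½
      ⅛ = ¼ ℚ.* ½
      go : (∃ λ N → ∀ m n → N ℕ.≤ m → N ℕ.≤ n → ∣ seq x m - seq x n ∣ ≤ ¼) → x R.< fromℚ (pos 2 ℚ./ 1)
      go (N , close) = ¼ , ℚP.positive⁻¹ ¼ , N , λ n N≤n →
          ≤-trans (+-monoˡ-≤ ¼ (upper n N≤n)) (ℚP.≤ᵇ⇒≤ {¼ + (1ℚ + ¼ + ⅛) + ¼} {pos 2 ℚ./ 1} _)
        where
        x_N≤ : seq x N ≤ 1ℚ + ¼ + ⅛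
        x_N≤ = ≮⇒≥ λ large → x≤1 (⅛ , ℚP.positive⁻¹ ⅛ , N , λ n N≤n →
          ≤-trans (≤-by (shift ¼ ⅛) ≤-refl)
            (≤-trans (+-mono-≤ (<⇒≤ large)
              (neg-antimono-≤ (≤-trans (p≤∣p∣ _) (close N n ℕP.≤-refl N≤n))))
            (≤-reflexive (cancel (seq x N) (seq x n)))))
          where
          shift : ∀ q e → 1ℚ + q + e + - q ≡ (1ℚ + e) + 0ℚ
          shift = solve 2 (λ q e → (con 1ℚ) :+ q :+ e :+ :- q := ((con 1ℚ) :+ e) :+ (con 0ℚ)) refl
          cancel : ∀ a b → a + - (a - b) ≡ b
          cancel = solve 2 (λ a b → a :+ :- (a :- b) := b) refl
        upper : ∀ n → N ℕ.≤ n → seq x n ≤ ¼ + (1ℚ + ¼ + ⅛)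
        upper n N≤n = ≤-trans (≤-reflexive (move (seq x n) (seq x N)))
          (+-mono-≤ (≤-trans (p≤∣p∣ (seq x n - seq x N)) (close n N N≤n ℕP.≤-refl)) x_N≤)
          where
          move : ∀ a b → a ≡ (a - b) + b
          move = solve 2 (λ a b → a := (a :- b) :+ b) refl

    <-intro : ∀ (r γ : ℝ) k a b {c} → 0ℚ < c →
      (∃ λ N → ∀ n → N ℕ.≤ n → ∣ ι k - seq r n * (ι a * ι b) ∣ + c ≤ seq γ n * (ι a * ι b)) →
      R.∣ fromℕ k R.- r R.* (fromℕ a R.* fromℕ b) ∣ R.< γ R.* (fromℕ a R.* fromℕ b)
    <-intro r γ k a b {c} 0<c (N , le) = c , 0<c , N , le

    <-elim : ∀ (r : ℝ) k x {e} → R.∣ fromℚ (pos k ℚ./ suc x) R.- r ∣ R.< fromℚ e →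
      ∃ λ N → ∀ n → N ℕ.≤ n → ∣ ι k * recip (suc x) - seq r n ∣ ≤ e
    <-elim r k x {e} (c , 0<c , N , le) = N , λ n N≤n →
      subst (λ z → ∣ z - seq r n ∣ ≤ e) (/≡ι*recip k x) (≤-trans (p≤p+q (<⇒≤ 0<c)) (le n N≤n))

  -- Of the eight parts `e` of `γ`, three cover the estimate at index `N`, one the passage from
  -- there to later approximations of `r`, and one the gap that strict inequality of reals demands.
  real-estimate : ∀ (r γ : ℝ) k a b {e} → 0ℚ < e → 0ℚ < ι a * ι b →
    (∃ λ N → ∀ n → N ℕ.≤ n → ι 8 * e ≤ seq γ n) →
    (N : ℕ) → (∀ m n → N ℕ.≤ m → N ℕ.≤ n → ∣ seq r m - seq r n ∣ ≤ e) →
    ∣ ι k - seq r N * (ι a * ι b) ∣ ≤ (e + e + e) * (ι a * ι b) →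
    R.∣ fromℕ k R.- r R.* (fromℕ a R.* fromℕ b) ∣ R.< γ R.* (fromℕ a R.* fromℕ b)
  real-estimate r γ k a b {e} 0<e 0<ab (M , γ≥) N close key = <-intro r γ k a b (0<* 0<e 0<ab)
    (M ℕ.⊔ N , λ n le → begin
      ∣ ι k - seq r n * ab ∣ + e * ab
        ≡⟨ cong (λ z → ∣ z ∣ + e * ab) (regroup (ι k) (seq r N) (seq r n) ab) ⟩
      ∣ (ι k - seq r N * ab) + (seq r N - seq r n) * ab ∣ + e * ab
        ≤⟨ +-monoˡ-≤ (e * ab) (≤-trans (∣p+q∣≤∣p∣+∣q∣ _ _) (+-mono-≤ key (≤-trans (≤-reflexive
             (trans (∣p*q∣≡∣p∣*∣q∣ _ ab) (cong (∣ seq r N - seq r n ∣ *_) (0≤p⇒∣p∣≡p (<⇒≤ 0<ab)))))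
             (*-monoʳ ab (<⇒≤ 0<ab) (close N n ℕP.≤-refl (ℕP.m⊔n≤o⇒n≤o M N le)))))) ⟩
      (e + e + e) * ab + e * ab + e * ab
        ≤⟨ ≤-by (collect e ab) (0≤* (0≤+ (0≤+ (<⇒≤ 0<e) (<⇒≤ 0<e)) (<⇒≤ 0<e)) (<⇒≤ 0<ab)) ⟩
      2ℚ * 2ℚ * 2ℚ * e * ab
        ≡⟨ cong (λ z → z * e * ab) (sym ι8) ⟩
      ι 8 * e * ab
        ≤⟨ *-monoʳ ab (<⇒≤ 0<ab) (γ≥ n (ℕP.m⊔n≤o⇒m≤o M N le)) ⟩
      seq γ n * ab ∎)
    where
    open ≤-Reasoning
    ab : ℚ
    ab = ι a * ι b
    regroup : ∀ k s t c → k - t * c ≡ (k - s * c) + (s - t) * c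
    regroup = solve 4 (λ k s t c → k :- t :* c := (k :- s :* c) :+ (s :- t) :* c) refl
    collect : ∀ e c → 2ℚ * 2ℚ * 2ℚ * e * c ≡ ((e + e + e) * c + e * c + e * c) + (e + e + e) * c
    collect = solve 2 (λ e c → (con 2ℚ) :* (con 2ℚ) :* (con 2ℚ) :* e :* c := ((e :+ e :+ e) :* c :+ e :*
      c :+ e :* c) :+ (e :+ e :+ e) :* c) refl

  density-estimate : ∀ (r : ℝ) k x {e} .{{_ : ℕ.NonZero x}} → R.∣ fromℚ (pos k ℚ./ x) R.- r ∣ R.< fromℚ
    e →
    (N : ℕ) → (∀ m n → N ℕ.≤ m → N ℕ.≤ n → ∣ seq r m - seq r n ∣ ≤ e) →
    ∣ ι k - ι x * seq r N ∣ ≤ ι x * (e + e)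
  density-estimate r k x@(suc x-1) {e} lt N close = begin
    ∣ ι k - ι x * seq r N ∣
      ≡⟨ cong ∣_∣ (trans (cong (λ z → z - ι x * seq r N) (trans (sym (*-identityʳ (ι k)))
        (cong (ι k *_) (sym (ι*recip x)))))
           (regroup (ι k) (ι x) (recip x) (seq r N) (seq r n))) ⟩
    ∣ ι x * ((ι k * recip x - seq r n) + (seq r n - seq r N)) ∣
      ≡⟨ trans (∣p*q∣≡∣p∣*∣q∣ (ι x) _) (cong (_* ∣ (ι k * recip x - seq r n) + (seq r n - seq r N) ∣)
        (0≤p⇒∣p∣≡p (0≤ι x))) ⟩
    ι x * ∣ (ι k * recip x - seq r n) + (seq r n - seq r N) ∣
      ≤⟨ *-monoˡ (ι x) (0≤ι x) (≤-trans (∣p+q∣≤∣p∣+∣q∣ _ _) (+-mono-≤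
           (proj₂ (<-elim r k x-1 lt) n (ℕP.m≤n⊔m N M))
           (close n N (ℕP.m≤m⊔n N M) ℕP.≤-refl))) ⟩
    ι x * (e + e) ∎
    where
    open ≤-Reasoning
    M : ℕ
    M = proj₁ (<-elim r k x-1 lt)
    n : ℕ
    n = N ℕ.⊔ M
    regroup : ∀ k x i s t → k * (x * i) - x * s ≡ x * ((k * i - t) + (t - s))
    regroup = solve 5 (λ k x i s t → k :* (x :* i) :- x :* s := x :* ((k :* i :- t) :+ (t :- s))) refl

-- Smooth sums, smooth integers and the theorem

module Main where

  open Rat
  open Sums
  open Average
  open Kernel
  open LargeSieve using (∑∑; 𝟙; 𝟙-yes; 𝟙-no; Weight)
  open PrimeSums
  open Comparison using (isZero; free)
  open Parameters
  open Truncation using (sifted)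
  open Counting
  open Reals
  import Defs as R
  open R using (ℝ; fromℕ; fromℚ; Smooth; SmoothPair; HasCardinality; element)
  open ℝ using (seq)

  -- Double negation commutes with finite conjunctions, so excluded middle may be assumed for
  -- finitely many instances at once.
  ¬¬-dec : ∀ (P : ℕ → Set) n → ¬ ¬ (∀ p → p ℕ.< n → Dec (P p))
  ¬¬-dec P zero    k = k λ _ ()
  ¬¬-dec P (suc n) k = ¬¬-dec P n λ below → ¬¬-excluded-middle λ d → k (pick d below)
    where
    pick : Dec (P n) → (∀ p → p ℕ.< n → Dec (P p)) → ∀ p → p ℕ.< suc n → Dec (P p)
    pick d below p p<1+n with p ℕ.≟ n
    ... | yes refl = d
    ... | no p≢n   = below p (ℕP.≤∧≢⇒< (ℕP.≤-pred p<1+n) p≢n)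

  root : ∀ K .{{_ : ℕ.NonZero K}} x → ∃ λ t → t ℕ.^ K ℕ.≤ x × x ℕ.< suc t ℕ.^ K
  root K@(suc _) zero = 0 , ℕ.z≤n , ℕP.m^n>0 1 K
  root K (suc x) = step (root K x)
    where
    step : (∃ λ t → t ℕ.^ K ℕ.≤ x × x ℕ.< suc t ℕ.^ K) → ∃ λ t → t ℕ.^ K ℕ.≤ suc x × suc x ℕ.< suc t ℕ.^
      K
    step (t , lower , upper) with suc t ℕ.^ K ℕ.≤? suc x
    ... | yes le = suc t , le , ℕP.≤-<-trans upper (ℕP.^-monoˡ-< K (ℕP.n<1+n (suc t)))
    ... | no ¬le = t , ℕP.m≤n⇒m≤1+n lower , ℕP.≰⇒> ¬le

  -- A lower bound for the reciprocal sum of the primes in (z, z ^ 65] shows that there are some.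
  prime-above : ∀ z → 16 ℕ.≤ z → ∃ λ p → Prime p × z ℕ.< p
  prime-above z 16≤z = go primes refl
    where
    primes = primesUpTo (z ℕ.<?_) (z ℕ.^ 65)
    go : ∀ ps → ps ≡ primes → ∃ λ p → Prime p × z ℕ.< p
    go [] e = ⊥-elim (<-irrefl refl (<-≤-trans 0<1 (≤-trans (1≤8∑recip z 16≤z)
        (≤-reflexive (trans (cong (λ ps → 2ℚ * (2ℚ * (2ℚ * ∑ ps recip))) (sym e)) (zeros 1ℚ))))))
      where
      zeros : ∀ a → 2ℚ * (2ℚ * (2ℚ * 0ℚ)) ≡ 0ℚ
      zeros = solve 1 (λ a → (con 2ℚ) :* ((con 2ℚ) :* ((con 2ℚ) :* (con 0ℚ))) := (con 0ℚ)) refl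
    go (p ∷ _) e with ∈-primesUpTo⁻ (z ℕ.<?_) (z ℕ.^ 65) (subst (p ∈_) e (here refl))
    ... | pp , z<p , _ = p , pp , z<p

  -- What sums and differences have in common: both add an injective `b j`, and `b i - b j` is
  -- `i - j` up to sign, so the same primes divide them.
  record Shift (_∙_ : ℤ → ℤ → ℤ) : Set where
    field
      b           : ℕ → ℤ
      ∙≡          : ∀ i j → pos (suc i) ∙ pos (suc j) ≡ pos (suc i) ℤ.+ b j
      b-δ         : ∀ p i j → δ p (b i ℤ.- b j) ≡ δ p (pos i ℤ.- pos j)
      b-injective : ∀ i j → b i ≡ b j → i ≡ j
      ∣b∣≡        : ∀ j → ℤ.∣ b j ∣ ≡ suc j

  addition : Shift ℤ._+_
  addition = record
    { b           = λ j → pos (suc j)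
    ; ∙≡          = λ _ _ → refl
    ; b-δ         = λ p i j → cong (δ p) (cancel (pos i) (pos j))
    ; b-injective = λ { _ _ refl → refl }
    ; ∣b∣≡        = λ _ → refl
    }
    where
    cancel : ∀ i j → (pos 1 ℤ.+ i) ℤ.- (pos 1 ℤ.+ j) ≡ i ℤ.- j
    cancel = solve-∀

  subtraction : Shift ℤ._-_
  subtraction = record
    { b           = λ j → ℤ.- pos (suc j)
    ; ∙≡          = λ _ _ → refl
    ; b-δ         = λ p i j → trans (cong (δ p) (flip (pos i) (pos j))) (δ-neg p (pos i ℤ.- pos j))
    ; b-injective = λ { _ _ refl → refl }
    ; ∣b∣≡        = λ _ → refl
    }
    where
    flip : ∀ i j → ℤ.- (pos 1 ℤ.+ i) ℤ.- (ℤ.- (pos 1 ℤ.+ j)) ≡ ℤ.- (i ℤ.- j)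
    flip = solve-∀

  module _ (θ γ : ℝ) (0<θ : fromℕ 0 R.< θ) (θ≤1 : θ R.≤ fromℕ 1) (0<γ : fromℕ 0 R.< γ) (r : ℝ)
           (density : R.ρ[ R.1/ θ 0<θ , R.1/-positive θ 0<θ ]≡ r) where

    private
      θ-bound = lower-bound {θ} 0<θ
      a₀ = proj₁ θ-bound
      -- As 1 / v is at most the rational lower bound `a₀` of `θ`, a prime above x ^ θ exceeds t ^
      -- (K / v) = t ^ J.
      v-arch = archimedean a₀ (proj₁ (proj₂ θ-bound))
      v = proj₁ v-arch
      3≤v = proj₁ (proj₂ v-arch)

      γ-bound = lower-bound {γ} 0<γ
      g = proj₁ γ-bound
      0<g = proj₁ (proj₂ γ-bound)
      e = g * recip 8
      0<e : 0ℚ < e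
      0<e = 0<* 0<g (0<recip 8)
      8e≡g : ι 8 * e ≡ g
      8e≡g = trans (rot (ι 8) g (recip 8)) (trans (cong (g *_) (ι*recip 8)) (*-identityʳ g))
        where
        rot : ∀ a b c → a * (b * c) ≡ b * (a * c)
        rot = solve 3 (λ a b c → a :* (b :* c) := b :* (a :* c)) refl
      G-arch = archimedean e 0<e
      G = proj₁ G-arch
      instance
        G≢0 : ℕ.NonZero G
        G≢0 = ℕ.>-nonZero (ℕP.<-≤-trans (ℕ.s≤s ℕ.z≤n) (proj₁ (proj₂ G-arch)))
      recip-G≤e : recip G ≤ e
      recip-G≤e = *-cancelˡ-≤ (ι G) (0<ι G) (≤-trans (≤-reflexive (ι*recip G)) (proj₂ (proj₂ G-arch)))

      K′ = K v G
      J′ = J v G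
      T₀ = t₀ v G

      1<K : 1 ℕ.< K′
      1<K = ℕP.≤-trans (ℕP.≤-trans (ℕ.s≤s (ℕ.s≤s ℕ.z≤n)) 3≤v)
        (ℕP.m≤m*n v J′ {{ℕP.m*n≢0 8 (65 ℕ.^ s v G) {{_}} {{ℕP.m^n≢0 65 (s v G)}}}})
      instance
        K≢0 : ℕ.NonZero K′
        K≢0 = ℕ.>-nonZero (ℕP.<-trans (ℕ.s≤s ℕ.z≤n) 1<K)

      ν : ℝ
      ν = fromℚ (ι (K′ ℕ.∸ 1) * recip K′)

      0<ν : fromℕ 0 R.< ν
      0<ν = 0<fromℚ (0<* (0<ι (K′ ℕ.∸ 1) {{ℕ.>-nonZero (ℕP.m<n⇒0<n∸m 1<K)}}) (0<recip K′))

      ν<1 : ν R.< fromℕ 1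
      ν<1 = fromℚ<1 (0<recip K′)
        (trans (trans (cong (ι (K′ ℕ.∸ 1) * recip K′ +_) (sym (*-identityˡ (recip K′))))
        (sym (*-distribʳ-+ (recip K′) (ι (K′ ℕ.∸ 1)) 1ℚ)))
        (trans (cong (_* recip K′) (trans (+-comm _ 1ℚ) (trans (sym (ι-suc (K′ ℕ.∸ 1)))
          (cong ι (ℕP.m+[n∸m]≡n (ℕP.<⇒≤ 1<K))))))
          (ι*recip K′)))

      ν-exponent : ∀ m n → ν R.< fromℚ (pos m ℚ./ suc n) → (K′ ℕ.∸ 1) ℕ.* suc n ℕ.≤ K′ ℕ.* m
      ν-exponent m n ν< = ι-cancel-≤ (begin
        ι ((K′ ℕ.∸ 1) ℕ.* suc n)
          ≡⟨ trans (ι-* (K′ ℕ.∸ 1) (suc n)) (trans (sym (*-identityˡ _))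
            (cong (_* (ι (K′ ℕ.∸ 1) * ι (suc n))) (sym (ι*recip K′)))) ⟩
        ι K′ * recip K′ * (ι (K′ ℕ.∸ 1) * ι (suc n))
          ≡⟨ regroup (ι K′) (recip K′) (ι (K′ ℕ.∸ 1)) (ι (suc n)) ⟩
        ι K′ * ι (suc n) * (ι (K′ ℕ.∸ 1) * recip K′)
          ≤⟨ *-monoˡ (ι K′ * ι (suc n)) (0≤* (0≤ι K′) (0≤ι (suc n)))
            (≤-trans (<fromℚ⇒ {ν} {N = 0} (λ _ _ → ≤-refl) ν<)
               (≤-reflexive (/≡ι*recip m n))) ⟩
        ι K′ * ι (suc n) * (ι m * recip (suc n))
          ≡⟨ regroup′ (ι K′) (ι (suc n)) (ι m) (recip (suc n)) ⟩
        ι (suc n) * recip (suc n) * (ι K′ * ι m)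
          ≡⟨ trans (cong₂ _*_ (ι*recip (suc n)) (sym (ι-* K′ m))) (*-identityˡ _) ⟩
        ι (K′ ℕ.* m) ∎)
        where
        open ≤-Reasoning
        regroup : ∀ a b c d → a * b * (c * d) ≡ a * d * (c * b)
        regroup = solve 4 (λ a b c d → a :* b :* (c :* d) := a :* d :* (c :* b)) refl
        regroup′ : ∀ a b c d → a * b * (c * d) ≡ b * d * (a * c)
        regroup′ = solve 4 (λ a b c d → a :* b :* (c :* d) := b :* d :* (a :* c)) refl

      θ-exponent : ∀ m n → θ R.< fromℚ (pos m ℚ./ suc n) → J′ ℕ.* suc n ℕ.≤ K′ ℕ.* m
      θ-exponent m n θ< = ℕP.≤-trans (ℕP.*-monoʳ-≤ J′ (ι-cancel-≤ (begin
        ι (suc n)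
          ≡⟨ *-identityʳ (ι (suc n)) ⟨
        ι (suc n) * 1ℚ
          ≤⟨ *-monoˡ (ι (suc n)) (0≤ι (suc n)) (proj₂ (proj₂ v-arch)) ⟩
        ι (suc n) * (ι v * a₀)
          ≤⟨ *-monoˡ (ι (suc n)) (0≤ι (suc n)) (*-monoˡ (ι v) (0≤ι v) (≤-trans
               (<fromℚ⇒ {θ} {N = proj₁ (proj₂ (proj₂ θ-bound))} (proj₂ (proj₂ (proj₂ θ-bound))) θ<)
                 (≤-reflexive (/≡ι*recip m n)))) ⟩
        ι (suc n) * (ι v * (ι m * recip (suc n)))
          ≡⟨ regroup (ι (suc n)) (ι v) (ι m) (recip (suc n)) ⟩
        ι (suc n) * recip (suc n) * (ι v * ι m)
          ≡⟨ trans (cong₂ _*_ (ι*recip (suc n)) (sym (ι-* v m))) (*-identityˡ _) ⟩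
        ι (v ℕ.* m) ∎))) (ℕP.≤-reflexive (rot J′ v m))
        where
        open ≤-Reasoning
        regroup : ∀ a b c d → a * (b * (c * d)) ≡ a * d * (b * c)
        regroup = solve 4 (λ a b c d → a :* (b :* (c :* d)) := a :* d :* (b :* c)) refl
        rot : ∀ j v m → j ℕ.* (v ℕ.* m) ≡ v ℕ.* j ℕ.* m
        rot = solve-ℕ

      settled = modulus r 0<e
      N = proj₁ settled
      density-at = density (fromℚ e) (0<fromℚ 0<e)
      xρ = proj₁ density-at
      -- The first summand serves the limit defining ρ; the second forces t > T₀, because x < (1 +
      -- t) ^ K.
      x₀ = xρ ℕ.+ suc T₀ ℕ.^ K′

    Conclusion : (ℤ → ℤ → ℤ) → Set
    Conclusion _∙_ = ∃ λ (ν : ℝ) → fromℕ 0 R.< ν × ν R.< fromℕ 1 ×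
      ∃ λ (x₀ : ℕ) → ∀ x → x₀ ℕ.≤ x →
      ∀ (A B : Subset x) → (x R.^ ν) R.≺ Subset.∣ A ∣ → (x R.^ ν) R.≺ Subset.∣ B ∣ →
      ∀ k → HasCardinality (SmoothPair _∙_ (x R.^ θ) A B) k →
      R.∣ fromℕ k R.- r R.* (fromℕ Subset.∣ A ∣ R.* fromℕ Subset.∣ B ∣) ∣
        R.< γ R.* (fromℕ Subset.∣ A ∣ R.* fromℕ Subset.∣ B ∣)

    module _ {_∙_ : ℤ → ℤ → ℤ} (shift : Shift _∙_) where

      open Shift shift

      private
        module At (x : ℕ) (x₀≤x : x₀ ℕ.≤ x) (A B : Subset x)
          (A-large : (x R.^ ν) R.≺ Subset.∣ A ∣) (B-large : (x R.^ ν) R.≺ Subset.∣ B ∣)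
          (k : ℕ) (count : HasCardinality (SmoothPair _∙_ (x R.^ θ) A B) k) where

          t-root = root K′ x
          t = proj₁ t-root
          t^K≤x = proj₁ (proj₂ t-root)
          x<[1+t]^K = proj₂ (proj₂ t-root)

          T₀≤t : suc T₀ ℕ.≤ t
          T₀≤t = ℕP.≮⇒≥ λ t< → ℕP.<⇒≱ x<[1+t]^K (ℕP.≤-trans (ℕP.^-monoˡ-≤ K′ t<)
            (ℕP.≤-trans (ℕP.m≤n+m (suc T₀ ℕ.^ K′) xρ) x₀≤x))

          instance
            t≢0 : ℕ.NonZero t
            t≢0 = ℕ.>-nonZero (ℕP.<-≤-trans (ℕ.s≤s ℕ.z≤n) T₀≤t)
            x≢0 : ℕ.NonZero x
            x≢0 = ℕ.>-nonZero (ℕP.<-≤-trans (ℕ.>-nonZero⁻¹ (t ℕ.^ K′) {{ℕP.m^n≢0 t K′}}) t^K≤x)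

          α = weightOf A
          β = weightOf B
          ab = ι Subset.∣ A ∣ * ι Subset.∣ B ∣

          size≥ : ∀ (C : Subset x) → (x R.^ ν) R.≺ Subset.∣ C ∣ → t ℕ.^ (K′ ℕ.∸ 1) ℕ.≤ Subset.∣ C ∣
          size≥ C large = ℕP.<⇒≤ (root-< {x} {t} {Subset.∣ C ∣} {K′ ℕ.∸ 1} {K′} {ν} ν-exponent t^K≤x
            large)

          weight≥ : ∀ (C : Subset x) → (x R.^ ν) R.≺ Subset.∣ C ∣ → ι (t ℕ.^ (K′ ℕ.∸ 1)) ≤ ∑< x
            (weightOf C)
          weight≥ C large = ≤-trans (ι-mono-≤ (size≥ C large)) (≤-reflexive (sym (∑-weightOf C)))

          0<size : ∀ (C : Subset x) → (x R.^ ν) R.≺ Subset.∣ C ∣ → 0ℚ < ι Subset.∣ C ∣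
          0<size C large = 0<ι Subset.∣ C ∣
            {{ℕ.>-nonZero (ℕP.<-≤-trans (ℕ.>-nonZero⁻¹ (t ℕ.^ (K′ ℕ.∸ 1)) {{ℕP.m^n≢0 t (K′ ℕ.∸ 1)}})
              (size≥ C large))}}

          0<ab : 0ℚ < ab
          0<ab = 0<* (0<size A A-large) (0<size B B-large)

          Bad : ℕ → Set
          Bad p = (x R.^ θ) R.≺ p

          bad-large : ∀ p → Bad p → t ℕ.^ J′ ℕ.< p
          bad-large p = root-< {x} {t} {p} {J′} {K′} {θ} θ-exponent t^K≤x

          module Decided (decide : ∀ p → p ℕ.< suc (2 ℕ.* x) → Dec (Bad p)) where

            -- The restriction to p ≤ 2x makes the predicate decidable for every p from finitely
            -- many decisions, and larger primes divide no nonzero integer that occurs.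
            Bad≤ : ℕ → Set
            Bad≤ p = p ℕ.< suc (2 ℕ.* x) × Bad p

            bad? : Decidable Bad≤
            bad? p with p ℕ.<? suc (2 ℕ.* x)
            ... | no p≮ = no λ (p< , _) → p≮ p<
            ... | yes p< with decide p p<
            ...   | yes bad = yes (p< , bad)
            ...   | no ¬bad = no λ (_ , bad) → ¬bad bad

            Q = primesUpTo bad? (2 ℕ.* x)

            -- Every prime divides 0, and some prime exceeds x ², hence x ^ θ because θ < 2. The 16
            -- is there to satisfy `prime-above`.
            ¬smooth-0 : ¬ Smooth (x R.^ θ) ℤ.0ℤ
            ¬smooth-0 smooth = go (prime-above (16 ℕ.+ x ℕ.* x) (ℕP.m≤m+n 16 (x ℕ.* x)))
              where
              go : (∃ λ p → Prime p × 16 ℕ.+ x ℕ.* x ℕ.< p) → ⊥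
              go (p , pp , 16+x²<p) = smooth p pp (p ℕD.∣0) (ℕ⇒≺ {x} {p} {θ} {{prime⇒nonZero pp}} 2 0
                (<2 {θ} θ≤1)
                (subst₂ ℕ._<_ (cong (x ℕ.*_) (sym (ℕP.*-identityʳ x))) (sym (ℕP.*-identityʳ p))
                  (ℕP.≤-<-trans (ℕP.m≤n+m (x ℕ.* x) 16) 16+x²<p)))

            smooth-free : ∀ n → ℤ.∣ n ∣ ℕ.≤ 2 ℕ.* x →
              (Smooth (x R.^ θ) n × free Q n ≡ 1ℚ) ⊎ (¬ Smooth (x R.^ θ) n × free Q n ≡ 0ℚ)
            smooth-free n ∣n∣≤ = go (n ℤ.≟ ℤ.0ℤ) (sifted-indicates Q n)
              where
              zeroˡ : ∀ s → (1ℚ - 1ℚ) * s ≡ 0ℚ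
              zeroˡ = solve 1 (λ s → ((con 1ℚ) :- (con 1ℚ)) :* s := (con 0ℚ)) refl
              one : ∀ s → (1ℚ - 0ℚ) * s ≡ s
              one = solve 1 (λ s → ((con 1ℚ) :- (con 0ℚ)) :* s := s) refl
              go : Dec (n ≡ ℤ.0ℤ) → _ → (Smooth (x R.^ θ) n × free Q n ≡ 1ℚ) ⊎
                (¬ Smooth (x R.^ θ) n × free Q n ≡ 0ℚ)
              go (yes n≡0) _ = inj₂ (subst (λ n → ¬ Smooth (x R.^ θ) n) (sym n≡0) ¬smooth-0 ,
                trans (cong (λ z → (1ℚ - z) * sifted Q n) (𝟙-yes (n ℤ.≟ ℤ.0ℤ) n≡0)) (zeroˡ _))
              go (no n≢0) (inj₁ (none , sifted≡1)) = inj₁ (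
                (λ p pp p∣n bad → let p≤ = ℕP.≤-trans (ℕD.∣⇒≤ p∣n) ∣n∣≤ in
                  none (∈-primesUpTo⁺ bad? (2 ℕ.* x) pp (ℕ.s≤s p≤ , bad) p≤) p∣n) ,
                trans (cong (λ z → (1ℚ - z) * sifted Q n) (𝟙-no (n ℤ.≟ ℤ.0ℤ) n≢0))
                  (trans (one _) sifted≡1))
                where instance
                  ∣n∣≢0 : ℕ.NonZero ℤ.∣ n ∣
                  ∣n∣≢0 = ℕ.≢-nonZero λ ∣n∣≡0 → n≢0 (ℤP.∣i∣≡0⇒i≡0 ∣n∣≡0)
              go (no n≢0) (inj₂ ((p , p∈ , p∣n) , sifted≡0)) =
                let pp , (_ , bad) , _ = ∈-primesUpTo⁻ bad? (2 ℕ.* x) p∈ in inj₂ (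
                (λ smooth → smooth p pp p∣n bad) ,
                trans (cong (λ z → (1ℚ - z) * sifted Q n) (𝟙-no (n ℤ.≟ ℤ.0ℤ) n≢0))
                  (trans (one _) sifted≡0))

            ∣sum∣≤ : ∀ i j → i ℕ.< x → j ℕ.< x → ℤ.∣ pos (suc i) ℤ.+ b j ∣ ℕ.≤ 2 ℕ.* x
            ∣sum∣≤ i j i<x j<x = ℕP.≤-trans (ℤP.∣i+j∣≤∣i∣+∣j∣ (pos (suc i)) (b j)) (ℕP.≤-trans
              (ℕP.+-mono-≤ i<x (ℕP.≤-trans (ℕP.≤-reflexive (∣b∣≡ j)) j<x))
                (ℕP.≤-reflexive (cong (x ℕ.+_) (sym (ℕP.+-identityʳ x)))))

            pair-value : Fin x × Fin x → ℚ
            pair-value (i , j) = α (toℕ i) * β (toℕ j) * free Q (pos (suc (toℕ i)) ℤ.+ b (toℕ j))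

            pair-indicates : Indicates (SmoothPair _∙_ (x R.^ θ) A B) pair-value
            pair-indicates (i , j) = go (weightOf-∈ A i) (weightOf-∈ B j)
                (smooth-free (pos (suc (toℕ i)) ℤ.+ b (toℕ j)) (∣sum∣≤ (toℕ i) (toℕ j) (FinP.toℕ<n i)
                  (FinP.toℕ<n j)))
              where
              n = pos (suc (toℕ i)) ℤ.+ b (toℕ j)
              zero₁ : ∀ a b → 0ℚ * a * b ≡ 0ℚ
              zero₁ = solve 2 (λ a b → (con 0ℚ) :* a :* b := (con 0ℚ)) refl
              zero₂ : ∀ a b → a * 0ℚ * b ≡ 0ℚ
              zero₂ = solve 2 (λ a b → a :* (con 0ℚ) :* b := (con 0ℚ)) refl
              ones : ∀ a → 1ℚ * 1ℚ * a ≡ a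
              ones = solve 1 (λ a → (con 1ℚ) :* (con 1ℚ) :* a := a) refl
              convert : element i ∙ element j ≡ n
              convert = ∙≡ (toℕ i) (toℕ j)
              go : _ → _ → (Smooth (x R.^ θ) n × free Q n ≡ 1ℚ) ⊎ (¬ Smooth (x R.^ θ) n × free Q n ≡ 0ℚ)
                →
                (SmoothPair _∙_ (x R.^ θ) A B (i , j) × pair-value (i , j) ≡ 1ℚ) ⊎
                (¬ SmoothPair _∙_ (x R.^ θ) A B (i , j) × pair-value (i , j) ≡ 0ℚ)
              go (inj₂ (i∉ , α≡0)) _ _ = inj₂ ((λ (i∈ , _) → i∉ i∈) ,
                trans (cong (λ z → z * β (toℕ j) * free Q n) α≡0) (zero₁ _ _))
              go (inj₁ _) (inj₂ (j∉ , β≡0)) _ = inj₂ ((λ (_ , j∈ , _) → j∉ j∈) ,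
                trans (cong (λ z → α (toℕ i) * z * free Q n) β≡0) (zero₂ _ _))
              go (inj₁ (i∈ , α≡1)) (inj₁ (j∈ , β≡1)) (inj₁ (smooth , free≡1)) = inj₁
                ((i∈ , j∈ , subst (Smooth (x R.^ θ)) (sym convert) smooth) ,
                 trans (cong₂ (λ y z → y * z * free Q n) α≡1 β≡1) (trans (ones _) free≡1))
              go (inj₁ (i∈ , α≡1)) (inj₁ (j∈ , β≡1)) (inj₂ (¬smooth , free≡0)) = inj₂
                ((λ (_ , _ , smooth) → ¬smooth (subst (Smooth (x R.^ θ)) convert smooth)) ,
                 trans (cong₂ (λ y z → y * z * free Q n) α≡1 β≡1) (trans (ones _) free≡0))

            pairs : List (Fin x × Fin x)
            pairs = cartesianProduct (allFin x) (allFin x)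

            S U : ℚ
            S = ∑∑ x λ i j → α i * β j * free Q (pos (suc i) ℤ.+ b j)
            U = run x (free Q) (pos 1)

            k≡S : ι k ≡ S
            k≡S = go count
              where
              go : HasCardinality (SmoothPair _∙_ (x R.^ θ) A B) k → ι k ≡ S
              go (xs , unique , ∈⇔ , length≡) = trans (cong ι (sym length≡)) (trans
                (ι-cardinality pair-indicates unique ∈⇔ (UniqueP.cartesianProduct⁺ (UniqueP.allFin⁺ x)
                  (UniqueP.allFin⁺ x))
                  (λ (i , j) → ∈-cartesianProduct⁺ (∈-allFin i) (∈-allFin j)))
                (trans (∑-cartesianProduct (allFin x) (allFin x) pair-value) (trans
                  (∑-cong (allFin x) λ i → ∑-allFin x (λ j → α (toℕ i) * β j * free Q
                    (pos (suc (toℕ i)) ℤ.+ b j)))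
                  (∑-allFin x (λ i → ∑< x λ j → α i * β j * free Q (pos (suc i) ℤ.+ b j))))))

            -- The bound that occurs in ρ(1 / θ): its exponent is the inverse of the inverse of `θ`,
            -- which only agrees with `θ` eventually.
            y′ = x R.^ R.1/ (R.1/ θ 0<θ) (R.1/-positive θ 0<θ)

            SmoothNumber : ℕ → Set
            SmoothNumber n = 1 ℕ.≤ n × n ℕ.≤ x × Smooth y′ (pos n)

            smooth⇒ : ∀ {n} → Smooth (x R.^ θ) n → Smooth y′ n
            smooth⇒ smooth p pp p∣n y′≺p = smooth p pp p∣n
              (^-resp-eventually {x} {R.1/ (R.1/ θ 0<θ) (R.1/-positive θ 0<θ)} {θ}
                (1/1/-eventually θ 0<θ) y′≺p)

            smooth⇐ : ∀ {n} → Smooth y′ n → Smooth (x R.^ θ) n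
            smooth⇐ smooth p pp p∣n y≺p = smooth p pp p∣n
              (^-resp-eventually {x} {θ} {R.1/ (R.1/ θ 0<θ) (R.1/-positive θ 0<θ)}
                (sym-eventually {R.1/ (R.1/ θ 0<θ) (R.1/-positive θ 0<θ)} {θ} (1/1/-eventually θ 0<θ))
                  y≺p)

            number-value : ℕ → ℚ
            number-value n = 𝟙 ((1 ℕ.≤? n) ×-dec (n ℕ.≤? x)) * free Q (pos n)

            number-indicates : Indicates SmoothNumber number-value
            number-indicates n = go ((1 ℕ.≤? n) ×-dec (n ℕ.≤? x))
              where
              in-range = (1 ℕ.≤? n) ×-dec (n ℕ.≤? x)
              go : Dec (1 ℕ.≤ n × n ℕ.≤ x) → (SmoothNumber n × number-value n ≡ 1ℚ) ⊎
                (¬ SmoothNumber n × number-value n ≡ 0ℚ)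
              go (no out) = inj₂ ((λ (1≤n , n≤x , _) → out (1≤n , n≤x)) ,
                trans (cong (_* free Q (pos n)) (𝟙-no in-range out)) (*-zeroˡ _))
              go (yes (1≤n , n≤x)) = finish (smooth-free (pos n) (ℕP.≤-trans n≤x (ℕP.m≤n*m x 2)))
                where
                value≡ : number-value n ≡ free Q (pos n)
                value≡ = trans (cong (_* free Q (pos n)) (𝟙-yes in-range (1≤n , n≤x))) (*-identityˡ _)
                finish : (Smooth (x R.^ θ) (pos n) × free Q (pos n) ≡ 1ℚ) ⊎ (¬ Smooth (x R.^ θ) (pos n)
                  × free Q (pos n) ≡ 0ℚ) →
                  (SmoothNumber n × number-value n ≡ 1ℚ) ⊎ (¬ SmoothNumber n × number-value n ≡ 0ℚ)
                finish (inj₁ (smooth , e)) = inj₁ ((1≤n , n≤x , smooth⇒ {pos n} smooth) , trans value≡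
                  e)
                finish (inj₂ (¬smooth , e)) = inj₂
                  ((λ (_ , _ , smooth) → ¬smooth (smooth⇐ {pos n} smooth)) , trans value≡ e)

            smooth? = indicates⇒dec number-indicates
            smooths : List ℕ
            smooths = filter smooth? (downFrom (suc x))

            -- The hypothesis on ρ speaks about a given cardinality, so a list of the smooth
            -- integers has to be exhibited; the decisions in force make this possible.
            Ψ : R.Ψ[ x , y′ ]≡ length smooths
            Ψ = smooths , UniqueP.filter⁺ smooth? (UniqueP.downFrom⁺ (suc x)) ,
              (λ n → mk⇔ (λ n∈ → proj₂ (∈-filter⁻ smooth? {xs = downFrom (suc x)} n∈))
                λ sn → ∈-filter⁺ smooth? (∈-downFrom⁺ (ℕ.s≤s (proj₁ (proj₂ sn)))) sn) , refl

            length≡U : ι (length smooths) ≡ U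
            length≡U = trans (ι-length-indicated number-indicates (downFrom (suc x)))
              (trans (∑<-suc x number-value)
              (trans (cong₂ _+_ (trans (cong (_* free Q (pos 0)) (𝟙-no ((1 ℕ.≤? 0) ×-dec (0 ℕ.≤? x))
                λ ())) (*-zeroˡ _))
                (∑<-cong x λ i i<x → trans (cong (_* free Q (pos (suc i)))
                  (𝟙-yes ((1 ℕ.≤? suc i) ×-dec (suc i ℕ.≤? x)) (ℕ.s≤s ℕ.z≤n , i<x)))
                  (*-identityˡ _))) (+-identityˡ _)))

            U-estimate : ∣ U - ι x * seq r N ∣ ≤ ι x * (e + e)
            U-estimate = subst (λ z → ∣ z - ι x * seq r N ∣ ≤ ι x * (e + e)) length≡U
              (density-estimate r (length smooths) x
                (proj₂ density-at x (ℕP.≤-trans (ℕP.m≤m+n xρ (suc T₀ ℕ.^ K′)) x₀≤x) (length smooths) Ψ)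
                  N (proj₂ settled))

            sieve-estimate : ∣ ι x * S - ab * U ∣ ≤ ι x * ab * recip G
            sieve-estimate = subst (λ z → ∣ ι x * S - z * U ∣ ≤ ι x * z * recip G)
              (cong₂ _*_ (∑-weightOf A) (∑-weightOf B))
              (sieve v G 3≤v t (ℕP.≤-trans (ℕP.n≤1+n T₀) T₀≤t) x t^K≤x x<[1+t]^K bad?
                (λ p (_ , bad) → bad-large p bad) (2 ℕ.* x)
                (weightOf-weight A) (weightOf-weight B) (weight≥ A A-large) (weight≥ B B-large)
                b b-δ b-injective (λ j j<x → ℕP.≤-trans (ℕP.≤-reflexive (∣b∣≡ j)) j<x))

            -- The deviation splits into the discrepancy between the sifted sums and the sifted
            -- integers, at most `e`, and the deviation of the density of smooth integers from `r`,
            -- at most `e + e`.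
            key : ∣ ι k - seq r N * ab ∣ ≤ (e + e + e) * ab
            key = *-cancelˡ-≤ (ι x) (0<ι x) (begin
              ι x * ∣ ι k - seq r N * ab ∣
                ≡⟨ trans (cong (_* ∣ ι k - seq r N * ab ∣) (sym (0≤p⇒∣p∣≡p (0≤ι x))))
                  (sym (∣p*q∣≡∣p∣*∣q∣ (ι x) _)) ⟩
              ∣ ι x * (ι k - seq r N * ab) ∣
                ≡⟨ cong ∣_∣ (trans (cong (λ z → ι x * (z - seq r N * ab)) k≡S)
                  (regroup (ι x) S (seq r N) ab U)) ⟩
              ∣ (ι x * S - ab * U) + ab * (U - ι x * seq r N) ∣
                ≤⟨ ≤-trans (∣p+q∣≤∣p∣+∣q∣ _ _) (+-mono-≤
                     (≤-trans sieve-estimate (*-monoˡ (ι x * ab) (0≤* (0≤ι x) (<⇒≤ 0<ab)) recip-G≤e))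
                     (≤-trans (≤-reflexive (trans (∣p*q∣≡∣p∣*∣q∣ ab _) (cong (_* ∣ U - ι x * seq r N ∣)
                       (0≤p⇒∣p∣≡p (<⇒≤ 0<ab)))))
                       (*-monoˡ ab (<⇒≤ 0<ab) U-estimate))) ⟩
              ι x * ab * e + ab * (ι x * (e + e))
                ≡⟨ collect (ι x) ab e ⟩
              ι x * ((e + e + e) * ab) ∎)
              where
              open ≤-Reasoning
              regroup : ∀ x s r c u → x * (s - r * c) ≡ (x * s - c * u) + c * (u - x * r)
              regroup = solve 5 (λ x s r c u → x :* (s :- r :* c) := (x :* s :- c :* u) :+ c :*
                (u :- x :* r)) refl
              collect : ∀ x c e → x * c * e + c * (x * (e + e)) ≡ x * ((e + e + e) * c)
              collect = solve 3 (λ x c e → x :* c :* e :+ c :* (x :* (e :+ e)) := x :*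
                ((e :+ e :+ e) :* c)) refl

          key : ∣ ι k - seq r N * ab ∣ ≤ (e + e + e) * ab
          key = decidable-stable (∣ ι k - seq r N * ab ∣ ≤? (e + e + e) * ab)
            λ ¬key → ¬¬-dec Bad (suc (2 ℕ.* x)) λ decide → ¬key (Decided.key decide)

      conclusion : Conclusion _∙_
      conclusion = ν , 0<ν , ν<1 , x₀ , λ x x₀≤x A B A-large B-large k count →
        real-estimate r γ k Subset.∣ A ∣ Subset.∣ B ∣ 0<e (At.0<ab x x₀≤x A B A-large B-large k count)
          (proj₁ (proj₂ (proj₂ γ-bound)) , λ n N≤n → subst (_≤ seq γ n) (sym 8e≡g)
            (proj₂ (proj₂ (proj₂ γ-bound)) n N≤n))
          N (proj₂ settled) (At.key x x₀≤x A B A-large B-large k count)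

open import Defs
open Main using (conclusion; addition; subtraction)

theorem4 : ∀ (θ γ : ℝ) (0<θ : fromℕ 0 < θ) → θ ≤ fromℕ 1 → fromℕ 0 < γ →
    ∀ (r : ℝ) → ρ[ 1/ θ 0<θ , 1/-positive θ 0<θ ]≡ r →
    (∃ λ (ν : ℝ) → fromℕ 0 < ν × ν < fromℕ 1 ×
    ∃ λ (x₀ : ℕ) → ∀ x → x₀ ℕ.≤ x →
    ∀ (A B : Subset x) → x ^ ν ≺ Subset.∣ A ∣ → x ^ ν ≺ Subset.∣ B ∣ →
    ∀ k → HasCardinality (SmoothPair ℤ._+_ (x ^ θ) A B) k →
    ∣ fromℕ k - r * (fromℕ Subset.∣ A ∣ * fromℕ Subset.∣ B ∣) ∣
    < γ * (fromℕ Subset.∣ A ∣ * fromℕ Subset.∣ B ∣))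
    ×
    (∃ λ (ν : ℝ) → fromℕ 0 < ν × ν < fromℕ 1 ×
    ∃ λ (x₀ : ℕ) → ∀ x → x₀ ℕ.≤ x →
    ∀ (A B : Subset x) → x ^ ν ≺ Subset.∣ A ∣ → x ^ ν ≺ Subset.∣ B ∣ →
    ∀ k → HasCardinality (SmoothPair ℤ._-_ (x ^ θ) A B) k →
    ∣ fromℕ k - r * (fromℕ Subset.∣ A ∣ * fromℕ Subset.∣ B ∣) ∣
    < γ * (fromℕ Subset.∣ A ∣ * fromℕ Subset.∣ B ∣))
theorem4 θ γ 0<θ θ≤1 0<γ r density =
  conclusion θ γ 0<θ θ≤1 0<γ r density addition ,
  conclusion θ γ 0<θ θ≤1 0<γ r density subtraction
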